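{- Let $\alpha=\pi_1^{a_1}\cdots\pi_n^{a_n}$ where $\pi_1,\dots,\pi_n$ are pairwise non-associate primes of $\mathcal{O}_K$ with $\pi_i\equiv 1\pmod{\lambda^3}$ and $a_i\in\{1,2\}$, let $L=K(\sqrt[3]{\alpha})$, and let $M_L$ be the R\'edei matrix of $L$ defined in the context. If $M_L$ has full rank, then there is a unit $u\in\mathcal{O}_L^\times$ with $N_{L/K}(u)=\zeta_3$.
   Context: $K=\mathbb{Q}(\zeta_3)$ with $\zeta_3$ a primitive cube root of unity, $\mathcal{O}_K=\mathbb{Z}[\zeta_3]$, $\lambda=1-\zeta_3$. For a prime $\pi$ of $\mathcal{O}_K$ not dividing $3$ and $v\in\mathcal{O}_K$ coprime to $\pi$, the cubic residue symbol $\left(\frac{v}{\pi}\right)_3$ is the unique cube root of unity congruent to $v^{(N(\pi)-1)/3}$ modulo $\pi$; it is extended multiplicatively to elements of $K^\times$ that are units at $\pi$. For $x=\zeta_3^a$ write $\log x=a\in\mathbb{F}_3$. The R\'edei matrix $M_L=(b_{ij})_{1\le i,j\le n-1}$ over $\mathbb{F}_3$ is defined by $b_{ij}=\log\left(\left(\frac{\pi_i}{\pi_j}\right)_3\right)$ for $i\neq j$ and $b_{ii}=a_i^{ -1}\log\left(\left(\frac{\pi_i^{a_i}/\alpha}{\pi_i}\right)_3\right)$. -}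

module Defs where

open import Data.Nat as ℕ using (ℕ; zero; suc)
open import Data.Integer as ℤ using (ℤ; +_; ∣_∣)
import Data.Integer.Divisibility as ℤDiv
open import Data.Rational as ℚ using (ℚ)
open import Data.Fin as Fin using (Fin; toℕ; inject₁)
open import Data.Product using (Σ; ∃; _×_; _,_)
open import Data.Sum using (_⊎_)
open import Relation.Binary.PropositionalEquality using (_≡_; _≢_)
open import Relation.Nullary using (¬_; yes; no)

-- O_K = ℤ[ζ₃] : elements re + im·ζ, with ζ² = -1 - ζ

record 𝒪K : Set where
  constructor _+_ζ
  field
    re : ℤ
    im : ℤ

infixl 6 _⊕_ _⊖_
infixl 7 _⊗_

_⊕_ : 𝒪K → 𝒪K → 𝒪K
(a + b ζ) ⊕ (c + d ζ) = (a ℤ.+ c) + (b ℤ.+ d) ζ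

⊝_ : 𝒪K → 𝒪K
⊝ (a + b ζ) = (ℤ.- a) + (ℤ.- b) ζ

_⊖_ : 𝒪K → 𝒪K → 𝒪K
x ⊖ y = x ⊕ (⊝ y)

_⊗_ : 𝒪K → 𝒪K → 𝒪K
(a + b ζ) ⊗ (c + d ζ) =
  (a ℤ.* c ℤ.- b ℤ.* d) + (a ℤ.* d ℤ.+ b ℤ.* c ℤ.- b ℤ.* d) ζ

𝟘 𝟙 ζ₃ λ₃ 𝟛 : 𝒪K
𝟘 = (+ 0) + (+ 0) ζ
𝟙 = (+ 1) + (+ 0) ζ
ζ₃ = (+ 0) + (+ 1) ζ
λ₃ = 𝟙 ⊖ ζ₃
𝟛 = (+ 3) + (+ 0) ζ

_^ᴷ_ : 𝒪K → ℕ → 𝒪K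
x ^ᴷ zero = 𝟙
x ^ᴷ suc n = x ⊗ (x ^ᴷ n)

Πᴷ : (n : ℕ) → (Fin n → 𝒪K) → 𝒪K
Πᴷ zero f = 𝟙
Πᴷ (suc n) f = f Fin.zero ⊗ Πᴷ n (λ i → f (Fin.suc i))

Nᴷ : 𝒪K → ℕ
Nᴷ (a + b ζ) = ∣ a ℤ.* a ℤ.- a ℤ.* b ℤ.+ b ℤ.* b ∣

_∣ᴷ_ : 𝒪K → 𝒪K → Set
x ∣ᴷ y = ∃ λ c → y ≡ x ⊗ c

IsUnitᴷ : 𝒪K → Set
IsUnitᴷ x = ∃ λ y → x ⊗ y ≡ 𝟙

Associated : 𝒪K → 𝒪K → Set
Associated x y = ∃ λ u → IsUnitᴷ u × (x ≡ u ⊗ y)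

IsPrimeᴷ : 𝒪K → Set
IsPrimeᴷ p = (p ≢ 𝟘) × (¬ IsUnitᴷ p)
           × (∀ x y → p ∣ᴷ (x ⊗ y) → (p ∣ᴷ x) ⊎ (p ∣ᴷ y))

_≡_[mod_] : 𝒪K → 𝒪K → 𝒪K → Set
x ≡ y [mod m ] = m ∣ᴷ (x ⊖ y)

-- Cubic residue symbol, via its logarithm:
-- CubicResLog π v k  ⟺  (v/π)₃ = ζ₃^k, i.e. π ∣ v^((N(π)-1)/3) - ζ₃^k
-- (for π a prime not dividing 3 and v coprime to π this k ∈ Fin 3 is unique)

CubicResLog : (π v : 𝒪K) → Fin 3 → Set
CubicResLog π v k = (v ^ᴷ ((Nᴷ π ℕ.∸ 1) ℕ./ 3)) ≡ (ζ₃ ^ᴷ toℕ k) [mod π ]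

record 𝕂 : Set where
  constructor _+_ζₖ
  field
    reₖ : ℚ
    imₖ : ℚ

infixl 6 _⊕ₖ_
infixl 7 _⊗ₖ_

_⊕ₖ_ : 𝕂 → 𝕂 → 𝕂
(a + b ζₖ) ⊕ₖ (c + d ζₖ) = (a ℚ.+ c) + (b ℚ.+ d) ζₖ

_⊗ₖ_ : 𝕂 → 𝕂 → 𝕂
(a + b ζₖ) ⊗ₖ (c + d ζₖ) =
  (a ℚ.* c ℚ.- b ℚ.* d) + (a ℚ.* d ℚ.+ b ℚ.* c ℚ.- b ℚ.* d) ζₖ

ι : 𝒪K → 𝕂
ι (a + b ζ) = (a ℚ./ 1) + (b ℚ./ 1) ζₖ

𝟘ₖ 𝟙ₖ : 𝕂
𝟘ₖ = ι 𝟘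
𝟙ₖ = ι 𝟙

-- L = K(∛α) = K[θ]/(θ³ - α) : elements c₀ + c₁θ + c₂θ²

record 𝕃 : Set where
  constructor ⟨_∣_∣_⟩
  field
    c₀ c₁ c₂ : 𝕂

module _ (α : 𝒪K) where
  private
    α̂ = ι α

  infixl 6 _⊕ₗ_
  infixl 7 _⊗ₗ_

  _⊕ₗ_ : 𝕃 → 𝕃 → 𝕃
  ⟨ a₀ ∣ a₁ ∣ a₂ ⟩ ⊕ₗ ⟨ b₀ ∣ b₁ ∣ b₂ ⟩ = ⟨ a₀ ⊕ₖ b₀ ∣ a₁ ⊕ₖ b₁ ∣ a₂ ⊕ₖ b₂ ⟩

  -- multiplication using θ³ = α
  _⊗ₗ_ : 𝕃 → 𝕃 → 𝕃
  ⟨ a₀ ∣ a₁ ∣ a₂ ⟩ ⊗ₗ ⟨ b₀ ∣ b₁ ∣ b₂ ⟩ =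
    ⟨ (a₀ ⊗ₖ b₀) ⊕ₖ (α̂ ⊗ₖ ((a₁ ⊗ₖ b₂) ⊕ₖ (a₂ ⊗ₖ b₁)))
    ∣ (a₀ ⊗ₖ b₁) ⊕ₖ (a₁ ⊗ₖ b₀) ⊕ₖ (α̂ ⊗ₖ (a₂ ⊗ₖ b₂))
    ∣ (a₀ ⊗ₖ b₂) ⊕ₖ (a₁ ⊗ₖ b₁) ⊕ₖ (a₂ ⊗ₖ b₀) ⟩

  ιₗ : 𝕂 → 𝕃
  ιₗ c = ⟨ c ∣ 𝟘ₖ ∣ 𝟘ₖ ⟩

  𝟘ₗ 𝟙ₗ : 𝕃
  𝟘ₗ = ιₗ 𝟘ₖ
  𝟙ₗ = ιₗ 𝟙ₖ

  _^ₗ_ : 𝕃 → ℕ → 𝕃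
  x ^ₗ zero = 𝟙ₗ
  x ^ₗ suc n = x ⊗ₗ (x ^ₗ n)

  polyEval : (k : ℕ) → (Fin k → 𝒪K) → 𝕃 → 𝕃
  polyEval zero p x = 𝟘ₗ
  polyEval (suc k) p x =
    ιₗ (ι (p Fin.zero)) ⊕ₗ (x ⊗ₗ polyEval k (λ j → p (Fin.suc j)) x)

  Integral : 𝕃 → Set
  Integral u = Σ ℕ λ k → Σ (Fin k → 𝒪K) λ p →
    (u ^ₗ k) ⊕ₗ polyEval k p u ≡ 𝟘ₗ

  UnitOL : 𝕃 → Set
  UnitOL u = Integral u × (Σ 𝕃 λ v → Integral v × (u ⊗ₗ v ≡ 𝟙ₗ))

  -- N_{L/K}(c₀ + c₁θ + c₂θ²) = det of multiplication-by-u on the K-basis 1, θ, θ²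
  --   = c₀³ + α c₁³ + α² c₂³ - 3α c₀c₁c₂
  Normₗ : 𝕃 → 𝕂
  Normₗ ⟨ a ∣ b ∣ c ⟩ =
    (a ⊗ₖ a ⊗ₖ a) ⊕ₖ (α̂ ⊗ₖ (b ⊗ₖ b ⊗ₖ b))
    ⊕ₖ (α̂ ⊗ₖ α̂ ⊗ₖ (c ⊗ₖ c ⊗ₖ c))
    ⊕ₖ (ι (⊝ 𝟛) ⊗ₖ α̂ ⊗ₖ (a ⊗ₖ b ⊗ₖ c))

-- Rédei matrix data (entries as integers, read modulo 3)

Σℤ : (n : ℕ) → (Fin n → ℤ) → ℤ
Σℤ zero f = + 0
Σℤ (suc n) f = f Fin.zero ℤ.+ Σℤ n (λ i → f (Fin.suc i))

expo : Fin 2 → ℕ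
expo e = suc (toℕ e)

-- a⁻¹ in F₃ (1⁻¹ = 1, 2⁻¹ = 2), as an integer representative
inv₃ : Fin 2 → ℤ
inv₃ e = + expo e

alphaOf : (n : ℕ) → (Fin n → 𝒪K) → (Fin n → Fin 2) → 𝒪K
alphaOf n π a = Πᴷ n (λ i → π i ^ᴷ expo (a i))

-- Given the logs ℓ i j = log (π_i/π_j)₃ (i ≠ j), the Rédei matrix
-- M_L = (b_ij)_{1 ≤ i,j ≤ n-1}, here with n = suc m and indices in Fin m:
--  b_ij = ℓ i j  (i ≠ j)
--  b_ii = a_i⁻¹ · log((π_i^{a_i}/α / π_i)₃) = a_i⁻¹ · ( - Σ_{k ≠ i} a_k ℓ k i )
-- (π_i^{a_i}/α = ∏_{k≠i} π_k^{-a_k} and the symbol is extended multiplicatively)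
redei : (m : ℕ) → (Fin (suc m) → Fin 2) → (Fin (suc m) → Fin (suc m) → Fin 3)
      → Fin m → Fin m → ℤ
redei m a ℓ i j with i Fin.≟ j
... | no _ = + toℕ (ℓ (inject₁ i) (inject₁ j))
... | yes _ = inv₃ (a (inject₁ i)) ℤ.*
   (ℤ.- Σℤ (suc m) (λ k → diagTerm k))
  where
  diagTerm : Fin (suc m) → ℤ
  diagTerm k with k Fin.≟ inject₁ i
  ... | yes _ = + 0
  ... | no _ = (+ expo (a k)) ℤ.* (+ toℕ (ℓ k (inject₁ i)))

FullRank₃ : (m : ℕ) → (Fin m → Fin m → ℤ) → Set
FullRank₃ m B = (c : Fin m → ℤ) →
  (∀ j → (+ 3) ℤDiv.∣ Σℤ m (λ i → c i ℤ.* B i j)) →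
  ∀ i → (+ 3) ℤDiv.∣ c i

{-# OPTIONS --safe #-}
module Submission where

-- Write α = βγ² with β, γ squarefree. The elements x₀ + x₁∛α + x₂(∛α)²/γ with suitable
-- coordinates in ⅓ℤ[ζ₃] form an order stable under σ : ∛α ↦ ζ₃∛α. By Hilbert 90 a unit u of
-- norm 1 is x/σ(x) with x primitive, and then (x) is ambiguous: the norm of x is a unit times
-- a product of powers of the πᵢ. Comparing cubic residue symbols at each πⱼ shows that the exponent
-- vector modulo 3 lies, up to a multiple of (a₁, …, aₙ), in the left kernel of the Rédei
-- matrix, so full rank makes x a unit times a power of ∛α and u = ζ₃ᵏ v/σ(v) with v a unit.
-- If no unit has norm ζ₃ then v may be taken of norm 1 again, and doing this twice extracts a
-- cube root of u up to a power of ζ₃, since (1 − σ)² acts as −3σ on units of norm 1. Hence for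
-- every n the cube of u is the cube of a 3ⁿ-th power of a unit of norm 1, and for E divisible
-- by 3 and by the order of the units modulo 3 this makes uᴱ congruent to 1 modulo every power
-- of 3, so uᴱ = 1. But Dirichlet's box principle, applied to approximations of ∛α by elements
-- of ℚ(ζ₃), yields a unit u of norm 1 with uᴱ ≠ 1.

open import Defs using (𝒪K; 𝕂; 𝕃; _+_ζ; _+_ζₖ; ⟨_∣_∣_⟩; 𝟙; ζ₃; λ₃; ι; _^ᴷ_; _≡_[mod_]; IsPrimeᴷ; Associated; CubicResLog; FullRank₃; redei; alphaOf; UnitOL; Normₗ)
import Defs as D

open import Algebra.Bundles using (CommutativeRing; CommutativeSemiring)
open import Algebra.Consequences.Propositional using (comm∧idˡ⇒id; comm∧invˡ⇒inv)
import Algebra.Properties.CommutativeSemiring.Binomial as BinomialTheorem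
import Algebra.Properties.CommutativeSemiring.Exp as Power
import Algebra.Properties.Monoid.Sum as MonoidSum
import Algebra.Properties.Ring as RingProperties
import Algebra.Solver.Ring.NaturalCoefficients.Default as NatSolver
open import Algebra.Structures using (IsCommutativeRing; IsCommutativeSemiring)
open import Algebra.Structures.Biased using (isCommutativeMonoidˡ; isCommutativeSemiringˡ)
open import Data.Empty using (⊥; ⊥-elim)
open import Data.Fin as Fin using (Fin; toℕ)
import Data.Fin.Properties as FinP
open import Data.Fin.Relation.Unary.Top using (view; ‵fromℕ; ‵inject₁)
open import Data.Integer as ℤ using (ℤ; +_; +0; -[1+_])
import Data.Integer.DivMod as ℤDM
import Data.Integer.Divisibility.Signed as ℤS
import Data.Integer.Properties as ℤP
import Data.Integer.Tactic.RingSolver as ℤR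
open import Data.List using ([]; _∷_)
open import Data.List.Relation.Unary.All using (All; []; _∷_)
open import Data.Maybe using (Maybe; just; nothing)
open import Data.Nat as ℕ using (ℕ; zero; suc; s≤s; z≤n; _!)
open import Data.Nat.Combinatorics using (_C_; nCk≡n!/k![n-k]!; k![n∸k]!∣n!; nCn≡1)
import Data.Nat.DivMod as ℕDM
import Data.Nat.Divisibility as ℕD
open import Data.Nat.Induction using (<-wellFounded)
open import Data.Nat.ListAction using (product)
open import Data.Nat.Primality using (euclidsLemma; prime⇒nonZero; prime⇒nonTrivial; prime⇒irreducible) renaming (Prime to ℕPrime)
open import Data.Nat.Primality.Factorisation using (factorise; PrimeFactorisation)
import Data.Nat.Properties as ℕP
import Data.Nat.Tactic.RingSolver as ℕR
open import Data.Product using (Σ; ∃; ∃₂; _×_; _,_; proj₁; proj₂)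
open import Data.Rational as ℚ using (ℚ; 0ℚ; 1ℚ)
import Data.Rational.Properties as ℚP
import Data.Rational.Unnormalised as ℚᵘ
import Data.Rational.Unnormalised.Properties as ℚᵘP
open import Data.Sum using (_⊎_; inj₁; inj₂; [_,_]′) renaming (map to map⊎)
open import Function using (_∘_)
open import Induction.WellFounded using (Acc; acc)
open import Level using (0ℓ)
open import Relation.Binary.PropositionalEquality hiding (J)
open import Relation.Binary.PropositionalEquality.Algebra using () renaming (isMagma to ≡-isMagma)
open import Relation.Nullary using (¬_; Dec; yes; no)
open import Relation.Nullary.Decidable using (toWitnessFalse)
open import Tactic.RingSolver using (solve-∀)
open import Tactic.RingSolver.Core.AlmostCommutativeRing using (AlmostCommutativeRing; fromCommutativeRing)

-- The congruence πᵢ ≡ 1 modulo λ³ carries the proof. As λ³ = 3(ω² - ω), the normal basis with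
-- denominator 3 has integral structure constants, so the order has discriminant prime to 3 and is
-- ramified only at the πᵢ. Moreover N πᵢ ≡ 1 modulo 9, so every unit of ℤ[ζ₃] is a cubic residue at
-- each πᵢ and the unknown unit in the norm of an ambiguous element drops out of the symbols. The
-- rank and the finite generation of the unit group are replaced by two weaker facts. All units of
-- norm 1 become 1 modulo 3 in one common exponent, so their 3ⁿ-th powers tend to 1 in the 3-adic
-- sense. And the unit from the box principle is made congruent to 1 modulo 3E, so that uᴱ ≠ 1 can
-- be read off a geometric sum that is E modulo 3E. Whether a unit of norm ζ₃ exists is never
-- decided in advance: each descent computes the norm ± ζ₃ʲ of the new unit, and either stops with a
-- solution or continues with norm 1.

data 𝔼 : Set where
  eis : ℤ → ℤ → 𝔼

-- Arithmetic of the Eisenstein integers: norm, division, gcd, primes.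

infixl 6 _+_ _-_
infixl 7 _*_
infix 8 -_
infixr 9 _^_
infix 4 _∣_

normℤ : 𝔼 → ℤ
normℤ (eis a b) = a ℤ.* a ℤ.- a ℤ.* b ℤ.+ b ℤ.* b

-- The operations are opaque so that they stay rigid during unification; on closed
-- arguments they compute inside the blocks that unfold them, which is what lets the
-- ring solver evaluate constants such as ω.
opaque
  _+_ _*_ : 𝔼 → 𝔼 → 𝔼
  eis a b + eis c d = eis (a ℤ.+ c) (b ℤ.+ d)
  eis a b * eis c d = eis (a ℤ.* c ℤ.- b ℤ.* d) (a ℤ.* d ℤ.+ b ℤ.* c ℤ.- b ℤ.* d)

  -_ : 𝔼 → 𝔼
  - eis a b = eis (ℤ.- a) (ℤ.- b)

  N : 𝔼 → ℕ
  N x = ℤ.∣ normℤ x ∣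

  conj : 𝔼 → 𝔼
  conj (eis a b) = eis (a ℤ.- b) (ℤ.- b)

_-_ : 𝔼 → 𝔼 → 𝔼
x - y = x + (- y)

0# 1# ω : 𝔼
0# = eis (+ 0) (+ 0)
1# = eis (+ 1) (+ 0)
ω = eis (+ 0) (+ 1)

_^_ : 𝔼 → ℕ → 𝔼
x ^ zero = 1#
x ^ suc n = x * x ^ n

_∣_ : 𝔼 → 𝔼 → Set
x ∣ y = ∃ λ c → y ≡ x * c

IsUnit : 𝔼 → Set
IsUnit x = ∃ λ y → x * y ≡ 1#

IsPrime : 𝔼 → Set
IsPrime p = (p ≢ 0#) × (¬ IsUnit p) × (∀ x y → p ∣ x * y → (p ∣ x) ⊎ (p ∣ y))

opaque
  unfolding _+_
  *-assoc : ∀ x y z → (x * y) * z ≡ x * (y * z)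
  *-assoc (eis a b) (eis c d) (eis e f) = cong₂ eis (p a b c d e f) (q a b c d e f)
    where
    p : ∀ a b c d e f → (a ℤ.* c ℤ.- b ℤ.* d) ℤ.* e ℤ.- (a ℤ.* d ℤ.+ b ℤ.* c ℤ.- b ℤ.* d) ℤ.* f
       ≡ a ℤ.* (c ℤ.* e ℤ.- d ℤ.* f) ℤ.- b ℤ.* (c ℤ.* f ℤ.+ d ℤ.* e ℤ.- d ℤ.* f)
    p = ℤR.solve-∀
    q : ∀ a b c d e f → (a ℤ.* c ℤ.- b ℤ.* d) ℤ.* f ℤ.+ (a ℤ.* d ℤ.+ b ℤ.* c ℤ.- b ℤ.* d) ℤ.* e ℤ.- (a ℤ.* d ℤ.+ b ℤ.* c ℤ.- b ℤ.* d) ℤ.* f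
       ≡ a ℤ.* (c ℤ.* f ℤ.+ d ℤ.* e ℤ.- d ℤ.* f) ℤ.+ b ℤ.* (c ℤ.* e ℤ.- d ℤ.* f) ℤ.- b ℤ.* (c ℤ.* f ℤ.+ d ℤ.* e ℤ.- d ℤ.* f)
    q = ℤR.solve-∀

opaque
  unfolding _+_
  *-comm : ∀ x y → x * y ≡ y * x
  *-comm (eis a b) (eis c d) = cong₂ eis (p a b c d) (q a b c d)
    where
    p : ∀ a b c d → a ℤ.* c ℤ.- b ℤ.* d ≡ c ℤ.* a ℤ.- d ℤ.* b
    p = ℤR.solve-∀
    q : ∀ a b c d → a ℤ.* d ℤ.+ b ℤ.* c ℤ.- b ℤ.* d ≡ c ℤ.* b ℤ.+ d ℤ.* a ℤ.- d ℤ.* b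
    q = ℤR.solve-∀

opaque
  unfolding _+_
  *-distribˡ : ∀ x y z → x * (y + z) ≡ (x * y) + (x * z)
  *-distribˡ (eis a b) (eis c d) (eis e f) = cong₂ eis (p a b c d e f) (q a b c d e f)
    where
    p : ∀ a b c d e f → a ℤ.* (c ℤ.+ e) ℤ.- b ℤ.* (d ℤ.+ f) ≡ (a ℤ.* c ℤ.- b ℤ.* d) ℤ.+ (a ℤ.* e ℤ.- b ℤ.* f)
    p = ℤR.solve-∀
    q : ∀ a b c d e f → a ℤ.* (d ℤ.+ f) ℤ.+ b ℤ.* (c ℤ.+ e) ℤ.- b ℤ.* (d ℤ.+ f)
       ≡ (a ℤ.* d ℤ.+ b ℤ.* c ℤ.- b ℤ.* d) ℤ.+ (a ℤ.* f ℤ.+ b ℤ.* e ℤ.- b ℤ.* f)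
    q = ℤR.solve-∀

opaque
  unfolding _+_
  *-identityˡ : ∀ x → 1# * x ≡ x
  *-identityˡ (eis a b) = cong₂ eis (p a b) (q a b)
    where
    p : ∀ a b → (+ 1) ℤ.* a ℤ.- (+ 0) ℤ.* b ≡ a
    p = ℤR.solve-∀
    q : ∀ a b → (+ 1) ℤ.* b ℤ.+ (+ 0) ℤ.* a ℤ.- (+ 0) ℤ.* b ≡ b
    q = ℤR.solve-∀

opaque
  unfolding _+_
  +-assoc : ∀ x y z → (x + y) + z ≡ x + (y + z)
  +-assoc (eis a b) (eis c d) (eis e f) = cong₂ eis (ℤP.+-assoc a c e) (ℤP.+-assoc b d f)

opaque
  unfolding _+_
  +-comm : ∀ x y → x + y ≡ y + x
  +-comm (eis a b) (eis c d) = cong₂ eis (ℤP.+-comm a c) (ℤP.+-comm b d)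

opaque
  unfolding _+_
  +-identityˡ : ∀ x → 0# + x ≡ x
  +-identityˡ (eis a b) = cong₂ eis (ℤP.+-identityˡ a) (ℤP.+-identityˡ b)

opaque
  unfolding _+_
  +-inverseˡ : ∀ x → (- x) + x ≡ 0#
  +-inverseˡ (eis a b) = cong₂ eis (ℤP.+-inverseˡ a) (ℤP.+-inverseˡ b)

𝔼-commutativeRing : CommutativeRing 0ℓ 0ℓ
𝔼-commutativeRing = record
  { Carrier = 𝔼 ; _≈_ = _≡_ ; _+_ = _+_ ; _*_ = _*_ ; -_ = -_ ; 0# = 0# ; 1# = 1#
  ; isCommutativeRing = record
    { isRing = record
      { +-isAbelianGroup = record
        { isGroup = record
          { isMonoid = record
            { isSemigroup = record
              { isMagma = ≡-isMagma _+_ ; assoc = +-assoc }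
            ; identity = comm∧idˡ⇒id +-comm +-identityˡ }
          ; inverse = comm∧invˡ⇒inv +-comm +-inverseˡ
          ; ⁻¹-cong = cong (λ x → - x) }
        ; comm = +-comm }
      ; *-cong = cong₂ _*_
      ; *-assoc = *-assoc
      ; *-identity = comm∧idˡ⇒id *-comm *-identityˡ
      ; distrib = *-distribˡ , λ x y z → trans (*-comm (y + z) x) (trans (*-distribˡ x y z) (cong₂ _+_ (*-comm x y) (*-comm x z))) }
    ; *-comm = *-comm } }

0#≟ : ∀ x → Maybe (0# ≡ x)
0#≟ (eis +0 +0) = just refl
0#≟ _ = nothing

𝔼-ring : AlmostCommutativeRing 0ℓ 0ℓ
𝔼-ring = fromCommutativeRing 𝔼-commutativeRing 0#≟

opaque
  unfolding _+_
  sq≡ : ∀ i → i ℤ.* i ≡ + (ℤ.∣ i ∣ ℕ.* ℤ.∣ i ∣)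
  sq≡ (+ n) = ℤP.+◃n≡+n (n ℕ.* n)
  sq≡ -[1+ n ] = refl

int : ℤ → 𝔼
int n = eis n +0

nat : ℕ → 𝔼
nat n = int (+ n)

private
  -- Completing the square; positivity of the norm and the bounds on both coordinates come from it.
  sq-form : ∀ a b → (+ 4) ℤ.* (a ℤ.* a ℤ.- a ℤ.* b ℤ.+ b ℤ.* b)
    ≡ ((+ 2) ℤ.* a ℤ.- b) ℤ.* ((+ 2) ℤ.* a ℤ.- b) ℤ.+ (+ 3) ℤ.* (b ℤ.* b)
  sq-form = ℤR.solve-∀

  norm-sym : ∀ a b → a ℤ.* a ℤ.- a ℤ.* b ℤ.+ b ℤ.* b ≡ b ℤ.* b ℤ.- b ℤ.* a ℤ.+ a ℤ.* a
  norm-sym = ℤR.solve-∀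

  four-normℤ : ∀ a b → (+ 4) ℤ.* normℤ (eis a b)
    ≡ + (ℤ.∣ (+ 2) ℤ.* a ℤ.- b ∣ ℕ.* ℤ.∣ (+ 2) ℤ.* a ℤ.- b ∣ ℕ.+ 3 ℕ.* (ℤ.∣ b ∣ ℕ.* ℤ.∣ b ∣))
  four-normℤ a b = trans (sq-form a b) (trans
    (cong₂ ℤ._+_ (sq≡ ((+ 2) ℤ.* a ℤ.- b)) (trans (cong ((+ 3) ℤ.*_) (sq≡ b)) (sym (ℤP.pos-* 3 (ℤ.∣ b ∣ ℕ.* ℤ.∣ b ∣))))) refl)

opaque
  unfolding _+_
  normℤ-nonneg : ∀ x → +0 ℤ.≤ normℤ x
  normℤ-nonneg (eis a b) = ℤP.*-cancelˡ-≤-pos +0 _ (+ 4)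
    (subst (+0 ℤ.≤_) (sym (four-normℤ a b)) (ℤ.+≤+ z≤n))

opaque
  unfolding _+_
  +N : ∀ x → + N x ≡ normℤ x
  +N x@(eis _ _) = ℤP.0≤i⇒+∣i∣≡i (normℤ-nonneg x)

opaque
  unfolding _+_
  four-N : ∀ a b → 4 ℕ.* N (eis a b)
    ≡ ℤ.∣ (+ 2) ℤ.* a ℤ.- b ∣ ℕ.* ℤ.∣ (+ 2) ℤ.* a ℤ.- b ∣ ℕ.+ 3 ℕ.* (ℤ.∣ b ∣ ℕ.* ℤ.∣ b ∣)
  four-N a b = ℤP.+-injective (trans (ℤP.pos-* 4 (N (eis a b)))
    (trans (cong ((+ 4) ℤ.*_) (+N (eis a b))) (four-normℤ a b)))

opaque
  unfolding _+_
  N-swap : ∀ a b → N (eis a b) ≡ N (eis b a)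
  N-swap a b = cong ℤ.∣_∣ (norm-sym a b)

opaque
  unfolding _+_
  im²≤ : ∀ a b → 3 ℕ.* (ℤ.∣ b ∣ ℕ.* ℤ.∣ b ∣) ℕ.≤ 4 ℕ.* N (eis a b)
  im²≤ a b = subst (3 ℕ.* (ℤ.∣ b ∣ ℕ.* ℤ.∣ b ∣) ℕ.≤_) (sym (four-N a b)) (ℕP.m≤n+m (3 ℕ.* (ℤ.∣ b ∣ ℕ.* ℤ.∣ b ∣)) (ℤ.∣ (+ 2) ℤ.* a ℤ.- b ∣ ℕ.* ℤ.∣ (+ 2) ℤ.* a ℤ.- b ∣))

opaque
  unfolding _+_
  re²≤ : ∀ a b → 3 ℕ.* (ℤ.∣ a ∣ ℕ.* ℤ.∣ a ∣) ℕ.≤ 4 ℕ.* N (eis a b)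
  re²≤ a b = subst (λ n → 3 ℕ.* (ℤ.∣ a ∣ ℕ.* ℤ.∣ a ∣) ℕ.≤ 4 ℕ.* n) (N-swap b a) (im²≤ b a)

opaque
  unfolding _+_
  N≡0⇒≡0# : ∀ x → N x ≡ 0 → x ≡ 0#
  N≡0⇒≡0# (eis a b) N≡0 = cong₂ eis (vanish a (re²≤ a b)) (vanish b (im²≤ a b))
    where
    vanish : ∀ i → 3 ℕ.* (ℤ.∣ i ∣ ℕ.* ℤ.∣ i ∣) ℕ.≤ 4 ℕ.* N (eis a b) → i ≡ +0
    vanish i le with ℤ.∣ i ∣ in eq
    ... | zero = ℤP.∣i∣≡0⇒i≡0 eq
    ... | suc k with subst (λ n → 3 ℕ.* (suc k ℕ.* suc k) ℕ.≤ 4 ℕ.* n) N≡0 le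
    ...   | ()

opaque
  unfolding _+_
  normℤ-* : ∀ x y → normℤ (x * y) ≡ normℤ x ℤ.* normℤ y
  normℤ-* (eis a b) (eis c d) = identity a b c d
    where
    identity : ∀ a b c d → (a ℤ.* c ℤ.- b ℤ.* d) ℤ.* (a ℤ.* c ℤ.- b ℤ.* d)
      ℤ.- (a ℤ.* c ℤ.- b ℤ.* d) ℤ.* (a ℤ.* d ℤ.+ b ℤ.* c ℤ.- b ℤ.* d)
      ℤ.+ (a ℤ.* d ℤ.+ b ℤ.* c ℤ.- b ℤ.* d) ℤ.* (a ℤ.* d ℤ.+ b ℤ.* c ℤ.- b ℤ.* d)
      ≡ (a ℤ.* a ℤ.- a ℤ.* b ℤ.+ b ℤ.* b) ℤ.* (c ℤ.* c ℤ.- c ℤ.* d ℤ.+ d ℤ.* d)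
    identity = ℤR.solve-∀

opaque
  unfolding _+_
  N-* : ∀ x y → N (x * y) ≡ N x ℕ.* N y
  N-* x y = trans (cong ℤ.∣_∣ (normℤ-* x y)) (ℤP.abs-* (normℤ x) (normℤ y))

opaque
  unfolding _+_
  x*conj : ∀ x → x * conj x ≡ nat (N x)
  x*conj x@(eis a b) = cong₂ eis (trans (re-eq a b) (sym (+N x))) (im-eq a b)
    where
    re-eq : ∀ a b → a ℤ.* (a ℤ.- b) ℤ.- b ℤ.* (ℤ.- b) ≡ a ℤ.* a ℤ.- a ℤ.* b ℤ.+ b ℤ.* b
    re-eq = ℤR.solve-∀
    im-eq : ∀ a b → a ℤ.* (ℤ.- b) ℤ.+ b ℤ.* (a ℤ.- b) ℤ.- b ℤ.* (ℤ.- b) ≡ +0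
    im-eq = ℤR.solve-∀

opaque
  unfolding _+_
  N-conj : ∀ x → N (conj x) ≡ N x
  N-conj (eis a b) = cong ℤ.∣_∣ (identity a b)
    where
    identity : ∀ a b → (a ℤ.- b) ℤ.* (a ℤ.- b) ℤ.- (a ℤ.- b) ℤ.* (ℤ.- b) ℤ.+ (ℤ.- b) ℤ.* (ℤ.- b)
      ≡ a ℤ.* a ℤ.- a ℤ.* b ℤ.+ b ℤ.* b
    identity = ℤR.solve-∀

opaque
  unfolding _+_
  N-int : ∀ i → N (int i) ≡ ℤ.∣ i ∣ ℕ.* ℤ.∣ i ∣
  N-int i = trans (cong ℤ.∣_∣ (identity i)) (ℤP.abs-* i i)
    where
    identity : ∀ i → i ℤ.* i ℤ.- i ℤ.* +0 ℤ.+ +0 ℤ.* +0 ≡ i ℤ.* i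
    identity = ℤR.solve-∀

opaque
  unfolding _+_
  int-* : ∀ i j → int (i ℤ.* j) ≡ int i * int j
  int-* i j = cong₂ eis (re-eq i j) (im-eq i j)
    where
    re-eq : ∀ i j → i ℤ.* j ≡ i ℤ.* j ℤ.- +0 ℤ.* +0
    re-eq = ℤR.solve-∀
    im-eq : ∀ i j → +0 ≡ i ℤ.* +0 ℤ.+ +0 ℤ.* j ℤ.- +0 ℤ.* +0
    im-eq = ℤR.solve-∀

opaque
  unfolding _+_
  nat-* : ∀ m n → nat (m ℕ.* n) ≡ nat m * nat n
  nat-* m n = trans (cong int (ℤP.pos-* m n)) (int-* (+ m) (+ n))

_≟_ : ∀ (x y : 𝔼) → Dec (x ≡ y)
(eis a b) ≟ (eis c d) with a ℤ.≟ c | b ℤ.≟ d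
... | yes refl | yes refl = yes refl
... | no a≢c | _ = no λ { refl → a≢c refl }
... | _ | no b≢d = no λ { refl → b≢d refl }

opaque
  N≢0 : ∀ {x} → x ≢ 0# → N x ≢ 0
  N≢0 {x} x≢0# = x≢0# ∘ N≡0⇒≡0# x

opaque
  unfolding _+_
  *-zeroʳ : ∀ x → x * 0# ≡ 0#
  *-zeroʳ = solve-∀ 𝔼-ring

opaque
  unfolding _+_
  *-zeroˡ : ∀ x → 0# * x ≡ 0#
  *-zeroˡ = solve-∀ 𝔼-ring

opaque
  *-identityʳ : ∀ x → x * 1# ≡ x
  *-identityʳ x = trans (*-comm x 1#) (*-identityˡ x)

opaque
  unfolding _+_
  *≡0# : ∀ x y → x * y ≡ 0# → x ≡ 0# ⊎ y ≡ 0#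
  *≡0# x y xy≡0# = map⊎ (N≡0⇒≡0# x) (N≡0⇒≡0# y) (ℕP.m*n≡0⇒m≡0∨n≡0 (N x) (trans (sym (N-* x y)) (cong N xy≡0#)))

opaque
  *≢0# : ∀ {x y} → x ≢ 0# → y ≢ 0# → x * y ≢ 0#
  *≢0# {x} {y} x≢0# y≢0# xy≡0# = [ x≢0# , y≢0# ]′ (*≡0# x y xy≡0#)

opaque
  unfolding _+_
  -≡0#⇒≡ : ∀ x y → x - y ≡ 0# → x ≡ y
  -≡0#⇒≡ x y x-y≡0# = trans (split x y) (trans (cong (_+ y) x-y≡0#) (+-identityˡ y))
    where
    split : ∀ x y → x ≡ (x - y) + y
    split = solve-∀ 𝔼-ring

opaque
  unfolding _+_
  x-x≡0# : ∀ x → x - x ≡ 0#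
  x-x≡0# = solve-∀ 𝔼-ring

opaque
  unfolding _+_
  *-cancelˡ : ∀ x {y z} → x ≢ 0# → x * y ≡ x * z → y ≡ z
  *-cancelˡ x {y} {z} x≢0# eq =
    [ ⊥-elim ∘ x≢0# , -≡0#⇒≡ y z ]′ (*≡0# x (y - z) (trans (distrib x y z) (trans (cong (_- (x * z)) eq) (x-x≡0# _))))
    where
    distrib : ∀ x y z → x * (y - z) ≡ x * y - x * z
    distrib = solve-∀ 𝔼-ring

opaque
  unfolding _+_
  IsUnit⇒N≡1 : ∀ {x} → IsUnit x → N x ≡ 1
  IsUnit⇒N≡1 {x} (y , xy≡1#) = ℕP.m*n≡1⇒m≡1 (N x) (N y) (trans (sym (N-* x y)) (cong N xy≡1#))

opaque
  N≡1⇒IsUnit : ∀ {x} → N x ≡ 1 → IsUnit x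
  N≡1⇒IsUnit {x} N≡1 = conj x , trans (x*conj x) (cong nat N≡1)

opaque
  unfolding _+_
  unit-cases : ∀ x → N x ≡ 1 → Σ (Fin 3) λ k → (x ≡ ω ^ toℕ k) ⊎ (x ≡ - (ω ^ toℕ k))
  unit-cases (eis a b) N≡1 = go a b (small a (re²≤ a b)) (small b (im²≤ a b)) N≡1
    where
    small : ∀ i → 3 ℕ.* (ℤ.∣ i ∣ ℕ.* ℤ.∣ i ∣) ℕ.≤ 4 ℕ.* N (eis a b) → ℤ.∣ i ∣ ℕ.≤ 1
    small i le with ℤ.∣ i ∣
    ... | 0 = z≤n
    ... | 1 = s≤s z≤n
    ... | suc (suc k) = ⊥-elim (ℕP.<⇒≱ (ℕP.<-≤-trans (ℕP.n<1+n 4)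
            (ℕP.≤-trans (ℕP.m≤m+n 5 7) (ℕP.*-monoʳ-≤ 3 (ℕP.*-mono-≤ two≤ two≤))))
            (subst (λ n → 3 ℕ.* (suc (suc k) ℕ.* suc (suc k)) ℕ.≤ 4 ℕ.* n) N≡1 le))
      where
      two≤ : 2 ℕ.≤ suc (suc k)
      two≤ = s≤s (s≤s z≤n)
    go : ∀ a b → ℤ.∣ a ∣ ℕ.≤ 1 → ℤ.∣ b ∣ ℕ.≤ 1 → N (eis a b) ≡ 1 →
         Σ (Fin 3) λ k → ((eis a b) ≡ ω ^ toℕ k) ⊎ ((eis a b) ≡ - (ω ^ toℕ k))
    go (+ 0) (+ 1) _ _ _ = Fin.suc Fin.zero , inj₁ refl
    go (+ 0) -[1+ 0 ] _ _ _ = Fin.suc Fin.zero , inj₂ refl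
    go (+ 1) (+ 0) _ _ _ = Fin.zero , inj₁ refl
    go (+ 1) (+ 1) _ _ _ = Fin.suc (Fin.suc Fin.zero) , inj₂ refl
    go -[1+ 0 ] (+ 0) _ _ _ = Fin.zero , inj₂ refl
    go -[1+ 0 ] -[1+ 0 ] _ _ _ = Fin.suc (Fin.suc Fin.zero) , inj₁ refl
    go (+ 0) (+ 0) _ _ ()
    go (+ 1) -[1+ 0 ] _ _ ()
    go -[1+ 0 ] (+ 1) _ _ ()
    go (+ suc (suc _)) _ (s≤s ()) _ _
    go -[1+ suc _ ] _ (s≤s ()) _ _
    go (+ 0) (+ suc (suc _)) _ (s≤s ()) _
    go (+ 1) (+ suc (suc _)) _ (s≤s ()) _
    go -[1+ 0 ] (+ suc (suc _)) _ (s≤s ()) _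
    go _ -[1+ suc _ ] _ (s≤s ()) _

opaque
  ∣-refl : ∀ {x} → x ∣ x
  ∣-refl {x} = 1# , sym (*-identityʳ x)

opaque
  ∣-trans : ∀ {x y z} → x ∣ y → y ∣ z → x ∣ z
  ∣-trans {x} (c , refl) (d , refl) = c * d , *-assoc x c d

opaque
  ∣-add : ∀ {x y z} → x ∣ y → x ∣ z → x ∣ (y + z)
  ∣-add {x} (c , refl) (d , refl) = c + d , sym (*-distribˡ x c d)

opaque
  unfolding _+_
  ∣-neg : ∀ {x y} → x ∣ y → x ∣ (- y)
  ∣-neg {x} (c , refl) = - c , neg x c
    where
    neg : ∀ x c → - (x * c) ≡ x * (- c)
    neg = solve-∀ 𝔼-ring

opaque
  ∣-sub : ∀ {x y z} → x ∣ y → x ∣ z → x ∣ (y - z)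
  ∣-sub p q = ∣-add p (∣-neg q)

opaque
  unfolding _+_
  ∣-*ˡ : ∀ {x y} z → x ∣ y → x ∣ (z * y)
  ∣-*ˡ {x} z (c , refl) = z * c , swap z x c
    where
    swap : ∀ z x c → z * (x * c) ≡ x * (z * c)
    swap = solve-∀ 𝔼-ring

opaque
  ∣-*ʳ : ∀ {x y} z → x ∣ y → x ∣ (y * z)
  ∣-*ʳ {x} z (c , refl) = c * z , *-assoc x c z

opaque
  x∣x* : ∀ {x} y → x ∣ (x * y)
  x∣x* y = y , refl

opaque
  ∣0# : ∀ {x} → x ∣ 0#
  ∣0# {x} = 0# , sym (*-zeroʳ x)

opaque
  ^-+ : ∀ x m n → x ^ (m ℕ.+ n) ≡ x ^ m * x ^ n
  ^-+ x zero n = sym (*-identityˡ _)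
  ^-+ x (suc m) n = trans (cong (x *_) (^-+ x m n)) (sym (*-assoc x _ _))

opaque
  unfolding _+_
  ^-distrib-* : ∀ x y n → (x * y) ^ n ≡ x ^ n * y ^ n
  ^-distrib-* x y zero = refl
  ^-distrib-* x y (suc n) = trans (cong (x * y *_) (^-distrib-* x y n)) (swap x y _ _)
    where
    swap : ∀ a b c d → (a * b) * (c * d) ≡ (a * c) * (b * d)
    swap = solve-∀ 𝔼-ring

opaque
  1#^ : ∀ n → 1# ^ n ≡ 1#
  1#^ zero = refl
  1#^ (suc n) = trans (*-identityˡ _) (1#^ n)

opaque
  ^-* : ∀ x m n → x ^ (m ℕ.* n) ≡ (x ^ m) ^ n
  ^-* x zero n = sym (1#^ n)
  ^-* x (suc m) n = trans (^-+ x n (m ℕ.* n)) (trans (cong (x ^ n *_) (^-* x m n)) (sym (^-distrib-* x (x ^ m) n)))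

opaque
  unfolding _+_
  ^≢0# : ∀ {x} n → x ≢ 0# → x ^ n ≢ 0#
  ^≢0# zero _ ()
  ^≢0# (suc n) x≢0# = *≢0# x≢0# (^≢0# n x≢0#)

opaque
  unfolding _+_
  N-small-≤ : ∀ r s n → r ℕ.≤ s → s ℕ.< n → N (eis (+ r) (+ s)) ℕ.< n ℕ.* n
  N-small-≤ r s n r≤s s<n with ℕP.m≤n⇒∃[o]m+o≡n r≤s
  ... | d , refl = ℕP.≤-<-trans (subst (ℕ._≤ (r ℕ.+ d) ℕ.* (r ℕ.+ d)) (sym norm≡) square)
                    (ℕP.*-mono-< s<n s<n)
    where
    expand : ∀ r d → r ℤ.* r ℤ.- r ℤ.* (r ℤ.+ d) ℤ.+ (r ℤ.+ d) ℤ.* (r ℤ.+ d) ≡ r ℤ.* r ℤ.+ r ℤ.* d ℤ.+ d ℤ.* d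
    expand = ℤR.solve-∀
    expandℕ : ∀ r d → (r ℕ.+ d) ℕ.* (r ℕ.+ d) ≡ (r ℕ.* r ℕ.+ r ℕ.* d ℕ.+ d ℕ.* d) ℕ.+ r ℕ.* d
    expandℕ = ℕR.solve-∀
    norm≡ : N (eis (+ r) (+ (r ℕ.+ d))) ≡ r ℕ.* r ℕ.+ r ℕ.* d ℕ.+ d ℕ.* d
    norm≡ = cong ℤ.∣_∣ (trans (expand (+ r) (+ d))
      (sym (cong₂ ℤ._+_ (cong₂ ℤ._+_ (ℤP.pos-* r r) (ℤP.pos-* r d)) (ℤP.pos-* d d))))
    square : r ℕ.* r ℕ.+ r ℕ.* d ℕ.+ d ℕ.* d ℕ.≤ (r ℕ.+ d) ℕ.* (r ℕ.+ d)
    square = subst (r ℕ.* r ℕ.+ r ℕ.* d ℕ.+ d ℕ.* d ℕ.≤_) (sym (expandℕ r d)) (ℕP.m≤m+n _ _)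

opaque
  unfolding _+_
  N-small : ∀ r s n → r ℕ.< n → s ℕ.< n → N (eis (+ r) (+ s)) ℕ.< n ℕ.* n
  N-small r s n r<n s<n with ℕP.≤-total r s
  ... | inj₁ r≤s = N-small-≤ r s n r≤s s<n
  ... | inj₂ s≤r = subst (ℕ._< n ℕ.* n) (N-swap (+ s) (+ r)) (N-small-≤ s r n s≤r r<n)

opaque
  unfolding _+_
  -- Rounding down is good enough: with both coordinates in [0, n) the cross term of the norm form
  -- is not positive, which keeps the norm below n².
  floorMod : ∀ p n .{{_ : ℕ.NonZero n}} → ∃₂ λ q ρ → (p ≡ ρ + q * nat n) × (N ρ ℕ.< n ℕ.* n)
  floorMod (eis a b) n =
    eis (a ℤDM./ℕ n) (b ℤDM./ℕ n) , eis (+ (a ℤDM.%ℕ n)) (+ (b ℤDM.%ℕ n)) ,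
    cong₂ eis (trans (ℤDM.a≡a%ℕn+[a/ℕn]*n a n) (re-eq (+ (a ℤDM.%ℕ n)) (a ℤDM./ℕ n) (b ℤDM./ℕ n) (+ n)))
        (trans (ℤDM.a≡a%ℕn+[a/ℕn]*n b n) (im-eq (+ (b ℤDM.%ℕ n)) (a ℤDM./ℕ n) (b ℤDM./ℕ n) (+ n))) ,
    N-small (a ℤDM.%ℕ n) (b ℤDM.%ℕ n) n (ℤDM.n%ℕd<d a n) (ℤDM.n%ℕd<d b n)
    where
    re-eq : ∀ r a b n → r ℤ.+ a ℤ.* n ≡ r ℤ.+ (a ℤ.* n ℤ.- b ℤ.* +0)
    re-eq = ℤR.solve-∀
    im-eq : ∀ r a b n → r ℤ.+ b ℤ.* n ≡ r ℤ.+ (a ℤ.* +0 ℤ.+ b ℤ.* n ℤ.- b ℤ.* +0)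
    im-eq = ℤR.solve-∀

opaque
  unfolding _+_
  remainder-*conj : ∀ x y q ρ → x * conj y ≡ ρ + q * nat (N y) → (x - q * y) * conj y ≡ ρ
  remainder-*conj x y q ρ eq = begin
    (x - q * y) * conj y            ≡⟨ expand x q y (conj y) ⟩
    x * conj y - q * (y * conj y)   ≡⟨ cong₂ (λ a b → a - q * b) eq (x*conj y) ⟩
    (ρ + q * nat (N y)) - q * nat (N y)  ≡⟨ drop ρ (q * nat (N y)) ⟩
    ρ ∎
    where
    open ≡-Reasoning
    expand : ∀ x q y z → (x - q * y) * z ≡ x * z - q * (y * z)
    expand = solve-∀ 𝔼-ring
    drop : ∀ a b → (a + b) - b ≡ a
    drop = solve-∀ 𝔼-ring

opaque
  N-*conj : ∀ x y → N (x * conj y) ≡ N x ℕ.* N y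
  N-*conj x y = trans (N-* x (conj y)) (cong (N x ℕ.*_) (N-conj y))

opaque
  unfolding _+_
  add-sub-split : ∀ x z → x ≡ z + (x - z)
  add-sub-split = solve-∀ 𝔼-ring

opaque
  unfolding _+_
  -- x · conj y is divided by the integer N y. The remainder is (x - qy) · conj y, so one factor N y
  -- cancels from the bound N y · N y.
  divMod : ∀ x y → y ≢ 0# → ∃₂ λ q r → (x ≡ q * y + r) × (N r ℕ.< N y)
  divMod x y y≢0# with floorMod (x * conj y) (N y) {{ℕ.≢-nonZero (N≢0 y≢0#)}}
  ... | q , ρ , eq , Nρ< = q , x - q * y , add-sub-split x (q * y) ,
    ℕP.*-cancelʳ-< (N y) (N (x - q * y)) (N y)
      (subst (ℕ._< N y ℕ.* N y) (trans (cong N (sym (remainder-*conj x y q ρ eq))) (N-*conj (x - q * y) y)) Nρ<)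

record GCD (x y : 𝔼) : Set where
  constructor mkGCD
  field
    {d} : 𝔼
    d∣x : d ∣ x
    d∣y : d ∣ y
    s t : 𝔼
    bézout : s * x + t * y ≡ d

opaque
  unfolding _+_
  gcd : ∀ x y → GCD x y
  gcd x y = go x y (<-wellFounded (N y))
    where
    go : ∀ x y → Acc ℕ._<_ (N y) → GCD x y
    go x y (acc rec) with y ≟ 0#
    ... | yes refl = mkGCD ∣-refl ∣0# 1# 0# (trivial x)
      where
      trivial : ∀ x → 1# * x + 0# * 0# ≡ x
      trivial = solve-∀ 𝔼-ring
    ... | no y≢0# with divMod x y y≢0#
    ...   | q , r , refl , Nr<Ny with go y r (rec Nr<Ny)
    ...     | mkGCD d∣y d∣r s t eq = mkGCD (∣-add (∣-*ˡ q d∣y) d∣r) d∣y t (s - t * q) (trans (regroup s t q r y) eq)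
      where
      regroup : ∀ s t q r y → t * (q * y + r) + (s - t * q) * y ≡ s * y + t * r
      regroup = solve-∀ 𝔼-ring

opaque
  unfolding _+_
  _∣?_ : ∀ x y → Dec (x ∣ y)
  x ∣? y with x ≟ 0#
  ... | yes refl with y ≟ 0#
  ...   | yes refl = yes ∣0#
  ...   | no y≢0# = no λ { (c , eq) → y≢0# (trans eq (*-zeroˡ c)) }
  x ∣? y | no x≢0# with divMod y x x≢0#
  ...   | q , r , y≡ , Nr<Nx with r ≟ 0#
  ...     | yes refl = yes (q , trans y≡ (simp q x))
    where
    simp : ∀ q x → q * x + 0# ≡ x * q
    simp = solve-∀ 𝔼-ring
  ...     | no r≢0# = no λ { (c , y≡xc) → multiple-≮ c (trans (isolate q x r) (trans (cong (_- q * x) (trans (sym y≡) y≡xc)) (factor x c q))) }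
    where
    isolate : ∀ q x r → r ≡ (q * x + r) - q * x
    isolate = solve-∀ 𝔼-ring
    factor : ∀ x c q → x * c - q * x ≡ x * (c - q)
    factor = solve-∀ 𝔼-ring
    multiple-≮ : ∀ c → r ≡ x * (c - q) → ⊥
    multiple-≮ c r≡ with N (c - q) in eq
    ... | zero = r≢0# (trans r≡ (trans (cong (x *_) (N≡0⇒≡0# _ eq)) (*-zeroʳ x)))
    ... | suc k = ℕP.<⇒≱ Nr<Nx (subst (N x ℕ.≤_) (sym (trans (cong N r≡) (trans (N-* x (c - q)) (cong (N x ℕ.*_) eq)))) (ℕP.m≤m*n (N x) (suc k)))

Coprime : 𝔼 → 𝔼 → Set
Coprime x y = ∃₂ λ s t → s * x + t * y ≡ 1#

opaque
  Coprime-sym : ∀ {x y} → Coprime x y → Coprime y x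
  Coprime-sym (s , t , eq) = t , s , trans (+-comm _ _) eq

opaque
  unfolding _+_
  Coprime-* : ∀ {x y z} → Coprime x y → Coprime x z → Coprime x (y * z)
  Coprime-* {x} {y} {z} (s , t , eq) (s′ , t′ , eq′) =
    s * (s′ * x + t′ * z) + t * y * s′ , t * t′ ,
    trans (regroup s t s′ t′ x y z) (trans (cong₂ _*_ eq eq′) refl)
    where
    regroup : ∀ s t s′ t′ x y z → (s * (s′ * x + t′ * z) + t * y * s′) * x + t * t′ * (y * z)
      ≡ (s * x + t * y) * (s′ * x + t′ * z)
    regroup = solve-∀ 𝔼-ring

opaque
  Coprime-1# : ∀ {x} → Coprime x 1#
  Coprime-1# {x} = 0# , 1# , trans (cong₂ _+_ (*-zeroˡ x) (*-identityˡ 1#)) (+-identityˡ 1#)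

opaque
  Coprime-^ : ∀ {x y} n → Coprime x y → Coprime x (y ^ n)
  Coprime-^ zero _ = Coprime-1#
  Coprime-^ (suc n) c = Coprime-* c (Coprime-^ n c)

opaque
  unfolding _+_
  coprime-∣ : ∀ {x y z} → Coprime x y → x ∣ (y * z) → x ∣ z
  coprime-∣ {x} {y} {z} (s , t , eq) x∣yz =
    subst (x ∣_) (trans (regroup s x t y z) (trans (cong (_* z) eq) (*-identityˡ z)))
      (∣-add (x∣x* (s * z)) (∣-*ˡ t x∣yz))
    where
    regroup : ∀ s x t y z → x * (s * z) + t * (y * z) ≡ (s * x + t * y) * z
    regroup = solve-∀ 𝔼-ring

opaque
  coprime-*-∣ : ∀ {x y z} → Coprime x y → x ∣ z → y ∣ z → (x * y) ∣ z
  coprime-*-∣ {x} {y} c (k , refl) y∣xk with coprime-∣ (Coprime-sym c) y∣xk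
  ... | l , refl = l , sym (*-assoc x y l)

module Prime {p : 𝔼} (prime : IsPrime p) where
  p≢0# : p ≢ 0#
  p≢0# = proj₁ prime

  p∤unit : ∀ {u} → IsUnit u → ¬ p ∣ u
  p∤unit (v , uv≡1#) (c , refl) = proj₁ (proj₂ prime) (c * v , trans (sym (*-assoc p c v)) uv≡1#)

  p∤1# : ¬ p ∣ 1#
  p∤1# = p∤unit (1# , *-identityˡ 1#)

  split-∣ : ∀ x y → p ∣ (x * y) → (p ∣ x) ⊎ (p ∣ y)
  split-∣ = proj₂ (proj₂ prime)

  ∤-* : ∀ {x y} → ¬ p ∣ x → ¬ p ∣ y → ¬ p ∣ (x * y)
  ∤-* p∤x p∤y p∣xy = [ p∤x , p∤y ]′ (split-∣ _ _ p∣xy)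

  ∤-^ : ∀ {x} n → ¬ p ∣ x → ¬ p ∣ (x ^ n)
  ∤-^ zero _ = p∤1#
  ∤-^ (suc n) p∤x = ∤-* p∤x (∤-^ n p∤x)

  opaque
    unfolding _+_
    -- Write p = dc with d = gcd(p, x). If p divided d it would divide x; so p divides c, d is a
    -- unit, and its inverse normalises the Bézout relation.
    ∤⇒coprime : ∀ {x} → ¬ p ∣ x → Coprime p x
    ∤⇒coprime {x} p∤x with gcd p x
    ... | mkGCD {d} (c , p≡dc) d∣x s t eq with split-∣ d c (1# , trans (sym p≡dc) (sym (*-identityʳ p)))
    ...   | inj₁ p∣d = ⊥-elim (p∤x (∣-trans p∣d d∣x))
    ...   | inj₂ (c′ , refl) = s * c′ , t * c′ , trans (regroup s t p x c′) (trans (cong (_* c′) eq) dc′≡1#)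
      where
      regroup : ∀ s t p x c → s * c * p + t * c * x ≡ (s * p + t * x) * c
      regroup = solve-∀ 𝔼-ring
      shuffle : ∀ d p c → d * (p * c) ≡ p * (d * c)
      shuffle = solve-∀ 𝔼-ring
      dc′≡1# : d * c′ ≡ 1#
      dc′≡1# = sym (*-cancelˡ p p≢0# (trans (*-identityʳ p) (trans p≡dc (shuffle d p c′))))

-- Coordinates for the order: powers of the cube root and the normal basis.

2# 3# ω² λ³ : 𝔼
2# = eis (+ 2) (+ 0)
3# = eis (+ 3) (+ 0)
ω² = eis -[1+ 0 ] -[1+ 0 ]
λ³ = eis -[1+ 2 ] -[1+ 5 ]

3≢0 : 3# ≢ 0#
3≢0 ()

-- Coordinates either in the basis 1, θ, θ₂ with θ² = gθ₂, θ₂² = bθ, θθ₂ = bg, or in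
-- the normal basis ψᵢ = (1 + ωⁱθ + ω²ⁱθ₂)/3; toθ is three times the change of basis.
data 𝕋 : Set where
  tri : 𝔼 → 𝔼 → 𝔼 → 𝕋

cong₃ : ∀ {A B C D : Set} (f : A → B → C → D) {a b c a′ b′ c′} →
  a ≡ a′ → b ≡ b′ → c ≡ c′ → f a b c ≡ f a′ b′ c′
cong₃ f refl refl refl = refl

infixl 6 _+ᵀ_
infix 8 -ᵀ_

opaque
  _+ᵀ_ : 𝕋 → 𝕋 → 𝕋
  tri a b c +ᵀ tri d e f = tri (a + d) (b + e) (c + f)

  -ᵀ_ : 𝕋 → 𝕋
  -ᵀ tri a b c = tri (- a) (- b) (- c)

  scale : 𝔼 → 𝕋 → 𝕋
  scale t (tri a b c) = tri (t * a) (t * b) (t * c)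

  -- θ ↦ ωθ, θ₂ ↦ ω²θ₂ permutes ψ₀, ψ₁, ψ₂ cyclically; in the normal basis the Galois action is a
  -- mere shift.
  σ : 𝕋 → 𝕋
  σ (tri a b c) = tri c a b

  toθ : 𝕋 → 𝕋
  toθ (tri a b c) = tri (a + b + c) (a + ω * b + ω² * c) (a + ω² * b + ω * c)

  mulθ : 𝔼 → 𝔼 → 𝕋 → 𝕋 → 𝕋
  mulθ b g (tri x₀ x₁ x₂) (tri y₀ y₁ y₂) =
    tri (x₀ * y₀ + b * g * (x₁ * y₂ + x₂ * y₁))
        (x₀ * y₁ + x₁ * y₀ + b * (x₂ * y₂))
        (x₀ * y₂ + x₂ * y₀ + g * (x₁ * y₁))

-- 1 = ψ₀ + ψ₁ + ψ₂, so the elements of ℤ[ω] are those with equal coordinates.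
const : 𝔼 → 𝕋
const t = tri t t t

0ᵀ 1ᵀ : 𝕋
0ᵀ = const 0#
1ᵀ = const 1#

opaque
  unfolding _+ᵀ_
  +ᵀ-assoc : ∀ x y z → (x +ᵀ y) +ᵀ z ≡ x +ᵀ (y +ᵀ z)
  +ᵀ-assoc (tri a b c) (tri d e f) (tri k l m) = cong₃ tri (+-assoc a d k) (+-assoc b e l) (+-assoc c f m)

  +ᵀ-comm : ∀ x y → x +ᵀ y ≡ y +ᵀ x
  +ᵀ-comm (tri a b c) (tri d e f) = cong₃ tri (+-comm a d) (+-comm b e) (+-comm c f)

  +ᵀ-identityˡ : ∀ x → 0ᵀ +ᵀ x ≡ x
  +ᵀ-identityˡ (tri a b c) = cong₃ tri (+-identityˡ a) (+-identityˡ b) (+-identityˡ c)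

  -ᵀ-inverseˡ : ∀ x → (-ᵀ x) +ᵀ x ≡ 0ᵀ
  -ᵀ-inverseˡ (tri a b c) = cong₃ tri (+-inverseˡ a) (+-inverseˡ b) (+-inverseˡ c)

opaque
  unfolding _+ᵀ_
  scale-cancel : ∀ t {x y} → t ≢ 0# → scale t x ≡ scale t y → x ≡ y
  scale-cancel t {tri _ _ _} {tri _ _ _} t≢0 eq = cong₃ tri (c₁ eq) (c₂ eq) (c₃ eq)
    where
    c₁ : ∀ {a b c d e f} → tri (t * a) (t * b) (t * c) ≡ tri (t * d) (t * e) (t * f) → a ≡ d
    c₁ eq = *-cancelˡ t t≢0 (cong (λ { (tri a _ _) → a }) eq)
    c₂ : ∀ {a b c d e f} → tri (t * a) (t * b) (t * c) ≡ tri (t * d) (t * e) (t * f) → b ≡ e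
    c₂ eq = *-cancelˡ t t≢0 (cong (λ { (tri _ b _) → b }) eq)
    c₃ : ∀ {a b c d e f} → tri (t * a) (t * b) (t * c) ≡ tri (t * d) (t * e) (t * f) → c ≡ f
    c₃ eq = *-cancelˡ t t≢0 (cong (λ { (tri _ _ c) → c }) eq)

opaque
  -- `toθ` is a discrete Fourier transform of length 3, and this is the opposite one.
  fromθ : 𝕋 → 𝕋
  fromθ (tri x₀ x₁ x₂) = tri (x₀ + x₁ + x₂) (x₀ + ω² * x₁ + ω * x₂) (x₀ + ω * x₁ + ω² * x₂)

opaque
  unfolding _+ᵀ_ fromθ
  fromθ-toθ : ∀ x → fromθ (toθ x) ≡ scale 3# x
  fromθ-toθ (tri a b c) = cong₃ tri (f₀ a b c) (f₁ a b c) (f₂ a b c)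
    where
    opaque
      unfolding _+_
      f₀ : ∀ a b c → (a + b + c) + (a + ω * b + ω² * c) + (a + ω² * b + ω * c) ≡ 3# * a
      f₀ = solve-∀ 𝔼-ring
      f₁ : ∀ a b c → (a + b + c) + ω² * (a + ω * b + ω² * c) + ω * (a + ω² * b + ω * c) ≡ 3# * b
      f₁ = solve-∀ 𝔼-ring
      f₂ : ∀ a b c → (a + b + c) + ω * (a + ω * b + ω² * c) + ω² * (a + ω² * b + ω * c) ≡ 3# * c
      f₂ = solve-∀ 𝔼-ring

opaque
  toθ-injective : ∀ {x y} → toθ x ≡ toθ y → x ≡ y
  toθ-injective {x} {y} eq = scale-cancel 3# 3≢0
    (trans (sym (fromθ-toθ x)) (trans (cong fromθ eq) (fromθ-toθ y)))

opaque
  unfolding _+ᵀ_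
  toθ-const : ∀ t → toθ (const t) ≡ scale 3# (tri t 0# 0#)
  toθ-const t = cong₃ tri (f₀ t) (f₁ t) (f₂ t)
    where
    opaque
      unfolding _+_
      f₀ : ∀ t → t + t + t ≡ 3# * t
      f₀ = solve-∀ 𝔼-ring
      f₁ : ∀ t → t + ω * t + ω² * t ≡ 3# * 0#
      f₁ = solve-∀ 𝔼-ring
      f₂ : ∀ t → t + ω² * t + ω * t ≡ 3# * 0#
      f₂ = solve-∀ 𝔼-ring

  toθ-scale : ∀ t x → toθ (scale t x) ≡ scale t (toθ x)
  toθ-scale t (tri a b c) = cong₃ tri (f₀ t a b c) (f₁ t a b c) (f₂ t a b c)
    where
    opaque
      unfolding _+_
      f₀ : ∀ t a b c → t * a + t * b + t * c ≡ t * (a + b + c)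
      f₀ = solve-∀ 𝔼-ring
      f₁ : ∀ t a b c → t * a + ω * (t * b) + ω² * (t * c) ≡ t * (a + ω * b + ω² * c)
      f₁ = solve-∀ 𝔼-ring
      f₂ : ∀ t a b c → t * a + ω² * (t * b) + ω * (t * c) ≡ t * (a + ω² * b + ω * c)
      f₂ = solve-∀ 𝔼-ring

  mulθ-scaleˡ : ∀ b g t x y → mulθ b g (scale t x) y ≡ scale t (mulθ b g x y)
  mulθ-scaleˡ b g t (tri x₀ x₁ x₂) (tri y₀ y₁ y₂) =
    cong₃ tri (f₀ b g t x₀ x₁ x₂ y₀ y₁ y₂) (f₁ b t x₀ x₁ x₂ y₀ y₁ y₂) (f₁ g t x₀ x₂ x₁ y₀ y₂ y₁)
    where
    opaque
      unfolding _+_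
      f₀ : ∀ b g t x₀ x₁ x₂ y₀ y₁ y₂ → t * x₀ * y₀ + b * g * (t * x₁ * y₂ + t * x₂ * y₁)
        ≡ t * (x₀ * y₀ + b * g * (x₁ * y₂ + x₂ * y₁))
      f₀ = solve-∀ 𝔼-ring
      f₁ : ∀ b t x₀ x₁ x₂ y₀ y₁ y₂ → t * x₀ * y₁ + t * x₁ * y₀ + b * (t * x₂ * y₂)
        ≡ t * (x₀ * y₁ + x₁ * y₀ + b * (x₂ * y₂))
      f₁ = solve-∀ 𝔼-ring

  mulθ-comm : ∀ b g x y → mulθ b g x y ≡ mulθ b g y x
  mulθ-comm b g (tri x₀ x₁ x₂) (tri y₀ y₁ y₂) =
    cong₃ tri (f₀ b g x₀ x₁ x₂ y₀ y₁ y₂) (f₁ b x₀ x₁ x₂ y₀ y₁ y₂) (f₁ g x₀ x₂ x₁ y₀ y₂ y₁)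
    where
    opaque
      unfolding _+_
      f₀ : ∀ b g x₀ x₁ x₂ y₀ y₁ y₂ → x₀ * y₀ + b * g * (x₁ * y₂ + x₂ * y₁) ≡ y₀ * x₀ + b * g * (y₁ * x₂ + y₂ * x₁)
      f₀ = solve-∀ 𝔼-ring
      f₁ : ∀ b x₀ x₁ x₂ y₀ y₁ y₂ → x₀ * y₁ + x₁ * y₀ + b * (x₂ * y₂) ≡ y₀ * x₁ + y₁ * x₀ + b * (y₂ * x₂)
      f₁ = solve-∀ 𝔼-ring

  mulθ-assoc : ∀ b g x y z → mulθ b g (mulθ b g x y) z ≡ mulθ b g x (mulθ b g y z)
  mulθ-assoc b g (tri x₀ x₁ x₂) (tri y₀ y₁ y₂) (tri z₀ z₁ z₂) =
    cong₃ tri (f₀ b g x₀ x₁ x₂ y₀ y₁ y₂ z₀ z₁ z₂) (f₁ b g x₀ x₁ x₂ y₀ y₁ y₂ z₀ z₁ z₂)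
             (f₂ b g x₀ x₁ x₂ y₀ y₁ y₂ z₀ z₁ z₂)
    where
    opaque
      unfolding _+_
      f₀ : ∀ b g x₀ x₁ x₂ y₀ y₁ y₂ z₀ z₁ z₂ →
        (x₀ * y₀ + b * g * (x₁ * y₂ + x₂ * y₁)) * z₀
          + b * g * ((x₀ * y₁ + x₁ * y₀ + b * (x₂ * y₂)) * z₂ + (x₀ * y₂ + x₂ * y₀ + g * (x₁ * y₁)) * z₁)
        ≡ x₀ * (y₀ * z₀ + b * g * (y₁ * z₂ + y₂ * z₁))
          + b * g * (x₁ * (y₀ * z₂ + y₂ * z₀ + g * (y₁ * z₁)) + x₂ * (y₀ * z₁ + y₁ * z₀ + b * (y₂ * z₂)))
      f₀ = solve-∀ 𝔼-ring
      f₁ : ∀ b g x₀ x₁ x₂ y₀ y₁ y₂ z₀ z₁ z₂ →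
        (x₀ * y₀ + b * g * (x₁ * y₂ + x₂ * y₁)) * z₁ + (x₀ * y₁ + x₁ * y₀ + b * (x₂ * y₂)) * z₀
          + b * ((x₀ * y₂ + x₂ * y₀ + g * (x₁ * y₁)) * z₂)
        ≡ x₀ * (y₀ * z₁ + y₁ * z₀ + b * (y₂ * z₂)) + x₁ * (y₀ * z₀ + b * g * (y₁ * z₂ + y₂ * z₁))
          + b * (x₂ * (y₀ * z₂ + y₂ * z₀ + g * (y₁ * z₁)))
      f₁ = solve-∀ 𝔼-ring
      f₂ : ∀ b g x₀ x₁ x₂ y₀ y₁ y₂ z₀ z₁ z₂ →
        (x₀ * y₀ + b * g * (x₁ * y₂ + x₂ * y₁)) * z₂ + (x₀ * y₂ + x₂ * y₀ + g * (x₁ * y₁)) * z₀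
          + g * ((x₀ * y₁ + x₁ * y₀ + b * (x₂ * y₂)) * z₁)
        ≡ x₀ * (y₀ * z₂ + y₂ * z₀ + g * (y₁ * z₁)) + x₂ * (y₀ * z₀ + b * g * (y₁ * z₂ + y₂ * z₁))
          + g * (x₁ * (y₀ * z₁ + y₁ * z₀ + b * (y₂ * z₂)))
      f₂ = solve-∀ 𝔼-ring

  mulθ-constant : ∀ b g t x → mulθ b g (tri t 0# 0#) x ≡ scale t x
  mulθ-constant b g t (tri x₀ x₁ x₂) = cong₃ tri (f₀ b g t x₀ x₁ x₂) (f₁ b t x₁ x₀ x₂) (f₁ g t x₂ x₀ x₁)
    where
    opaque
      unfolding _+_
      f₀ : ∀ b g t x₀ x₁ x₂ → t * x₀ + b * g * (0# * x₂ + 0# * x₁) ≡ t * x₀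
      f₀ = solve-∀ 𝔼-ring
      f₁ : ∀ b t x₁ x₀ x₂ → t * x₁ + 0# * x₀ + b * (0# * x₂) ≡ t * x₁
      f₁ = solve-∀ 𝔼-ring

-- ψ₀² = p₀ψ₀ + p₁ψ₁ + p₂ψ₂ and ψ₀ψ₁ = q₀ψ₀ + q₁ψ₁ + q₂ψ₂, read off in the basis 1, θ, θ₂.
record StructureConstants (b g : 𝔼) : Set where
  field
    p₀ p₁ p₂ q₀ q₁ q₂ : 𝔼
    P₀ : 3# * (p₀ + p₁ + p₂) ≡ 1# + 2# * (b * g)
    P₁ : 3# * (p₀ + ω * p₁ + ω² * p₂) ≡ 2# + b
    P₂ : 3# * (p₀ + ω² * p₁ + ω * p₂) ≡ 2# + g
    Q₀ : 3# * (q₀ + q₁ + q₂) ≡ 1# - b * g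
    Q₁ : 3# * (q₀ + ω * q₁ + ω² * q₂) ≡ ω² * (b - 1#)
    Q₂ : 3# * (q₀ + ω² * q₁ + ω * q₂) ≡ ω * (g - 1#)

opaque
  -- Solving the two Fourier systems divides by 9. The quotients are integral because λ³ = 3(ω² - ω)
  -- and λ⁶ = -27: for example p₀ = (5 + b + g + 2bg)/9 has constant term 1, linear coefficient λ³/3
  -- and mixed coefficient 2λ⁶/9 = -6.
  structureConstants : ∀ B G → StructureConstants (1# + λ³ * B) (1# + λ³ * G)
  structureConstants B G = record
    { p₀ = 1# - (ω - ω²) * (B + G) - eis (+ 6) +0 * (B * G)
    ; p₁ = ω² * B - ω * G - eis (+ 6) +0 * (B * G)
    ; p₂ = ω² * G - ω * B - eis (+ 6) +0 * (B * G)
    ; q₀ = ω * B - ω² * G + 3# * (B * G)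
    ; q₁ = ω * G - ω² * B + 3# * (B * G)
    ; q₂ = 3# * (B * G)
    ; P₀ = P₀ B G ; P₁ = P₁ B G ; P₂ = P₂ B G ; Q₀ = Q₀ B G ; Q₁ = Q₁ B G ; Q₂ = Q₂ B G }
    where
    opaque
      unfolding _+_
      P₀ : ∀ B G → 3# * ((1# - (ω - ω²) * (B + G) - eis (+ 6) +0 * (B * G)) + (ω² * B - ω * G - eis (+ 6) +0 * (B * G))
        + (ω² * G - ω * B - eis (+ 6) +0 * (B * G))) ≡ 1# + 2# * ((1# + λ³ * B) * (1# + λ³ * G))
      P₀ = solve-∀ 𝔼-ring
      P₁ : ∀ B G → 3# * ((1# - (ω - ω²) * (B + G) - eis (+ 6) +0 * (B * G)) + ω * (ω² * B - ω * G - eis (+ 6) +0 * (B * G))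
        + ω² * (ω² * G - ω * B - eis (+ 6) +0 * (B * G))) ≡ 2# + (1# + λ³ * B)
      P₁ = solve-∀ 𝔼-ring
      P₂ : ∀ B G → 3# * ((1# - (ω - ω²) * (B + G) - eis (+ 6) +0 * (B * G)) + ω² * (ω² * B - ω * G - eis (+ 6) +0 * (B * G))
        + ω * (ω² * G - ω * B - eis (+ 6) +0 * (B * G))) ≡ 2# + (1# + λ³ * G)
      P₂ = solve-∀ 𝔼-ring
      Q₀ : ∀ B G → 3# * ((ω * B - ω² * G + 3# * (B * G)) + (ω * G - ω² * B + 3# * (B * G)) + 3# * (B * G))
        ≡ 1# - (1# + λ³ * B) * (1# + λ³ * G)
      Q₀ = solve-∀ 𝔼-ring
      Q₁ : ∀ B G → 3# * ((ω * B - ω² * G + 3# * (B * G)) + ω * (ω * G - ω² * B + 3# * (B * G)) + ω² * (3# * (B * G)))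
        ≡ ω² * ((1# + λ³ * B) - 1#)
      Q₁ = solve-∀ 𝔼-ring
      Q₂ : ∀ B G → 3# * ((ω * B - ω² * G + 3# * (B * G)) + ω² * (ω * G - ω² * B + 3# * (B * G)) + ω * (3# * (B * G)))
        ≡ ω * ((1# + λ³ * G) - 1#)
      Q₂ = solve-∀ 𝔼-ring

σθ : 𝕋 → 𝕋
σθ (tri x₀ x₁ x₂) = tri x₀ (ω * x₁) (ω² * x₂)

first : 𝕋 → 𝔼
first (tri a _ _) = a

tr : 𝕋 → 𝔼
tr (tri a b c) = a + b + c

-- The norm form of x₀ + x₁θ + x₂θ₂, where θ³ = bg² and θ₂³ = b²g.
normθ : 𝔼 → 𝔼 → 𝔼 → 𝔼 → 𝔼 → 𝔼
normθ b g x₀ x₁ x₂ =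
  x₀ * x₀ * x₀ + b * (g * g) * (x₁ * x₁ * x₁) + b * b * g * (x₂ * x₂ * x₂) - 3# * (b * g) * (x₀ * x₁ * x₂)

27# : 𝔼
27# = eis (+ 27) +0

opaque
  unfolding _+ᵀ_
  const-injective : ∀ {s t} → const s ≡ const t → s ≡ t
  const-injective = cong first

  σ-fixed⇒const : ∀ x → σ x ≡ x → x ≡ const (first x)
  σ-fixed⇒const (tri a b c) eq = cong₃ tri refl (sym a≡b) (trans (sym b≡c) (sym a≡b))
    where
    a≡b : a ≡ b
    a≡b = cong (λ { (tri _ y _) → y }) eq
    b≡c : b ≡ c
    b≡c = cong (λ { (tri _ _ z) → z }) eq

  σ³ : ∀ x → σ (σ (σ x)) ≡ x
  σ³ (tri a b c) = refl

  σ-+ : ∀ x y → σ (x +ᵀ y) ≡ σ x +ᵀ σ y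
  σ-+ (tri a b c) (tri d e f) = refl

  σ-scale : ∀ t x → σ (scale t x) ≡ scale t (σ x)
  σ-scale t (tri a b c) = refl

  σ-const : ∀ t → σ (const t) ≡ const t
  σ-const t = refl

  scale-const : ∀ s t → scale s (const t) ≡ const (s * t)
  scale-const s t = refl

  const-+ : ∀ s t → const (s + t) ≡ const s +ᵀ const t
  const-+ s t = refl

  scale-scale : ∀ s t x → scale s (scale t x) ≡ scale (s * t) x
  scale-scale s t (tri a b c) = sym (cong₃ tri (*-assoc s t a) (*-assoc s t b) (*-assoc s t c))

  scale-1 : ∀ x → scale 1# x ≡ x
  scale-1 (tri a b c) = cong₃ tri (*-identityˡ a) (*-identityˡ b) (*-identityˡ c)

  first-scale : ∀ t x → first (scale t x) ≡ t * first x
  first-scale t (tri a b c) = refl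

  const-tr : ∀ x → const (tr x) ≡ x +ᵀ σ x +ᵀ σ (σ x)
  const-tr (tri a b c) = cong₃ tri (f₀ a b c) (f₁ a b c) (f₂ a b c)
    where
    opaque
      unfolding _+_
      f₀ : ∀ a b c → a + b + c ≡ a + c + b
      f₀ = solve-∀ 𝔼-ring
      f₁ : ∀ a b c → a + b + c ≡ b + a + c
      f₁ = solve-∀ 𝔼-ring
      f₂ : ∀ a b c → a + b + c ≡ c + b + a
      f₂ = solve-∀ 𝔼-ring

  toθ-σ : ∀ x → toθ (σ x) ≡ σθ (toθ x)
  toθ-σ (tri a b c) = cong₃ tri (f₀ a b c) (f₁ a b c) (f₂ a b c)
    where
    opaque
      unfolding _+_
      f₀ : ∀ a b c → c + a + b ≡ a + b + c
      f₀ = solve-∀ 𝔼-ring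
      f₁ : ∀ a b c → c + ω * a + ω² * b ≡ ω * (a + ω * b + ω² * c)
      f₁ = solve-∀ 𝔼-ring
      f₂ : ∀ a b c → c + ω² * a + ω * b ≡ ω² * (a + ω² * b + ω * c)
      f₂ = solve-∀ 𝔼-ring

  first-mulθ-conjugates : ∀ b g x₀ x₁ x₂ → let X = tri x₀ x₁ x₂ in
    first (mulθ b g X (mulθ b g (σθ X) (σθ (σθ X)))) ≡ normθ b g x₀ x₁ x₂
  first-mulθ-conjugates b g x₀ x₁ x₂ = f b g x₀ x₁ x₂
    where
    opaque
      unfolding _+_
      f : ∀ b g x₀ x₁ x₂ →
        x₀ * (x₀ * x₀ + b * g * (ω * x₁ * (ω² * (ω² * x₂)) + ω² * x₂ * (ω * (ω * x₁))))
          + b * g * (x₁ * (x₀ * (ω² * (ω² * x₂)) + ω² * x₂ * x₀ + g * (ω * x₁ * (ω * (ω * x₁))))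
            + x₂ * (x₀ * (ω * (ω * x₁)) + ω * x₁ * x₀ + b * (ω² * x₂ * (ω² * (ω² * x₂)))))
        ≡ x₀ * x₀ * x₀ + b * (g * g) * (x₁ * x₁ * x₁) + b * b * g * (x₂ * x₂ * x₂) - 3# * (b * g) * (x₀ * x₁ * x₂)
      f = solve-∀ 𝔼-ring

-- The order as a commutative ring with Galois action, norm and characteristic polynomial.

module Order {b g : 𝔼} (S : StructureConstants b g) where
  open StructureConstants S

  infixl 7 _·_

  opaque
    -- The remaining products of basis elements are conjugates of ψ₀² and ψ₀ψ₁, so the six constants
    -- recur with cyclically shifted indices.
    _·_ : 𝕋 → 𝕋 → 𝕋
    tri x₀ x₁ x₂ · tri y₀ y₁ y₂ = tri
      (x₀ * y₀ * p₀ + x₁ * y₁ * p₂ + x₂ * y₂ * p₁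
        + ((x₀ * y₁ + x₁ * y₀) * q₀ + (x₁ * y₂ + x₂ * y₁) * q₂ + (x₂ * y₀ + x₀ * y₂) * q₁))
      (x₀ * y₀ * p₁ + x₁ * y₁ * p₀ + x₂ * y₂ * p₂
        + ((x₀ * y₁ + x₁ * y₀) * q₁ + (x₁ * y₂ + x₂ * y₁) * q₀ + (x₂ * y₀ + x₀ * y₂) * q₂))
      (x₀ * y₀ * p₂ + x₁ * y₁ * p₁ + x₂ * y₂ * p₀
        + ((x₀ * y₁ + x₁ * y₀) * q₂ + (x₁ * y₂ + x₂ * y₁) * q₁ + (x₂ * y₀ + x₀ * y₂) * q₀))

  opaque
    unfolding _+ᵀ_ _·_
    -- `toθ` yields three times the coordinates: the right side carries a factor 9, `toθ` of the
    -- product only 3.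
    toθ-· : ∀ x y → scale 3# (toθ (x · y)) ≡ mulθ b g (toθ x) (toθ y)
    toθ-· (tri x₀ x₁ x₂) (tri y₀ y₁ y₂) = cong₃ tri
      (trans (d₀ (x₀ * y₀) (x₁ * y₁) (x₂ * y₂) (x₀ * y₁ + x₁ * y₀) (x₁ * y₂ + x₂ * y₁) (x₂ * y₀ + x₀ * y₂) p₀ p₁ p₂ q₀ q₁ q₂)
        (trans (cong₂ (λ s t → _ * s + _ * t) P₀ Q₀) (e₀ b g x₀ x₁ x₂ y₀ y₁ y₂)))
      (trans (d₁ (x₀ * y₀) (x₁ * y₁) (x₂ * y₂) (x₀ * y₁ + x₁ * y₀) (x₁ * y₂ + x₂ * y₁) (x₂ * y₀ + x₀ * y₂) p₀ p₁ p₂ q₀ q₁ q₂)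
        (trans (cong₂ (λ s t → _ * s + _ * t) P₁ Q₁) (e₁ b x₀ x₁ x₂ y₀ y₁ y₂)))
      (trans (d₂ (x₀ * y₀) (x₁ * y₁) (x₂ * y₂) (x₀ * y₁ + x₁ * y₀) (x₁ * y₂ + x₂ * y₁) (x₂ * y₀ + x₀ * y₂) p₀ p₁ p₂ q₀ q₁ q₂)
        (trans (cong₂ (λ s t → _ * s + _ * t) P₂ Q₂) (e₂ g x₀ x₁ x₂ y₀ y₁ y₂)))
      where
      opaque
        unfolding _+_
        d₀ : ∀ A B C D E F p₀ p₁ p₂ q₀ q₁ q₂ →
          3# * ((A * p₀ + B * p₂ + C * p₁ + (D * q₀ + E * q₂ + F * q₁))
            + (A * p₁ + B * p₀ + C * p₂ + (D * q₁ + E * q₀ + F * q₂))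
            + (A * p₂ + B * p₁ + C * p₀ + (D * q₂ + E * q₁ + F * q₀)))
          ≡ (A + B + C) * (3# * (p₀ + p₁ + p₂)) + (D + E + F) * (3# * (q₀ + q₁ + q₂))
        d₀ = solve-∀ 𝔼-ring
        d₁ : ∀ A B C D E F p₀ p₁ p₂ q₀ q₁ q₂ →
          3# * ((A * p₀ + B * p₂ + C * p₁ + (D * q₀ + E * q₂ + F * q₁))
            + ω * (A * p₁ + B * p₀ + C * p₂ + (D * q₁ + E * q₀ + F * q₂))
            + ω² * (A * p₂ + B * p₁ + C * p₀ + (D * q₂ + E * q₁ + F * q₀)))
          ≡ (A + ω * B + ω² * C) * (3# * (p₀ + ω * p₁ + ω² * p₂))
            + (D + ω * E + ω² * F) * (3# * (q₀ + ω * q₁ + ω² * q₂))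
        d₁ = solve-∀ 𝔼-ring
        d₂ : ∀ A B C D E F p₀ p₁ p₂ q₀ q₁ q₂ →
          3# * ((A * p₀ + B * p₂ + C * p₁ + (D * q₀ + E * q₂ + F * q₁))
            + ω² * (A * p₁ + B * p₀ + C * p₂ + (D * q₁ + E * q₀ + F * q₂))
            + ω * (A * p₂ + B * p₁ + C * p₀ + (D * q₂ + E * q₁ + F * q₀)))
          ≡ (A + ω² * B + ω * C) * (3# * (p₀ + ω² * p₁ + ω * p₂))
            + (D + ω² * E + ω * F) * (3# * (q₀ + ω² * q₁ + ω * q₂))
        d₂ = solve-∀ 𝔼-ring
        e₀ : ∀ b g x₀ x₁ x₂ y₀ y₁ y₂ →
          (x₀ * y₀ + x₁ * y₁ + x₂ * y₂) * (1# + 2# * (b * g))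
            + ((x₀ * y₁ + x₁ * y₀) + (x₁ * y₂ + x₂ * y₁) + (x₂ * y₀ + x₀ * y₂)) * (1# - b * g)
          ≡ (x₀ + x₁ + x₂) * (y₀ + y₁ + y₂)
            + b * g * ((x₀ + ω * x₁ + ω² * x₂) * (y₀ + ω² * y₁ + ω * y₂)
              + (x₀ + ω² * x₁ + ω * x₂) * (y₀ + ω * y₁ + ω² * y₂))
        e₀ = solve-∀ 𝔼-ring
        e₁ : ∀ b x₀ x₁ x₂ y₀ y₁ y₂ →
          (x₀ * y₀ + ω * (x₁ * y₁) + ω² * (x₂ * y₂)) * (2# + b)
            + ((x₀ * y₁ + x₁ * y₀) + ω * (x₁ * y₂ + x₂ * y₁) + ω² * (x₂ * y₀ + x₀ * y₂)) * (ω² * (b - 1#))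
          ≡ (x₀ + x₁ + x₂) * (y₀ + ω * y₁ + ω² * y₂) + (x₀ + ω * x₁ + ω² * x₂) * (y₀ + y₁ + y₂)
            + b * ((x₀ + ω² * x₁ + ω * x₂) * (y₀ + ω² * y₁ + ω * y₂))
        e₁ = solve-∀ 𝔼-ring
        e₂ : ∀ g x₀ x₁ x₂ y₀ y₁ y₂ →
          (x₀ * y₀ + ω² * (x₁ * y₁) + ω * (x₂ * y₂)) * (2# + g)
            + ((x₀ * y₁ + x₁ * y₀) + ω² * (x₁ * y₂ + x₂ * y₁) + ω * (x₂ * y₀ + x₀ * y₂)) * (ω * (g - 1#))
          ≡ (x₀ + x₁ + x₂) * (y₀ + ω² * y₁ + ω * y₂) + (x₀ + ω² * x₁ + ω * x₂) * (y₀ + y₁ + y₂)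
            + g * ((x₀ + ω * x₁ + ω² * x₂) * (y₀ + ω * y₁ + ω² * y₂))
        e₂ = solve-∀ 𝔼-ring

    ·-comm : ∀ x y → x · y ≡ y · x
    ·-comm (tri x₀ x₁ x₂) (tri y₀ y₁ y₂) = cong₃ tri
      (f x₀ x₁ x₂ y₀ y₁ y₂ p₀ p₂ p₁ q₀ q₂ q₁) (f x₀ x₁ x₂ y₀ y₁ y₂ p₁ p₀ p₂ q₁ q₀ q₂)
      (f x₀ x₁ x₂ y₀ y₁ y₂ p₂ p₁ p₀ q₂ q₁ q₀)
      where
      opaque
        unfolding _+_
        f : ∀ x₀ x₁ x₂ y₀ y₁ y₂ a b c d e f →
          x₀ * y₀ * a + x₁ * y₁ * b + x₂ * y₂ * c + ((x₀ * y₁ + x₁ * y₀) * d + (x₁ * y₂ + x₂ * y₁) * e + (x₂ * y₀ + x₀ * y₂) * f)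
          ≡ y₀ * x₀ * a + y₁ * x₁ * b + y₂ * x₂ * c + ((y₀ * x₁ + y₁ * x₀) * d + (y₁ * x₂ + y₂ * x₁) * e + (y₂ * x₀ + y₀ * x₂) * f)
        f = solve-∀ 𝔼-ring

    ·-distribˡ : ∀ x y z → x · (y +ᵀ z) ≡ x · y +ᵀ x · z
    ·-distribˡ (tri x₀ x₁ x₂) (tri y₀ y₁ y₂) (tri z₀ z₁ z₂) = cong₃ tri
      (f x₀ x₁ x₂ y₀ y₁ y₂ z₀ z₁ z₂ p₀ p₂ p₁ q₀ q₂ q₁) (f x₀ x₁ x₂ y₀ y₁ y₂ z₀ z₁ z₂ p₁ p₀ p₂ q₁ q₀ q₂)
      (f x₀ x₁ x₂ y₀ y₁ y₂ z₀ z₁ z₂ p₂ p₁ p₀ q₂ q₁ q₀)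
      where
      opaque
        unfolding _+_
        f : ∀ x₀ x₁ x₂ y₀ y₁ y₂ z₀ z₁ z₂ a b c d e f →
          x₀ * (y₀ + z₀) * a + x₁ * (y₁ + z₁) * b + x₂ * (y₂ + z₂) * c
            + ((x₀ * (y₁ + z₁) + x₁ * (y₀ + z₀)) * d + (x₁ * (y₂ + z₂) + x₂ * (y₁ + z₁)) * e + (x₂ * (y₀ + z₀) + x₀ * (y₂ + z₂)) * f)
          ≡ (x₀ * y₀ * a + x₁ * y₁ * b + x₂ * y₂ * c + ((x₀ * y₁ + x₁ * y₀) * d + (x₁ * y₂ + x₂ * y₁) * e + (x₂ * y₀ + x₀ * y₂) * f))
            + (x₀ * z₀ * a + x₁ * z₁ * b + x₂ * z₂ * c + ((x₀ * z₁ + x₁ * z₀) * d + (x₁ * z₂ + x₂ * z₁) * e + (x₂ * z₀ + x₀ * z₂) * f))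
        f = solve-∀ 𝔼-ring

    σ-· : ∀ x y → σ (x · y) ≡ σ x · σ y
    σ-· (tri x₀ x₁ x₂) (tri y₀ y₁ y₂) = cong₃ tri (rotate _ _ _ _ _ _) (rotate _ _ _ _ _ _) (rotate _ _ _ _ _ _)
      where
      opaque
        unfolding _+_
        rotate : ∀ A B C D E F → A + B + C + (D + E + F) ≡ C + A + B + (F + D + E)
        rotate = solve-∀ 𝔼-ring

  opaque
    toθ-·² : ∀ x y z → scale 3# (scale 3# (toθ (x · y · z))) ≡ mulθ b g (mulθ b g (toθ x) (toθ y)) (toθ z)
    toθ-·² x y z = begin
      scale 3# (scale 3# (toθ (x · y · z)))      ≡⟨ cong (scale 3#) (toθ-· (x · y) z) ⟩
      scale 3# (mulθ b g (toθ (x · y)) (toθ z))  ≡⟨ sym (mulθ-scaleˡ b g 3# (toθ (x · y)) (toθ z)) ⟩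
      mulθ b g (scale 3# (toθ (x · y))) (toθ z)  ≡⟨ cong (λ w → mulθ b g w (toθ z)) (toθ-· x y) ⟩
      mulθ b g (mulθ b g (toθ x) (toθ y)) (toθ z) ∎
      where open ≡-Reasoning

    -- Pulled back from the basis 1, θ, θ₂, where it is a polynomial identity in b and g; in the
    -- normal basis it would rest on relations among the six constants.
    ·-assoc : ∀ x y z → x · y · z ≡ x · (y · z)
    ·-assoc x y z = toθ-injective (scale-cancel 3# 3≢0 (scale-cancel 3# 3≢0 (begin
      scale 3# (scale 3# (toθ (x · y · z)))       ≡⟨ toθ-·² x y z ⟩
      mulθ b g (mulθ b g (toθ x) (toθ y)) (toθ z) ≡⟨ mulθ-assoc b g (toθ x) (toθ y) (toθ z) ⟩
      mulθ b g (toθ x) (mulθ b g (toθ y) (toθ z)) ≡⟨ mulθ-comm b g (toθ x) (mulθ b g (toθ y) (toθ z)) ⟩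
      mulθ b g (mulθ b g (toθ y) (toθ z)) (toθ x) ≡⟨ sym (toθ-·² y z x) ⟩
      scale 3# (scale 3# (toθ (y · z · x)))       ≡⟨ cong (λ w → scale 3# (scale 3# (toθ w))) (·-comm (y · z) x) ⟩
      scale 3# (scale 3# (toθ (x · (y · z)))) ∎)))
      where open ≡-Reasoning

    const-· : ∀ t x → const t · x ≡ scale t x
    const-· t x = toθ-injective (scale-cancel 3# 3≢0 (begin
      scale 3# (toθ (const t · x))                ≡⟨ toθ-· (const t) x ⟩
      mulθ b g (toθ (const t)) (toθ x)            ≡⟨ cong (λ w → mulθ b g w (toθ x)) (toθ-const t) ⟩
      mulθ b g (scale 3# (tri t 0# 0#)) (toθ x)   ≡⟨ mulθ-scaleˡ b g 3# (tri t 0# 0#) (toθ x) ⟩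
      scale 3# (mulθ b g (tri t 0# 0#) (toθ x))   ≡⟨ cong (scale 3#) (mulθ-constant b g t (toθ x)) ⟩
      scale 3# (scale t (toθ x))                  ≡⟨ cong (scale 3#) (sym (toθ-scale t x)) ⟩
      scale 3# (toθ (scale t x)) ∎))
      where open ≡-Reasoning

    ·-identityˡ : ∀ x → 1ᵀ · x ≡ x
    ·-identityˡ x = trans (const-· 1# x) (scale-1 x)

    isCommutativeRing : IsCommutativeRing _≡_ _+ᵀ_ _·_ -ᵀ_ 0ᵀ 1ᵀ
    isCommutativeRing = record
      { isRing = record
        { +-isAbelianGroup = record
          { isGroup = record
            { isMonoid = record
              { isSemigroup = record
                { isMagma = ≡-isMagma _+ᵀ_ ; assoc = +ᵀ-assoc }
              ; identity = comm∧idˡ⇒id +ᵀ-comm +ᵀ-identityˡ }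
            ; inverse = comm∧invˡ⇒inv +ᵀ-comm -ᵀ-inverseˡ
            ; ⁻¹-cong = cong -ᵀ_ }
          ; comm = +ᵀ-comm }
        ; *-cong = cong₂ _·_
        ; *-assoc = ·-assoc
        ; *-identity = comm∧idˡ⇒id ·-comm ·-identityˡ
        ; distrib = ·-distribˡ , λ x y z → trans (·-comm (y +ᵀ z) x)
            (trans (·-distribˡ x y z) (cong₂ _+ᵀ_ (·-comm x y) (·-comm x z))) }
      ; *-comm = ·-comm }

  𝕆 : CommutativeRing 0ℓ 0ℓ
  𝕆 = record { isCommutativeRing = isCommutativeRing }

  module Solve = NatSolver (CommutativeRing.commutativeSemiring 𝕆)
  open Solve using (_:+_; _:*_; _:=_; con)

  open ≡-Reasoning

  conjugates : 𝕋 → 𝕋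
  conjugates x = x · (σ x · σ (σ x))

  nm : 𝕋 → 𝔼
  nm x = first (conjugates x)

  opaque
    nm-spec : ∀ x → x · (σ x · σ (σ x)) ≡ const (nm x)
    nm-spec x = σ-fixed⇒const (conjugates x) (begin
      σ (x · (σ x · σ (σ x)))          ≡⟨ trans (σ-· x (σ x · σ (σ x))) (cong (σ x ·_) (σ-· (σ x) (σ (σ x)))) ⟩
      σ x · (σ (σ x) · σ (σ (σ x)))    ≡⟨ cong (λ w → σ x · (σ (σ x) · w)) (σ³ x) ⟩
      σ x · (σ (σ x) · x)              ≡⟨ Solve.solve 3 (λ x y z → y :* (z :* x) := x :* (y :* z)) refl x (σ x) (σ (σ x)) ⟩
      x · (σ x · σ (σ x)) ∎)

    nm-· : ∀ x y → nm (x · y) ≡ nm x * nm y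
    nm-· x y = const-injective (begin
      const (nm (x · y))                              ≡⟨ sym (nm-spec (x · y)) ⟩
      x · y · (σ (x · y) · σ (σ (x · y)))             ≡⟨ cong (λ w → x · y · (w · σ w)) (σ-· x y) ⟩
      x · y · (σ x · σ y · σ (σ x · σ y))             ≡⟨ cong (λ w → x · y · (σ x · σ y · w)) (σ-· (σ x) (σ y)) ⟩
      x · y · (σ x · σ y · (σ (σ x) · σ (σ y)))
        ≡⟨ Solve.solve 6 (λ a b c d e f → a :* d :* (b :* e :* (c :* f)) := a :* (b :* c) :* (d :* (e :* f))) refl
             x (σ x) (σ (σ x)) y (σ y) (σ (σ y)) ⟩
      conjugates x · conjugates y                     ≡⟨ cong₂ _·_ (nm-spec x) (nm-spec y) ⟩
      const (nm x) · const (nm y)                     ≡⟨ trans (const-· (nm x) (const (nm y))) (scale-const (nm x) (nm y)) ⟩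
      const (nm x * nm y) ∎)

    scale-·ˡ : ∀ t x y → scale t x · y ≡ scale t (x · y)
    scale-·ˡ t x y = begin
      scale t x · y        ≡⟨ cong (_· y) (sym (const-· t x)) ⟩
      const t · x · y      ≡⟨ ·-assoc (const t) x y ⟩
      const t · (x · y)    ≡⟨ const-· t (x · y) ⟩
      scale t (x · y) ∎

    scale-·ʳ : ∀ t x y → x · scale t y ≡ scale t (x · y)
    scale-·ʳ t x y = trans (·-comm x (scale t y)) (trans (scale-·ˡ t y x) (cong (scale t) (·-comm y x)))

    nm-const : ∀ t → nm (const t) ≡ t * (t * t)
    nm-const t = const-injective (begin
      const (nm (const t))                              ≡⟨ sym (nm-spec (const t)) ⟩
      const t · (σ (const t) · σ (σ (const t)))         ≡⟨ cong₂ (λ v w → const t · (v · w)) (σ-const t) (trans (cong σ (σ-const t)) (σ-const t)) ⟩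
      const t · (const t · const t)                     ≡⟨ cong (const t ·_) (trans (const-· t (const t)) (scale-const t t)) ⟩
      const t · const (t * t)                           ≡⟨ trans (const-· t (const (t * t))) (scale-const t (t * t)) ⟩
      const (t * (t * t)) ∎)

    nm-scale : ∀ t x → nm (scale t x) ≡ t * (t * t) * nm x
    nm-scale t x = trans (cong nm (sym (const-· t x))) (trans (nm-· (const t) x) (cong (_* nm x) (nm-const t)))

    -- The second symmetric function of the conjugates. Integrality only asks that it lie in ℤ[ω],
    -- so its value stays existential.
    s₂ : ∀ x → ∃ λ t → x · σ x +ᵀ σ x · σ (σ x) +ᵀ σ (σ x) · x ≡ const t
    s₂ x = _ , σ-fixed⇒const s (begin
      σ s            ≡⟨ trans (σ-+ (x · σ x +ᵀ σ x · σ (σ x)) (σ (σ x) · x)) (cong₂ _+ᵀ_ (σ-+ (x · σ x) (σ x · σ (σ x))) (σ-· (σ (σ x)) x)) ⟩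
      σ (x · σ x) +ᵀ σ (σ x · σ (σ x)) +ᵀ σ (σ (σ x)) · σ x
                     ≡⟨ cong₂ (λ v w → v +ᵀ w · σ x) (cong₂ _+ᵀ_ (σ-· x (σ x)) (σ-· (σ x) (σ (σ x)))) (σ³ x) ⟩
      σ x · σ (σ x) +ᵀ σ (σ x) · σ (σ (σ x)) +ᵀ x · σ x
                     ≡⟨ cong (λ w → σ x · σ (σ x) +ᵀ σ (σ x) · w +ᵀ x · σ x) (σ³ x) ⟩
      σ x · σ (σ x) +ᵀ σ (σ x) · x +ᵀ x · σ x
                     ≡⟨ Solve.solve 3 (λ a b c → a :+ b :+ c := c :+ a :+ b) refl (σ x · σ (σ x)) (σ (σ x) · x) (x · σ x) ⟩
      s ∎)
      where
      s : 𝕋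
      s = x · σ x +ᵀ σ x · σ (σ x) +ᵀ σ (σ x) · x

    charPoly : ∀ x → ∃ λ t → x · (x · x) +ᵀ const t · x ≡ const (tr x) · (x · x) +ᵀ const (nm x)
    charPoly x with s₂ x
    ... | t , eq = t , (begin
      x · (x · x) +ᵀ const t · x
        ≡⟨ cong (λ w → x · (x · x) +ᵀ w · x) (sym eq) ⟩
      x · (x · x) +ᵀ (x · σ x +ᵀ σ x · σ (σ x) +ᵀ σ (σ x) · x) · x
        ≡⟨ Solve.solve 3 (λ x y z → x :* (x :* x) :+ (x :* y :+ y :* z :+ z :* x) :* x
             := (x :+ y :+ z) :* (x :* x) :+ x :* (y :* z)) refl x (σ x) (σ (σ x)) ⟩
      (x +ᵀ σ x +ᵀ σ (σ x)) · (x · x) +ᵀ conjugates x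
        ≡⟨ cong₂ (λ v w → v · (x · x) +ᵀ w) (sym (const-tr x)) (nm-spec x) ⟩
      const (tr x) · (x · x) +ᵀ const (nm x) ∎)

    27·nm : ∀ x {x₀ x₁ x₂} → toθ x ≡ tri x₀ x₁ x₂ → 27# * nm x ≡ normθ b g x₀ x₁ x₂
    27·nm x {x₀} {x₁} {x₂} eq = begin
      27# * nm x                                          ≡⟨ f (nm x) ⟩
      3# * (3# * (3# * nm x))                             ≡⟨ sym (trans (first-scale 3# _) (cong (3# *_) (trans (first-scale 3# _) (cong (3# *_) (first-scale 3# _))))) ⟩
      first (scale 3# (scale 3# (scale 3# (tri (nm x) 0# 0#))))
        ≡⟨ cong (λ w → first (scale 3# (scale 3# w))) (sym (toθ-const (nm x))) ⟩
      first (scale 3# (scale 3# (toθ (const (nm x)))))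
        ≡⟨ cong (λ w → first (scale 3# (scale 3# (toθ w)))) (trans (sym (nm-spec x)) (·-comm x _)) ⟩
      first (scale 3# (scale 3# (toθ (σ x · σ (σ x) · x)))) ≡⟨ cong first (toθ-·² (σ x) (σ (σ x)) x) ⟩
      first (mulθ b g (mulθ b g (toθ (σ x)) (toθ (σ (σ x)))) (toθ x))
        ≡⟨ cong first (mulθ-comm b g _ (toθ x)) ⟩
      first (mulθ b g (toθ x) (mulθ b g (toθ (σ x)) (toθ (σ (σ x)))))
        ≡⟨ cong first (cong₂ (λ v w → mulθ b g (toθ x) (mulθ b g v w)) (toθ-σ x) (trans (toθ-σ (σ x)) (cong σθ (toθ-σ x)))) ⟩
      first (mulθ b g (toθ x) (mulθ b g (σθ (toθ x)) (σθ (σθ (toθ x)))))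
        ≡⟨ cong (λ X → first (mulθ b g X (mulθ b g (σθ X) (σθ (σθ X))))) eq ⟩
      first (mulθ b g (tri x₀ x₁ x₂) (mulθ b g (σθ (tri x₀ x₁ x₂)) (σθ (σθ (tri x₀ x₁ x₂)))))
        ≡⟨ first-mulθ-conjugates b g x₀ x₁ x₂ ⟩
      normθ b g x₀ x₁ x₂ ∎
      where
      opaque
        unfolding _+_
        f : ∀ n → 27# * n ≡ 3# * (3# * (3# * n))
        f = solve-∀ 𝔼-ring

-- Primitive elements and divisibility of coordinates.

opaque
  unfolding _+_
  -- 5 = 3 + 3 - 1 is the exponent from which every monomial in X and Y contains X³ or Y³; likewise
  -- 7 = 5 + 3 - 1 below.
  ∣-fifth : ∀ {d} X Y → d ∣ X * X * X → d ∣ Y * Y * Y → d ∣ (X + Y) * (X + Y) * (X + Y) * (X + Y) * (X + Y)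
  ∣-fifth X Y d∣X³ d∣Y³ = subst (_ ∣_) (sym (expand X Y)) (∣-add (∣-*ʳ _ d∣X³) (∣-*ʳ _ d∣Y³))
    where
    expand : ∀ X Y → (X + Y) * (X + Y) * (X + Y) * (X + Y) * (X + Y)
      ≡ X * X * X * (X * X + eis (+ 5) +0 * X * Y + eis (+ 10) +0 * Y * Y)
        + Y * Y * Y * (eis (+ 10) +0 * X * X + eis (+ 5) +0 * X * Y + Y * Y)
    expand = solve-∀ 𝔼-ring

  ∣-seventh : ∀ {d} X Y → d ∣ X * X * X * X * X → d ∣ Y * Y * Y →
    d ∣ (X + Y) * (X + Y) * (X + Y) * (X + Y) * (X + Y) * (X + Y) * (X + Y)
  ∣-seventh X Y d∣X⁵ d∣Y³ = subst (_ ∣_) (sym (expand X Y)) (∣-add (∣-*ʳ _ d∣X⁵) (∣-*ʳ _ d∣Y³))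
    where
    expand : ∀ X Y → (X + Y) * (X + Y) * (X + Y) * (X + Y) * (X + Y) * (X + Y) * (X + Y)
      ≡ X * X * X * X * X * (X * X + eis (+ 7) +0 * X * Y + eis (+ 21) +0 * Y * Y)
        + Y * Y * Y * (eis (+ 35) +0 * X * X * X * X + eis (+ 35) +0 * X * X * X * Y + eis (+ 21) +0 * X * X * Y * Y
          + eis (+ 7) +0 * X * Y * Y * Y + Y * Y * Y * Y)
    expand = solve-∀ 𝔼-ring

  ∣-cube-multiple : ∀ {d} r x → d ∣ x * x * x → d ∣ (r * x) * (r * x) * (r * x)
  ∣-cube-multiple r x d∣x³ = subst (_ ∣_) (sym (expand r x)) (∣-*ˡ (r * r * r) d∣x³)
    where
    expand : ∀ r x → (r * x) * (r * x) * (r * x) ≡ r * r * r * (x * x * x)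
    expand = solve-∀ 𝔼-ring

  seventh-of-1 : 1# * 1# * 1# * 1# * 1# * 1# * 1# ≡ 1#
  seventh-of-1 = refl

Primitive : 𝕋 → Set
Primitive (tri a b c) = ∃₂ λ r s → ∃ λ t → r * a + s * b + t * c ≡ 1#

opaque
  -- The seventh power of the Bézout relation lies in the ideal of the three cubes.
  primitive-cubes : ∀ {x y z d} → Primitive (tri x y z) → d ∣ x * x * x → d ∣ y * y * y → d ∣ z * z * z → d ∣ 1#
  primitive-cubes {x} {y} {z} {d} (r , s , t , eq) d∣x³ d∣y³ d∣z³ = subst (d ∣_)
    (trans (cong (λ w → w * w * w * w * w * w * w) eq) seventh-of-1)
    (∣-seventh (r * x + s * y) (t * z) (∣-fifth (r * x) (s * y) (∣-cube-multiple r x d∣x³) (∣-cube-multiple s y d∣y³))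
      (∣-cube-multiple t z d∣z³))

_≟ᵀ_ : ∀ (x y : 𝕋) → Dec (x ≡ y)
tri a b c ≟ᵀ tri d e f with a ≟ d | b ≟ e | c ≟ f
... | yes refl | yes refl | yes refl = yes refl
... | no a≢d | _ | _ = no λ { refl → a≢d refl }
... | _ | no b≢e | _ = no λ { refl → b≢e refl }
... | _ | _ | no c≢f = no λ { refl → c≢f refl }

opaque
  unfolding _+ᵀ_
  primitive-part : ∀ x → x ≢ 0ᵀ → ∃₂ λ c y → c ≢ 0# × x ≡ scale c y × Primitive y
  primitive-part (tri a b c) x≢0 with gcd a b
  ... | mkGCD {d} (a′ , refl) (b′ , refl) s t eq with gcd d c
  ...   | mkGCD {e} (d′ , refl) (c′ , refl) s′ t′ eq′ =
    e , tri (d′ * a′) (d′ * b′) c′ , e≢0 , cong₃ tri (*-assoc e d′ a′) (*-assoc e d′ b′) refl ,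
    s′ * s , s′ * t , t′ , *-cancelˡ e e≢0
      (trans (regroup e d′ a′ b′ c′ s t s′ t′) (trans (cong (λ w → s′ * w + t′ * (e * c′)) eq) (trans eq′ (sym (*-identityʳ e)))))
    where
    opaque
      unfolding _+_
      regroup : ∀ e d a b c s t s′ t′ → e * (s′ * s * (d * a) + s′ * t * (d * b) + t′ * c)
        ≡ s′ * (s * (e * d * a) + t * (e * d * b)) + t′ * (e * c)
      regroup = solve-∀ 𝔼-ring
    e≢0 : e ≢ 0#
    e≢0 e≡0 = x≢0 (cong₃ tri (vanish₂ a′) (vanish₂ b′) (vanish c′))
      where
      vanish : ∀ w → e * w ≡ 0#
      vanish w = trans (cong (_* w) e≡0) (*-zeroˡ w)
      vanish₂ : ∀ w → e * d′ * w ≡ 0#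
      vanish₂ w = trans (*-assoc e d′ w) (vanish (d′ * w))

  -- Applying `fromθ` shows that t divides 3z, and t is prime to 3.
  divide-coordinates : ∀ t {z w} → Coprime t 3# → toθ z ≡ scale t w → ∃ λ v → z ≡ scale t v
  divide-coordinates t {z} {w} (r , s , eq) toθz≡ = scale r z +ᵀ scale s (fromθ w) , sym (begin
    scale t (scale r z +ᵀ scale s (fromθ w))            ≡⟨ scale-+ t (scale r z) (scale s (fromθ w)) ⟩
    scale t (scale r z) +ᵀ scale t (scale s (fromθ w))  ≡⟨ cong₂ _+ᵀ_ (scale-comm t r z) (scale-comm t s (fromθ w)) ⟩
    scale r (scale t z) +ᵀ scale s (scale t (fromθ w))  ≡⟨ cong (λ v → scale r (scale t z) +ᵀ scale s v) (sym (fromθ-scale t w)) ⟩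
    scale r (scale t z) +ᵀ scale s (fromθ (scale t w))  ≡⟨ cong (λ v → scale r (scale t z) +ᵀ scale s (fromθ v)) (sym toθz≡) ⟩
    scale r (scale t z) +ᵀ scale s (fromθ (toθ z))      ≡⟨ cong (λ v → scale r (scale t z) +ᵀ scale s v) (fromθ-toθ z) ⟩
    scale r (scale t z) +ᵀ scale s (scale 3# z)         ≡⟨ cong₂ _+ᵀ_ (scale-scale r t z) (scale-scale s 3# z) ⟩
    scale (r * t) z +ᵀ scale (s * 3#) z                 ≡⟨ sym (+-scale (r * t) (s * 3#) z) ⟩
    scale (r * t + s * 3#) z                            ≡⟨ cong (λ v → scale v z) eq ⟩
    scale 1# z                                          ≡⟨ scale-1 z ⟩
    z ∎)
    where
    open ≡-Reasoning
    scale-+ : ∀ t x y → scale t (x +ᵀ y) ≡ scale t x +ᵀ scale t y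
    scale-+ t (tri a b c) (tri d e f) = cong₃ tri (*-distribˡ t a d) (*-distribˡ t b e) (*-distribˡ t c f)
    opaque
      unfolding _+_
      distribʳ : ∀ s t a → (s + t) * a ≡ s * a + t * a
      distribʳ = solve-∀ 𝔼-ring
      comm : ∀ s t a → s * (t * a) ≡ t * (s * a)
      comm = solve-∀ 𝔼-ring
      f₁ : ∀ t a b c → t * a + ω² * (t * b) + ω * (t * c) ≡ t * (a + ω² * b + ω * c)
      f₁ = solve-∀ 𝔼-ring
      f₂ : ∀ t a b c → t * a + ω * (t * b) + ω² * (t * c) ≡ t * (a + ω * b + ω² * c)
      f₂ = solve-∀ 𝔼-ring
      f₀ : ∀ t a b c → t * a + t * b + t * c ≡ t * (a + b + c)
      f₀ = solve-∀ 𝔼-ring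
    +-scale : ∀ s t x → scale (s + t) x ≡ scale s x +ᵀ scale t x
    +-scale s t (tri a b c) = cong₃ tri (distribʳ s t a) (distribʳ s t b) (distribʳ s t c)
    scale-comm : ∀ s t x → scale s (scale t x) ≡ scale t (scale s x)
    scale-comm s t (tri a b c) = cong₃ tri (comm s t a) (comm s t b) (comm s t c)
    fromθ-scale : ∀ t x → fromθ (scale t x) ≡ scale t (fromθ x)
    fromθ-scale t (tri a b c) = fromθ-scale-tri t a b c
      where
      opaque
        unfolding fromθ
        fromθ-scale-tri : ∀ t a b c → fromθ (scale t (tri a b c)) ≡ scale t (fromθ (tri a b c))
        fromθ-scale-tri t a b c = cong₃ tri (f₀ t a b c) (f₁ t a b c) (f₂ t a b c)

-- θ and θ₂ in the normal basis: θ = ψ₀ + ω²ψ₁ + ωψ₂, and θ₂ with ω and ω² exchanged.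
θ₁ θ₂ : 𝕋
θ₁ = tri 1# ω² ω
θ₂ = tri 1# ω ω²

opaque
  unfolding _+_ _+ᵀ_
  toθ-θ₁ : toθ θ₁ ≡ tri 0# 3# 0#
  toθ-θ₁ = refl

  toθ-θ₂ : toθ θ₂ ≡ tri 0# 0# 3#
  toθ-θ₂ = refl

  σθ₁ : σ θ₁ ≡ scale ω θ₁
  σθ₁ = refl

  σθ₂ : σ θ₂ ≡ scale ω² θ₂
  σθ₂ = refl

  σσθ₁ : σ (σ θ₁) ≡ scale ω² θ₁
  σσθ₁ = refl

  σσθ₂ : σ (σ θ₂) ≡ scale ω θ₂
  σσθ₂ = refl

  1+ω+ω² : const 1# +ᵀ const ω +ᵀ const ω² ≡ 0ᵀ
  1+ω+ω² = refl

opaque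
  unfolding _+ᵀ_
  mulθ-θ₁ : ∀ b g x₀ x₁ x₂ → mulθ b g (tri 0# 3# 0#) (tri x₀ x₁ x₂) ≡ scale 3# (tri (b * g * x₂) x₀ (g * x₁))
  mulθ-θ₁ b g x₀ x₁ x₂ = cong₃ tri (f₀ b g x₀ x₁ x₂) (f₁ b x₀ x₁ x₂) (f₂ g x₀ x₁ x₂)
    where
    opaque
      unfolding _+_
      f₀ : ∀ b g x₀ x₁ x₂ → 0# * x₀ + b * g * (3# * x₂ + 0# * x₁) ≡ 3# * (b * g * x₂)
      f₀ = solve-∀ 𝔼-ring
      f₁ : ∀ b x₀ x₁ x₂ → 0# * x₁ + 3# * x₀ + b * (0# * x₂) ≡ 3# * x₀
      f₁ = solve-∀ 𝔼-ring
      f₂ : ∀ g x₀ x₁ x₂ → 0# * x₂ + 0# * x₀ + g * (3# * x₁) ≡ 3# * (g * x₁)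
      f₂ = solve-∀ 𝔼-ring

  mulθ-θ₂ : ∀ b g x₀ x₁ x₂ → mulθ b g (tri 0# 0# 3#) (tri x₀ x₁ x₂) ≡ scale 3# (tri (b * g * x₁) (b * x₂) x₀)
  mulθ-θ₂ b g x₀ x₁ x₂ = cong₃ tri (f₀ b g x₀ x₁ x₂) (f₁ b x₀ x₁ x₂) (f₂ g x₀ x₁ x₂)
    where
    opaque
      unfolding _+_
      f₀ : ∀ b g x₀ x₁ x₂ → 0# * x₀ + b * g * (0# * x₂ + 3# * x₁) ≡ 3# * (b * g * x₁)
      f₀ = solve-∀ 𝔼-ring
      f₁ : ∀ b x₀ x₁ x₂ → 0# * x₁ + 0# * x₀ + b * (3# * x₂) ≡ 3# * (b * x₂)
      f₁ = solve-∀ 𝔼-ring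
      f₂ : ∀ g x₀ x₁ x₂ → 0# * x₂ + 3# * x₀ + g * (0# * x₁) ≡ 3# * x₀
      f₂ = solve-∀ 𝔼-ring

  first-toθ : ∀ x → first (toθ x) ≡ tr x
  first-toθ (tri a b c) = refl

-- Trace form, Hilbert 90 and the norms of ambiguous elements.

module Ambiguous {b g : 𝔼} (S : StructureConstants b g) where
  open StructureConstants S
  open Order S
  open Solve using (_:+_; _:*_; _:=_)
  open CommutativeRing 𝕆 using () renaming (zeroʳ to ·-zeroʳ; zeroˡ to ·-zeroˡ; *-identityʳ to ·-identityʳ)
  open ≡-Reasoning

  opaque
    toθ-θ₁· : ∀ x {x₀ x₁ x₂} → toθ x ≡ tri x₀ x₁ x₂ → toθ (θ₁ · x) ≡ tri (b * g * x₂) x₀ (g * x₁)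
    toθ-θ₁· x {x₀} {x₁} {x₂} eq = scale-cancel 3# 3≢0
      (trans (toθ-· θ₁ x) (trans (cong₂ (mulθ b g) toθ-θ₁ eq) (mulθ-θ₁ b g x₀ x₁ x₂)))

    toθ-θ₂· : ∀ x {x₀ x₁ x₂} → toθ x ≡ tri x₀ x₁ x₂ → toθ (θ₂ · x) ≡ tri (b * g * x₁) (b * x₂) x₀
    toθ-θ₂· x {x₀} {x₁} {x₂} eq = scale-cancel 3# 3≢0
      (trans (toθ-· θ₂ x) (trans (cong₂ (mulθ b g) toθ-θ₂ eq) (mulθ-θ₂ b g x₀ x₁ x₂)))

    θ₁·θ₂ : θ₁ · θ₂ ≡ const (b * g)
    θ₁·θ₂ = toθ-injective (trans (toθ-θ₁· θ₂ toθ-θ₂) (trans (normal (b * g) g) (sym (toθ-const (b * g)))))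
      where
      opaque
        unfolding _+_ _+ᵀ_
        f : ∀ t → t * 3# ≡ 3# * t
        f = solve-∀ 𝔼-ring
        z : ∀ t → t * 0# ≡ 3# * 0#
        z = solve-∀ 𝔼-ring
        normal : ∀ t g → tri (t * 3#) 0# (g * 0#) ≡ scale 3# (tri t 0# 0#)
        normal t g = cong₃ tri (f t) refl (z g)

    nm-θ₁ : nm θ₁ ≡ b * (g * g)
    nm-θ₁ = *-cancelˡ 27# (λ ()) (trans (27·nm θ₁ toθ-θ₁) (f b g))
      where
      opaque
        unfolding _+_
        f : ∀ b g → 0# * 0# * 0# + b * (g * g) * (3# * 3# * 3#) + b * b * g * (0# * 0# * 0#) - 3# * (b * g) * (0# * 3# * 0#)
          ≡ 27# * (b * (g * g))
        f = solve-∀ 𝔼-ring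

    nm-θ₂ : nm θ₂ ≡ b * b * g
    nm-θ₂ = *-cancelˡ 27# (λ ()) (trans (27·nm θ₂ toθ-θ₂) (f b g))
      where
      opaque
        unfolding _+_
        f : ∀ b g → 0# * 0# * 0# + b * (g * g) * (0# * 0# * 0#) + b * b * g * (3# * 3# * 3#) - 3# * (b * g) * (0# * 0# * 3#)
          ≡ 27# * (b * b * g)
        f = solve-∀ 𝔼-ring

    const-·-const : ∀ s t → const s · const t ≡ const (s * t)
    const-·-const s t = trans (const-· s (const t)) (scale-const s t)

    tr-· : ∀ x w → 3# * tr (x · w) ≡ first (mulθ b g (toθ x) (toθ w))
    tr-· x w = trans (cong (3# *_) (sym (first-toθ (x · w)))) (trans (sym (first-scale 3# (toθ (x · w)))) (cong first (toθ-· x w)))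

  -- The basis dual to ψ₀, ψ₁, ψ₂ for the trace form, multiplied by bg.
  dual₀ dual₁ dual₂ : 𝕋
  dual₀ = let q = q₀ + q₁ + q₂ in tri (1# - q) (- q) (- q)
  dual₁ = let q = q₀ + q₁ + q₂ in tri (- q) (1# - q) (- q)
  dual₂ = let q = q₀ + q₁ + q₂ in tri (- q) (- q) (1# - q)

  opaque
    unfolding _+ᵀ_
    bg≡ : 1# - 3# * (q₀ + q₁ + q₂) ≡ b * g
    bg≡ = trans (cong (λ w → 1# - w) Q₀) (f (b * g))
      where
      opaque
        unfolding _+_
        f : ∀ t → 1# - (1# - t) ≡ t
        f = solve-∀ 𝔼-ring

    toθ-dual₀ : toθ dual₀ ≡ tri (b * g) 1# 1#
    toθ-dual₀ = cong₃ tri (trans (f₀ (q₀ + q₁ + q₂)) bg≡) (f₁ (q₀ + q₁ + q₂)) (f₂ (q₀ + q₁ + q₂))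
      where
      opaque
        unfolding _+_
        f₀ : ∀ q → (1# - q) + (- q) + (- q) ≡ 1# - 3# * q
        f₀ = solve-∀ 𝔼-ring
        f₁ : ∀ q → (1# - q) + ω * (- q) + ω² * (- q) ≡ 1#
        f₁ = solve-∀ 𝔼-ring
        f₂ : ∀ q → (1# - q) + ω² * (- q) + ω * (- q) ≡ 1#
        f₂ = solve-∀ 𝔼-ring

    toθ-dual₁ : toθ dual₁ ≡ tri (b * g) ω ω²
    toθ-dual₁ = cong₃ tri (trans (f₀ (q₀ + q₁ + q₂)) bg≡) (f₁ (q₀ + q₁ + q₂)) (f₂ (q₀ + q₁ + q₂))
      where
      opaque
        unfolding _+_
        f₀ : ∀ q → (- q) + (1# - q) + (- q) ≡ 1# - 3# * q
        f₀ = solve-∀ 𝔼-ring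
        f₁ : ∀ q → (- q) + ω * (1# - q) + ω² * (- q) ≡ ω
        f₁ = solve-∀ 𝔼-ring
        f₂ : ∀ q → (- q) + ω² * (1# - q) + ω * (- q) ≡ ω²
        f₂ = solve-∀ 𝔼-ring

    toθ-dual₂ : toθ dual₂ ≡ tri (b * g) ω² ω
    toθ-dual₂ = cong₃ tri (trans (f₀ (q₀ + q₁ + q₂)) bg≡) (f₁ (q₀ + q₁ + q₂)) (f₂ (q₀ + q₁ + q₂))
      where
      opaque
        unfolding _+_
        f₀ : ∀ q → (- q) + (- q) + (1# - q) ≡ 1# - 3# * q
        f₀ = solve-∀ 𝔼-ring
        f₁ : ∀ q → (- q) + ω * (- q) + ω² * (1# - q) ≡ ω²
        f₁ = solve-∀ 𝔼-ring
        f₂ : ∀ q → (- q) + ω² * (- q) + ω * (1# - q) ≡ ω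
        f₂ = solve-∀ 𝔼-ring

    -- Away from bg the coordinates can be recovered from traces; this expresses that the order is
    -- unramified outside the πᵢ.
    tr-dual : ∀ y₀ y₁ y₂ → let x = tri y₀ y₁ y₂ in
      tr (x · dual₀) ≡ b * g * y₀ × tr (x · dual₁) ≡ b * g * y₁ × tr (x · dual₂) ≡ b * g * y₂
    tr-dual y₀ y₁ y₂ =
        *-cancelˡ 3# 3≢0 (trans (tr-· x dual₀) (trans (cong (λ w → first (mulθ b g (toθ x) w)) toθ-dual₀) (f₀ b g y₀ y₁ y₂)))
      , *-cancelˡ 3# 3≢0 (trans (tr-· x dual₁) (trans (cong (λ w → first (mulθ b g (toθ x) w)) toθ-dual₁) (f₁ b g y₀ y₁ y₂)))
      , *-cancelˡ 3# 3≢0 (trans (tr-· x dual₂) (trans (cong (λ w → first (mulθ b g (toθ x) w)) toθ-dual₂) (f₂ b g y₀ y₁ y₂)))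
      where
      x : 𝕋
      x = tri y₀ y₁ y₂
      opaque
        unfolding _+_
        f₀ : ∀ b g y₀ y₁ y₂ → (y₀ + y₁ + y₂) * (b * g)
          + b * g * ((y₀ + ω * y₁ + ω² * y₂) * 1# + (y₀ + ω² * y₁ + ω * y₂) * 1#) ≡ 3# * (b * g * y₀)
        f₀ = solve-∀ 𝔼-ring
        f₁ : ∀ b g y₀ y₁ y₂ → (y₀ + y₁ + y₂) * (b * g)
          + b * g * ((y₀ + ω * y₁ + ω² * y₂) * ω² + (y₀ + ω² * y₁ + ω * y₂) * ω) ≡ 3# * (b * g * y₁)
        f₁ = solve-∀ 𝔼-ring
        f₂ : ∀ b g y₀ y₁ y₂ → (y₀ + y₁ + y₂) * (b * g)
          + b * g * ((y₀ + ω * y₁ + ω² * y₂) * ω + (y₀ + ω² * y₁ + ω * y₂) * ω²) ≡ 3# * (b * g * y₂)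
        f₂ = solve-∀ 𝔼-ring

  -- Hilbert 90 for a unit u of relative norm 1 and its consequences for ambiguous x = u σ(x).
  module NormOne (u : 𝕋) (nm-u : nm u ≡ 1#) where
    u⁻¹ : 𝕋
    u⁻¹ = σ u · σ (σ u)

    hilbert : 𝕋 → 𝕋
    hilbert w = w +ᵀ u · σ w +ᵀ u · σ u · σ (σ w)

    opaque
      u·u⁻¹ : u · u⁻¹ ≡ 1ᵀ
      u·u⁻¹ = trans (nm-spec u) (cong const nm-u)

      hilbert-ambiguous : ∀ w → u · σ (hilbert w) ≡ hilbert w
      hilbert-ambiguous w = begin
        u · σ (hilbert w)
          ≡⟨ cong (u ·_) (trans (σ-+ (w +ᵀ u · σ w) (u · σ u · σ (σ w))) (cong₂ _+ᵀ_ (trans (σ-+ w (u · σ w)) (cong (λ v → σ w +ᵀ v) (σ-· u (σ w))))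
               (trans (σ-· (u · σ u) (σ (σ w))) (cong₂ _·_ (σ-· u (σ u)) (σ³ w))))) ⟩
        u · (σ w +ᵀ σ u · σ (σ w) +ᵀ σ u · σ (σ u) · w)
          ≡⟨ Solve.solve 6 (λ u a b c d w → u :* (a :+ b :* c :+ b :* d :* w) := u :* (b :* d) :* w :+ u :* a :+ u :* b :* c)
               refl u (σ w) (σ u) (σ (σ w)) (σ (σ u)) w ⟩
        u · u⁻¹ · w +ᵀ u · σ w +ᵀ u · σ u · σ (σ w)
          ≡⟨ cong (λ v → v +ᵀ u · σ w +ᵀ u · σ u · σ (σ w)) (trans (cong (_· w) u·u⁻¹) (·-identityˡ w)) ⟩
        hilbert w ∎

      -- An explicit form of the independence of characters: in this combination u and u · σ u are
      -- multiplied by 1 + ω + ω² = 0 and only 3bg survives, so the three values of `hilbert` cannot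
      -- all vanish.
      hilbert-sum : θ₁ · θ₂ · hilbert 1ᵀ +ᵀ θ₂ · hilbert θ₁ +ᵀ θ₁ · hilbert θ₂ ≡ const (b * g) +ᵀ (const (b * g) +ᵀ const (b * g))
      hilbert-sum = begin
        θ₁ · θ₂ · hilbert 1ᵀ +ᵀ θ₂ · hilbert θ₁ +ᵀ θ₁ · hilbert θ₂
          ≡⟨ cong₂ _+ᵀ_ (cong₂ (λ v w → θ₁ · θ₂ · v +ᵀ θ₂ · w)
               (cong₂ (λ v w → 1ᵀ +ᵀ u · v +ᵀ u · σ u · w) (σ-const 1#) (trans (cong σ (σ-const 1#)) (σ-const 1#)))
               (cong₂ (λ v w → θ₁ +ᵀ u · v +ᵀ u · σ u · w) (trans σθ₁ (sym (const-· ω θ₁))) (trans σσθ₁ (sym (const-· ω² θ₁)))))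
               (cong₂ (λ v w → θ₁ · (θ₂ +ᵀ u · v +ᵀ u · σ u · w)) (trans σθ₂ (sym (const-· ω² θ₂))) (trans σσθ₂ (sym (const-· ω θ₂)))) ⟩
        θ₁ · θ₂ · (1ᵀ +ᵀ u · 1ᵀ +ᵀ u · σ u · 1ᵀ) +ᵀ θ₂ · (θ₁ +ᵀ u · (const ω · θ₁) +ᵀ u · σ u · (const ω² · θ₁))
          +ᵀ θ₁ · (θ₂ +ᵀ u · (const ω² · θ₂) +ᵀ u · σ u · (const ω · θ₂))
          ≡⟨ Solve.solve 7 (λ s t u v e Ω Ω′ →
               s :* t :* (e :+ u :* e :+ v :* e) :+ t :* (s :+ u :* (Ω :* s) :+ v :* (Ω′ :* s)) :+ s :* (t :+ u :* (Ω′ :* t) :+ v :* (Ω :* t))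
               := s :* t :* e :+ (s :* t :+ s :* t) :+ s :* t :* ((e :+ Ω :+ Ω′) :* (u :+ v)))
               refl θ₁ θ₂ u (u · σ u) 1ᵀ (const ω) (const ω²) ⟩
        θ₁ · θ₂ · 1ᵀ +ᵀ (θ₁ · θ₂ +ᵀ θ₁ · θ₂) +ᵀ θ₁ · θ₂ · ((1ᵀ +ᵀ const ω +ᵀ const ω²) · (u +ᵀ u · σ u))
          ≡⟨ cong₂ (λ D v → D · 1ᵀ +ᵀ (D +ᵀ D) +ᵀ D · (v · (u +ᵀ u · σ u))) θ₁·θ₂ 1+ω+ω² ⟩
        const (b * g) · 1ᵀ +ᵀ (const (b * g) +ᵀ const (b * g)) +ᵀ const (b * g) · (0ᵀ · (u +ᵀ u · σ u))
          ≡⟨ cong₂ (λ v w → v +ᵀ (const (b * g) +ᵀ const (b * g)) +ᵀ w) (·-identityʳ (const (b * g)))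
               (trans (cong (const (b * g) ·_) (·-zeroˡ (u +ᵀ u · σ u))) (·-zeroʳ (const (b * g)))) ⟩
        const (b * g) +ᵀ (const (b * g) +ᵀ const (b * g)) +ᵀ 0ᵀ
          ≡⟨ trans (+ᵀ-comm _ 0ᵀ) (+ᵀ-identityˡ _) ⟩
        const (b * g) +ᵀ (const (b * g) +ᵀ const (b * g)) ∎

      hilbert-nonzero : b * g ≢ 0# → ∃ λ w → hilbert w ≢ 0ᵀ
      hilbert-nonzero bg≢0 with hilbert 1ᵀ ≟ᵀ 0ᵀ | hilbert θ₁ ≟ᵀ 0ᵀ | hilbert θ₂ ≟ᵀ 0ᵀ
      ... | no h≢0 | _ | _ = 1ᵀ , h≢0
      ... | yes _ | no h≢0 | _ = θ₁ , h≢0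
      ... | yes _ | yes _ | no h≢0 = θ₂ , h≢0
      ... | yes h₀ | yes h₁ | yes h₂ = ⊥-elim (*≢0# 3≢0 bg≢0 (trans (f (b * g)) (const-injective 3bg≡0)))
        where
        opaque
          unfolding _+_
          f : ∀ t → 3# * t ≡ t + (t + t)
          f = solve-∀ 𝔼-ring
        3bg≡0 : const (b * g + (b * g + b * g)) ≡ 0ᵀ
        3bg≡0 = begin
          const (b * g + (b * g + b * g))                    ≡⟨ trans (const-+ (b * g) (b * g + b * g)) (cong (λ v → const (b * g) +ᵀ v) (const-+ (b * g) (b * g))) ⟩
          const (b * g) +ᵀ (const (b * g) +ᵀ const (b * g))   ≡⟨ sym hilbert-sum ⟩
          θ₁ · θ₂ · hilbert 1ᵀ +ᵀ θ₂ · hilbert θ₁ +ᵀ θ₁ · hilbert θ₂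
            ≡⟨ cong₂ _+ᵀ_ (cong₂ _+ᵀ_ (trans (cong (θ₁ · θ₂ ·_) h₀) (·-zeroʳ (θ₁ · θ₂))) (trans (cong (θ₂ ·_) h₁) (·-zeroʳ θ₂)))
                 (trans (cong (θ₁ ·_) h₂) (·-zeroʳ θ₁)) ⟩
          0ᵀ +ᵀ 0ᵀ +ᵀ 0ᵀ                                      ≡⟨ trans (cong (_+ᵀ 0ᵀ) (+ᵀ-identityˡ 0ᵀ)) (+ᵀ-identityˡ 0ᵀ) ⟩
          0ᵀ ∎

    module _ (x : 𝕋) (amb : u · σ x ≡ x) where
      opaque
        σx : σ x ≡ u⁻¹ · x
        σx = begin
          σ x                ≡⟨ sym (·-identityˡ (σ x)) ⟩
          1ᵀ · σ x           ≡⟨ cong (_· σ x) (sym u·u⁻¹) ⟩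
          u · u⁻¹ · σ x      ≡⟨ Solve.solve 3 (λ u v s → u :* v :* s := v :* (u :* s)) refl u u⁻¹ (σ x) ⟩
          u⁻¹ · (u · σ x)    ≡⟨ cong (u⁻¹ ·_) amb ⟩
          u⁻¹ · x ∎

        σσx : σ (σ x) ≡ σ u⁻¹ · (u⁻¹ · x)
        σσx = trans (cong σ σx) (trans (σ-· u⁻¹ x) (cong (σ u⁻¹ ·_) σx))

        -- The conjugates of an ambiguous x are x times units, so x can be taken out of the trace.
        tr-multiple : ∀ w → const (tr (x · w)) ≡ x · (w +ᵀ u⁻¹ · σ w +ᵀ σ u⁻¹ · u⁻¹ · σ (σ w))
        tr-multiple w = begin
          const (tr (x · w))                                ≡⟨ const-tr (x · w) ⟩
          x · w +ᵀ σ (x · w) +ᵀ σ (σ (x · w))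
            ≡⟨ cong₂ (λ s t → x · w +ᵀ s +ᵀ t) (trans (σ-· x w) (cong (_· σ w) σx))
                 (trans (cong σ (σ-· x w)) (trans (σ-· (σ x) (σ w)) (cong (_· σ (σ w)) σσx))) ⟩
          x · w +ᵀ u⁻¹ · x · σ w +ᵀ σ u⁻¹ · (u⁻¹ · x) · σ (σ w)
            ≡⟨ Solve.solve 6 (λ x w v w′ v′ w″ → x :* w :+ v :* x :* w′ :+ v′ :* (v :* x) :* w″
                 := x :* (w :+ v :* w′ :+ v′ :* v :* w″)) refl x w u⁻¹ (σ w) (σ u⁻¹) (σ (σ w)) ⟩
          x · (w +ᵀ u⁻¹ · σ w +ᵀ σ u⁻¹ · u⁻¹ · σ (σ w)) ∎

        -- The three conjugates generate the same ideal, so (x)³ = (nm x). The unit comes from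
        -- substituting σ x = u⁻¹x in x · σ x · σ²x.
        cube-of-ambiguous : x · (x · x) ≡ const (nm x) · (u · (σ u · u))
        cube-of-ambiguous = sym (begin
          const (nm x) · (u · (σ u · u))                    ≡⟨ cong (_· (u · (σ u · u))) (sym (nm-spec x)) ⟩
          x · (σ x · σ (σ x)) · (u · (σ u · u))             ≡⟨ cong₂ (λ s t → x · (s · t) · (u · (σ u · u))) σx σσx ⟩
          x · (u⁻¹ · x · (σ u⁻¹ · (u⁻¹ · x))) · (u · (σ u · u))
            ≡⟨ Solve.solve 5 (λ x v v′ u u′ → x :* (v :* x :* (v′ :* (v :* x))) :* (u :* (u′ :* u))
                 := u :* v :* (u :* v) :* (u′ :* v′) :* (x :* (x :* x))) refl x u⁻¹ (σ u⁻¹) u (σ u) ⟩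
          u · u⁻¹ · (u · u⁻¹) · (σ u · σ u⁻¹) · (x · (x · x))
            ≡⟨ cong₂ (λ s t → s · s · t · (x · (x · x))) u·u⁻¹ (trans (sym (σ-· u u⁻¹)) (trans (cong σ u·u⁻¹) (σ-const 1#))) ⟩
          1ᵀ · 1ᵀ · 1ᵀ · (x · (x · x))
            ≡⟨ trans (cong (λ v → v · 1ᵀ · (x · (x · x))) (·-identityˡ 1ᵀ)) (trans (cong (_· (x · (x · x))) (·-identityˡ 1ᵀ)) (·-identityˡ _)) ⟩
          x · (x · x) ∎)

        -- The trace is xW, and the cube of x is `nm x` times a unit. Divisibility in the order of a
        -- constant by a constant passes to ℤ[ω] by comparing one coordinate.
        nm∣tr³ : ∀ w → nm x ∣ tr (x · w) * tr (x · w) * tr (x · w)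
        nm∣tr³ w = first (u · (σ u · u) · (W · (W · W))) , trans (cong first const-t³) (first-scale (nm x) _)
          where
          t : 𝔼
          t = tr (x · w)
          W : 𝕋
          W = w +ᵀ u⁻¹ · σ w +ᵀ σ u⁻¹ · u⁻¹ · σ (σ w)
          const-t³ : const (t * t * t) ≡ scale (nm x) (u · (σ u · u) · (W · (W · W)))
          const-t³ = begin
            const (t * t * t)                      ≡⟨ sym (trans (cong (_· const t) (const-·-const t t)) (const-·-const (t * t) t)) ⟩
            const t · const t · const t            ≡⟨ cong (λ v → v · v · v) (tr-multiple w) ⟩
            x · W · (x · W) · (x · W)              ≡⟨ Solve.solve 2 (λ x W → x :* W :* (x :* W) :* (x :* W) := x :* (x :* x) :* (W :* (W :* W))) refl x W ⟩
            x · (x · x) · (W · (W · W))            ≡⟨ cong (_· (W · (W · W))) cube-of-ambiguous ⟩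
            const (nm x) · (u · (σ u · u)) · (W · (W · W)) ≡⟨ ·-assoc _ _ _ ⟩
            const (nm x) · (u · (σ u · u) · (W · (W · W))) ≡⟨ const-· (nm x) _ ⟩
            scale (nm x) (u · (σ u · u) · (W · (W · W))) ∎

        -- ρ divides the cubes of the traces of x against the dual basis, which are bg times the
        -- coordinates of x; being prime to bg it divides the cubes of the coordinates, and these
        -- generate the unit ideal.
        coprime-divisor-trivial : ∀ {ρ} → ρ ∣ nm x → Coprime ρ (b * g) → Primitive x → ρ ∣ 1#
        coprime-divisor-trivial {ρ} ρ∣ν coprime = go x refl
          where
          bg : 𝔼
          bg = b * g
          cancel : ∀ w y → tr (x · w) ≡ bg * y → ρ ∣ y * y * y
          cancel w y eq = coprime-∣ (Coprime-* (Coprime-* coprime coprime) coprime)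
            (subst (ρ ∣_) (trans (cong (λ t → t * t * t) eq) (f bg y)) (∣-trans ρ∣ν (nm∣tr³ w)))
            where
            opaque
              unfolding _+_
              f : ∀ t y → (t * y) * (t * y) * (t * y) ≡ t * t * t * (y * y * y)
              f = solve-∀ 𝔼-ring
          go : ∀ y → x ≡ y → Primitive y → ρ ∣ 1#
          go (tri y₀ y₁ y₂) refl prim with tr-dual y₀ y₁ y₂
          ... | e₀ , e₁ , e₂ = primitive-cubes prim (cancel dual₀ y₀ e₀) (cancel dual₁ y₁ e₁) (cancel dual₂ y₂ e₂)

-- Congruences, Fermat's theorem and logarithms of cubic residue symbols.

module Mod (p : 𝔼) where
  infix 4 _≈_
  _≈_ : 𝔼 → 𝔼 → Set
  x ≈ y = p ∣ x - y

  opaque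
    ≈-refl : ∀ {x} → x ≈ x
    ≈-refl {x} = subst (p ∣_) (sym (x-x≡0# x)) ∣0#

    ≡⇒≈ : ∀ {x y} → x ≡ y → x ≈ y
    ≡⇒≈ refl = ≈-refl

    ≈-sym : ∀ {x y} → x ≈ y → y ≈ x
    ≈-sym {x} {y} q = subst (p ∣_) (f x y) (∣-neg q)
      where
      opaque
        unfolding _+_
        f : ∀ x y → - (x - y) ≡ y - x
        f = solve-∀ 𝔼-ring

    ≈-trans : ∀ {x y z} → x ≈ y → y ≈ z → x ≈ z
    ≈-trans {x} {y} {z} q r = subst (p ∣_) (f x y z) (∣-add q r)
      where
      opaque
        unfolding _+_
        f : ∀ x y z → (x - y) + (y - z) ≡ x - z
        f = solve-∀ 𝔼-ring

    ≈-+ : ∀ {x y z w} → x ≈ y → z ≈ w → x + z ≈ y + w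
    ≈-+ {x} {y} {z} {w} q r = subst (p ∣_) (f x y z w) (∣-add q r)
      where
      opaque
        unfolding _+_
        f : ∀ x y z w → (x - y) + (z - w) ≡ (x + z) - (y + w)
        f = solve-∀ 𝔼-ring

    ≈-* : ∀ {x y z w} → x ≈ y → z ≈ w → x * z ≈ y * w
    ≈-* {x} {y} {z} {w} q r = subst (p ∣_) (f x y z w) (∣-add (∣-*ʳ z q) (∣-*ˡ y r))
      where
      opaque
        unfolding _+_
        f : ∀ x y z w → (x - y) * z + y * (z - w) ≡ x * z - y * w
        f = solve-∀ 𝔼-ring

    ≈-^ : ∀ {x y} n → x ≈ y → x ^ n ≈ y ^ n
    ≈-^ zero q = ≈-refl
    ≈-^ (suc n) q = ≈-* q (≈-^ n q)

opaque
  unfolding _+_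
  nat-suc : ∀ n → nat (suc n) ≡ 1# + nat n
  nat-suc n = refl

  conj-+ : ∀ x y → conj (x + y) ≡ conj x + conj y
  conj-+ (eis a b) (eis c d) = cong₂ eis (f a b c d) (g b d)
    where
    f : ∀ a b c d → (a ℤ.+ c) ℤ.- (b ℤ.+ d) ≡ (a ℤ.- b) ℤ.+ (c ℤ.- d)
    f = ℤR.solve-∀
    g : ∀ b d → ℤ.- (b ℤ.+ d) ≡ ℤ.- b ℤ.+ ℤ.- d
    g = ℤR.solve-∀

  conj-- : ∀ x y → conj (x - y) ≡ conj x - conj y
  conj-- (eis a b) (eis c d) = cong₂ eis (f a b c d) (g b d)
    where
    f : ∀ a b c d → (a ℤ.+ ℤ.- c) ℤ.- (b ℤ.+ ℤ.- d) ≡ (a ℤ.- b) ℤ.+ ℤ.- (c ℤ.- d)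
    f = ℤR.solve-∀
    g : ∀ b d → ℤ.- (b ℤ.+ ℤ.- d) ≡ ℤ.- b ℤ.+ ℤ.- (ℤ.- d)
    g = ℤR.solve-∀

  conj-* : ∀ x y → conj (x * y) ≡ conj x * conj y
  conj-* (eis a b) (eis c d) = cong₂ eis (f a b c d) (g a b c d)
    where
    f : ∀ a b c d → (a ℤ.* c ℤ.- b ℤ.* d) ℤ.- (a ℤ.* d ℤ.+ b ℤ.* c ℤ.- b ℤ.* d)
      ≡ (a ℤ.- b) ℤ.* (c ℤ.- d) ℤ.- (ℤ.- b) ℤ.* (ℤ.- d)
    f = ℤR.solve-∀
    g : ∀ a b c d → ℤ.- (a ℤ.* d ℤ.+ b ℤ.* c ℤ.- b ℤ.* d)
      ≡ (a ℤ.- b) ℤ.* (ℤ.- d) ℤ.+ (ℤ.- b) ℤ.* (c ℤ.- d) ℤ.- (ℤ.- b) ℤ.* (ℤ.- d)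
    g = ℤR.solve-∀

  conj-conj : ∀ x → conj (conj x) ≡ x
  conj-conj (eis a b) = cong₂ eis (f a b) (g b)
    where
    f : ∀ a b → (a ℤ.- b) ℤ.- (ℤ.- b) ≡ a
    f = ℤR.solve-∀
    g : ∀ b → ℤ.- (ℤ.- b) ≡ b
    g = ℤR.solve-∀

  conj-nat : ∀ n → conj (nat n) ≡ nat n
  conj-nat n = cong₂ eis (f (+ n)) refl
    where
    f : ∀ a → a ℤ.- +0 ≡ a
    f = ℤR.solve-∀

  conj-1 : conj 1# ≡ 1#
  conj-1 = refl

  conj-ω : conj ω ≡ ω²
  conj-ω = refl

  ω³ : ω ^ 3 ≡ 1#
  ω³ = refl

  ω^1 : ω ^ 1 ≡ ω
  ω^1 = refl

  ω^2 : ω ^ 2 ≡ ω²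
  ω^2 = refl

  int-decomposition : ∀ a b → eis a b ≡ int a + int b * ω
  int-decomposition a b = cong₂ eis (f a b) (g b)
    where
    f : ∀ a b → a ≡ a ℤ.+ (b ℤ.* +0 ℤ.- +0 ℤ.* (+ 1))
    f = ℤR.solve-∀
    g : ∀ b → b ≡ +0 ℤ.+ (b ℤ.* (+ 1) ℤ.+ +0 ℤ.* +0 ℤ.- +0 ℤ.* (+ 1))
    g = ℤR.solve-∀

  int-+ : ∀ i j → int (i ℤ.+ j) ≡ int i + int j
  int-+ i j = refl

opaque
  ω^-mod3 : ∀ r k → ω ^ (r ℕ.+ k ℕ.* 3) ≡ ω ^ r
  ω^-mod3 r k = begin
    ω ^ (r ℕ.+ k ℕ.* 3)    ≡⟨ ^-+ ω r (k ℕ.* 3) ⟩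
    ω ^ r * ω ^ (k ℕ.* 3)  ≡⟨ cong (λ m → ω ^ r * ω ^ m) (ℕP.*-comm k 3) ⟩
    ω ^ r * ω ^ (3 ℕ.* k)  ≡⟨ cong (ω ^ r *_) (trans (^-* ω 3 k) (trans (cong (_^ k) ω³) (1#^ k))) ⟩
    ω ^ r * 1#             ≡⟨ *-identityʳ (ω ^ r) ⟩
    ω ^ r ∎
    where open ≡-Reasoning

  prime∤! : ∀ {ℓ} → ℕPrime ℓ → ∀ k → k ℕ.< ℓ → ¬ ℓ ℕD.∣ k !
  prime∤! pr zero _ ℓ∣1 = ℕP.<⇒≢ (ℕ.nonTrivial⇒n>1 _ {{prime⇒nonTrivial pr}}) (sym (ℕD.∣1⇒≡1 ℓ∣1))
  prime∤! pr (suc k) k<ℓ ℓ∣ with euclidsLemma (suc k) (k !) pr ℓ∣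
  ... | inj₁ ℓ∣sk = ℕP.<⇒≱ k<ℓ (ℕD.∣⇒≤ ℓ∣sk)
  ... | inj₂ ℓ∣k! = prime∤! pr k (ℕP.<-trans (ℕP.n<1+n k) k<ℓ) ℓ∣k!

  ℓ∣ℓ! : ∀ ℓ → .{{ℕ.NonZero ℓ}} → ℓ ℕD.∣ ℓ !
  ℓ∣ℓ! (suc m) = ℕD.m∣m*n (m !)

  ℓ∣choose*! : ∀ ℓ k → .{{ℕ.NonZero ℓ}} → k ℕ.≤ ℓ → ℓ ℕD.∣ (ℓ C k) ℕ.* (k ! ℕ.* (ℓ ℕ.∸ k) !)
  ℓ∣choose*! ℓ k k≤ℓ = subst (ℓ ℕD.∣_) (sym (trans (cong (ℕ._* (k ! ℕ.* (ℓ ℕ.∸ k) !)) (nCk≡n!/k![n-k]! k≤ℓ))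
    (ℕDM.m/n*n≡m {{ℕP._!*_!≢0 k (ℓ ℕ.∸ k)}} (k![n∸k]!∣n! k≤ℓ)))) (ℓ∣ℓ! ℓ)

  prime∣choose : ∀ {ℓ} → ℕPrime ℓ → ∀ k → 0 ℕ.< k → k ℕ.< ℓ → ℓ ℕD.∣ (ℓ C k)
  prime∣choose {ℓ} pr k 0<k k<ℓ
    with euclidsLemma (ℓ C k) (k ! ℕ.* (ℓ ℕ.∸ k) !) pr (ℓ∣choose*! ℓ k {{prime⇒nonZero pr}} (ℕP.<⇒≤ k<ℓ))
  ... | inj₁ ℓ∣C = ℓ∣C
  ... | inj₂ ℓ∣! with euclidsLemma (k !) ((ℓ ℕ.∸ k) !) pr ℓ∣!
  ...   | inj₁ ℓ∣k! = ⊥-elim (prime∤! pr k k<ℓ ℓ∣k!)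
  ...   | inj₂ ℓ∣! = ⊥-elim (prime∤! pr (ℓ ℕ.∸ k) (ℕP.∸-monoʳ-< 0<k (ℕP.<⇒≤ k<ℓ)) ℓ∣!)

private
  module 𝔼R = CommutativeRing 𝔼-commutativeRing
  module Bin = BinomialTheorem 𝔼R.commutativeSemiring
  module Sum = MonoidSum 𝔼R.+-monoid
  open import Algebra.Definitions.RawSemiring (CommutativeSemiring.rawSemiring 𝔼R.commutativeSemiring) using () renaming (_^_ to _^ˢ_; _×_ to _×ˢ_)

opaque
  ^ˢ≡^ : ∀ x n → x ^ˢ n ≡ x ^ n
  ^ˢ≡^ x zero = refl
  ^ˢ≡^ x (suc n) = cong (x *_) (^ˢ≡^ x n)

  ×ˢ≡nat* : ∀ n x → n ×ˢ x ≡ nat n * x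
  ×ˢ≡nat* zero x = sym (*-zeroˡ x)
  ×ˢ≡nat* (suc n) x = trans (cong (λ w → x + w) (×ˢ≡nat* n x)) (trans (f x (nat n)) (cong (_* x) (sym (nat-suc n))))
    where
    opaque
      unfolding _+_
      f : ∀ x m → x + m * x ≡ (1# + m) * x
      f = solve-∀ 𝔼-ring

  nat-∣ : ∀ {m n} → m ℕD.∣ n → nat m ∣ nat n
  nat-∣ {m} (ℕD.divides q refl) = nat q , trans (nat-* q m) (*-comm (nat q) (nat m))

  ∣-sum : ∀ {d n} (v : Fin n → 𝔼) → (∀ i → d ∣ v i) → d ∣ Sum.sum v
  ∣-sum {n = zero} v _ = ∣0#
  ∣-sum {n = suc n} v d∣v = ∣-add (d∣v Fin.zero) (∣-sum (λ i → v (Fin.suc i)) (λ i → d∣v (Fin.suc i)))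

  frobenius : ∀ {ℓ} → ℕPrime ℓ → ∀ x y → nat ℓ ∣ (x + y) ^ ℓ - (x ^ ℓ + y ^ ℓ)
  frobenius {zero} pr x y = ⊥-elim (ℕ.≢-nonZero⁻¹ 0 {{prime⇒nonZero pr}} refl)
  frobenius {suc m} pr x y = subst (nat ℓ ∣_) (sym expansion) (∣-sum middle middle-∣)
    where
    ℓ : ℕ
    ℓ = suc m
    t : Fin (suc ℓ) → 𝔼
    t = Bin.binomialTerm x y ℓ
    middle : Fin m → 𝔼
    middle i = t (Fin.suc (Fin.inject₁ i))
    middle-∣ : ∀ i → nat ℓ ∣ middle i
    middle-∣ i = subst (nat ℓ ∣_) (sym (×ˢ≡nat* (ℓ C k) (Bin.binomial x y ℓ (Fin.suc (Fin.inject₁ i)))))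
      (∣-*ʳ _ (nat-∣ (prime∣choose pr k (s≤s z≤n) (s≤s (subst (ℕ._< m) (sym (FinP.toℕ-inject₁ i)) (FinP.toℕ<n i))))))
      where
      k : ℕ
      k = suc (toℕ (Fin.inject₁ i))
    t-first : t Fin.zero ≡ y ^ ℓ
    t-first = trans (×ˢ≡nat* 1 (1# * y ^ˢ ℓ)) (trans (*-identityˡ _) (trans (*-identityˡ _) (^ˢ≡^ y ℓ)))
    t-last : t (Fin.suc (Fin.fromℕ m)) ≡ x ^ ℓ
    t-last = begin
      (ℓ C suc (toℕ (Fin.fromℕ m))) ×ˢ (x ^ˢ suc (toℕ (Fin.fromℕ m)) * y ^ˢ (m ℕ.∸ toℕ (Fin.fromℕ m)))
        ≡⟨ cong (λ k → (ℓ C suc k) ×ˢ (x ^ˢ suc k * y ^ˢ (m ℕ.∸ k))) (FinP.toℕ-fromℕ m) ⟩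
      (ℓ C ℓ) ×ˢ (x ^ˢ ℓ * y ^ˢ (m ℕ.∸ m))
        ≡⟨ cong₂ (λ c k → c ×ˢ (x ^ˢ ℓ * y ^ˢ k)) (nCn≡1 ℓ) (ℕP.n∸n≡0 m) ⟩
      1 ×ˢ (x ^ˢ ℓ * 1#)   ≡⟨ ×ˢ≡nat* 1 _ ⟩
      nat 1 * (x ^ˢ ℓ * 1#) ≡⟨ trans (*-identityˡ _) (trans (*-identityʳ _) (^ˢ≡^ x ℓ)) ⟩
      x ^ ℓ ∎
      where open ≡-Reasoning
    opaque
      unfolding _+_
      cancel : ∀ a b c → (b + (c + a)) - (a + b) ≡ c
      cancel = solve-∀ 𝔼-ring
    expansion : (x + y) ^ ℓ - (x ^ ℓ + y ^ ℓ) ≡ Sum.sum middle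
    expansion = begin
      (x + y) ^ ℓ - (x ^ ℓ + y ^ ℓ)     ≡⟨ cong (λ w → w - (x ^ ℓ + y ^ ℓ)) (trans (sym (^ˢ≡^ (x + y) ℓ)) (Bin.theorem ℓ x y)) ⟩
      Sum.sum t - (x ^ ℓ + y ^ ℓ)
        ≡⟨ cong (λ w → (t Fin.zero + w) - (x ^ ℓ + y ^ ℓ)) (Sum.sum-init-last (λ i → t (Fin.suc i))) ⟩
      (t Fin.zero + (Sum.sum middle + t (Fin.suc (Fin.fromℕ m)))) - (x ^ ℓ + y ^ ℓ)
        ≡⟨ cong₂ (λ v w → (v + (Sum.sum middle + w)) - (x ^ ℓ + y ^ ℓ)) t-first t-last ⟩
      (y ^ ℓ + (Sum.sum middle + x ^ ℓ)) - (x ^ ℓ + y ^ ℓ) ≡⟨ cancel (x ^ ℓ) (y ^ ℓ) (Sum.sum middle) ⟩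
      Sum.sum middle ∎
      where open ≡-Reasoning

opaque
  0#^ : ∀ n → .{{ℕ.NonZero n}} → 0# ^ n ≡ 0#
  0#^ (suc n) = *-zeroˡ (0# ^ n)

-- s ↦ s^ℓ is additive modulo ℓ, so it agrees with an additive τ as soon as it does at 1 and ω. τ
-- will be the identity if ω^ℓ = ω and conjugation if ω^ℓ = ω².
module AdditivePower {ℓ : ℕ} (pr : ℕPrime ℓ) (τ : 𝔼 → 𝔼) (τ-+ : ∀ x y → τ (x + y) ≡ τ x + τ y)
  (τ-0 : τ 0# ≡ 0#) (τ-1 : τ 1# ≡ 1#) (τ-∣ : ∀ x y → nat ℓ ∣ x - y → nat ℓ ∣ τ x - τ y) (τ-ω : ω ^ ℓ ≡ τ ω) where
  open Mod (nat ℓ)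

  P : 𝔼 → Set
  P s = s ^ ℓ ≈ τ s

  opaque
    P-+ : ∀ {x y} → P x → P y → P (x + y)
    P-+ {x} {y} px py = ≈-trans (frobenius pr x y) (≈-trans (≈-+ px py) (≡⇒≈ (sym (τ-+ x y))))

    P-≈ : ∀ {x y} → x ≈ y → P y → P x
    P-≈ {x} {y} x≈y py = ≈-trans (≈-^ ℓ x≈y) (≈-trans py (≈-sym (τ-∣ x y x≈y)))

    P-nat* : ∀ n {s} → P s → P (nat n * s)
    P-nat* zero {s} _ = subst P (sym (*-zeroˡ s)) (≡⇒≈ (trans (0#^ ℓ {{prime⇒nonZero pr}}) (sym τ-0)))
    P-nat* (suc n) {s} ps = subst P (trans (f s (nat n)) (cong (_* s) (sym (nat-suc n)))) (P-+ ps (P-nat* n ps))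
      where
      opaque
        unfolding _+_
        f : ∀ x m → x + m * x ≡ (1# + m) * x
        f = solve-∀ 𝔼-ring

    int≈nat : ∀ a → ∃ λ r → int a ≈ nat r
    int≈nat a = a ℤDM.%ℕ ℓ , int (a ℤDM./ℕ ℓ) ,
      trans (cong (_- nat (a ℤDM.%ℕ ℓ)) (trans (cong int (ℤDM.a≡a%ℕn+[a/ℕn]*n a ℓ)) (int-+ (+ (a ℤDM.%ℕ ℓ)) ((a ℤDM./ℕ ℓ) ℤ.* + ℓ))))
        (trans (cong (λ w → nat (a ℤDM.%ℕ ℓ) + w - nat (a ℤDM.%ℕ ℓ)) (int-* (a ℤDM./ℕ ℓ) (+ ℓ)))
          (f (nat (a ℤDM.%ℕ ℓ)) (int (a ℤDM./ℕ ℓ)) (nat ℓ)))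
      where
      instance
        ℓ≢0 : ℕ.NonZero ℓ
        ℓ≢0 = prime⇒nonZero pr
      opaque
        unfolding _+_
        f : ∀ r q l → r + q * l - r ≡ l * q
        f = solve-∀ 𝔼-ring

    power≈τ : ∀ s → P s
    power≈τ (eis a b) with int≈nat a | int≈nat b
    ... | r , a≈r | r′ , b≈r′ = subst P (sym (int-decomposition a b))
      (P-+ (P-≈ (≈-trans a≈r (≡⇒≈ (sym (*-identityʳ (nat r))))) (P-nat* r (≡⇒≈ (trans (1#^ ℓ) (sym τ-1)))))
           (P-≈ (≈-* b≈r′ ≈-refl) (P-nat* r′ (≡⇒≈ τ-ω))))

opaque
  unfolding _+_
  conj-0 : conj 0# ≡ 0#
  conj-0 = refl

opaque
  conj-∣ : ∀ n x y → nat n ∣ x - y → nat n ∣ conj x - conj y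
  conj-∣ n x y (c , eq) = conj c , trans (sym (conj-- x y)) (trans (cong conj eq) (trans (conj-* (nat n) c) (cong (_* conj c) (conj-nat n))))

  power-split : ∀ {ℓ} → ℕPrime ℓ → ω ^ ℓ ≡ ω → ∀ s → nat ℓ ∣ s ^ ℓ - s
  power-split pr ω^ℓ = AdditivePower.power≈τ pr (λ x → x) (λ _ _ → refl) refl refl (λ _ _ q → q) ω^ℓ

  power-inert : ∀ {ℓ} → ℕPrime ℓ → ω ^ ℓ ≡ ω² → ∀ s → nat ℓ ∣ s ^ ℓ - conj s
  power-inert {ℓ} pr ω^ℓ = AdditivePower.power≈τ pr conj conj-+ conj-0 conj-1 (conj-∣ ℓ) (trans ω^ℓ (sym conj-ω))

  power-inert² : ∀ {ℓ} → ℕPrime ℓ → ω ^ ℓ ≡ ω² → ∀ s → nat ℓ ∣ s ^ (ℓ ℕ.* ℓ) - s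
  power-inert² {ℓ} pr ω^ℓ s = subst (λ w → w ≈ s) (sym (^-* s ℓ ℓ))
    (≈-trans (power-inert pr ω^ℓ (s ^ ℓ)) (subst (conj (s ^ ℓ) ≈_) (conj-conj s) (conj-∣ ℓ (s ^ ℓ) (conj s) (power-inert pr ω^ℓ s))))
    where open Mod (nat ℓ)

  divisors-of-prime-square : ∀ {ℓ} → ℕPrime ℓ → ∀ d e → d ℕ.* e ≡ ℓ ℕ.* ℓ → d ≢ 1 → d ≡ ℓ ⊎ d ≡ ℓ ℕ.* ℓ
  divisors-of-prime-square {ℓ} pr d e de≡ d≢1 with euclidsLemma d e pr (ℕD.divides ℓ de≡)
  ... | inj₁ (ℕD.divides d′ refl) = [ (λ d′≡1 → inj₁ (trans (cong (ℕ._* ℓ) d′≡1) (ℕP.*-identityˡ ℓ)))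
                                    , (λ d′≡ℓ → inj₂ (cong (ℕ._* ℓ) d′≡ℓ)) ]′
    (prime⇒irreducible pr (ℕD.divides e (sym (trans (ℕP.*-comm e d′) (ℕP.*-cancelʳ-≡ (d′ ℕ.* e) ℓ ℓ {{prime⇒nonZero pr}} (trans (shuffle d′ e ℓ) de≡))))))
    where
    shuffle : ∀ d e l → d ℕ.* e ℕ.* l ≡ d ℕ.* l ℕ.* e
    shuffle = ℕR.solve-∀
  ... | inj₂ (ℕD.divides e′ refl) = [ ⊥-elim ∘ d≢1 , inj₁ ]′
    (prime⇒irreducible pr (ℕD.divides e′ (sym (trans (ℕP.*-comm e′ d) (ℕP.*-cancelʳ-≡ (d ℕ.* e′) ℓ ℓ {{prime⇒nonZero pr}} (trans (ℕP.*-assoc d e′ ℓ) de≡))))))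

  prime-factor : ∀ {p} → IsPrime p → ∀ ls → All ℕPrime ls → p ∣ nat (product ls) → ∃ λ ℓ → ℕPrime ℓ × p ∣ nat ℓ
  prime-factor prime [] [] p∣1 = ⊥-elim (Prime.p∤1# prime p∣1)
  prime-factor prime (ℓ ∷ ls) (pr ∷ prs) p∣ with Prime.split-∣ prime (nat ℓ) (nat (product ls)) (subst (_ ∣_) (nat-* ℓ (product ls)) p∣)
  ... | inj₁ p∣ℓ = ℓ , pr , p∣ℓ
  ... | inj₂ p∣ls = prime-factor prime ls prs p∣ls

  rational-prime-below : ∀ {p} → IsPrime p → ∃ λ ℓ → ℕPrime ℓ × p ∣ nat ℓ
  rational-prime-below {p} prime@(p≢0 , _) = prime-factor prime factors factorsPrime
    (subst (p ∣_) (trans (x*conj p) (cong nat isFactorisation)) (x∣x* (conj p)))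
    where open PrimeFactorisation (factorise (N p) {{ℕ.≢-nonZero (N≢0 p≢0)}})

  -- No residue field is counted. If ℓ is the rational prime below p, then N p is ℓ or ℓ². For ℓ ≡ 1
  -- modulo 3 the congruence s^ℓ ≡ s serves both values, applied once or twice; for ℓ ≡ 2 Frobenius
  -- is conjugation and its square the identity. N p ≡ 1 modulo 9 excludes ℓ = 3 and N p = ℓ ≡ 2.
  fermat : ∀ {p} → IsPrime p → ∀ k → N p ≡ suc (9 ℕ.* k) → ∀ s → p ∣ s ^ N p - s
  fermat {p} prime@(_ , p-nonunit , _) k Np≡ s with rational-prime-below prime
  ... | ℓ , pr , p∣ℓ@(c , ℓ≡pc) with ℓ ℕ.% 3 in r≡ | ℕDM.m≡m%n+[m/n]*n ℓ 3 | divisors-of-prime-square pr (N p) (N c)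
         (trans (sym (N-* p c)) (trans (cong N (sym ℓ≡pc)) (N-int (+ ℓ)))) (p-nonunit ∘ N≡1⇒IsUnit)
  ...   | 0 | eq | Np = ⊥-elim (3∤1 (ℕD.∣m+n∣m⇒∣n {m = 9 ℕ.* k} {n = 1} (subst (3 ℕD.∣_) (trans Np≡ (ℕP.+-comm 1 (9 ℕ.* k))) 3∣Np) (ℕD.∣m⇒∣m*n k (ℕD.divides 3 refl))))
    where
    3∤1 : ¬ 3 ℕD.∣ 1
    3∤1 q with ℕD.∣1⇒≡1 q
    ... | ()
    3∣ℓ : 3 ℕD.∣ ℓ
    3∣ℓ = ℕD.divides (ℓ ℕ./ 3) eq
    3∣Np : 3 ℕD.∣ N p
    3∣Np = [ (λ e → subst (3 ℕD.∣_) (sym e) 3∣ℓ) , (λ e → subst (3 ℕD.∣_) (sym e) (ℕD.∣m⇒∣m*n ℓ 3∣ℓ)) ]′ Np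
  ...   | 1 | eq | Np = [ (λ e → subst (λ n → p ∣ s ^ n - s) (sym e) (∣-trans p∣ℓ (s^ℓ s)))
                        , (λ e → subst (λ n → p ∣ s ^ n - s) (sym e) (∣-trans p∣ℓ (subst (λ w → nat ℓ ∣ w - s) (sym (^-* s ℓ ℓ)) (Mod.≈-trans (nat ℓ) (s^ℓ (s ^ ℓ)) (s^ℓ s))))) ]′ Np
    where
    s^ℓ : ∀ s → nat ℓ ∣ s ^ ℓ - s
    s^ℓ = power-split pr (trans (cong (ω ^_) eq) (trans (ω^-mod3 1 (ℓ ℕ./ 3)) ω^1))
  ...   | 2 | eq | inj₁ Np≡ℓ = ⊥-elim (2≢1 (trans (sym r≡) (trans (cong (ℕ._% 3) (trans (sym Np≡ℓ) (trans Np≡ (cong suc (f k))))) (ℕDM.[m+kn]%n≡m%n 1 (3 ℕ.* k) 3))))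
    where
    2≢1 : 2 ≢ 1
    2≢1 ()
    f : ∀ k → 9 ℕ.* k ≡ 3 ℕ.* k ℕ.* 3
    f = ℕR.solve-∀
  ...   | 2 | eq | inj₂ Np≡ℓ² = subst (λ n → p ∣ s ^ n - s) (sym Np≡ℓ²)
    (∣-trans p∣ℓ (power-inert² pr (trans (cong (ω ^_) eq) (trans (ω^-mod3 2 (ℓ ℕ./ 3)) ω^2)) s))
  ...   | suc (suc (suc r)) | eq | Np = ⊥-elim (ℕP.<⇒≱ (ℕDM.m%n<n ℓ 3) (subst (3 ℕ.≤_) (sym r≡) (s≤s (s≤s (s≤s z≤n)))))

opaque
  unfolding _+_
  -- For p = 1 + λ³c with c = a + bω the norm is 1 + tr(λ³c) + 27 · N c, and λ³ = 3(ω² - ω) gives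
  -- tr(λ³c) = 9b.
  N-≡1mod9 : ∀ {p} → p ≢ 0# → λ³ ∣ p - 1# → ∃ λ k → N p ≡ suc (9 ℕ.* k)
  N-≡1mod9 {p} p≢0 (eis a b , eq) with N p in Np≡
  ... | zero = ⊥-elim (N≢0 p≢0 Np≡)
  ... | suc m = ℤ.∣ K ∣ , cong suc (trans (cong ℤ.∣_∣ +m≡9K) (ℤP.abs-* (+ 9) K))
    where
    K : ℤ
    K = b ℤ.+ (((+ 2) ℤ.* b ℤ.- a) ℤ.* ((+ 2) ℤ.* b ℤ.- a) ℤ.- ((+ 2) ℤ.* b ℤ.- a) ℤ.* (b ℤ.- (+ 2) ℤ.* a)
      ℤ.+ (b ℤ.- (+ 2) ℤ.* a) ℤ.* (b ℤ.- (+ 2) ℤ.* a))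
    form : ∀ a b → let x = (+ 1) ℤ.+ (-[1+ 2 ] ℤ.* a ℤ.- -[1+ 5 ] ℤ.* b) ; y = +0 ℤ.+ (-[1+ 2 ] ℤ.* b ℤ.+ -[1+ 5 ] ℤ.* a ℤ.- -[1+ 5 ] ℤ.* b) in
      x ℤ.* x ℤ.- x ℤ.* y ℤ.+ y ℤ.* y ≡ (+ 1) ℤ.+ (+ 9) ℤ.* (b ℤ.+ (((+ 2) ℤ.* b ℤ.- a) ℤ.* ((+ 2) ℤ.* b ℤ.- a) ℤ.- ((+ 2) ℤ.* b ℤ.- a) ℤ.* (b ℤ.- (+ 2) ℤ.* a)
      ℤ.+ (b ℤ.- (+ 2) ℤ.* a) ℤ.* (b ℤ.- (+ 2) ℤ.* a)))
    form = form′
      where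
      form′ : ∀ a b → ((+ 1) ℤ.+ (-[1+ 2 ] ℤ.* a ℤ.- -[1+ 5 ] ℤ.* b)) ℤ.* ((+ 1) ℤ.+ (-[1+ 2 ] ℤ.* a ℤ.- -[1+ 5 ] ℤ.* b))
        ℤ.- ((+ 1) ℤ.+ (-[1+ 2 ] ℤ.* a ℤ.- -[1+ 5 ] ℤ.* b)) ℤ.* (+0 ℤ.+ (-[1+ 2 ] ℤ.* b ℤ.+ -[1+ 5 ] ℤ.* a ℤ.- -[1+ 5 ] ℤ.* b))
        ℤ.+ (+0 ℤ.+ (-[1+ 2 ] ℤ.* b ℤ.+ -[1+ 5 ] ℤ.* a ℤ.- -[1+ 5 ] ℤ.* b)) ℤ.* (+0 ℤ.+ (-[1+ 2 ] ℤ.* b ℤ.+ -[1+ 5 ] ℤ.* a ℤ.- -[1+ 5 ] ℤ.* b))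
        ≡ (+ 1) ℤ.+ (+ 9) ℤ.* (b ℤ.+ (((+ 2) ℤ.* b ℤ.- a) ℤ.* ((+ 2) ℤ.* b ℤ.- a) ℤ.- ((+ 2) ℤ.* b ℤ.- a) ℤ.* (b ℤ.- (+ 2) ℤ.* a)
        ℤ.+ (b ℤ.- (+ 2) ℤ.* a) ℤ.* (b ℤ.- (+ 2) ℤ.* a)))
      form′ = ℤR.solve-∀
    p≡ : p ≡ 1# + λ³ * eis a b
    p≡ = trans (add-sub-split p 1#) (cong (λ w → 1# + w) eq)
    +m≡9K : + m ≡ (+ 9) ℤ.* K
    +m≡9K = trans (drop-1 (+ m)) (trans (cong (ℤ._- (+ 1)) (trans (cong +_ (sym Np≡)) (trans (+N p) (trans (cong normℤ p≡) (form a b))))) (sym (drop-1 ((+ 9) ℤ.* K))))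
      where
      drop-1 : ∀ x → x ≡ ((+ 1) ℤ.+ x) ℤ.- (+ 1)
      drop-1 = ℤR.solve-∀

module Residue {p : 𝔼} (prime : IsPrime p) (k : ℕ) (Np≡ : N p ≡ suc (9 ℕ.* k)) where
  open Mod p
  open Prime prime

  -- 3k is (N p - 1)/3. The logarithm e is an arbitrary natural number, determined modulo 3, so that
  -- products add without reduction.
  Log : 𝔼 → ℕ → Set
  Log v e = v ^ (3 ℕ.* k) ≈ ω ^ e

  opaque
    -- N p divides N d, but N p = 9k + 1 is at least 10, since k = 0 would make p a unit.
    small-norm-∤ : ∀ {d} → N d ≢ 0 → N d ℕ.≤ 9 → ¬ p ∣ d
    small-norm-∤ {d} Nd≢0 Nd≤9 (c , d≡pc) = go k refl
      where
      Np∣Nd : N p ℕD.∣ N d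
      Np∣Nd = ℕD.divides (N c) (trans (cong N d≡pc) (trans (N-* p c) (ℕP.*-comm (N p) (N c))))
      go : ∀ j → j ≡ k → ⊥
      go zero refl = proj₁ (proj₂ prime) (N≡1⇒IsUnit Np≡)
      go (suc j) refl = ℕP.<⇒≱ (s≤s (ℕP.≤-trans Nd≤9 (ℕP.m≤m*n 9 (suc j)))) (subst (ℕ._≤ N d) Np≡ (ℕD.∣⇒≤ {{ℕ.≢-nonZero Nd≢0}} Np∣Nd))

  opaque
    unfolding _+_
    p∤3 : ¬ p ∣ 3#
    p∤3 = small-norm-∤ {3#} (λ ()) ℕP.≤-refl

    p∤-1 : ¬ p ∣ - 1#
    p∤-1 = small-norm-∤ {d = - 1#} (λ ()) (s≤s z≤n)

    ω^-distinct : ∀ r s → r ℕ.< 3 → s ℕ.< 3 → ω ^ r ≈ ω ^ s → r ≡ s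
    ω^-distinct 0 0 _ _ _ = refl
    ω^-distinct 1 1 _ _ _ = refl
    ω^-distinct 2 2 _ _ _ = refl
    ω^-distinct 0 1 _ _ q = ⊥-elim (small-norm-∤ {ω ^ 0 - ω ^ 1} (λ ()) (s≤s (s≤s (s≤s z≤n))) q)
    ω^-distinct 0 2 _ _ q = ⊥-elim (small-norm-∤ {ω ^ 0 - ω ^ 2} (λ ()) (s≤s (s≤s (s≤s z≤n))) q)
    ω^-distinct 1 0 _ _ q = ⊥-elim (small-norm-∤ {ω ^ 1 - ω ^ 0} (λ ()) (s≤s (s≤s (s≤s z≤n))) q)
    ω^-distinct 1 2 _ _ q = ⊥-elim (small-norm-∤ {ω ^ 1 - ω ^ 2} (λ ()) (s≤s (s≤s (s≤s z≤n))) q)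
    ω^-distinct 2 0 _ _ q = ⊥-elim (small-norm-∤ {ω ^ 2 - ω ^ 0} (λ ()) (s≤s (s≤s (s≤s z≤n))) q)
    ω^-distinct 2 1 _ _ q = ⊥-elim (small-norm-∤ {ω ^ 2 - ω ^ 1} (λ ()) (s≤s (s≤s (s≤s z≤n))) q)
    ω^-distinct (suc (suc (suc _))) _ (s≤s (s≤s (s≤s ()))) _ _
    ω^-distinct 0 (suc (suc (suc _))) _ (s≤s (s≤s (s≤s ()))) _
    ω^-distinct 1 (suc (suc (suc _))) _ (s≤s (s≤s (s≤s ()))) _
    ω^-distinct 2 (suc (suc (suc _))) _ (s≤s (s≤s (s≤s ()))) _

    -1-cube : - 1# * - 1# * - 1# ≡ - 1#
    -1-cube = refl

    27≡3³ : 3# * 3# * 3# ≡ 27#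
    27≡3³ = refl

    neg≡-1* : ∀ x → - x ≡ - 1# * x
    neg≡-1* = solve-∀ 𝔼-ring

  opaque
    log-1 : Log 1# 0
    log-1 = ≡⇒≈ (1#^ (3 ℕ.* k))

    log-* : ∀ {v w} e f → Log v e → Log w f → Log (v * w) (e ℕ.+ f)
    log-* {v} {w} e f lv lw = ≈-trans (≡⇒≈ (^-distrib-* v w (3 ℕ.* k))) (≈-trans (≈-* lv lw) (≡⇒≈ (sym (^-+ ω e f))))

    log-^ : ∀ {v} n e → Log v e → Log (v ^ n) (n ℕ.* e)
    log-^ zero e _ = log-1
    log-^ (suc n) e lv = log-* e (n ℕ.* e) lv (log-^ n e lv)

    log-≈ : ∀ {v w} e → v ≈ w → Log v e → Log w e
    log-≈ e v≈w lv = ≈-trans (≈-^ (3 ℕ.* k) (≈-sym v≈w)) lv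

    log-unique : ∀ {v} e f → Log v e → Log v f → e ℕ.% 3 ≡ f ℕ.% 3
    log-unique {v} e f le lf = ω^-distinct (e ℕ.% 3) (f ℕ.% 3) (ℕDM.m%n<n e 3) (ℕDM.m%n<n f 3)
      (≈-trans (≡⇒≈ (reduce e)) (≈-trans (≈-sym le) (≈-trans lf (≡⇒≈ (sym (reduce f))))))
      where
      reduce : ∀ e → ω ^ (e ℕ.% 3) ≡ ω ^ e
      reduce e = sym (trans (cong (ω ^_) (ℕDM.m≡m%n+[m/n]*n e 3)) (ω^-mod3 (e ℕ.% 3) (e ℕ./ 3)))

    log-cube : ∀ {s} → ¬ p ∣ s → Log (s * s * s) 0
    log-cube {s} p∤s = subst (λ w → w ≈ 1#) (trans (^-* s 3 (3 ℕ.* k)) (cong (_^ (3 ℕ.* k)) (cube s)))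
      (coprime-∣ (∤⇒coprime p∤s) (subst (p ∣_) (trans (cong (λ n → s ^ n - s) Np≡) (trans (f s (s ^ (9 ℕ.* k))) (cong (λ n → s * (s ^ n - 1#)) (ℕP.*-assoc 3 3 k)))) (fermat prime k Np≡ s)))
      where
      opaque
        unfolding _+_
        f : ∀ s t → s * t - s ≡ s * (t - 1#)
        f = solve-∀ 𝔼-ring
        cube : ∀ s → s * (s * (s * 1#)) ≡ s * s * s
        cube = solve-∀ 𝔼-ring

    log-27 : Log 27# 0
    log-27 = subst (λ v → Log v 0) 27≡3³ (log-cube p∤3)

    -- Here N p ≡ 1 modulo 9, and not only modulo 3, is essential: the exponent (N p - 1)/3 is
    -- itself a multiple of 3.
    log-ω : ∀ j → Log (ω ^ j) 0
    log-ω j = ≡⇒≈ {(ω ^ j) ^ (3 ℕ.* k)} {ω ^ 0} (begin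
      (ω ^ j) ^ (3 ℕ.* k)        ≡⟨ sym (^-* ω j (3 ℕ.* k)) ⟩
      ω ^ (j ℕ.* (3 ℕ.* k))      ≡⟨ cong (λ n → ω ^ n) (f j k) ⟩
      ω ^ (0 ℕ.+ j ℕ.* k ℕ.* 3)  ≡⟨ ω^-mod3 0 (j ℕ.* k) ⟩
      ω ^ 0 ∎)
      where
      open ≡-Reasoning
      f : ∀ j k → j ℕ.* (3 ℕ.* k) ≡ j ℕ.* k ℕ.* 3
      f = ℕR.solve-∀

    log-unit : ∀ {ε} → N ε ≡ 1 → Log ε 0
    log-unit {ε} Nε≡1 with unit-cases ε Nε≡1
    ... | j , inj₁ refl = log-ω (toℕ j)
    ... | j , inj₂ refl = subst (λ v → Log v 0) (sym (neg≡-1* (ω ^ toℕ j)))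
      (log-* { - 1# } {ω ^ toℕ j} 0 0 (subst (λ v → Log v 0) -1-cube (log-cube p∤-1)) (log-ω (toℕ j)))

-- Finite products, and the valuation of a norm at a ramified prime.

Π : ∀ n → (Fin n → 𝔼) → 𝔼
Π zero f = 1#
Π (suc n) f = f Fin.zero * Π n (f ∘ Fin.suc)

Σℕ : ∀ n → (Fin n → ℕ) → ℕ
Σℕ zero f = 0
Σℕ (suc n) f = f Fin.zero ℕ.+ Σℕ n (f ∘ Fin.suc)

omit : ∀ {A : Set} {n} → A → Fin n → (Fin n → A) → Fin n → A
omit d Fin.zero f Fin.zero = d
omit d Fin.zero f (Fin.suc i) = f (Fin.suc i)
omit d (Fin.suc j) f Fin.zero = f Fin.zero
omit d (Fin.suc j) f (Fin.suc i) = omit d j (f ∘ Fin.suc) i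

omit-same : ∀ {A : Set} {n} (d : A) (j : Fin n) f → omit d j f j ≡ d
omit-same d Fin.zero f = refl
omit-same d (Fin.suc j) f = omit-same d j (f ∘ Fin.suc)

omit-other : ∀ {A : Set} {n} (d : A) (j i : Fin n) f → i ≢ j → omit d j f i ≡ f i
omit-other d Fin.zero Fin.zero f i≢j = ⊥-elim (i≢j refl)
omit-other d Fin.zero (Fin.suc i) f i≢j = refl
omit-other d (Fin.suc j) Fin.zero f i≢j = refl
omit-other d (Fin.suc j) (Fin.suc i) f i≢j = omit-other d j i (f ∘ Fin.suc) (i≢j ∘ cong Fin.suc)

opaque
  Π-cong : ∀ n {f g} → (∀ i → f i ≡ g i) → Π n f ≡ Π n g
  Π-cong zero eq = refl
  Π-cong (suc n) eq = cong₂ _*_ (eq Fin.zero) (Π-cong n (eq ∘ Fin.suc))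

  Π-* : ∀ n f g → Π n (λ i → f i * g i) ≡ Π n f * Π n g
  Π-* zero f g = sym (*-identityˡ 1#)
  Π-* (suc n) f g = trans (cong (f Fin.zero * g Fin.zero *_) (Π-* n (f ∘ Fin.suc) (g ∘ Fin.suc))) (swap _ _ _ _)
    where
    opaque
      unfolding _+_
      swap : ∀ a b c d → (a * b) * (c * d) ≡ (a * c) * (b * d)
      swap = solve-∀ 𝔼-ring

  Π-omit : ∀ n j f → Π n f ≡ f j * Π n (omit 1# j f)
  Π-omit (suc n) Fin.zero f = cong (f Fin.zero *_) (sym (*-identityˡ _))
  Π-omit (suc n) (Fin.suc j) f = trans (cong (f Fin.zero *_) (Π-omit n j (f ∘ Fin.suc))) (swap _ _ _)
    where
    opaque
      unfolding _+_
      swap : ∀ a b c → a * (b * c) ≡ b * (a * c)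
      swap = solve-∀ 𝔼-ring

  Π-1 : ∀ n → Π n (λ _ → 1#) ≡ 1#
  Π-1 zero = refl
  Π-1 (suc n) = trans (*-identityˡ _) (Π-1 n)

  Π-≡1 : ∀ n f → (∀ i → λ³ ∣ f i - 1#) → λ³ ∣ Π n f - 1#
  Π-≡1 zero f _ = Mod.≈-refl λ³
  Π-≡1 (suc n) f f≡1 = subst (λ w → λ³ ∣ f Fin.zero * Π n (f ∘ Fin.suc) - w) (*-identityˡ 1#)
    (Mod.≈-* λ³ (f≡1 Fin.zero) (Π-≡1 n (f ∘ Fin.suc) (f≡1 ∘ Fin.suc)))

  coprime-Π : ∀ {x} n f → (∀ i → Coprime x (f i)) → Coprime x (Π n f)
  coprime-Π zero f _ = Coprime-1#
  coprime-Π (suc n) f c = Coprime-* (c Fin.zero) (coprime-Π n (f ∘ Fin.suc) (c ∘ Fin.suc))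

  ∤-Π : ∀ {p} → IsPrime p → ∀ n f → (∀ i → ¬ p ∣ f i) → ¬ p ∣ Π n f
  ∤-Π prime zero f _ = Prime.p∤1# prime
  ∤-Π prime (suc n) f p∤ = Prime.∤-* prime (p∤ Fin.zero) (∤-Π prime n (f ∘ Fin.suc) (p∤ ∘ Fin.suc))

  Π-∣ : ∀ {z} n f → (∀ i → f i ∣ z) → (∀ i j → i ≢ j → Coprime (f i) (f j)) → Π n f ∣ z
  Π-∣ {z} zero f _ _ = z , sym (*-identityˡ z)
  Π-∣ (suc n) f f∣z coprime = coprime-*-∣ (coprime-Π n (f ∘ Fin.suc) (λ i → coprime Fin.zero (Fin.suc i) λ ()))
    (f∣z Fin.zero) (Π-∣ n (f ∘ Fin.suc) (f∣z ∘ Fin.suc) (λ i j i≢j → coprime (Fin.suc i) (Fin.suc j) (i≢j ∘ FinP.suc-injective)))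

  -- One prime is divided out at a time: the later prime powers are coprime to the power of the
  -- first one, so they divide its cofactor, with new cofactors still prime to them.
  extract-primes : ∀ n (q : Fin n → 𝔼) (e : Fin n → ℕ) → (∀ i → IsPrime (q i)) → (∀ i j → i ≢ j → ¬ q i ∣ q j) →
    ∀ ν (ν′ : Fin n → 𝔼) → (∀ i → ν ≡ q i ^ e i * ν′ i) → (∀ i → ¬ q i ∣ ν′ i) →
    ∃ λ ρ → ν ≡ Π n (λ i → q i ^ e i) * ρ × (∀ i → ¬ q i ∣ ρ)
  extract-primes zero q e _ _ ν ν′ _ _ = ν , sym (*-identityˡ ν) , λ ()
  extract-primes (suc n) q e prime distinct ν ν′ ν≡ q∤
    with extract-primes n (q ∘ Fin.suc) (e ∘ Fin.suc) (prime ∘ Fin.suc)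
           (λ i j i≢j → distinct (Fin.suc i) (Fin.suc j) (i≢j ∘ FinP.suc-injective))
           (ν′ Fin.zero) (λ i → proj₁ (quotient i)) (λ i → proj₂ (quotient i)) rest-∤
    where
    q₀ᵉ : 𝔼
    q₀ᵉ = q Fin.zero ^ e Fin.zero
    quotient : ∀ i → (q (Fin.suc i) ^ e (Fin.suc i)) ∣ ν′ Fin.zero
    quotient i = coprime-∣ (Coprime-sym (Coprime-^ (e (Fin.suc i)) (Coprime-sym (Coprime-^ (e Fin.zero)
        (Prime.∤⇒coprime (prime (Fin.suc i)) (distinct (Fin.suc i) Fin.zero λ ()))))))
      (subst (q (Fin.suc i) ^ e (Fin.suc i) ∣_) (trans (sym (ν≡ (Fin.suc i))) (ν≡ Fin.zero)) (x∣x* (ν′ (Fin.suc i))))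
    rest-∤ : ∀ i → ¬ q (Fin.suc i) ∣ proj₁ (quotient i)
    rest-∤ i q∣ = q∤ (Fin.suc i) (subst (q (Fin.suc i) ∣_) (sym ν′≡) (∣-*ˡ q₀ᵉ q∣))
      where
      opaque
        unfolding _+_
        swap : ∀ a b c → a * (b * c) ≡ b * (a * c)
        swap = solve-∀ 𝔼-ring
      ν′≡ : ν′ (Fin.suc i) ≡ q₀ᵉ * proj₁ (quotient i)
      ν′≡ = *-cancelˡ (q (Fin.suc i) ^ e (Fin.suc i)) (^≢0# (e (Fin.suc i)) (Prime.p≢0# (prime (Fin.suc i))))
        (trans (sym (ν≡ (Fin.suc i))) (trans (ν≡ Fin.zero) (trans (cong (q₀ᵉ *_) (proj₂ (quotient i))) (swap _ _ _))))
  ... | ρ , eq , ρ-∤ = ρ , trans (ν≡ Fin.zero) (trans (cong (q Fin.zero ^ e Fin.zero *_) eq) (sym (*-assoc _ _ ρ))) , all-∤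
    where
    all-∤ : ∀ i → ¬ q i ∣ ρ
    all-∤ Fin.zero q₀∣ρ = q∤ Fin.zero (subst (q Fin.zero ∣_) (sym eq) (∣-*ˡ _ q₀∣ρ))
    all-∤ (Fin.suc i) = ρ-∤ i

-- For p dividing b once and prime to g: p is totally ramified, 1, θ, θ₂ have norms of valuation 0,
-- 1, 2, and e is the index of the first coordinate not divisible by p. `cubic` gives the class of
-- ν′ modulo p up to cubes, where c is bg²/p.
record Valuation (p c x₀ x₁ ν : 𝔼) : Set where
  field
    e : ℕ
    e≤2 : e ℕ.≤ 2
    ν′ : 𝔼
    ν≡ : ν ≡ p ^ e * ν′
    p∤ν′ : ¬ p ∣ ν′
    s t : 𝔼
    p∤s : ¬ p ∣ s
    p∤t : ¬ p ∣ t
    cubic : p ∣ 27# * ν′ * (s * s * s) - c ^ e * (t * t * t)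
    p∣x₀ : 1 ℕ.≤ e → p ∣ x₀
    p∣x₁ : 2 ℕ.≤ e → p ∣ x₁

opaque
  unfolding _+_
  -- Exchanging θ with θ₂ exchanges b with g, which reduces the primes dividing g to those dividing
  -- b.
  normθ-swap : ∀ b g x₀ x₁ x₂ → normθ b g x₀ x₁ x₂ ≡ normθ g b x₀ x₂ x₁
  normθ-swap = f
    where
    f : ∀ b g x₀ x₁ x₂ →
      x₀ * x₀ * x₀ + b * (g * g) * (x₁ * x₁ * x₁) + b * b * g * (x₂ * x₂ * x₂) - 3# * (b * g) * (x₀ * x₁ * x₂)
      ≡ x₀ * x₀ * x₀ + g * (b * b) * (x₂ * x₂ * x₂) + g * g * b * (x₁ * x₁ * x₁) - 3# * (g * b) * (x₀ * x₂ * x₁)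
    f = solve-∀ 𝔼-ring

opaque
  valuation : ∀ {p} → IsPrime p → ¬ p ∣ 3# → ∀ b′ g x₀ x₁ x₂ ν → ¬ p ∣ b′ → ¬ p ∣ g → ¬ (p ∣ x₀ × p ∣ x₁ × p ∣ x₂) →
    27# * ν ≡ normθ (p * b′) g x₀ x₁ x₂ → Valuation p (b′ * (g * g)) x₀ x₁ ν
  valuation {p} prime p∤3 b′ g x₀ x₁ x₂ ν p∤b′ p∤g not-all 27ν≡ = go (p ∣? x₀) (p ∣? x₁)
    where
    open Prime prime
    open Mod p
    c : 𝔼
    c = b′ * (g * g)
    p∤c : ¬ p ∣ c
    p∤c = ∤-* p∤b′ (∤-* p∤g p∤g)
    p∤27 : ¬ p ∣ 27#
    p∤27 = subst (λ w → ¬ p ∣ w) 27≡ (∤-* (∤-* p∤3 p∤3) p∤3)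
      where
      opaque
        unfolding _+_
        27≡ : 3# * 3# * 3# ≡ 27#
        27≡ = refl
    p∤cube : ∀ {t} → ¬ p ∣ t → ¬ p ∣ t * t * t
    p∤cube p∤t = ∤-* (∤-* p∤t p∤t) p∤t
    cubic⇒∤ : ∀ ν′ s e t → ¬ p ∣ t → 27# * ν′ * (s * s * s) ≈ c ^ e * (t * t * t) → ¬ p ∣ ν′
    cubic⇒∤ ν′ s e t p∤t cubic p∣ν′ = ∤-* (∤-^ e p∤c) (p∤cube p∤t)
      (subst (p ∣_) (f _ _) (∣-sub (∣-*ʳ (s * s * s) (∣-*ˡ 27# p∣ν′)) cubic))
      where
      opaque
        unfolding _+_
        f : ∀ v w → v - (v - w) ≡ w
        f = solve-∀ 𝔼-ring
    opaque
      unfolding _+_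
      step₀ : ∀ p b′ g x₀ x₁ x₂ →
        (x₀ * x₀ * x₀ + p * b′ * (g * g) * (x₁ * x₁ * x₁) + p * b′ * (p * b′) * g * (x₂ * x₂ * x₂) - 3# * (p * b′ * g) * (x₀ * x₁ * x₂))
          * (1# * 1# * 1#) - 1# * (x₀ * x₀ * x₀)
        ≡ p * (b′ * (g * g) * (x₁ * x₁ * x₁) + p * b′ * b′ * g * (x₂ * x₂ * x₂) - 3# * (b′ * g) * (x₀ * x₁ * x₂))
      step₀ = solve-∀ 𝔼-ring
      step₁ : ∀ p b′ g z₀ x₁ x₂ →
        p * z₀ * (p * z₀) * (p * z₀) + p * b′ * (g * g) * (x₁ * x₁ * x₁) + p * b′ * (p * b′) * g * (x₂ * x₂ * x₂) - 3# * (p * b′ * g) * (p * z₀ * x₁ * x₂)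
        ≡ p * (p * p * z₀ * z₀ * z₀ + b′ * (g * g) * (x₁ * x₁ * x₁) + p * b′ * b′ * g * (x₂ * x₂ * x₂) - 3# * p * b′ * g * z₀ * x₁ * x₂)
      step₁ = solve-∀ 𝔼-ring
      step₁′ : ∀ p b′ g z₀ x₁ x₂ →
        (p * p * z₀ * z₀ * z₀ + b′ * (g * g) * (x₁ * x₁ * x₁) + p * b′ * b′ * g * (x₂ * x₂ * x₂) - 3# * p * b′ * g * z₀ * x₁ * x₂)
          * (1# * 1# * 1#) - b′ * (g * g) * 1# * (x₁ * x₁ * x₁)
        ≡ p * (p * z₀ * z₀ * z₀ + b′ * b′ * g * (x₂ * x₂ * x₂) - 3# * b′ * g * z₀ * x₁ * x₂)
      step₁′ = solve-∀ 𝔼-ring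
      step₂ : ∀ p b′ g z₀ z₁ x₂ →
        p * p * z₀ * z₀ * z₀ + b′ * (g * g) * (p * z₁ * (p * z₁) * (p * z₁)) + p * b′ * b′ * g * (x₂ * x₂ * x₂) - 3# * p * b′ * g * z₀ * (p * z₁) * x₂
        ≡ p * (p * z₀ * z₀ * z₀ + p * p * b′ * g * g * z₁ * z₁ * z₁ + b′ * b′ * g * (x₂ * x₂ * x₂) - 3# * p * b′ * g * z₀ * z₁ * x₂)
      step₂ = solve-∀ 𝔼-ring
      step₂′ : ∀ p b′ g z₀ z₁ x₂ →
        (p * z₀ * z₀ * z₀ + p * p * b′ * g * g * z₁ * z₁ * z₁ + b′ * b′ * g * (x₂ * x₂ * x₂) - 3# * p * b′ * g * z₀ * z₁ * x₂) * (g * g * g)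
          - b′ * (g * g) * (b′ * (g * g) * 1#) * (x₂ * x₂ * x₂)
        ≡ p * ((z₀ * z₀ * z₀ + p * b′ * g * g * z₁ * z₁ * z₁ - 3# * b′ * g * z₀ * z₁ * x₂) * (g * g * g))
      step₂′ = solve-∀ 𝔼-ring
      27-out : ∀ p ν₁ → 27# * (p * ν₁) ≡ p * (27# * ν₁)
      27-out = solve-∀ 𝔼-ring
      p¹ : ∀ p ν → p * ν ≡ p * 1# * ν
      p¹ = solve-∀ 𝔼-ring
      p² : ∀ p ν → p * (p * ν) ≡ p * (p * 1#) * ν
      p² = solve-∀ 𝔼-ring
    divide : ∀ {ν M} → 27# * ν ≡ p * M → ∃ λ ν₁ → ν ≡ p * ν₁ × 27# * ν₁ ≡ M
    divide {ν} {M} eq with split-∣ 27# ν (M , eq)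
    ... | inj₁ p∣27 = ⊥-elim (p∤27 p∣27)
    ... | inj₂ (ν₁ , refl) = ν₁ , refl , *-cancelˡ p p≢0# (trans (sym (27-out p ν₁)) eq)
    go : Dec (p ∣ x₀) → Dec (p ∣ x₁) → Valuation p c x₀ x₁ ν
    go (no p∤x₀) _ = record
      { e = 0 ; e≤2 = z≤n ; ν′ = ν ; ν≡ = sym (*-identityˡ ν) ; p∤ν′ = cubic⇒∤ ν 1# 0 x₀ p∤x₀ cubic ; s = 1# ; t = x₀
      ; p∤s = p∤1# ; p∤t = p∤x₀ ; cubic = cubic ; p∣x₀ = λ () ; p∣x₁ = λ () }
      where
      cubic : 27# * ν * (1# * 1# * 1#) ≈ c ^ 0 * (x₀ * x₀ * x₀)
      cubic = _ , trans (cong (λ w → w * (1# * 1# * 1#) - 1# * (x₀ * x₀ * x₀)) 27ν≡) (step₀ p b′ g x₀ x₁ x₂)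
    go (yes (z₀ , refl)) x₁-case with divide (trans 27ν≡ (step₁ p b′ g z₀ x₁ x₂))
    ... | ν₁ , refl , 27ν₁≡ = go₁ x₁-case
      where
      go₁ : Dec (p ∣ x₁) → Valuation p c (p * z₀) x₁ (p * ν₁)
      go₁ (no p∤x₁) = record
        { e = 1 ; e≤2 = s≤s z≤n ; ν′ = ν₁ ; ν≡ = p¹ p ν₁ ; p∤ν′ = cubic⇒∤ ν₁ 1# 1 x₁ p∤x₁ cubic ; s = 1# ; t = x₁
        ; p∤s = p∤1# ; p∤t = p∤x₁ ; cubic = cubic ; p∣x₀ = λ _ → x∣x* z₀ ; p∣x₁ = λ { (s≤s ()) } }
        where
        cubic : 27# * ν₁ * (1# * 1# * 1#) ≈ c ^ 1 * (x₁ * x₁ * x₁)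
        cubic = _ , trans (cong (λ w → w * (1# * 1# * 1#) - c ^ 1 * (x₁ * x₁ * x₁)) 27ν₁≡) (step₁′ p b′ g z₀ x₁ x₂)
      go₁ (yes (z₁ , refl)) with divide (trans 27ν₁≡ (step₂ p b′ g z₀ z₁ x₂))
      -- Modulo p the leading term is b′²g · x₂³. Multiplying by g³ turns b′²g into c², whence s =
      -- g.
      ... | ν₂ , refl , 27ν₂≡ = record
        { e = 2 ; e≤2 = s≤s (s≤s z≤n) ; ν′ = ν₂ ; ν≡ = p² p ν₂ ; p∤ν′ = cubic⇒∤ ν₂ g 2 x₂ p∤x₂ cubic ; s = g ; t = x₂
        ; p∤s = p∤g ; p∤t = p∤x₂ ; cubic = cubic ; p∣x₀ = λ _ → x∣x* z₀ ; p∣x₁ = λ _ → x∣x* z₁ }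
        where
        p∤x₂ : ¬ p ∣ x₂
        p∤x₂ p∣x₂ = not-all (x∣x* z₀ , x∣x* z₁ , p∣x₂)
        cubic : 27# * ν₂ * (g * g * g) ≈ c ^ 2 * (x₂ * x₂ * x₂)
        cubic = _ , trans (cong (λ w → w * (g * g * g) - c ^ 2 * (x₂ * x₂ * x₂)) 27ν₂≡) (step₂′ p b′ g z₀ z₁ x₂)

-- The Rédei matrix and its left kernel.

Σ-cong : ∀ n {f g : Fin n → ℤ} → (∀ i → f i ≡ g i) → D.Σℤ n f ≡ D.Σℤ n g
Σ-cong zero eq = refl
Σ-cong (suc n) eq = cong₂ ℤ._+_ (eq Fin.zero) (Σ-cong n (λ i → eq (Fin.suc i)))

-- The summand in `redei` is a local function and cannot be named: its first value is written out
-- once the decisions it depends on are made, and the others are left to unification.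
diagonal-sum : ∀ m a ℓ j → ∃₂ λ f₀ (f₊ : Fin m → ℤ) →
  D.redei m a ℓ j j ≡ (+ D.expo (a (Fin.inject₁ j))) ℤ.* (ℤ.- (f₀ ℤ.+ D.Σℤ m f₊))
diagonal-sum m a ℓ j with j Fin.≟ j
... | no j≢j = ⊥-elim (j≢j refl)
... | yes p with Fin.zero Fin.≟ Fin.inject₁ j
...   | yes _ = + 0 , _ , refl
...   | no _ = (+ D.expo (a Fin.zero)) ℤ.* (+ toℕ (ℓ Fin.zero (Fin.inject₁ j))) , _ , refl

diagonal-term : ∀ m a ℓ j → Fin (suc m) → ℤ
diagonal-term m a ℓ j Fin.zero = proj₁ (diagonal-sum m a ℓ j)
diagonal-term m a ℓ j (Fin.suc k) = proj₁ (proj₂ (diagonal-sum m a ℓ j)) k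

diagonal-same : ∀ m a ℓ j k → k ≡ Fin.inject₁ j → diagonal-term m a ℓ j k ≡ + 0
diagonal-same m a ℓ j Fin.zero k≡J with j Fin.≟ j
... | no j≢j = ⊥-elim (j≢j refl)
... | yes p with Fin.zero Fin.≟ Fin.inject₁ j
...   | yes _ = refl
...   | no k≢J = ⊥-elim (k≢J k≡J)
diagonal-same m a ℓ j (Fin.suc k) k≡J with j Fin.≟ j
... | no j≢j = ⊥-elim (j≢j refl)
... | yes p with Fin.zero Fin.≟ Fin.inject₁ j
...   | yes _ with Fin.suc k Fin.≟ Fin.inject₁ j
...     | yes _ = refl
...     | no k≢J = ⊥-elim (k≢J k≡J)
diagonal-same m a ℓ j (Fin.suc k) k≡J | yes p | no _ with Fin.suc k Fin.≟ Fin.inject₁ j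
...     | yes _ = refl
...     | no k≢J = ⊥-elim (k≢J k≡J)

diagonal-other : ∀ m a ℓ j k → k ≢ Fin.inject₁ j →
  diagonal-term m a ℓ j k ≡ (+ D.expo (a k)) ℤ.* (+ toℕ (ℓ k (Fin.inject₁ j)))
diagonal-other m a ℓ j Fin.zero k≢J with j Fin.≟ j
... | no j≢j = ⊥-elim (j≢j refl)
... | yes p with Fin.zero Fin.≟ Fin.inject₁ j
...   | yes k≡J = ⊥-elim (k≢J k≡J)
...   | no _ = refl
diagonal-other m a ℓ j (Fin.suc k) k≢J with j Fin.≟ j
... | no j≢j = ⊥-elim (j≢j refl)
... | yes p with Fin.zero Fin.≟ Fin.inject₁ j
...   | yes _ with Fin.suc k Fin.≟ Fin.inject₁ j
...     | yes k≡J = ⊥-elim (k≢J k≡J)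
...     | no _ = refl
diagonal-other m a ℓ j (Fin.suc k) k≢J | yes p | no _ with Fin.suc k Fin.≟ Fin.inject₁ j
...     | yes k≡J = ⊥-elim (k≢J k≡J)
...     | no _ = refl

Σ-last : ∀ m (f : Fin (suc m) → ℤ) → D.Σℤ (suc m) f ≡ D.Σℤ m (f ∘ Fin.inject₁) ℤ.+ f (Fin.fromℕ m)
Σ-last zero f = ℤP.+-comm (f Fin.zero) +0
Σ-last (suc m) f = trans (cong (λ z → f Fin.zero ℤ.+ z) (Σ-last m (f ∘ Fin.suc))) (sym (ℤP.+-assoc (f Fin.zero) _ _))

Σ-except : ∀ n j (f g : Fin n → ℤ) → (∀ i → i ≢ j → f i ≡ g i) → g j ≡ +0 → D.Σℤ n f ≡ D.Σℤ n g ℤ.+ f j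
Σ-except (suc n) Fin.zero f g f≡g g₀≡0 = begin
  f Fin.zero ℤ.+ D.Σℤ n (f ∘ Fin.suc)            ≡⟨ cong (λ z → f Fin.zero ℤ.+ z) (Σ-cong n (λ i → f≡g (Fin.suc i) λ ())) ⟩
  f Fin.zero ℤ.+ D.Σℤ n (g ∘ Fin.suc)            ≡⟨ rearrange (f Fin.zero) (D.Σℤ n (g ∘ Fin.suc)) ⟩
  +0 ℤ.+ D.Σℤ n (g ∘ Fin.suc) ℤ.+ f Fin.zero     ≡⟨ cong (λ z → z ℤ.+ D.Σℤ n (g ∘ Fin.suc) ℤ.+ f Fin.zero) (sym g₀≡0) ⟩
  g Fin.zero ℤ.+ D.Σℤ n (g ∘ Fin.suc) ℤ.+ f Fin.zero ∎
  where
  open ≡-Reasoning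
  rearrange : ∀ x y → x ℤ.+ y ≡ +0 ℤ.+ y ℤ.+ x
  rearrange = ℤR.solve-∀
Σ-except (suc n) (Fin.suc j) f g f≡g gⱼ≡0 = trans
  (cong₂ ℤ._+_ (f≡g Fin.zero λ ()) (Σ-except n j (f ∘ Fin.suc) (g ∘ Fin.suc) (λ i i≢j → f≡g (Fin.suc i) (i≢j ∘ FinP.suc-injective)) gⱼ≡0))
  (sym (ℤP.+-assoc (g Fin.zero) _ _))

Σ-linear : ∀ n κ (f g : Fin n → ℤ) → D.Σℤ n (λ i → f i ℤ.- κ ℤ.* g i) ≡ D.Σℤ n f ℤ.- κ ℤ.* D.Σℤ n g
Σ-linear zero κ f g = sym (zero-case κ)
  where
  zero-case : ∀ κ → +0 ℤ.- κ ℤ.* +0 ≡ +0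
  zero-case = ℤR.solve-∀
Σ-linear (suc n) κ f g = trans (cong (λ z → (f Fin.zero ℤ.- κ ℤ.* g Fin.zero) ℤ.+ z) (Σ-linear n κ (f ∘ Fin.suc) (g ∘ Fin.suc))) (rearrange (f Fin.zero) κ (g Fin.zero) _ _)
  where
  rearrange : ∀ a κ b c d → (a ℤ.- κ ℤ.* b) ℤ.+ (c ℤ.- κ ℤ.* d) ≡ (a ℤ.+ c) ℤ.- κ ℤ.* (b ℤ.+ d)
  rearrange = ℤR.solve-∀

pos-Σ : ∀ n f → + Σℕ n f ≡ D.Σℤ n (λ i → + f i)
pos-Σ zero f = refl
pos-Σ (suc n) f = cong (λ z → + f Fin.zero ℤ.+ z) (pos-Σ n (f ∘ Fin.suc))

module Rédei (m : ℕ) (a : Fin (suc m) → Fin 2) (ℓ : Fin (suc m) → Fin (suc m) → Fin 3) where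
  -- The logarithm at πⱼ of the product of the πᵢ to the powers eᵢ over i ≠ j. The omitted index
  -- contributes 0 in place of the meaningless ℓ j j.
  exponentLog : (Fin (suc m) → ℕ) → Fin (suc m) → ℕ
  exponentLog e j = Σℕ (suc m) (omit 0 j (λ i → e i ℕ.* toℕ (ℓ i j)))

  α-log : Fin (suc m) → ℕ
  α-log = exponentLog (D.expo ∘ a)

  off-diagonal : ∀ i j → i ≢ j → D.redei m a ℓ i j ≡ + toℕ (ℓ (Fin.inject₁ i) (Fin.inject₁ j))
  off-diagonal i j i≢j with i Fin.≟ j
  ... | yes i≡j = ⊥-elim (i≢j i≡j)
  ... | no _ = refl

  opaque
    diagonal : ∀ j → D.redei m a ℓ j j ≡ + D.expo (a (Fin.inject₁ j)) ℤ.* (ℤ.- (+ α-log (Fin.inject₁ j)))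
    diagonal j = trans (proj₂ (proj₂ (diagonal-sum m a ℓ j))) (cong (λ s → + D.expo (a (Fin.inject₁ j)) ℤ.* (ℤ.- s))
      (trans (Σ-cong (suc m) {diagonal-term m a ℓ j} pointwise) (sym (pos-Σ (suc m) (omit 0 J (λ k → D.expo (a k) ℕ.* toℕ (ℓ k J)))))))
      where
      J : Fin (suc m)
      J = Fin.inject₁ j
      pointwise : ∀ k → diagonal-term m a ℓ j k ≡ + omit 0 J (λ k → D.expo (a k) ℕ.* toℕ (ℓ k J)) k
      pointwise k with k Fin.≟ J
      ... | yes refl = trans (diagonal-same m a ℓ j J refl) (sym (cong +_ (omit-same 0 J (λ k → D.expo (a k) ℕ.* toℕ (ℓ k J)))))
      ... | no k≢J = trans (diagonal-other m a ℓ j k k≢J)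
        (sym (trans (cong +_ (omit-other 0 J k (λ k → D.expo (a k) ℕ.* toℕ (ℓ k J)) k≢J)) (ℤP.pos-* (D.expo (a k)) (toℕ (ℓ k J)))))

    -- Inversion on the nonzero elements of F₃ is the identity. The choice of κ and the factor a⁻¹
    -- on the diagonal both rely on this.
    3∣expo²-1 : ∀ (b : Fin 2) → (+ 3) ℤS.∣ + D.expo b ℤ.* + D.expo b ℤ.- (+ 1)
    3∣expo²-1 Fin.zero = ℤS.divides +0 refl
    3∣expo²-1 (Fin.suc Fin.zero) = ℤS.divides (+ 1) refl

    -- Subtracting the multiple κa of a makes the last coordinate vanish modulo 3; what is left is in the left kernel of the Rédei matrix.
    proportional : D.FullRank₃ m (D.redei m a ℓ) → ∀ e →
      (∀ j → (+ 3) ℤS.∣ + exponentLog e j ℤ.- + (D.expo (a j) ℕ.* e j ℕ.* α-log j)) →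
      ∃ λ κ → ∀ i → (+ 3) ℤS.∣ + e i ℤ.- κ ℤ.* + D.expo (a i)
    proportional full e rel = κ , λ i → go i
      where
      -- The quotient e/a modulo 3 at the last index, the one without a row in the matrix.
      κ : ℤ
      κ = + e (Fin.fromℕ m) ℤ.* + D.expo (a (Fin.fromℕ m))
      c : Fin (suc m) → ℤ
      c i = + e i ℤ.- κ ℤ.* + D.expo (a i)
      c-last : (+ 3) ℤS.∣ c (Fin.fromℕ m)
      c-last = subst ((+ 3) ℤS.∣_) (f (+ e (Fin.fromℕ m)) (+ D.expo (a (Fin.fromℕ m))))
        (ℤS.∣n⇒∣m*n (ℤ.- + e (Fin.fromℕ m)) (3∣expo²-1 (a (Fin.fromℕ m))))
        where
        f : ∀ e a → (ℤ.- e) ℤ.* (a ℤ.* a ℤ.- (+ 1)) ≡ e ℤ.- e ℤ.* a ℤ.* a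
        f = ℤR.solve-∀
      column : ∀ j → (+ 3) ℤS.∣ D.Σℤ m (λ i → c (Fin.inject₁ i) ℤ.* D.redei m a ℓ i j)
      column j = subst ((+ 3) ℤS.∣_) (sym total)
        (ℤS.∣m∣n⇒∣m+n (ℤS.∣m∣n⇒∣m-n (rel J) (ℤS.∣m⇒∣m*n (L (Fin.fromℕ m)) c-last)) (ℤS.∣n⇒∣m*n (κ ℤ.* + α-log J) (3∣expo²-1 (a J))))
        where
        J : Fin (suc m)
        J = Fin.inject₁ j
        L : Fin (suc m) → ℤ
        L i = + omit 0 J (λ i → toℕ (ℓ i J)) i
        L-other : ∀ i → i ≢ J → L i ≡ + toℕ (ℓ i J)
        L-other i i≢J = cong +_ (omit-other 0 J i (λ i → toℕ (ℓ i J)) i≢J)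
        L-same : L J ≡ +0
        L-same = cong +_ (omit-same 0 J (λ i → toℕ (ℓ i J)))
        weighted : ∀ (w : Fin (suc m) → ℕ) i → + omit 0 J (λ i → w i ℕ.* toℕ (ℓ i J)) i ≡ + w i ℤ.* L i
        weighted w i with i Fin.≟ J
        ... | yes refl = trans (cong +_ (omit-same 0 J (λ i → w i ℕ.* toℕ (ℓ i J)))) (sym (trans (cong (+ w J ℤ.*_) L-same) (ℤP.*-zeroʳ (+ w J))))
        ... | no i≢J = trans (cong +_ (omit-other 0 J i (λ i → w i ℕ.* toℕ (ℓ i J)) i≢J))
          (trans (ℤP.pos-* (w i) (toℕ (ℓ i J))) (cong (+ w i ℤ.*_) (sym (L-other i i≢J))))
        full-sum : D.Σℤ (suc m) (λ i → c i ℤ.* L i) ≡ + exponentLog e J ℤ.- κ ℤ.* + α-log J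
        full-sum = begin
          D.Σℤ (suc m) (λ i → c i ℤ.* L i)
            ≡⟨ Σ-cong (suc m) (λ i → trans (f (+ e i) κ (+ D.expo (a i)) (L i)) (sym (cong₂ (λ s t → s ℤ.- κ ℤ.* t) (weighted e i) (weighted (D.expo ∘ a) i)))) ⟩
          D.Σℤ (suc m) (λ i → + omit 0 J (λ i → e i ℕ.* toℕ (ℓ i J)) i ℤ.- κ ℤ.* + omit 0 J (λ i → D.expo (a i) ℕ.* toℕ (ℓ i J)) i)
            ≡⟨ Σ-linear (suc m) κ (λ i → + omit 0 J (λ i → e i ℕ.* toℕ (ℓ i J)) i) (λ i → + omit 0 J (λ i → D.expo (a i) ℕ.* toℕ (ℓ i J)) i) ⟩
          D.Σℤ (suc m) (λ i → + omit 0 J (λ i → e i ℕ.* toℕ (ℓ i J)) i) ℤ.- κ ℤ.* D.Σℤ (suc m) (λ i → + omit 0 J (λ i → D.expo (a i) ℕ.* toℕ (ℓ i J)) i)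
            ≡⟨ sym (cong₂ (λ s t → s ℤ.- κ ℤ.* t) (pos-Σ (suc m) (omit 0 J (λ i → e i ℕ.* toℕ (ℓ i J)))) (pos-Σ (suc m) (omit 0 J (λ i → D.expo (a i) ℕ.* toℕ (ℓ i J))))) ⟩
          + exponentLog e J ℤ.- κ ℤ.* + α-log J ∎
          where
          open ≡-Reasoning
          f : ∀ e κ a l → (e ℤ.- κ ℤ.* a) ℤ.* l ≡ e ℤ.* l ℤ.- κ ℤ.* (a ℤ.* l)
          f = ℤR.solve-∀
        -- Three terms, each divisible by 3: the relation `rel` at j, the contribution of the last
        -- index, and a multiple of a² - 1. The multiple of α removed from e cancels against the
        -- diagonal entry.
        total : D.Σℤ m (λ i → c (Fin.inject₁ i) ℤ.* D.redei m a ℓ i j)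
          ≡ (+ exponentLog e J ℤ.- + (D.expo (a J) ℕ.* e J ℕ.* α-log J)) ℤ.- c (Fin.fromℕ m) ℤ.* L (Fin.fromℕ m)
            ℤ.+ κ ℤ.* + α-log J ℤ.* (+ D.expo (a J) ℤ.* + D.expo (a J) ℤ.- (+ 1))
        total = begin
          D.Σℤ m (λ i → c (Fin.inject₁ i) ℤ.* D.redei m a ℓ i j)
            ≡⟨ Σ-except m j _ (λ i → c (Fin.inject₁ i) ℤ.* L (Fin.inject₁ i))
                 (λ i i≢j → cong (c (Fin.inject₁ i) ℤ.*_) (trans (off-diagonal i j i≢j) (sym (L-other (Fin.inject₁ i) (i≢j ∘ FinP.inject₁-injective)))))
                 (trans (cong (c J ℤ.*_) L-same) (ℤP.*-zeroʳ (c J))) ⟩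
          D.Σℤ m (λ i → c (Fin.inject₁ i) ℤ.* L (Fin.inject₁ i)) ℤ.+ c J ℤ.* D.redei m a ℓ j j
            ≡⟨ cong₂ ℤ._+_ (trans (isolate (D.Σℤ m (λ i → c (Fin.inject₁ i) ℤ.* L (Fin.inject₁ i))) (c (Fin.fromℕ m) ℤ.* L (Fin.fromℕ m))) (cong (ℤ._- c (Fin.fromℕ m) ℤ.* L (Fin.fromℕ m)) (trans (sym (Σ-last m (λ i → c i ℤ.* L i))) full-sum)))
                 (cong (c J ℤ.*_) (diagonal j)) ⟩
          (+ exponentLog e J ℤ.- κ ℤ.* + α-log J) ℤ.- c (Fin.fromℕ m) ℤ.* L (Fin.fromℕ m) ℤ.+ c J ℤ.* (+ D.expo (a J) ℤ.* (ℤ.- (+ α-log J)))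
            ≡⟨ f (+ exponentLog e J) κ (+ α-log J) (c (Fin.fromℕ m) ℤ.* L (Fin.fromℕ m)) (+ e J) (+ D.expo (a J)) ⟩
          (+ exponentLog e J ℤ.- + D.expo (a J) ℤ.* + e J ℤ.* + α-log J) ℤ.- c (Fin.fromℕ m) ℤ.* L (Fin.fromℕ m)
            ℤ.+ κ ℤ.* + α-log J ℤ.* (+ D.expo (a J) ℤ.* + D.expo (a J) ℤ.- (+ 1))
            ≡⟨ cong (λ z → (+ exponentLog e J ℤ.- z) ℤ.- c (Fin.fromℕ m) ℤ.* L (Fin.fromℕ m) ℤ.+ κ ℤ.* + α-log J ℤ.* (+ D.expo (a J) ℤ.* + D.expo (a J) ℤ.- (+ 1)))
                 (sym (trans (ℤP.pos-* (D.expo (a J) ℕ.* e J) (α-log J)) (cong (ℤ._* + α-log J) (ℤP.pos-* (D.expo (a J)) (e J))))) ⟩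
          (+ exponentLog e J ℤ.- + (D.expo (a J) ℕ.* e J ℕ.* α-log J)) ℤ.- c (Fin.fromℕ m) ℤ.* L (Fin.fromℕ m)
            ℤ.+ κ ℤ.* + α-log J ℤ.* (+ D.expo (a J) ℤ.* + D.expo (a J) ℤ.- (+ 1)) ∎
          where
          open ≡-Reasoning
          isolate : ∀ s t → s ≡ (s ℤ.+ t) ℤ.- t
          isolate = ℤR.solve-∀
          f : ∀ n κ A l e a → (n ℤ.- κ ℤ.* A) ℤ.- l ℤ.+ (e ℤ.- κ ℤ.* a) ℤ.* (a ℤ.* (ℤ.- A))
            ≡ (n ℤ.- a ℤ.* e ℤ.* A) ℤ.- l ℤ.+ κ ℤ.* A ℤ.* (a ℤ.* a ℤ.- (+ 1))
          f = ℤR.solve-∀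
      go : ∀ i → (+ 3) ℤS.∣ c i
      go i with view i
      ... | ‵fromℕ = c-last
      ... | ‵inject₁ i′ = ℤS.∣ᵤ⇒∣ (full (λ i → c (Fin.inject₁ i)) (λ j → ℤS.∣⇒∣ᵤ (column j)) i′)

-- For r < 3 the representative of r · a in {0, 1, 2}; 2a ≡ 3 - a.
multiples : ℕ → Fin 2 → ℕ
multiples 0 b = 0
multiples 1 b = D.expo b
multiples _ b = 3 ℕ.∸ D.expo b

opaque
  multiples-mod-3 : ∀ r e (b : Fin 2) → r ℕ.< 3 → e ℕ.≤ 2 → 3 ℕD.∣ ℤ.∣ + e ℤ.- + r ℤ.* + D.expo b ∣ → e ≡ multiples r b
  multiples-mod-3 0 0 Fin.zero _ _ q = refl
  multiples-mod-3 0 0 (Fin.suc Fin.zero) _ _ q = refl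
  multiples-mod-3 0 1 Fin.zero _ _ q = ⊥-elim (toWitnessFalse {a? = 3 ℕD.∣? 1} _ q)
  multiples-mod-3 0 1 (Fin.suc Fin.zero) _ _ q = ⊥-elim (toWitnessFalse {a? = 3 ℕD.∣? 1} _ q)
  multiples-mod-3 0 2 Fin.zero _ _ q = ⊥-elim (toWitnessFalse {a? = 3 ℕD.∣? 2} _ q)
  multiples-mod-3 0 2 (Fin.suc Fin.zero) _ _ q = ⊥-elim (toWitnessFalse {a? = 3 ℕD.∣? 2} _ q)
  multiples-mod-3 1 0 Fin.zero _ _ q = ⊥-elim (toWitnessFalse {a? = 3 ℕD.∣? 1} _ q)
  multiples-mod-3 1 0 (Fin.suc Fin.zero) _ _ q = ⊥-elim (toWitnessFalse {a? = 3 ℕD.∣? 2} _ q)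
  multiples-mod-3 1 1 Fin.zero _ _ q = refl
  multiples-mod-3 1 1 (Fin.suc Fin.zero) _ _ q = ⊥-elim (toWitnessFalse {a? = 3 ℕD.∣? 1} _ q)
  multiples-mod-3 1 2 Fin.zero _ _ q = ⊥-elim (toWitnessFalse {a? = 3 ℕD.∣? 1} _ q)
  multiples-mod-3 1 2 (Fin.suc Fin.zero) _ _ q = refl
  multiples-mod-3 2 0 Fin.zero _ _ q = ⊥-elim (toWitnessFalse {a? = 3 ℕD.∣? 2} _ q)
  multiples-mod-3 2 0 (Fin.suc Fin.zero) _ _ q = ⊥-elim (toWitnessFalse {a? = 3 ℕD.∣? 4} _ q)
  multiples-mod-3 2 1 Fin.zero _ _ q = ⊥-elim (toWitnessFalse {a? = 3 ℕD.∣? 1} _ q)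
  multiples-mod-3 2 1 (Fin.suc Fin.zero) _ _ q = refl
  multiples-mod-3 2 2 Fin.zero _ _ q = refl
  multiples-mod-3 2 2 (Fin.suc Fin.zero) _ _ q = ⊥-elim (toWitnessFalse {a? = 3 ℕD.∣? 2} _ q)
  multiples-mod-3 (suc (suc (suc _))) _ _ (s≤s (s≤s (s≤s ()))) _ _
  multiples-mod-3 0 (suc (suc (suc _))) _ _ (s≤s (s≤s ())) _
  multiples-mod-3 1 (suc (suc (suc _))) _ _ (s≤s (s≤s ())) _
  multiples-mod-3 2 (suc (suc (suc _))) _ _ (s≤s (s≤s ())) _

  κ-residue : ∀ κ e (b : Fin 2) → (+ 3) ℤS.∣ + e ℤ.- κ ℤ.* + D.expo b → (+ 3) ℤS.∣ + e ℤ.- + (κ ℤDM.%ℕ 3) ℤ.* + D.expo b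
  κ-residue κ e b q = subst ((+ 3) ℤS.∣_)
    (trans (cong (λ z → + e ℤ.- z ℤ.* + D.expo b ℤ.+ κ ℤDM./ℕ 3 ℤ.* + D.expo b ℤ.* (+ 3)) (ℤDM.a≡a%ℕn+[a/ℕn]*n κ 3))
      (f (+ e) (+ (κ ℤDM.%ℕ 3)) (κ ℤDM./ℕ 3) (+ D.expo b)))
    (ℤS.∣m∣n⇒∣m+n q (ℤS.∣n⇒∣m*n (κ ℤDM./ℕ 3 ℤ.* + D.expo b) (ℤS.divides (+ 1) refl)))
    where
    f : ∀ e r q a → e ℤ.- (r ℤ.+ q ℤ.* (+ 3)) ℤ.* a ℤ.+ q ℤ.* a ℤ.* (+ 3) ≡ e ℤ.- r ℤ.* a
    f = ℤR.solve-∀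

-- The splitting α = βγ² and one descent step.

β-part γ-part : Fin 2 → 𝔼 → 𝔼
β-part Fin.zero p = p
β-part (Fin.suc _) p = 1#
γ-part Fin.zero p = 1#
γ-part (Fin.suc _) p = p

opaque
  unfolding _+_
  part-power : ∀ b p → p ^ D.expo b ≡ β-part b p * (γ-part b p * γ-part b p)
  part-power Fin.zero p = f p
    where
    f : ∀ p → p * 1# ≡ p * (1# * 1#)
    f = solve-∀ 𝔼-ring
  part-power (Fin.suc Fin.zero) p = f p
    where
    f : ∀ p → p * (p * 1#) ≡ 1# * (p * p)
    f = solve-∀ 𝔼-ring

  part-copower : ∀ b p → p ^ (3 ℕ.∸ D.expo b) ≡ β-part b p * β-part b p * γ-part b p
  part-copower Fin.zero p = f p
    where
    f : ∀ p → p * (p * 1#) ≡ p * p * 1#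
    f = solve-∀ 𝔼-ring
  part-copower (Fin.suc Fin.zero) p = f p
    where
    f : ∀ p → p * 1# ≡ 1# * 1# * p
    f = solve-∀ 𝔼-ring

  part-product : ∀ b p → β-part b p * γ-part b p ≡ p
  part-product Fin.zero p = f p
    where
    f : ∀ p → p * 1# ≡ p
    f = solve-∀ 𝔼-ring
  part-product (Fin.suc Fin.zero) p = *-identityˡ p

opaque
  β-part-∣ : ∀ b {p y} → (b ≡ Fin.zero → p ∣ y) → β-part b p ∣ y
  β-part-∣ Fin.zero p∣y = p∣y refl
  β-part-∣ (Fin.suc _) {y = y} _ = y , sym (*-identityˡ y)

  γ-part-∣ : ∀ b {p y} → (b ≡ Fin.suc Fin.zero → p ∣ y) → γ-part b p ∣ y
  γ-part-∣ Fin.zero {y = y} _ = y , sym (*-identityˡ y)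
  γ-part-∣ (Fin.suc Fin.zero) p∣y = p∣y refl

  %-≡⇒∣ : ∀ x y → x ℕ.% 3 ≡ y ℕ.% 3 → (+ 3) ℤS.∣ + x ℤ.- + y
  %-≡⇒∣ x y eq = ℤS.divides (+ (x ℕ./ 3) ℤ.- + (y ℕ./ 3)) (begin
    + x ℤ.- + y
      ≡⟨ cong₂ ℤ._-_ (split x) (trans (split y) (cong (λ r → + r ℤ.+ + (y ℕ./ 3) ℤ.* (+ 3)) (sym eq))) ⟩
    (+ (x ℕ.% 3) ℤ.+ + (x ℕ./ 3) ℤ.* (+ 3)) ℤ.- (+ (x ℕ.% 3) ℤ.+ + (y ℕ./ 3) ℤ.* (+ 3))
      ≡⟨ f (+ (x ℕ.% 3)) (+ (x ℕ./ 3)) (+ (y ℕ./ 3)) ⟩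
    (+ (x ℕ./ 3) ℤ.- + (y ℕ./ 3)) ℤ.* (+ 3) ∎)
    where
    open ≡-Reasoning
    split : ∀ x → + x ≡ + (x ℕ.% 3) ℤ.+ + (x ℕ./ 3) ℤ.* (+ 3)
    split x = trans (cong +_ (ℕDM.m≡m%n+[m/n]*n x 3)) (trans (ℤP.pos-+ (x ℕ.% 3) (x ℕ./ 3 ℕ.* 3)) (cong (λ z → + (x ℕ.% 3) ℤ.+ z) (ℤP.pos-* (x ℕ./ 3) 3)))
    f : ∀ r s t → (r ℤ.+ s ℤ.* (+ 3)) ℤ.- (r ℤ.+ t ℤ.* (+ 3)) ≡ (s ℤ.- t) ℤ.* (+ 3)
    f = ℤR.solve-∀

  omit-* : ∀ {n} (j : Fin n) (f g h : Fin n → 𝔼) → (∀ i → f i ≡ g i * h i) → ∀ i → omit 1# j f i ≡ omit 1# j g i * omit 1# j h i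
  omit-* Fin.zero f g h eq Fin.zero = sym (*-identityˡ 1#)
  omit-* Fin.zero f g h eq (Fin.suc i) = eq (Fin.suc i)
  omit-* (Fin.suc j) f g h eq Fin.zero = eq Fin.zero
  omit-* (Fin.suc j) f g h eq (Fin.suc i) = omit-* j (f ∘ Fin.suc) (g ∘ Fin.suc) (h ∘ Fin.suc) (eq ∘ Fin.suc) i

  ∤-omit : ∀ {p} → IsPrime p → ∀ {n} (j : Fin n) f → (∀ i → i ≢ j → ¬ p ∣ f i) → ¬ p ∣ Π n (omit 1# j f)
  ∤-omit {p} prime {n} j f p∤f = ∤-Π prime n (omit 1# j f) go
    where
    go : ∀ i → ¬ p ∣ omit 1# j f i
    go i with i Fin.≟ j
    ... | yes refl = subst (λ w → ¬ p ∣ w) (sym (omit-same 1# j f)) (Prime.p∤1# prime)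
    ... | no i≢j = subst (λ w → ¬ p ∣ w) (sym (omit-other 1# j i f i≢j)) (p∤f i i≢j)

module Setup (m : ℕ) (π : Fin (suc m) → 𝔼) (a : Fin (suc m) → Fin 2)
  (prime : ∀ i → IsPrime (π i)) (distinct : ∀ i j → i ≢ j → ¬ π i ∣ π j) (π≡1 : ∀ i → λ³ ∣ π i - 1#)
  (ℓ : Fin (suc m) → Fin (suc m) → Fin 3)
  (log : ∀ i j → i ≢ j → ∀ k → N (π j) ≡ suc (9 ℕ.* k) → π j ∣ π i ^ (3 ℕ.* k) - ω ^ toℕ (ℓ i j))
  (full : D.FullRank₃ m (D.redei m a ℓ)) where

  open Rédei m a ℓ using (exponentLog; α-log; proportional)

  βf γf : Fin (suc m) → 𝔼
  βf i = β-part (a i) (π i)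
  γf i = γ-part (a i) (π i)

  β γ : 𝔼
  β = Π (suc m) βf
  γ = Π (suc m) γf

  opaque
    part≡1 : ∀ i → λ³ ∣ βf i - 1# × λ³ ∣ γf i - 1#
    part≡1 i with a i | π≡1 i
    ... | Fin.zero | p≡1 = p≡1 , Mod.≈-refl λ³
    ... | Fin.suc _ | p≡1 = Mod.≈-refl λ³ , p≡1

    S : StructureConstants β γ
    S with Π-≡1 (suc m) βf (proj₁ ∘ part≡1) | Π-≡1 (suc m) γf (proj₂ ∘ part≡1)
    ... | B , β-1≡ | G , γ-1≡ = subst₂ StructureConstants
      (sym (trans (add-sub-split β 1#) (cong (λ w → 1# + w) β-1≡))) (sym (trans (add-sub-split γ 1#) (cong (λ w → 1# + w) γ-1≡)))
      (structureConstants B G)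

  open Order S
  open Ambiguous S

  opaque
    Np : ∀ j → ∃ λ k → N (π j) ≡ suc (9 ℕ.* k)
    Np j = N-≡1mod9 (Prime.p≢0# (prime j)) (π≡1 j)

  module R (j : Fin (suc m)) = Residue (prime j) (proj₁ (Np j)) (proj₂ (Np j))

  b′ g′ α′ : Fin (suc m) → 𝔼
  b′ j = Π (suc m) (omit 1# j βf)
  g′ j = Π (suc m) (omit 1# j γf)
  α′ j = Π (suc m) (omit 1# j (λ i → π i ^ D.expo (a i)))

  opaque
    α′≡ : ∀ j → α′ j ≡ b′ j * (g′ j * g′ j)
    α′≡ j = trans (Π-cong (suc m) (λ i → trans (omit-* j _ βf (λ i → γf i * γf i) (λ i → part-power (a i) (π i)) i)
        (cong (omit 1# j βf i *_) (omit-* j _ γf γf (λ i → refl) i))))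
      (trans (Π-* (suc m) (omit 1# j βf) (λ i → omit 1# j γf i * omit 1# j γf i)) (cong (b′ j *_) (Π-* (suc m) (omit 1# j γf) (omit 1# j γf))))

    ∤-parts : ∀ i j → i ≢ j → ¬ π j ∣ βf i × ¬ π j ∣ γf i
    ∤-parts i j i≢j with a i
    ... | Fin.zero = distinct j i (i≢j ∘ sym) , Prime.p∤1# (prime j)
    ... | Fin.suc _ = Prime.p∤1# (prime j) , distinct j i (i≢j ∘ sym)

    ∤b′ : ∀ j → ¬ π j ∣ b′ j
    ∤b′ j = ∤-omit (prime j) j βf (λ i i≢j → proj₁ (∤-parts i j i≢j))

    ∤g′ : ∀ j → ¬ π j ∣ g′ j
    ∤g′ j = ∤-omit (prime j) j γf (λ i i≢j → proj₂ (∤-parts i j i≢j))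

    log-Π : ∀ j n (f : Fin n → 𝔼) e → (∀ i → R.Log j (f i) (e i)) → R.Log j (Π n f) (Σℕ n e)
    log-Π j zero f e _ = R.log-1 j
    log-Π j (suc n) f e logs = R.log-* j (e Fin.zero) (Σℕ n (e ∘ Fin.suc)) (logs Fin.zero) (log-Π j n (f ∘ Fin.suc) (e ∘ Fin.suc) (logs ∘ Fin.suc))

    log-omit : ∀ j (w : Fin (suc m) → ℕ) → R.Log j (Π (suc m) (omit 1# j (λ i → π i ^ w i))) (exponentLog w j)
    log-omit j w = log-Π j (suc m) _ (omit 0 j (λ i → w i ℕ.* toℕ (ℓ i j))) go
      where
      go : ∀ i → R.Log j (omit 1# j (λ i → π i ^ w i) i) (omit 0 j (λ i → w i ℕ.* toℕ (ℓ i j)) i)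
      go i with i Fin.≟ j
      ... | yes refl = subst₂ (R.Log j) (sym (omit-same 1# j (λ i → π i ^ w i))) (sym (omit-same 0 j (λ i → w i ℕ.* toℕ (ℓ i j)))) (R.log-1 j)
      ... | no i≢j = subst₂ (R.Log j) (sym (omit-other 1# j i (λ i → π i ^ w i) i≢j)) (sym (omit-other 0 j i (λ i → w i ℕ.* toℕ (ℓ i j)) i≢j))
        (R.log-^ j (w i) (toℕ (ℓ i j)) (log i j i≢j (proj₁ (Np j)) (proj₂ (Np j))))

  -- The common shape of the two ramified cases. The element of relative norm divisible by πⱼ
  -- exactly once is θ for aⱼ = 1 and θ₂ for aⱼ = 2; hence the exchange of x₁ with x₂ and the factor
  -- aⱼ in the logarithm.
  record Local (j : Fin (suc m)) (x₀ x₁ x₂ ν : 𝔼) : Set where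
    field
      e : ℕ
      e≤2 : e ℕ.≤ 2
      ν′ : 𝔼
      ν≡ : ν ≡ π j ^ e * ν′
      p∤ν′ : ¬ π j ∣ ν′
      log-ν′ : ∀ n → R.Log j ν′ n → n ℕ.% 3 ≡ (D.expo (a j) ℕ.* e ℕ.* α-log j) ℕ.% 3
      ∣x₀ : 1 ℕ.≤ e → π j ∣ x₀
      ∣x₁ : a j ≡ Fin.zero → 2 ℕ.≤ e → π j ∣ x₁
      ∣x₂ : a j ≡ Fin.suc Fin.zero → 2 ℕ.≤ e → π j ∣ x₂

  opaque
    local : ∀ j x₀ x₁ x₂ ν → ¬ (π j ∣ x₀ × π j ∣ x₁ × π j ∣ x₂) → 27# * ν ≡ normθ β γ x₀ x₁ x₂ → Local j x₀ x₁ x₂ ν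
    local j x₀ x₁ x₂ ν not-all 27ν≡ with a j in aj≡
    ... | Fin.zero = record
      { e = e ; e≤2 = e≤2 ; ν′ = ν′ ; ν≡ = ν≡ ; p∤ν′ = p∤ν′ ; log-ν′ = log-ν′
      ; ∣x₀ = p∣x₀ ; ∣x₁ = λ _ → p∣x₁ ; ∣x₂ = λ aj≡1 → ⊥-elim (0≢1 (trans (sym aj≡) aj≡1)) }
      where
      open R j
      0≢1 : Fin.zero {1} ≢ Fin.suc Fin.zero
      0≢1 ()
      β≡ : β ≡ π j * b′ j
      β≡ = trans (Π-omit (suc m) j βf) (cong (λ b → β-part b (π j) * b′ j) aj≡)
      γ≡ : γ ≡ g′ j
      γ≡ = trans (Π-omit (suc m) j γf) (trans (cong (λ b → γ-part b (π j) * g′ j) aj≡) (*-identityˡ (g′ j)))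
      open Valuation (valuation (prime j) p∤3 (b′ j) (g′ j) x₀ x₁ x₂ ν (∤b′ j) (∤g′ j) not-all
        (trans 27ν≡ (cong₂ (λ b g → normθ b g x₀ x₁ x₂) β≡ γ≡)))
      log-ν′ : ∀ n → R.Log j ν′ n → n ℕ.% 3 ≡ (D.expo (a j) ℕ.* e ℕ.* α-log j) ℕ.% 3
      log-ν′ n ln = trans (cong (ℕ._% 3) (f n)) (trans
        (log-unique (0 ℕ.+ n ℕ.+ 0) (e ℕ.* α-log j ℕ.+ 0)
          (log-≈ (0 ℕ.+ n ℕ.+ 0) cubic (log-* (0 ℕ.+ n) 0 (log-* 0 n log-27 ln) (log-cube p∤s)))
          (log-* (e ℕ.* α-log j) 0 (log-^ e (α-log j) (subst (λ w → Log w (α-log j)) (α′≡ j) (log-omit j (D.expo ∘ a)))) (log-cube p∤t)))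
        (cong (ℕ._% 3) (trans (g e (α-log j)) (cong (λ b → D.expo b ℕ.* e ℕ.* α-log j) (sym aj≡)))))
        where
        f : ∀ n → n ≡ 0 ℕ.+ n ℕ.+ 0
        f = ℕR.solve-∀
        g : ∀ e A → e ℕ.* A ℕ.+ 0 ≡ 1 ℕ.* e ℕ.* A
        g = ℕR.solve-∀
    ... | Fin.suc Fin.zero = record
      { e = e ; e≤2 = e≤2 ; ν′ = ν′ ; ν≡ = ν≡ ; p∤ν′ = p∤ν′ ; log-ν′ = log-ν′
      ; ∣x₀ = p∣x₀ ; ∣x₁ = λ aj≡0 → ⊥-elim (1≢0 (trans (sym aj≡) aj≡0)) ; ∣x₂ = λ _ → p∣x₁ }
      where
      open R j
      1≢0 : Fin.suc {1} Fin.zero ≢ Fin.zero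
      1≢0 ()
      β≡ : β ≡ b′ j
      β≡ = trans (Π-omit (suc m) j βf) (trans (cong (λ b → β-part b (π j) * b′ j) aj≡) (*-identityˡ (b′ j)))
      γ≡ : γ ≡ π j * g′ j
      γ≡ = trans (Π-omit (suc m) j γf) (cong (λ b → γ-part b (π j) * g′ j) aj≡)
      open Valuation (valuation (prime j) p∤3 (g′ j) (b′ j) x₀ x₂ x₁ ν (∤g′ j) (∤b′ j) (λ (p , q , r) → not-all (p , r , q))
        (trans 27ν≡ (trans (normθ-swap β γ x₀ x₁ x₂) (cong₂ (λ b g → normθ g b x₀ x₂ x₁) β≡ γ≡))))
      open Mod (π j)
      opaque
        unfolding _+_
        square : ∀ b g → g * (b * b) * (g * g * g) ≡ b * (g * g) * (b * (g * g))
        square = solve-∀ 𝔼-ring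
        swap : ∀ c t d → c * t * d ≡ c * d * t
        swap = solve-∀ 𝔼-ring
      -- With the roles exchanged c is g′b′². Multiplied by the cube g′³ it becomes α′², and cubes
      -- have logarithm 0; this produces the factor 2 = aⱼ.
      cubic′ : 27# * ν′ * (s * s * s) * (g′ j * g′ j * g′ j) ^ e ≈ (α′ j * α′ j) ^ e * (t * t * t)
      cubic′ = ≈-trans (≈-* cubic ≈-refl) (≡⇒≈ (trans (swap _ _ _) (cong (_* (t * t * t))
        (trans (sym (^-distrib-* _ _ e)) (cong (_^ e) (trans (square (b′ j) (g′ j)) (sym (cong₂ _*_ (α′≡ j) (α′≡ j)))))))))
      log-α′ : Log (α′ j) (α-log j)
      log-α′ = log-omit j (D.expo ∘ a)
      log-ν′ : ∀ n → R.Log j ν′ n → n ℕ.% 3 ≡ (D.expo (a j) ℕ.* e ℕ.* α-log j) ℕ.% 3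
      log-ν′ n ln = trans (cong (ℕ._% 3) (f n e)) (trans
        (log-unique (0 ℕ.+ n ℕ.+ 0 ℕ.+ e ℕ.* 0) (e ℕ.* (α-log j ℕ.+ α-log j) ℕ.+ 0)
          (log-≈ (0 ℕ.+ n ℕ.+ 0 ℕ.+ e ℕ.* 0) cubic′ (log-* (0 ℕ.+ n ℕ.+ 0) (e ℕ.* 0) (log-* (0 ℕ.+ n) 0 (log-* 0 n log-27 ln) (log-cube p∤s))
            (log-^ e 0 (log-cube (∤g′ j)))))
          (log-* (e ℕ.* (α-log j ℕ.+ α-log j)) 0 (log-^ e (α-log j ℕ.+ α-log j) (log-* (α-log j) (α-log j) log-α′ log-α′)) (log-cube p∤t)))
        (cong (ℕ._% 3) (trans (g e (α-log j)) (cong (λ b → D.expo b ℕ.* e ℕ.* α-log j) (sym aj≡)))))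
        where
        f : ∀ n e → n ≡ 0 ℕ.+ n ℕ.+ 0 ℕ.+ e ℕ.* 0
        f = ℕR.solve-∀
        g : ∀ e A → e ℕ.* (A ℕ.+ A) ℕ.+ 0 ≡ 2 ℕ.* e ℕ.* A
        g = ℕR.solve-∀

  P : 𝔼
  P = Π (suc m) π

  opaque
    βγ≡P : β * γ ≡ P
    βγ≡P = trans (sym (Π-* (suc m) βf γf)) (Π-cong (suc m) (λ i → part-product (a i) (π i)))

    βγ≢0 : β * γ ≢ 0#
    βγ≢0 = subst (_≢ 0#) (sym βγ≡P) (go (suc m) π (λ i → Prime.p≢0# (prime i)))
      where
      go : ∀ n (f : Fin n → 𝔼) → (∀ i → f i ≢ 0#) → Π n f ≢ 0#
      go zero f _ = λ ()
      go (suc n) f f≢0 = *≢0# (f≢0 Fin.zero) (go n (f ∘ Fin.suc) (f≢0 ∘ Fin.suc))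

    coprime-π : ∀ i j → i ≢ j → Coprime (π i) (π j)
    coprime-π i j i≢j = Prime.∤⇒coprime (prime i) (distinct i j i≢j)

    coprime-βγ-3 : Coprime (β * γ) 3#
    coprime-βγ-3 = subst (λ w → Coprime w 3#) (sym βγ≡P)
      (Coprime-sym (coprime-Π (suc m) π (λ i → Coprime-sym (Prime.∤⇒coprime (prime i) (R.p∤3 i)))))

    coprime-βf : ∀ i j → i ≢ j → Coprime (βf i) (βf j)
    coprime-βf i j i≢j with a i | a j
    ... | Fin.zero | Fin.zero = coprime-π i j i≢j
    ... | Fin.zero | Fin.suc _ = Coprime-1#
    ... | Fin.suc _ | _ = Coprime-sym Coprime-1#

    coprime-γf : ∀ i j → i ≢ j → Coprime (γf i) (γf j)
    coprime-γf i j i≢j with a i | a j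
    ... | Fin.suc _ | Fin.suc _ = coprime-π i j i≢j
    ... | Fin.suc _ | Fin.zero = Coprime-1#
    ... | Fin.zero | _ = Coprime-sym Coprime-1#

  record Step (u : 𝕋) : Set where
    constructor step
    field
      v : 𝕋
      k : ℕ
      relation : u · σ v ≡ scale (ω ^ k) v
      unit : N (nm v) ≡ 1

  opaque
    divide-by-θ : ∀ u x → u · σ x ≡ x → ∀ θ k → σ θ ≡ scale (ω ^ k) θ → ∀ {W} → toθ (θ · x) ≡ scale (β * γ) W →
      ∀ {ρ} → N ρ ≡ 1 → nm θ * nm x ≡ (β * γ) * ((β * γ) * (β * γ)) * ρ → Step u
    divide-by-θ u x amb θ k σθ toθ≡ {ρ} Nρ≡1 norm≡ with divide-coordinates (β * γ) {z = θ · x} coprime-βγ-3 toθ≡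
    ... | v , θx≡ = step v k
      (scale-cancel t βγ≢0 (begin
        scale t (u · σ v)               ≡⟨ sym (scale-·ʳ t u (σ v)) ⟩
        u · scale t (σ v)               ≡⟨ cong (u ·_) (trans (sym (σ-scale t v)) (cong σ (sym θx≡))) ⟩
        u · σ (θ · x)                   ≡⟨ cong (u ·_) (trans (σ-· θ x) (cong (_· σ x) σθ)) ⟩
        u · (scale w θ · σ x)           ≡⟨ cong (u ·_) (scale-·ˡ w θ (σ x)) ⟩
        u · scale w (θ · σ x)           ≡⟨ scale-·ʳ w u (θ · σ x) ⟩
        scale w (u · (θ · σ x))         ≡⟨ cong (scale w) (trans (sym (·-assoc u θ (σ x))) (trans (cong (_· σ x) (·-comm u θ)) (·-assoc θ u (σ x)))) ⟩
        scale w (θ · (u · σ x))         ≡⟨ cong (λ y → scale w (θ · y)) amb ⟩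
        scale w (θ · x)                 ≡⟨ cong (scale w) θx≡ ⟩
        scale w (scale t v)             ≡⟨ trans (scale-scale w t v) (trans (cong (λ s → scale s v) (*-comm w t)) (sym (scale-scale t w v))) ⟩
        scale t (scale w v) ∎))
      (trans (cong N nm-v≡ρ) Nρ≡1)
      where
      open ≡-Reasoning
      t w : 𝔼
      t = β * γ
      w = ω ^ k
      nm-v≡ρ : nm v ≡ ρ
      nm-v≡ρ = *-cancelˡ (t * (t * t)) (*≢0# βγ≢0 (*≢0# βγ≢0 βγ≢0))
        (trans (sym (nm-scale t v)) (trans (cong nm (sym θx≡)) (trans (nm-· θ x) norm≡)))

    primitive-coordinates : ∀ {p} → IsPrime p → ¬ p ∣ 3# → ∀ x {x₀ x₁ x₂} → Primitive x → toθ x ≡ tri x₀ x₁ x₂ →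
      ¬ (p ∣ x₀ × p ∣ x₁ × p ∣ x₂)
    primitive-coordinates {p} pr p∤3 x {x₀} {x₁} {x₂} prim toθx≡ (p∣x₀ , p∣x₁ , p∣x₂) = go x prim (trans (sym (fromθ-toθ x)) (cong fromθ toθx≡))
      where
      opaque
        unfolding _+ᵀ_ fromθ
        go : ∀ x → Primitive x → scale 3# x ≡ fromθ (tri x₀ x₁ x₂) → ⊥
        go (tri y₀ y₁ y₂) (r , s , t , eq) 3x≡ = Prime.p∤1# pr (subst (p ∣_) eq
          (∣-add (∣-add (∣-*ˡ r (strip (cong (λ { (tri w _ _) → w }) 3x≡) (∣-add (∣-add p∣x₀ p∣x₁) p∣x₂)))
                        (∣-*ˡ s (strip (cong (λ { (tri _ w _) → w }) 3x≡) (∣-add (∣-add p∣x₀ (∣-*ˡ ω² p∣x₁)) (∣-*ˡ ω p∣x₂)))))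
                 (∣-*ˡ t (strip (cong (λ { (tri _ _ w) → w }) 3x≡) (∣-add (∣-add p∣x₀ (∣-*ˡ ω p∣x₁)) (∣-*ˡ ω² p∣x₂))))))
          where
          strip : ∀ {y z} → 3# * y ≡ z → p ∣ z → p ∣ y
          strip {y} refl p∣3y with Prime.split-∣ pr 3# y p∣3y
          ... | inj₁ p∣3 = ⊥-elim (p∤3 p∣3)
          ... | inj₂ p∣y = p∣y

    ∣-scale : ∀ {t x₀ x₁ x₂} → t ∣ x₀ → t ∣ x₁ → t ∣ x₂ → ∃ λ W → tri x₀ x₁ x₂ ≡ scale t W
    ∣-scale (c , refl) (d , refl) (e , refl) = tri c d e , scaled _ c d e
      where
      opaque
        unfolding _+ᵀ_
        scaled : ∀ t c d e → tri (t * c) (t * d) (t * e) ≡ scale t (tri c d e)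
        scaled t c d e = refl

    -- The exponents of the norm of x are r · a reduced modulo 3. For r = 0 the norm is a unit; for
    -- r = 1 it is βγ² = nm θ₁ and for r = 2 it is β²γ = nm θ₂, both up to a unit, and x is that θᵢ
    -- times a unit.
    descend-ambiguous : ∀ u → (nm-u : nm u ≡ 1#) → ∀ x → u · σ x ≡ x → Primitive x → ∀ {x₀ x₁ x₂} → toθ x ≡ tri x₀ x₁ x₂ → Step u
    descend-ambiguous u nm-u x amb prim {x₀} {x₁} {x₂} toθx≡ = go r refl
      where
      ν : 𝔼
      ν = nm x
      locals : ∀ j → Local j x₀ x₁ x₂ ν
      locals j = local j x₀ x₁ x₂ ν (primitive-coordinates (prime j) (R.p∤3 j) x prim toθx≡) (27·nm x toθx≡)
      e : Fin (suc m) → ℕ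
      e j = Local.e (locals j)
      extracted : ∃ λ ρ → ν ≡ Π (suc m) (λ i → π i ^ e i) * ρ × (∀ i → ¬ π i ∣ ρ)
      extracted = extract-primes (suc m) π e prime distinct ν (λ j → Local.ν′ (locals j)) (λ j → Local.ν≡ (locals j)) (λ j → Local.p∤ν′ (locals j))
      ρ : 𝔼
      ρ = proj₁ extracted
      ν≡ : ν ≡ Π (suc m) (λ i → π i ^ e i) * ρ
      ν≡ = proj₁ (proj₂ extracted)
      coprime-ρ : Coprime ρ (β * γ)
      coprime-ρ = subst (Coprime ρ) (sym βγ≡P) (coprime-Π (suc m) π (λ i → Coprime-sym (Prime.∤⇒coprime (prime i) (proj₂ (proj₂ extracted) i))))
      ρ∣1 : ρ ∣ 1#
      ρ∣1 = NormOne.coprime-divisor-trivial u nm-u x amb (Π (suc m) (λ i → π i ^ e i) , trans ν≡ (*-comm _ ρ)) coprime-ρ prim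
      Nρ≡1 : N ρ ≡ 1
      Nρ≡1 = IsUnit⇒N≡1 (proj₁ ρ∣1 , sym (proj₂ ρ∣1))
      ν′≡ : ∀ j → Local.ν′ (locals j) ≡ Π (suc m) (omit 1# j (λ i → π i ^ e i)) * ρ
      ν′≡ j = *-cancelˡ (π j ^ e j) (^≢0# (e j) (Prime.p≢0# (prime j)))
        (trans (sym (Local.ν≡ (locals j))) (trans ν≡ (trans (cong (_* ρ) (Π-omit (suc m) j (λ i → π i ^ e i))) (*-assoc _ _ ρ))))
      -- The symbol of ν′ at πⱼ is evaluated twice: by the local congruence, and by the
      -- factorisation over the other primes, in which the unit ρ has logarithm 0.
      rel : ∀ j → (+ 3) ℤS.∣ + exponentLog e j ℤ.- + (D.expo (a j) ℕ.* e j ℕ.* α-log j)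
      rel j = %-≡⇒∣ (exponentLog e j) (D.expo (a j) ℕ.* e j ℕ.* α-log j) (Local.log-ν′ (locals j) (exponentLog e j)
        (subst₂ (R.Log j) (sym (ν′≡ j)) (ℕP.+-identityʳ (exponentLog e j)) (R.log-* j (exponentLog e j) 0 (log-omit j e) (R.log-unit j Nρ≡1))))
      κ : ℤ
      κ = proj₁ (proportional full e rel)
      r : ℕ
      r = κ ℤDM.%ℕ 3
      e≡ : ∀ i → e i ≡ multiples r (a i)
      e≡ i = multiples-mod-3 r (e i) (a i) (ℤDM.n%ℕd<d κ 3) (Local.e≤2 (locals i))
        (ℤS.∣⇒∣ᵤ (κ-residue κ (e i) (a i) (proj₂ (proportional full e rel) i)))
      all∣x₀ : (∀ i → 1 ℕ.≤ e i) → β * γ ∣ x₀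
      all∣x₀ 1≤e = subst (_∣ x₀) (sym βγ≡P) (Π-∣ (suc m) π (λ i → Local.∣x₀ (locals i) (1≤e i)) coprime-π)
      go : ∀ s → r ≡ s → Step u
      go 0 r≡0 = step x 0 (trans amb (sym (scale-1 x))) (trans (cong N (trans ν≡ (trans (cong (_* ρ) trivial) (*-identityˡ ρ)))) Nρ≡1)
        where
        trivial : Π (suc m) (λ i → π i ^ e i) ≡ 1#
        trivial = trans (Π-cong (suc m) (λ i → cong (π i ^_) (trans (e≡ i) (cong (λ s → multiples s (a i)) r≡0)))) (Π-1 (suc m))
      -- θ₂ · x has coordinates βγx₁, βx₂, x₀. They are multiples of βγ because every prime has e ≥
      -- 1, which gives βγ ∣ x₀, and the primes of γ have e = 2, which gives γ ∣ x₂.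
      go 1 r≡1 = divide-by-θ u x amb θ₂ 2 (trans σθ₂ (cong (λ w → scale w θ₂) (sym ω^2)))
        (trans (toθ-θ₂· x toθx≡) (proj₂ (∣-scale (x∣x* x₁) (βγ∣β* (Π-∣ (suc m) γf γf∣x₂ coprime-γf)) (all∣x₀ (λ i → subst (1 ℕ.≤_) (sym (ei i)) (s≤s z≤n))))))
        Nρ≡1 (trans (cong₂ _*_ nm-θ₂ (trans ν≡ (cong (_* ρ) power))) (f β γ ρ))
        where
        ei : ∀ i → e i ≡ D.expo (a i)
        ei i = trans (e≡ i) (cong (λ s → multiples s (a i)) r≡1)
        βγ∣β* : ∀ {y} → γ ∣ y → β * γ ∣ β * y
        βγ∣β* (c , refl) = c , sym (*-assoc β γ c)
        γf∣x₂ : ∀ i → γf i ∣ x₂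
        γf∣x₂ i = γ-part-∣ (a i) (λ ai≡ → Local.∣x₂ (locals i) ai≡ (subst (2 ℕ.≤_) (sym (trans (ei i) (cong D.expo ai≡))) (s≤s (s≤s z≤n))))
        power : Π (suc m) (λ i → π i ^ e i) ≡ β * (γ * γ)
        power = trans (Π-cong (suc m) (λ i → trans (cong (π i ^_) (ei i)) (part-power (a i) (π i))))
          (trans (Π-* (suc m) βf (λ i → γf i * γf i)) (cong (β *_) (Π-* (suc m) γf γf)))
        opaque
          unfolding _+_
          f : ∀ b g r → b * b * g * (b * (g * g) * r) ≡ b * g * (b * g * (b * g)) * r
          f = solve-∀ 𝔼-ring
      go 2 r≡2 = divide-by-θ u x amb θ₁ 1 (trans σθ₁ (cong (λ w → scale w θ₁) (sym ω^1)))
        (trans (toθ-θ₁· x toθx≡) (proj₂ (∣-scale (x∣x* x₂) (all∣x₀ (λ i → subst (1 ℕ.≤_) (sym (ei i)) (1≤co (a i)))) (βγ∣γ* (Π-∣ (suc m) βf βf∣x₁ coprime-βf)))))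
        Nρ≡1 (trans (cong₂ _*_ nm-θ₁ (trans ν≡ (cong (_* ρ) power))) (f β γ ρ))
        where
        ei : ∀ i → e i ≡ 3 ℕ.∸ D.expo (a i)
        ei i = trans (e≡ i) (cong (λ s → multiples s (a i)) r≡2)
        1≤co : ∀ b → 1 ℕ.≤ 3 ℕ.∸ D.expo b
        1≤co Fin.zero = s≤s z≤n
        1≤co (Fin.suc Fin.zero) = s≤s z≤n
        βγ∣γ* : ∀ {y} → β ∣ y → β * γ ∣ γ * y
        βγ∣γ* (c , refl) = c , trans (sym (*-assoc γ β c)) (cong (_* c) (*-comm γ β))
        βf∣x₁ : ∀ i → βf i ∣ x₁
        βf∣x₁ i = β-part-∣ (a i) (λ ai≡ → Local.∣x₁ (locals i) ai≡ (subst (2 ℕ.≤_) (sym (trans (ei i) (cong (λ b → 3 ℕ.∸ D.expo b) ai≡))) (s≤s (s≤s z≤n))))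
        power : Π (suc m) (λ i → π i ^ e i) ≡ β * β * γ
        power = trans (Π-cong (suc m) (λ i → trans (cong (π i ^_) (ei i)) (part-copower (a i) (π i))))
          (trans (Π-* (suc m) (λ i → βf i * βf i) γf) (cong (_* γ) (Π-* (suc m) βf βf)))
        opaque
          unfolding _+_
          f : ∀ b g r → b * (g * g) * (b * b * g * r) ≡ b * g * (b * g * (b * g)) * r
          f = solve-∀ 𝔼-ring
      go (suc (suc (suc s))) r≡ = ⊥-elim (ℕP.<⇒≱ (ℤDM.n%ℕd<d κ 3) (subst (3 ℕ.≤_) (sym r≡) (s≤s (s≤s (s≤s z≤n)))))

    descend : ∀ u → nm u ≡ 1# → Step u
    descend u nm-u with NormOne.hilbert-nonzero u nm-u βγ≢0
    ... | w , h≢0 with primitive-part (NormOne.hilbert u nm-u w) h≢0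
    ...   | c , x , c≢0 , h≡ , prim = descend-ambiguous u nm-u x amb prim (proj₂ (coordinates (toθ x)))
      where
      coordinates : ∀ X → ∃ λ ((x₀ , x₁ , x₂) : 𝔼 × 𝔼 × 𝔼) → X ≡ tri x₀ x₁ x₂
      coordinates (tri x₀ x₁ x₂) = (x₀ , x₁ , x₂) , refl
      amb : u · σ x ≡ x
      amb = scale-cancel c c≢0 (trans (sym (trans (cong (u ·_) (σ-scale c x)) (scale-·ʳ c u (σ x))))
        (trans (cong (λ y → u · σ y) (sym h≡)) (trans (NormOne.hilbert-ambiguous u nm-u w) h≡)))

-- Units of norm 1: cube roots, congruences modulo powers of 3.

opaque
  unfolding _+ᵀ_
  scale-+ : ∀ t x y → scale t (x +ᵀ y) ≡ scale t x +ᵀ scale t y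
  scale-+ t (tri a b c) (tri d e f) = cong₃ tri (*-distribˡ t a d) (*-distribˡ t b e) (*-distribˡ t c f)

  +-scale : ∀ s t x → scale (s + t) x ≡ scale s x +ᵀ scale t x
  +-scale s t (tri a b c) = cong₃ tri (distribʳ s t a) (distribʳ s t b) (distribʳ s t c)
    where
    opaque
      unfolding _+_
      distribʳ : ∀ s t a → (s + t) * a ≡ s * a + t * a
      distribʳ = solve-∀ 𝔼-ring

  triple-scale : ∀ t x → scale t x +ᵀ scale t x +ᵀ scale t x ≡ scale (3# * t) x
  triple-scale t (tri a b c) = cong₃ tri (f t a) (f t b) (f t c)
    where
    opaque
      unfolding _+_
      f : ∀ t a → t * a + t * a + t * a ≡ 3# * t * a
      f = solve-∀ 𝔼-ring

  scale-0 : ∀ t → scale t 0ᵀ ≡ 0ᵀ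
  scale-0 t = cong₃ tri (*-zeroʳ t) (*-zeroʳ t) (*-zeroʳ t)

opaque
  divides-! : ∀ K d → 0 ℕ.< d → d ℕ.≤ K → d ℕD.∣ K !
  divides-! K (suc d) _ d≤K = ℕD.∣-trans (ℓ∣ℓ! (suc d)) (ℕD.m≤n⇒m!∣n! d≤K)

  residue : ∀ W → .{{_ : ℕ.NonZero W}} → ℤ → Fin W
  residue W i = Fin.fromℕ< (ℤDM.n%ℕd<d i W)

  residue-≡ : ∀ W → .{{_ : ℕ.NonZero W}} → ∀ i j → residue W i ≡ residue W j → ∃ λ q → i ≡ j ℤ.+ + W ℤ.* q
  residue-≡ W i j eq = (i ℤDM./ℕ W) ℤ.- (j ℤDM./ℕ W) , (begin
    i                                                    ≡⟨ ℤDM.a≡a%ℕn+[a/ℕn]*n i W ⟩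
    + (i ℤDM.%ℕ W) ℤ.+ (i ℤDM./ℕ W) ℤ.* + W                ≡⟨ cong (λ r → + r ℤ.+ (i ℤDM./ℕ W) ℤ.* + W) same ⟩
    + (j ℤDM.%ℕ W) ℤ.+ (i ℤDM./ℕ W) ℤ.* + W                ≡⟨ f (+ (j ℤDM.%ℕ W)) (i ℤDM./ℕ W) (j ℤDM./ℕ W) (+ W) ⟩
    + (j ℤDM.%ℕ W) ℤ.+ (j ℤDM./ℕ W) ℤ.* + W ℤ.+ + W ℤ.* ((i ℤDM./ℕ W) ℤ.- (j ℤDM./ℕ W))
      ≡⟨ cong (λ z → z ℤ.+ + W ℤ.* ((i ℤDM./ℕ W) ℤ.- (j ℤDM./ℕ W))) (sym (ℤDM.a≡a%ℕn+[a/ℕn]*n j W)) ⟩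
    j ℤ.+ + W ℤ.* ((i ℤDM./ℕ W) ℤ.- (j ℤDM./ℕ W)) ∎)
    where
    open ≡-Reasoning
    same : i ℤDM.%ℕ W ≡ j ℤDM.%ℕ W
    same = trans (sym (FinP.toℕ-fromℕ< (ℤDM.n%ℕd<d i W))) (trans (cong toℕ eq) (FinP.toℕ-fromℕ< (ℤDM.n%ℕd<d j W)))
    f : ∀ r a b w → r ℤ.+ a ℤ.* w ≡ r ℤ.+ b ℤ.* w ℤ.+ w ℤ.* (a ℤ.- b)
    f = ℤR.solve-∀

residueᴱ : ∀ W → .{{_ : ℕ.NonZero W}} → 𝔼 → Fin (W ℕ.* W)
residueᴱ W (eis a b) = Fin.combine (residue W a) (residue W b)

residueᵀ : ∀ W → .{{_ : ℕ.NonZero W}} → 𝕋 → Fin ((W ℕ.* W) ℕ.* ((W ℕ.* W) ℕ.* (W ℕ.* W)))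
residueᵀ W (tri x y z) = Fin.combine (residueᴱ W x) (Fin.combine (residueᴱ W y) (residueᴱ W z))

opaque
  unfolding _+_ _+ᵀ_
  residueᴱ-≡ : ∀ W → .{{_ : ℕ.NonZero W}} → ∀ x y → residueᴱ W x ≡ residueᴱ W y → ∃ λ q → x ≡ y + nat W * q
  residueᴱ-≡ W (eis a b) (eis c d) eq with FinP.combine-injective _ _ _ _ eq
  ... | eq₁ , eq₂ with residue-≡ W a c eq₁ | residue-≡ W b d eq₂
  ...   | q , refl | r , refl = eis q r , cong₂ eis (f c (+ W) q r) (g d (+ W) q r)
    where
    f : ∀ c w q r → c ℤ.+ w ℤ.* q ≡ c ℤ.+ (w ℤ.* q ℤ.- +0 ℤ.* r)
    f = ℤR.solve-∀
    g : ∀ d w q r → d ℤ.+ w ℤ.* r ≡ d ℤ.+ (w ℤ.* r ℤ.+ +0 ℤ.* q ℤ.- +0 ℤ.* r)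
    g = ℤR.solve-∀

  residueᵀ-≡ : ∀ W → .{{_ : ℕ.NonZero W}} → ∀ x y → residueᵀ W x ≡ residueᵀ W y → ∃ λ q → x ≡ y +ᵀ scale (nat W) q
  residueᵀ-≡ W (tri a b c) (tri d e f) eq with FinP.combine-injective _ _ _ _ eq
  ... | eq₁ , eq₂₃ with FinP.combine-injective _ _ _ _ eq₂₃
  ...   | eq₂ , eq₃ with residueᴱ-≡ W a d eq₁ | residueᴱ-≡ W b e eq₂ | residueᴱ-≡ W c f eq₃
  ...     | q , a≡ | r , b≡ | s , c≡ = tri q r s , cong₃ tri a≡ b≡ c≡

module Units {b g : 𝔼} (S : StructureConstants b g) where
  open Order S
  open Solve using (_:+_; _:*_; _:=_)
  open CommutativeRing 𝕆 using () renaming (*-identityʳ to ·-identityʳ; distribˡ to ·-distribˡ′; zeroʳ to ·-zeroʳ)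
  open Power (CommutativeRing.commutativeSemiring 𝕆) using () renaming (_^_ to _⋆_; ^-homo-* to ⋆-+; ^-assocʳ to ⋆-*; ^-distrib-* to ⋆-·)
  open ≡-Reasoning

  Descent : Set
  Descent = ∀ u → nm u ≡ 1# → ∃₂ λ v k → u · σ v ≡ scale (ω ^ k) v × N (nm v) ≡ 1

  NormRoot : Set
  NormRoot = ∃ λ u → nm u ≡ ω

  opaque
    unfolding _+_
    nm-neg : ∀ v w → nm v ≡ - w → nm (scale (- 1#) v) ≡ w
    nm-neg v w eq = trans (nm-scale (- 1#) v) (trans (cong (- 1# * (- 1# * - 1#) *_) eq) (f w))
      where
      f : ∀ w → - 1# * (- 1# * - 1#) * (- w) ≡ w
      f = solve-∀ 𝔼-ring

    ω^2·ω^2 : ω ^ 2 * ω ^ 2 ≡ ω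
    ω^2·ω^2 = refl

  opaque
    -- Norm ω² is as good as norm ω: v² then has norm ω⁴ = ω.
    normalise : ∀ u v k (j : Fin 3) → u · σ v ≡ scale (ω ^ k) v → nm v ≡ ω ^ toℕ j →
      NormRoot ⊎ (∃₂ λ v k → u · σ v ≡ scale (ω ^ k) v × nm v ≡ 1#)
    normalise u v k Fin.zero rel nm-v = inj₂ (v , k , rel , nm-v)
    normalise u v k (Fin.suc Fin.zero) rel nm-v = inj₁ (v , trans nm-v ω^1)
    normalise u v k (Fin.suc (Fin.suc Fin.zero)) rel nm-v = inj₁ (v · v , trans (nm-· v v) (trans (cong₂ _*_ nm-v nm-v) ω^2·ω^2))

  opaque
    -- The relation is linear in v and the norm has odd degree, so a sign in `nm v` is absorbed into
    -- v.
    normalised-descent : Descent → ∀ u → nm u ≡ 1# → NormRoot ⊎ (∃₂ λ v k → u · σ v ≡ scale (ω ^ k) v × nm v ≡ 1#)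
    normalised-descent descent u nm-u with descent u nm-u
    ... | v , k , rel , Nnm≡1 with unit-cases (nm v) Nnm≡1
    ...   | j , inj₁ eq = normalise u v k j rel eq
    ...   | j , inj₂ eq = normalise u (scale (- 1#) v) k j (begin
      u · σ (scale (- 1#) v)             ≡⟨ cong (u ·_) (σ-scale (- 1#) v) ⟩
      u · scale (- 1#) (σ v)             ≡⟨ scale-·ʳ (- 1#) u (σ v) ⟩
      scale (- 1#) (u · σ v)             ≡⟨ cong (scale (- 1#)) rel ⟩
      scale (- 1#) (scale (ω ^ k) v)     ≡⟨ trans (scale-scale (- 1#) (ω ^ k) v) (trans (cong (λ s → scale s v) (*-comm (- 1#) (ω ^ k))) (sym (scale-scale (ω ^ k) (- 1#) v))) ⟩
      scale (ω ^ k) (scale (- 1#) v) ∎) (nm-neg v (ω ^ toℕ j) eq)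

  opaque
    -- (σ − 1)² acts as −3σ on elements of norm 1: two descents extract a cube root up to roots of unity.
    cube-root : ∀ u v w k l → u · σ v ≡ scale (ω ^ k) v → v · σ w ≡ scale (ω ^ l) w → nm w ≡ 1# →
      let w′ = w · σ (σ w) in nm w′ ≡ 1# × u ≡ scale (ω ^ k) (w′ · (w′ · w′))
    cube-root u v w k l rel-v rel-w nm-w = nm-w′ , u≡
      where
      w′ : 𝕋
      w′ = w · σ (σ w)
      -- Since nm w = 1, w′ = w · σ²w is the inverse of σ w. So v = ωˡw/σ w, and u = ωᵏ · w · σ²w/(σ
      -- w)² = ωᵏw′³.
      w′σw : w′ · σ w ≡ 1ᵀ
      w′σw = trans (Solve.solve 3 (λ w s t → w :* t :* s := w :* (s :* t)) refl w (σ w) (σ (σ w))) (trans (nm-spec w) (cong const nm-w))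
      σw′σσw : σ w′ · σ (σ w) ≡ 1ᵀ
      σw′σσw = trans (sym (σ-· w′ (σ w))) (trans (cong σ w′σw) (σ-const 1#))
      nm-σ : ∀ x → nm (σ x) ≡ nm x
      nm-σ x = const-injective (begin
        const (nm (σ x))                      ≡⟨ sym (nm-spec (σ x)) ⟩
        σ x · (σ (σ x) · σ (σ (σ x)))         ≡⟨ cong (λ y → σ x · (σ (σ x) · y)) (σ³ x) ⟩
        σ x · (σ (σ x) · x)                   ≡⟨ Solve.solve 3 (λ x y z → y :* (z :* x) := x :* (y :* z)) refl x (σ x) (σ (σ x)) ⟩
        x · (σ x · σ (σ x))                   ≡⟨ nm-spec x ⟩
        const (nm x) ∎)
      nm-w′ : nm w′ ≡ 1#
      nm-w′ = trans (nm-· w (σ (σ w))) (trans (cong₂ _*_ nm-w (trans (nm-σ (σ w)) (trans (nm-σ w) nm-w))) (*-identityˡ 1#))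
      v≡ : v ≡ scale (ω ^ l) (w · w′)
      v≡ = begin
        v                          ≡⟨ sym (·-identityʳ v) ⟩
        v · 1ᵀ                     ≡⟨ cong (v ·_) (sym w′σw) ⟩
        v · (w′ · σ w)             ≡⟨ Solve.solve 3 (λ v a b → v :* (a :* b) := v :* b :* a) refl v w′ (σ w) ⟩
        v · σ w · w′               ≡⟨ cong (_· w′) rel-w ⟩
        scale (ω ^ l) w · w′       ≡⟨ scale-·ˡ (ω ^ l) w w′ ⟩
        scale (ω ^ l) (w · w′) ∎
      ω≢0 : ω ≢ 0#
      ω≢0 ()
      reduced : u · (σ w · σ w′) ≡ scale (ω ^ k) (w · w′)
      reduced = scale-cancel (ω ^ l) (^≢0# l ω≢0) (begin
        scale (ω ^ l) (u · (σ w · σ w′))        ≡⟨ sym (scale-·ʳ (ω ^ l) u (σ w · σ w′)) ⟩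
        u · scale (ω ^ l) (σ w · σ w′)          ≡⟨ cong (u ·_) (sym (trans (cong σ v≡) (trans (σ-scale (ω ^ l) (w · w′)) (cong (scale (ω ^ l)) (σ-· w w′))))) ⟩
        u · σ v                                 ≡⟨ rel-v ⟩
        scale (ω ^ k) v                         ≡⟨ cong (scale (ω ^ k)) v≡ ⟩
        scale (ω ^ k) (scale (ω ^ l) (w · w′))  ≡⟨ trans (scale-scale (ω ^ k) (ω ^ l) (w · w′)) (trans (cong (λ s → scale s (w · w′)) (*-comm (ω ^ k) (ω ^ l))) (sym (scale-scale (ω ^ l) (ω ^ k) (w · w′)))) ⟩
        scale (ω ^ l) (scale (ω ^ k) (w · w′)) ∎)
      u≡ : u ≡ scale (ω ^ k) (w′ · (w′ · w′))
      u≡ = begin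
        u                                            ≡⟨ sym (trans (cong (u ·_) (·-identityˡ 1ᵀ)) (·-identityʳ u)) ⟩
        u · (1ᵀ · 1ᵀ)                                ≡⟨ cong₂ (λ s t → u · (s · t)) (sym w′σw) (sym σw′σσw) ⟩
        u · (w′ · σ w · (σ w′ · σ (σ w)))            ≡⟨ Solve.solve 5 (λ u a s a′ t → u :* (a :* s :* (a′ :* t)) := u :* (s :* a′) :* (a :* t)) refl u w′ (σ w) (σ w′) (σ (σ w)) ⟩
        u · (σ w · σ w′) · (w′ · σ (σ w))            ≡⟨ cong (_· (w′ · σ (σ w))) reduced ⟩
        scale (ω ^ k) (w · w′) · (w′ · σ (σ w))      ≡⟨ scale-·ˡ (ω ^ k) (w · w′) (w′ · σ (σ w)) ⟩
        scale (ω ^ k) (w · w′ · (w′ · σ (σ w)))      ≡⟨ cong (scale (ω ^ k)) (Solve.solve 3 (λ w a t → w :* a :* (a :* t) := w :* t :* (a :* a)) refl w w′ (σ (σ w))) ⟩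
        scale (ω ^ k) (w′ · (w′ · w′)) ∎

  opaque
    scale-⋆ : ∀ t x n → scale t x ⋆ n ≡ scale (t ^ n) (x ⋆ n)
    scale-⋆ t x zero = sym (scale-1 1ᵀ)
    scale-⋆ t x (suc n) = trans (cong (scale t x ·_) (scale-⋆ t x n)) (trans (scale-·ˡ t x (scale (t ^ n) (x ⋆ n)))
      (trans (cong (scale t) (scale-·ʳ (t ^ n) x (x ⋆ n))) (scale-scale t (t ^ n) (x · (x ⋆ n)))))

  opaque
    -- Each stage leaves a root of unity ωᵏ; carrying the cube u³ instead of u kills it, so the
    -- stages compose to an exact 3ⁿ-th power.
    repeated-descent : Descent → ∀ n u → nm u ≡ 1# → NormRoot ⊎ (∃ λ w → nm w ≡ 1# × u ⋆ 3 ≡ (w ⋆ 3) ⋆ (3 ℕ.^ n))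
    repeated-descent descent zero u nm-u = inj₂ (u , nm-u , sym (·-identityʳ (u ⋆ 3)))
    repeated-descent descent (suc n) u nm-u with repeated-descent descent n u nm-u
    ... | inj₁ found = inj₁ found
    ... | inj₂ (u₁ , nm-u₁ , eq) with normalised-descent descent u₁ nm-u₁
    ...   | inj₁ found = inj₁ found
    ...   | inj₂ (v , k , rel-v , nm-v) with normalised-descent descent v nm-v
    ...     | inj₁ found = inj₁ found
    ...     | inj₂ (w , l , rel-w , nm-w) with cube-root u₁ v w k l rel-v rel-w nm-w
    ...       | nm-w′ , u₁≡ = inj₂ (w′ , nm-w′ , (begin
      u ⋆ 3                             ≡⟨ eq ⟩
      (u₁ ⋆ 3) ⋆ (3 ℕ.^ n)              ≡⟨ cong (_⋆ (3 ℕ.^ n)) u₁³ ⟩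
      ((w′ ⋆ 3) ⋆ 3) ⋆ (3 ℕ.^ n)        ≡⟨ ⋆-* (w′ ⋆ 3) 3 (3 ℕ.^ n) ⟩
      (w′ ⋆ 3) ⋆ (3 ℕ.^ suc n) ∎))
      where
      w′ : 𝕋
      w′ = w · σ (σ w)
      cube : w′ · (w′ · w′) ≡ w′ ⋆ 3
      cube = cong (λ y → w′ · (w′ · y)) (sym (·-identityʳ w′))
      u₁³ : u₁ ⋆ 3 ≡ (w′ ⋆ 3) ⋆ 3
      u₁³ = begin
        u₁ ⋆ 3                               ≡⟨ cong (_⋆ 3) (trans u₁≡ (cong (scale (ω ^ k)) cube)) ⟩
        scale (ω ^ k) (w′ ⋆ 3) ⋆ 3           ≡⟨ scale-⋆ (ω ^ k) (w′ ⋆ 3) 3 ⟩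
        scale ((ω ^ k) ^ 3) ((w′ ⋆ 3) ⋆ 3)   ≡⟨ cong (λ s → scale s ((w′ ⋆ 3) ⋆ 3)) (trans (sym (^-* ω k 3)) (ω^-mod3 0 k)) ⟩
        scale 1# ((w′ ⋆ 3) ⋆ 3)              ≡⟨ scale-1 ((w′ ⋆ 3) ⋆ 3) ⟩
        (w′ ⋆ 3) ⋆ 3 ∎

  _≡1[mod_] : 𝕋 → 𝔼 → Set
  x ≡1[mod t ] = ∃ λ z → x ≡ 1ᵀ +ᵀ scale t z

  opaque
    ≡1-· : ∀ t {x y} → x ≡1[mod t ] → y ≡1[mod t ] → (x · y) ≡1[mod t ]
    ≡1-· t (p , refl) (q , refl) = p +ᵀ q +ᵀ p · scale t q , (begin
      (1ᵀ +ᵀ scale t p) · (1ᵀ +ᵀ scale t q)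
        ≡⟨ Solve.solve 3 (λ e p q → (e :+ p) :* (e :+ q) := e :* e :+ (e :* p :+ e :* q :+ p :* q)) refl 1ᵀ (scale t p) (scale t q) ⟩
      1ᵀ · 1ᵀ +ᵀ (1ᵀ · scale t p +ᵀ 1ᵀ · scale t q +ᵀ scale t p · scale t q)
        ≡⟨ cong₂ _+ᵀ_ (·-identityˡ 1ᵀ) (cong₂ _+ᵀ_ (cong₂ _+ᵀ_ (·-identityˡ _) (·-identityˡ _)) (scale-·ˡ t p (scale t q))) ⟩
      1ᵀ +ᵀ (scale t p +ᵀ scale t q +ᵀ scale t (p · scale t q))
        ≡⟨ cong (λ y → 1ᵀ +ᵀ y) (sym (trans (scale-+ t (p +ᵀ q) (p · scale t q)) (cong (_+ᵀ scale t (p · scale t q)) (scale-+ t p q)))) ⟩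
      1ᵀ +ᵀ scale t (p +ᵀ q +ᵀ p · scale t q) ∎)

    ≡1-⋆ : ∀ t {x} n → x ≡1[mod t ] → (x ⋆ n) ≡1[mod t ]
    ≡1-⋆ t zero _ = 0ᵀ , sym (trans (cong (λ y → 1ᵀ +ᵀ y) (scale-0 t)) (trans (+ᵀ-comm 1ᵀ 0ᵀ) (+ᵀ-identityˡ 1ᵀ)))
    ≡1-⋆ t (suc n) x≡1 = ≡1-· t x≡1 (≡1-⋆ t n x≡1)

  opaque
    -- With t = 3s, of the terms 3tz, 3t²z², t³z³ only the last needs 3 ∣ t: t³ = 3t · st.
    ≡1-cube : ∀ s {x} → x ≡1[mod 3# * s ] → (x ⋆ 3) ≡1[mod 3# * (3# * s) ]
    ≡1-cube s (z , refl) = z +ᵀ scale t (z · z) +ᵀ scale (s * t) (z · (z · z)) , (begin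
      (1ᵀ +ᵀ y) · ((1ᵀ +ᵀ y) · ((1ᵀ +ᵀ y) · 1ᵀ))
        ≡⟨ cong (λ w → (1ᵀ +ᵀ y) · ((1ᵀ +ᵀ y) · w)) (·-identityʳ (1ᵀ +ᵀ y)) ⟩
      (1ᵀ +ᵀ y) · ((1ᵀ +ᵀ y) · (1ᵀ +ᵀ y))
        ≡⟨ Solve.solve 2 (λ e y → (e :+ y) :* ((e :+ y) :* (e :+ y))
             := e :* (e :* e) :+ ((e :* (e :* y) :+ e :* (e :* y) :+ e :* (e :* y)) :+ (e :* (y :* y) :+ e :* (y :* y) :+ e :* (y :* y)) :+ y :* (y :* y))) refl 1ᵀ y ⟩
      1ᵀ · (1ᵀ · 1ᵀ) +ᵀ ((1ᵀ · (1ᵀ · y) +ᵀ 1ᵀ · (1ᵀ · y) +ᵀ 1ᵀ · (1ᵀ · y)) +ᵀ (1ᵀ · (y · y) +ᵀ 1ᵀ · (y · y) +ᵀ 1ᵀ · (y · y)) +ᵀ y · (y · y))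
        ≡⟨ cong₂ _+ᵀ_ (e²) (cong₂ (λ v w → (v +ᵀ v +ᵀ v) +ᵀ (w +ᵀ w +ᵀ w) +ᵀ y · (y · y)) (trans (·-identityˡ _) (·-identityˡ y)) (·-identityˡ (y · y))) ⟩
      1ᵀ +ᵀ ((y +ᵀ y +ᵀ y) +ᵀ (y · y +ᵀ y · y +ᵀ y · y) +ᵀ y · (y · y))
        ≡⟨ cong (λ w → 1ᵀ +ᵀ w) (cong₂ _+ᵀ_ (cong₂ _+ᵀ_ (triple-scale t z) squares) cubes) ⟩
      1ᵀ +ᵀ (scale (3# * t) z +ᵀ scale (3# * t) (scale t (z · z)) +ᵀ scale (3# * t) (scale (s * t) (z · (z · z))))
        ≡⟨ cong (λ w → 1ᵀ +ᵀ w) (sym (trans (scale-+ (3# * t) _ _) (cong (_+ᵀ scale (3# * t) (scale (s * t) (z · (z · z)))) (scale-+ (3# * t) z (scale t (z · z)))))) ⟩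
      1ᵀ +ᵀ scale (3# * t) (z +ᵀ scale t (z · z) +ᵀ scale (s * t) (z · (z · z))) ∎)
      where
      t : 𝔼
      t = 3# * s
      y : 𝕋
      y = scale t z
      e² : 1ᵀ · (1ᵀ · 1ᵀ) ≡ 1ᵀ
      e² = trans (·-identityˡ _) (·-identityˡ 1ᵀ)
      y² : y · y ≡ scale (t * t) (z · z)
      y² = trans (scale-·ˡ t z y) (trans (cong (scale t) (scale-·ʳ t z z)) (scale-scale t t (z · z)))
      squares : y · y +ᵀ y · y +ᵀ y · y ≡ scale (3# * t) (scale t (z · z))
      squares = trans (cong (λ w → w +ᵀ w +ᵀ w) y²) (trans (triple-scale (t * t) (z · z)) (trans (cong (λ r → scale r (z · z)) (sym (*-assoc 3# t t))) (sym (scale-scale (3# * t) t (z · z)))))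
      opaque
        unfolding _+_
        f : ∀ s → 3# * s * (3# * s * (3# * s)) ≡ 3# * (3# * s) * (s * (3# * s))
        f = solve-∀ 𝔼-ring
      cubes : y · (y · y) ≡ scale (3# * t) (scale (s * t) (z · (z · z)))
      cubes = trans (cong (y ·_) y²) (trans (scale-·ˡ t z _) (trans (cong (scale t) (scale-·ʳ (t * t) z (z · z))) (trans (scale-scale t (t * t) _)
        (trans (cong (λ r → scale r (z · (z · z))) (f s)) (sym (scale-scale (3# * t) (s * t) _))))))

  opaque
    ≡1-3^ : ∀ n {x} → x ≡1[mod 3# ] → (x ⋆ (3 ℕ.^ n)) ≡1[mod 3# * 3# ^ n ]
    ≡1-3^ zero {x} x≡1 = subst₂ _≡1[mod_] (sym (·-identityʳ x)) (sym (*-identityʳ 3#)) x≡1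
    ≡1-3^ (suc n) {x} x≡1 = subst (_≡1[mod 3# * (3# * 3# ^ n) ]) (trans (⋆-* x (3 ℕ.^ n) 3) (cong (x ⋆_) (ℕP.*-comm (3 ℕ.^ n) 3)))
      (≡1-cube (3# ^ n) (≡1-3^ n x≡1))

  opaque
    some-power-≡1 : ∀ t K (c : 𝕋 → Fin K) → (∀ x y → c x ≡ c y → ∃ λ q → x ≡ y +ᵀ scale t q) →
      ∀ w → nm w ≡ 1# → ∃ λ d → 0 ℕ.< d × d ℕ.≤ K × (w ⋆ d) ≡1[mod t ]
    some-power-≡1 t K c separated w nm-w with FinP.pigeonhole (ℕP.n<1+n K) (λ i → c (w ⋆ toℕ i))
    ... | i , j , i<j , same = d , ℕP.m<n⇒0<n∸m i<j , ℕP.≤-trans (ℕP.m∸n≤m (toℕ j) (toℕ i)) (ℕP.≤-pred (FinP.toℕ<n j)) ,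
      go (separated (w ⋆ toℕ j) (w ⋆ toℕ i) (sym same))
      where
      d : ℕ
      d = toℕ j ℕ.∸ toℕ i
      w⁻¹ : 𝕋
      w⁻¹ = σ w · σ (σ w)
      inverse : w⁻¹ ⋆ toℕ i · (w ⋆ toℕ i) ≡ 1ᵀ
      inverse = trans (sym (⋆-· w⁻¹ w (toℕ i))) (trans (cong (_⋆ toℕ i) (trans (·-comm w⁻¹ w) (trans (nm-spec w) (cong const nm-w)))) (1⋆ (toℕ i)))
        where
        1⋆ : ∀ n → 1ᵀ ⋆ n ≡ 1ᵀ
        1⋆ zero = refl
        1⋆ (suc n) = trans (·-identityˡ _) (1⋆ n)
      go : (∃ λ q → w ⋆ toℕ j ≡ w ⋆ toℕ i +ᵀ scale t q) → (w ⋆ d) ≡1[mod t ]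
      go (z , wʲ≡) = w⁻¹ ⋆ toℕ i · z , (begin
        w ⋆ d                                            ≡⟨ sym (·-identityˡ _) ⟩
        1ᵀ · (w ⋆ d)                                     ≡⟨ cong (_· (w ⋆ d)) (sym inverse) ⟩
        w⁻¹ ⋆ toℕ i · (w ⋆ toℕ i) · (w ⋆ d)              ≡⟨ ·-assoc _ _ _ ⟩
        w⁻¹ ⋆ toℕ i · (w ⋆ toℕ i · (w ⋆ d))              ≡⟨ cong (w⁻¹ ⋆ toℕ i ·_) (sym (⋆-+ w (toℕ i) d)) ⟩
        w⁻¹ ⋆ toℕ i · (w ⋆ (toℕ i ℕ.+ d))                ≡⟨ cong (λ n → w⁻¹ ⋆ toℕ i · (w ⋆ n)) (ℕP.m+[n∸m]≡n (ℕP.<⇒≤ i<j)) ⟩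
        w⁻¹ ⋆ toℕ i · (w ⋆ toℕ j)                        ≡⟨ cong (w⁻¹ ⋆ toℕ i ·_) wʲ≡ ⟩
        w⁻¹ ⋆ toℕ i · (w ⋆ toℕ i +ᵀ scale t z)           ≡⟨ ·-distribˡ _ _ _ ⟩
        w⁻¹ ⋆ toℕ i · (w ⋆ toℕ i) +ᵀ w⁻¹ ⋆ toℕ i · scale t z ≡⟨ cong₂ _+ᵀ_ inverse (scale-·ʳ t _ z) ⟩
        1ᵀ +ᵀ scale t (w⁻¹ ⋆ toℕ i · z) ∎)

  opaque
    factorial-power-≡1 : ∀ t K (c : 𝕋 → Fin K) → (∀ x y → c x ≡ c y → ∃ λ q → x ≡ y +ᵀ scale t q) →
      ∀ w → nm w ≡ 1# → (w ⋆ (K !)) ≡1[mod t ]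
    factorial-power-≡1 t K c separated w nm-w with some-power-≡1 t K c separated w nm-w
    ... | d , 0<d , d≤K , w^d≡1 with divides-! K d 0<d d≤K
    ...   | ℕD.divides q K!≡ = subst (_≡1[mod t ]) (trans (⋆-* w d q) (cong (w ⋆_) (trans (ℕP.*-comm d q) (sym K!≡)))) (≡1-⋆ t q w^d≡1)

  opaque
    -- There are 9³ = 729 classes modulo 3, nine for each of the three coordinates. Every order
    -- occurring among the units of norm 1 modulo 3 is at most 729 and divides the factorial.
    exponent : ℕ
    exponent = ((3 ℕ.* 3) ℕ.* ((3 ℕ.* 3) ℕ.* (3 ℕ.* 3))) !

    exponent-mod-3 : ∀ w → nm w ≡ 1# → (w ⋆ exponent) ≡1[mod 3# ]
    exponent-mod-3 = factorial-power-≡1 3# _ (residueᵀ 3) (residueᵀ-≡ 3)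

    exponent≢0 : ℕ.NonZero exponent
    exponent≢0 = ℕP._!≢0 ((3 ℕ.* 3) ℕ.* ((3 ℕ.* 3) ℕ.* (3 ℕ.* 3)))

  geometric : 𝕋 → ℕ → 𝕋
  geometric u zero = 0ᵀ
  geometric u (suc n) = geometric u n +ᵀ u ⋆ n

  opaque
    geometric-sum : ∀ y n → (1ᵀ +ᵀ y) ⋆ n ≡ 1ᵀ +ᵀ y · geometric (1ᵀ +ᵀ y) n
    geometric-sum y zero = sym (trans (cong (λ w → 1ᵀ +ᵀ w) (·-zeroʳ y)) (trans (+ᵀ-comm 1ᵀ 0ᵀ) (+ᵀ-identityˡ 1ᵀ)))
    geometric-sum y (suc n) = begin
      (1ᵀ +ᵀ y) · u^n                        ≡⟨ Solve.solve 3 (λ e y p → (e :+ y) :* p := e :* p :+ y :* p) refl 1ᵀ y u^n ⟩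
      1ᵀ · u^n +ᵀ y · u^n                    ≡⟨ cong (_+ᵀ y · u^n) (trans (·-identityˡ u^n) (geometric-sum y n)) ⟩
      1ᵀ +ᵀ y · G +ᵀ y · u^n                 ≡⟨ Solve.solve 4 (λ e y g p → e :+ y :* g :+ y :* p := e :+ y :* (g :+ p)) refl 1ᵀ y G u^n ⟩
      1ᵀ +ᵀ y · (G +ᵀ u^n) ∎
      where
      u^n G : 𝕋
      u^n = (1ᵀ +ᵀ y) ⋆ n
      G = geometric (1ᵀ +ᵀ y) n

    geometric-mod : ∀ t u n → u ≡1[mod t ] → ∃ λ z → geometric u n ≡ const (nat n) +ᵀ scale t z
    geometric-mod t u zero _ = 0ᵀ , sym (trans (cong (λ w → 0ᵀ +ᵀ w) (scale-0 t)) (+ᵀ-identityˡ 0ᵀ))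
    geometric-mod t u (suc n) u≡1 with geometric-mod t u n u≡1 | ≡1-⋆ t n u≡1
    ... | z , eq | z′ , eq′ = z +ᵀ z′ , (begin
      geometric u n +ᵀ u ⋆ n                                       ≡⟨ cong₂ _+ᵀ_ eq eq′ ⟩
      const (nat n) +ᵀ scale t z +ᵀ (1ᵀ +ᵀ scale t z′)
        ≡⟨ Solve.solve 4 (λ c z e z′ → c :+ z :+ (e :+ z′) := (e :+ c) :+ (z :+ z′)) refl (const (nat n)) (scale t z) 1ᵀ (scale t z′) ⟩
      (1ᵀ +ᵀ const (nat n)) +ᵀ (scale t z +ᵀ scale t z′)
        ≡⟨ cong₂ _+ᵀ_ (trans (sym (const-+ 1# (nat n))) (cong const (sym (nat-suc n)))) (sym (scale-+ t z z′)) ⟩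
      const (nat (suc n)) +ᵀ scale t (z +ᵀ z′) ∎)

  opaque
    unfolding _+_ _+ᵀ_
    -- If n + 3nz vanished, cancelling n would make 3 a unit of ℤ[ω]. Applied to the geometric sum 1
    -- + u + ... + uⁿ⁻¹ ≡ n modulo 3n, this gives uⁿ ≠ 1.
    const+scale≢0 : ∀ n → .{{ℕ.NonZero n}} → ∀ z → const (nat n) +ᵀ scale (3# * nat n) z ≢ 0ᵀ
    const+scale≢0 n@(suc _) (tri a b c) eq = unit-3 (IsUnit⇒N≡1 {3#} (- a , *-cancelˡ (nat n) (λ ()) (trans (f (nat n) a) (trans (cong (λ w → nat n - w) (cong first eq)) (f′ (nat n))))))
      where
      unit-3 : N 3# ≢ 1
      unit-3 ()
      f : ∀ n a → n * (3# * (- a)) ≡ n - (n + 3# * n * a)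
      f = solve-∀ 𝔼-ring
      f′ : ∀ n → n - 0# ≡ n * 1#
      f′ = solve-∀ 𝔼-ring

    N-≥-of-∣ : ∀ n x → x ≢ 0# → (3# * 3# ^ n) ∣ x → n ℕ.< N x
    N-≥-of-∣ n x x≢0 (c , refl) = ℕP.<-≤-trans (n<3^ n)
      (ℕP.≤-trans (subst (3 ℕ.^ suc n ℕ.≤_) (sym (N-3^ (suc n))) (ℕP.m≤m*n (3 ℕ.^ suc n) (3 ℕ.^ suc n) {{ℕP.m^n≢0 3 (suc n)}}))
        (subst (N (3# ^ suc n) ℕ.≤_) (sym (N-* (3# ^ suc n) c)) (ℕP.m≤m*n (N (3# ^ suc n)) (N c) {{ℕ.≢-nonZero (N≢0 c≢0)}})))
      where
      c≢0 : c ≢ 0#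
      c≢0 refl = x≢0 (*-zeroʳ (3# ^ suc n))
      n<3^ : ∀ n → n ℕ.< 3 ℕ.^ suc n
      n<3^ zero = s≤s z≤n
      n<3^ (suc n) = ℕP.≤-trans (s≤s (n<3^ n)) (ℕP.≤-trans (ℕP.+-monoˡ-≤ (3 ℕ.^ suc n) (ℕP.m^n>0 3 (suc n))) (ℕP.+-monoʳ-≤ (3 ℕ.^ suc n) (ℕP.m≤m+n (3 ℕ.^ suc n) _)))
      N-3^ : ∀ n → N (3# ^ n) ≡ 3 ℕ.^ n ℕ.* 3 ℕ.^ n
      N-3^ zero = refl
      N-3^ (suc n) = trans (N-* 3# (3# ^ n)) (trans (cong (9 ℕ.*_) (N-3^ n)) (h (3 ℕ.^ n)))
        where
        h : ∀ t → 9 ℕ.* (t ℕ.* t) ≡ 3 ℕ.* t ℕ.* (3 ℕ.* t)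
        h = ℕR.solve-∀

    -- A nonzero multiple of 3ⁿ⁺¹ has norm greater than n, so n can be taken to be the norm of a
    -- nonzero coordinate.
    nonzero-not-divisible : ∀ x → x ≢ 0ᵀ → ∃ λ n → ∀ z → x ≢ scale (3# * 3# ^ n) z
    nonzero-not-divisible (tri a b c) x≢0 with a ≟ 0# | b ≟ 0# | c ≟ 0#
    ... | no a≢0 | _ | _ = N a , λ { (tri p q r) eq → ℕP.<-irrefl refl (N-≥-of-∣ (N a) a a≢0 (p , cong (λ { (tri w _ _) → w }) eq)) }
    ... | yes _ | no b≢0 | _ = N b , λ { (tri p q r) eq → ℕP.<-irrefl refl (N-≥-of-∣ (N b) b b≢0 (q , cong (λ { (tri _ w _) → w }) eq)) }
    ... | yes _ | yes _ | no c≢0 = N c , λ { (tri p q r) eq → ℕP.<-irrefl refl (N-≥-of-∣ (N c) c c≢0 (r , cong (λ { (tri _ _ w) → w }) eq)) }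
    ... | yes refl | yes refl | yes refl = ⊥-elim (x≢0 refl)

  -- A unit u ≠ 1 congruent to 1 modulo 3·3·exponent has u^(3·exponent) ≠ 1, so the cube roots cannot be extracted forever.
  opaque
    norm-root : Descent → (∀ x → nm x ≡ 0# → x ≡ 0ᵀ) → ∀ u y → nm u ≡ 1# → y ≢ 0ᵀ → u ≡ 1ᵀ +ᵀ y →
      u ≡1[mod 3# * nat (3 ℕ.* exponent) ] → NormRoot
    norm-root descent anisotropic u y nm-u y≢0 u≡ u≡1 = go (nonzero-not-divisible (y · G) yG≢0)
      where
      E : ℕ
      E = 3 ℕ.* exponent
      G : 𝕋
      G = geometric (1ᵀ +ᵀ y) E
      u^E : u ⋆ E ≡ 1ᵀ +ᵀ y · G
      u^E = trans (cong (_⋆ E) u≡) (geometric-sum y E)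
      instance
        E≢0 : ℕ.NonZero E
        E≢0 = ℕP.m*n≢0 3 exponent {{_}} {{exponent≢0}}
      G≢0 : G ≢ 0ᵀ
      G≢0 G≡0 with geometric-mod (3# * nat E) (1ᵀ +ᵀ y) E (subst (_≡1[mod 3# * nat E ]) u≡ u≡1)
      ... | z , G≡ = const+scale≢0 E z (trans (sym G≡) G≡0)
      yG≢0 : y · G ≢ 0ᵀ
      yG≢0 yG≡0 = *≢0# (y≢0 ∘ anisotropic y) (G≢0 ∘ anisotropic G) (trans (sym (nm-· y G)) (trans (cong nm yG≡0) nm-0))
        where
        nm-0 : nm 0ᵀ ≡ 0#
        nm-0 = trans (nm-const 0#) (*-zeroˡ _)
      go : (∃ λ n → ∀ z → y · G ≢ scale (3# * 3# ^ n) z) → NormRoot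
      go (n , not-divisible) with repeated-descent descent n u nm-u
      ... | inj₁ found = found
      -- With M the common exponent, w³ᴹ is 1 modulo 3, so its 3ⁿ-th power is 1 modulo 3ⁿ⁺¹. That
      -- power is uᴱ, and n was chosen so that 3ⁿ⁺¹ does not divide uᴱ - 1.
      ... | inj₂ (w , nm-w , u³≡) = ⊥-elim (contradiction-with (subst (_≡1[mod 3# * 3# ^ n ]) powers (≡1-3^ n w³ᴹ≡1)))
        where
        M : ℕ
        M = exponent
        w³ᴹ≡1 : ((w ⋆ 3) ⋆ M) ≡1[mod 3# ]
        w³ᴹ≡1 = subst (_≡1[mod 3# ]) (trans (⋆-* w M 3) (trans (cong (w ⋆_) (ℕP.*-comm M 3)) (sym (⋆-* w 3 M)))) (≡1-⋆ 3# 3 (exponent-mod-3 w nm-w))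
        powers : ((w ⋆ 3) ⋆ M) ⋆ (3 ℕ.^ n) ≡ u ⋆ E
        powers = begin
          ((w ⋆ 3) ⋆ M) ⋆ (3 ℕ.^ n)     ≡⟨ trans (⋆-* (w ⋆ 3) M (3 ℕ.^ n)) (trans (cong ((w ⋆ 3) ⋆_) (ℕP.*-comm M (3 ℕ.^ n))) (sym (⋆-* (w ⋆ 3) (3 ℕ.^ n) M))) ⟩
          ((w ⋆ 3) ⋆ (3 ℕ.^ n)) ⋆ M     ≡⟨ cong (_⋆ M) (sym u³≡) ⟩
          (u ⋆ 3) ⋆ M                   ≡⟨ ⋆-* u 3 M ⟩
          u ⋆ E ∎
        contradiction-with : (u ⋆ E) ≡1[mod 3# * 3# ^ n ] → ⊥
        contradiction-with (z , eq) = not-divisible z (+ᵀ-cancelˡ (trans (sym u^E) eq))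
          where
          +ᵀ-cancelˡ : ∀ {a b} → 1ᵀ +ᵀ a ≡ 1ᵀ +ᵀ b → a ≡ b
          +ᵀ-cancelˡ {a} {b} eq = trans (drop a) (trans (cong (λ w → -ᵀ 1ᵀ +ᵀ w) eq) (sym (drop b)))
            where
            drop : ∀ a → a ≡ -ᵀ 1ᵀ +ᵀ (1ᵀ +ᵀ a)
            drop a = sym (trans (sym (+ᵀ-assoc (-ᵀ 1ᵀ) 1ᵀ a)) (trans (cong (_+ᵀ a) (-ᵀ-inverseˡ 1ᵀ)) (+ᵀ-identityˡ a)))

-- Approximation of the cube root of α in ℚ(ζ₃).

square-mono⁻¹ : ∀ m n → m ℕ.* m ℕ.≤ n ℕ.* n → m ℕ.≤ n
square-mono⁻¹ m n m²≤n² with ℕP.≤-total m n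
... | inj₁ m≤n = m≤n
... | inj₂ n≤m with ℕP.m≤n⇒m<n∨m≡n n≤m
...   | inj₂ refl = ℕP.≤-refl
...   | inj₁ n<m = ⊥-elim (ℕP.<⇒≱ (ℕP.*-mono-< n<m n<m) m²≤n²)

opaque
  unfolding _+_
  -- The triangle inequality for the absolute value √N, stated without square roots. The cross term
  -- T is the trace of x · conj y, and the identity 4 · N x · N y = T² + 3W² bounds it.
  N-+-≤ : ∀ x y R S → N x ℕ.≤ R ℕ.* R → N y ℕ.≤ S ℕ.* S → N (x + y) ℕ.≤ (R ℕ.+ S) ℕ.* (R ℕ.+ S)
  N-+-≤ x@(eis a b) y@(eis c d) R S Nx≤ Ny≤ = begin
    N (x + y)                               ≡⟨ cong ℤ.∣_∣ (expand a b c d) ⟩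
    ℤ.∣ normℤ x ℤ.+ normℤ y ℤ.+ T ∣           ≤⟨ ℤP.∣i+j∣≤∣i∣+∣j∣ (normℤ x ℤ.+ normℤ y) T ⟩
    ℤ.∣ normℤ x ℤ.+ normℤ y ∣ ℕ.+ ℤ.∣ T ∣      ≤⟨ ℕP.+-mono-≤ (ℕP.≤-trans (ℤP.∣i+j∣≤∣i∣+∣j∣ (normℤ x) (normℤ y)) (ℕP.+-mono-≤ Nx≤ Ny≤)) T≤ ⟩
    (R ℕ.* R ℕ.+ S ℕ.* S) ℕ.+ 2 ℕ.* (R ℕ.* S)  ≡⟨ collect R S ⟩
    (R ℕ.+ S) ℕ.* (R ℕ.+ S) ∎
    where
    open ℕP.≤-Reasoning
    T W : ℤ
    T = (+ 2) ℤ.* (a ℤ.* c) ℤ.- a ℤ.* d ℤ.- b ℤ.* c ℤ.+ (+ 2) ℤ.* (b ℤ.* d)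
    W = a ℤ.* d ℤ.- b ℤ.* c
    expand : ∀ a b c d → (a ℤ.+ c) ℤ.* (a ℤ.+ c) ℤ.- (a ℤ.+ c) ℤ.* (b ℤ.+ d) ℤ.+ (b ℤ.+ d) ℤ.* (b ℤ.+ d)
      ≡ (a ℤ.* a ℤ.- a ℤ.* b ℤ.+ b ℤ.* b) ℤ.+ (c ℤ.* c ℤ.- c ℤ.* d ℤ.+ d ℤ.* d)
        ℤ.+ ((+ 2) ℤ.* (a ℤ.* c) ℤ.- a ℤ.* d ℤ.- b ℤ.* c ℤ.+ (+ 2) ℤ.* (b ℤ.* d))
    expand = ℤR.solve-∀
    collect : ∀ R S → (R ℕ.* R ℕ.+ S ℕ.* S) ℕ.+ 2 ℕ.* (R ℕ.* S) ≡ (R ℕ.+ S) ℕ.* (R ℕ.+ S)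
    collect = ℕR.solve-∀
    cauchy-schwarz : ∀ a b c d → (+ 4) ℤ.* ((a ℤ.* a ℤ.- a ℤ.* b ℤ.+ b ℤ.* b) ℤ.* (c ℤ.* c ℤ.- c ℤ.* d ℤ.+ d ℤ.* d))
      ≡ ((+ 2) ℤ.* (a ℤ.* c) ℤ.- a ℤ.* d ℤ.- b ℤ.* c ℤ.+ (+ 2) ℤ.* (b ℤ.* d)) ℤ.* ((+ 2) ℤ.* (a ℤ.* c) ℤ.- a ℤ.* d ℤ.- b ℤ.* c ℤ.+ (+ 2) ℤ.* (b ℤ.* d))
        ℤ.+ (+ 3) ℤ.* ((a ℤ.* d ℤ.- b ℤ.* c) ℤ.* (a ℤ.* d ℤ.- b ℤ.* c))
    cauchy-schwarz = ℤR.solve-∀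
    T²≤ : ℤ.∣ T ∣ ℕ.* ℤ.∣ T ∣ ℕ.≤ 4 ℕ.* (N x ℕ.* N y)
    T²≤ = subst (ℤ.∣ T ∣ ℕ.* ℤ.∣ T ∣ ℕ.≤_) (ℤP.+-injective (sym (trans (ℤP.pos-* 4 (N x ℕ.* N y))
      (trans (cong ((+ 4) ℤ.*_) (trans (ℤP.pos-* (N x) (N y)) (cong₂ ℤ._*_ (+N x) (+N y))))
        (trans (cauchy-schwarz a b c d) (cong₂ ℤ._+_ (sq≡ T) (trans (cong ((+ 3) ℤ.*_) (sq≡ W)) (sym (ℤP.pos-* 3 (ℤ.∣ W ∣ ℕ.* ℤ.∣ W ∣)))))))))) (ℕP.m≤m+n (ℤ.∣ T ∣ ℕ.* ℤ.∣ T ∣) (3 ℕ.* (ℤ.∣ W ∣ ℕ.* ℤ.∣ W ∣)))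
    T≤ : ℤ.∣ T ∣ ℕ.≤ 2 ℕ.* (R ℕ.* S)
    T≤ = square-mono⁻¹ _ _ (ℕP.≤-trans T²≤ (ℕP.≤-trans (ℕP.*-monoʳ-≤ 4 (ℕP.*-mono-≤ Nx≤ Ny≤)) (ℕP.≤-reflexive (f R S))))
      where
      f : ∀ R S → 4 ℕ.* (R ℕ.* R ℕ.* (S ℕ.* S)) ≡ 2 ℕ.* (R ℕ.* S) ℕ.* (2 ℕ.* (R ℕ.* S))
      f = ℕR.solve-∀

  N-neg : ∀ x → N (- x) ≡ N x
  N-neg (eis a b) = cong ℤ.∣_∣ (f a b)
    where
    f : ∀ a b → (ℤ.- a) ℤ.* (ℤ.- a) ℤ.- (ℤ.- a) ℤ.* (ℤ.- b) ℤ.+ (ℤ.- b) ℤ.* (ℤ.- b) ≡ a ℤ.* a ℤ.- a ℤ.* b ℤ.+ b ℤ.* b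
    f = ℤR.solve-∀

opaque
  -- (1 + 1/f)ᵏ ≥ 1 + k/f, cleared of denominators.
  bernoulli : ∀ f k → f ℕ.^ k ℕ.* (f ℕ.+ k) ℕ.≤ f ℕ.* suc f ℕ.^ k
  bernoulli f zero = ℕP.≤-reflexive (e f)
    where
    e : ∀ f → 1 ℕ.* (f ℕ.+ 0) ≡ f ℕ.* 1
    e = ℕR.solve-∀
  bernoulli f (suc k) = begin
    f ℕ.* f ℕ.^ k ℕ.* (f ℕ.+ suc k)                          ≤⟨ ℕP.m≤m+n _ (f ℕ.^ k ℕ.* k) ⟩
    f ℕ.* f ℕ.^ k ℕ.* (f ℕ.+ suc k) ℕ.+ f ℕ.^ k ℕ.* k        ≡⟨ e₁ f (f ℕ.^ k) k ⟩
    suc f ℕ.* (f ℕ.^ k ℕ.* (f ℕ.+ k))                        ≤⟨ ℕP.*-monoʳ-≤ (suc f) (bernoulli f k) ⟩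
    suc f ℕ.* (f ℕ.* suc f ℕ.^ k)                            ≡⟨ e₂ f (suc f) (suc f ℕ.^ k) ⟩
    f ℕ.* (suc f ℕ.* suc f ℕ.^ k) ∎
    where
    open ℕP.≤-Reasoning
    e₁ : ∀ f p k → f ℕ.* p ℕ.* (f ℕ.+ suc k) ℕ.+ p ℕ.* k ≡ suc f ℕ.* (p ℕ.* (f ℕ.+ k))
    e₁ = ℕR.solve-∀
    e₂ : ∀ f g p → g ℕ.* (f ℕ.* p) ≡ f ℕ.* (g ℕ.* p)
    e₂ = ℕR.solve-∀

  -- For f > 0, (n/f)ᵏ ≥ (1 + 1/f)ᵏ ≥ k/f ≥ E.
  power-gap : ∀ E f n k → f ℕ.< n → E ℕ.* f ℕ.≤ k → 1 ℕ.≤ k → E ℕ.* f ℕ.^ k ℕ.≤ n ℕ.^ k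
  power-gap E zero n (suc k) _ _ _ = subst (ℕ._≤ n ℕ.* n ℕ.^ k) (sym (ℕP.*-zeroʳ E)) z≤n
  power-gap E f@(suc _) n k f<n Ef≤k _ = ℕP.*-cancelˡ-≤ f (begin
    f ℕ.* (E ℕ.* f ℕ.^ k)    ≡⟨ e f E (f ℕ.^ k) ⟩
    f ℕ.^ k ℕ.* (E ℕ.* f)    ≤⟨ ℕP.*-monoʳ-≤ (f ℕ.^ k) (ℕP.≤-trans Ef≤k (ℕP.m≤n+m k f)) ⟩
    f ℕ.^ k ℕ.* (f ℕ.+ k)    ≤⟨ bernoulli f k ⟩
    f ℕ.* suc f ℕ.^ k        ≤⟨ ℕP.*-monoʳ-≤ f (ℕP.^-monoˡ-≤ k f<n) ⟩
    f ℕ.* n ℕ.^ k ∎)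
    where
    open ℕP.≤-Reasoning
    e : ∀ f E p → f ℕ.* (E ℕ.* p) ≡ p ℕ.* (E ℕ.* f)
    e = ℕR.solve-∀

4# 8# 18# : 𝔼
4# = eis (+ 4) +0
8# = eis (+ 8) +0
18# = eis (+ 18) +0

opaque
  unfolding _+_
  N-3⁴ : ∀ A → N (27# * (A * A * (A * A))) ≡ 729 ℕ.* (N A ℕ.* N A ℕ.* (N A ℕ.* N A))
  N-3⁴ A = trans (N-* 27# (A * A * (A * A))) (cong (729 ℕ.*_) (trans (N-* (A * A) (A * A)) (cong₂ ℕ._*_ (N-* A A) (N-* A A))))

opaque
  -- With r₃ = A − F standing for the cube of the approximation, one step of the iteration
  -- r ↦ r(4A − r₃)/3A squares the relative error: 18A² + 8AF + F² has coefficients summing to 27.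
  N-error : ∀ A F → N F ℕ.≤ N A → N (F * F * (18# * (A * A) + 8# * (A * F) + F * F)) ℕ.≤ N F ℕ.* N F ℕ.* (729 ℕ.* (N A ℕ.* N A))
  N-error A F NF≤NA = begin
    N (F * F * (18# * (A * A) + 8# * (A * F) + F * F))    ≡⟨ trans (N-* (F * F) _) (cong (ℕ._* N (18# * (A * A) + 8# * (A * F) + F * F)) (N-* F F)) ⟩
    N F ℕ.* N F ℕ.* N (18# * (A * A) + 8# * (A * F) + F * F)
      ≤⟨ ℕP.*-monoʳ-≤ (N F ℕ.* N F) (N-+-≤ (18# * (A * A) + 8# * (A * F)) (F * F) (18 ℕ.* a ℕ.+ 8 ℕ.* a) a
           (N-+-≤ (18# * (A * A)) (8# * (A * F)) (18 ℕ.* a) (8 ℕ.* a) (ℕP.≤-reflexive bound₁) bound₂) bound₃) ⟩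
    N F ℕ.* N F ℕ.* ((18 ℕ.* a ℕ.+ 8 ℕ.* a ℕ.+ a) ℕ.* (18 ℕ.* a ℕ.+ 8 ℕ.* a ℕ.+ a))  ≡⟨ cong (N F ℕ.* N F ℕ.*_) (f a) ⟩
    N F ℕ.* N F ℕ.* (729 ℕ.* (a ℕ.* a)) ∎
    where
    open ℕP.≤-Reasoning
    a : ℕ
    a = N A
    f : ∀ a → (18 ℕ.* a ℕ.+ 8 ℕ.* a ℕ.+ a) ℕ.* (18 ℕ.* a ℕ.+ 8 ℕ.* a ℕ.+ a) ≡ 729 ℕ.* (a ℕ.* a)
    f = ℕR.solve-∀
    f₁ : ∀ a → 324 ℕ.* (a ℕ.* a) ≡ 18 ℕ.* a ℕ.* (18 ℕ.* a)
    f₁ = ℕR.solve-∀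
    f₂ : ∀ a → 64 ℕ.* (a ℕ.* a) ≡ 8 ℕ.* a ℕ.* (8 ℕ.* a)
    f₂ = ℕR.solve-∀
    bound₁ : N (18# * (A * A)) ≡ 18 ℕ.* a ℕ.* (18 ℕ.* a)
    bound₁ = trans (N-* 18# (A * A)) (trans (cong₂ ℕ._*_ (N-int (+ 18)) (N-* A A)) (f₁ a))
    bound₂ : N (8# * (A * F)) ℕ.≤ 8 ℕ.* a ℕ.* (8 ℕ.* a)
    bound₂ = ℕP.≤-trans (ℕP.≤-reflexive (trans (N-* 8# (A * F)) (cong₂ ℕ._*_ (N-int (+ 8)) (N-* A F))))
      (ℕP.≤-trans (ℕP.*-monoʳ-≤ 64 (ℕP.*-monoʳ-≤ a NF≤NA)) (ℕP.≤-reflexive (f₂ a)))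
    bound₃ : N (F * F) ℕ.≤ a ℕ.* a
    bound₃ = ℕP.≤-trans (ℕP.≤-reflexive (N-* F F)) (ℕP.*-mono-≤ NF≤NA NF≤NA)

module CubeRoot (α : 𝔼) (α≡1 : λ³ ∣ α - 1#) where
  -- t/s is the approximation of ∛α; N F/N A is the squared absolute value of the relative error of
  -- its cube.
  A F : 𝔼 → 𝔼 → 𝔼
  A t s = α * (s * s * s)
  F t s = A t s - t * t * t

  opaque
    unfolding _+_
    -- The step is Newton's method for α/r³ = 1 with r = t/s. In this form the denominator is 3As,
    -- so t may be any number, zero included.
    next-A : ∀ t s → A (t * (4# * A t s - t * t * t)) (3# * A t s * s) ≡ 27# * (A t s * A t s * (A t s * A t s))
    next-A t s = f α (A t s) s
      where
      f : ∀ α A s → α * ((3# * A * s) * (3# * A * s) * (3# * A * s)) ≡ 27# * (A * A * (A * (α * (s * s * s))))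
      f = solve-∀ 𝔼-ring

    next-F : ∀ t s → F (t * (4# * A t s - t * t * t)) (3# * A t s * s)
      ≡ F t s * F t s * (18# * (A t s * A t s) + 8# * (A t s * F t s) + F t s * F t s)
    next-F t s = trans (cong (λ w → w - (t * (4# * A t s - t * t * t)) * (t * (4# * A t s - t * t * t)) * (t * (4# * A t s - t * t * t))) (next-A t s))
      (trans (cong (λ w → 27# * (A t s * A t s * (A t s * A t s)) - w) (g t (4# * A t s - t * t * t))) (f (A t s) (t * t * t)))
      where
      g : ∀ t u → t * u * (t * u) * (t * u) ≡ t * t * t * (u * u * u)
      g = solve-∀ 𝔼-ring
      f : ∀ A P → 27# * (A * A * (A * A)) - P * ((4# * A - P) * (4# * A - P) * (4# * A - P))
        ≡ (A - P) * (A - P) * (18# * (A * A) + 8# * (A * (A - P)) + (A - P) * (A - P))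
      f = solve-∀ 𝔼-ring

  trace : 𝔼 → ℤ
  trace (eis x y) = (+ 2) ℤ.* x ℤ.- y

  opaque
    unfolding _+_
    -- Traces of multiples of λ³ are divisible by 3, so the trace of α is 2 modulo 3.
    trace-α≢0 : trace α ≢ +0
    trace-α≢0 tr≡0 = go α≡1
      where
      open ≡-Reasoning
      f : ∀ p q → + 2 ≡ ((+ 2) ℤ.* ((+ 1) ℤ.+ (-[1+ 2 ] ℤ.* p ℤ.- -[1+ 5 ] ℤ.* q)) ℤ.- (+0 ℤ.+ (-[1+ 2 ] ℤ.* q ℤ.+ -[1+ 5 ] ℤ.* p ℤ.- -[1+ 5 ] ℤ.* q)))
        ℤ.+ -[1+ 2 ] ℤ.* q ℤ.* (+ 3)
      f = ℤR.solve-∀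
      go : λ³ ∣ α - 1# → ⊥
      go (eis p q , eq) = toWitnessFalse {a? = 3 ℕD.∣? 2} _ (ℤS.∣⇒∣ᵤ (ℤS.divides (-[1+ 2 ] ℤ.* q) (begin
          + 2                                              ≡⟨ f p q ⟩
          trace (1# + λ³ * eis p q) ℤ.+ -[1+ 2 ] ℤ.* q ℤ.* (+ 3) ≡⟨ cong (λ w → w ℤ.+ -[1+ 2 ] ℤ.* q ℤ.* (+ 3)) (trans (cong trace (sym (trans (add-sub-split α 1#) (cong (λ w → 1# + w) eq)))) tr≡0) ⟩
          +0 ℤ.+ -[1+ 2 ] ℤ.* q ℤ.* (+ 3)                        ≡⟨ ℤP.+-identityˡ _ ⟩
          -[1+ 2 ] ℤ.* q ℤ.* (+ 3) ∎)))

    α≢0 : α ≢ 0#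
    α≢0 α≡0 = trace-α≢0 (cong trace α≡0)

    -- N(x - 1) = N x - tr x + 1.
    N-shift : ∀ x k → trace x ≡ + (2 ℕ.+ k) → N (x - 1# * 1# * 1#) ℕ.< N x
    N-shift x@(eis a b) k tr≡ = subst (N (x - 1#) ℕ.<_) (sym Nx≡) (ℕP.m<m+n (N (x - 1#)) (s≤s z≤n))
      where
      f : ∀ a b → a ℤ.* a ℤ.- a ℤ.* b ℤ.+ b ℤ.* b
        ≡ ((a ℤ.+ -[1+ 0 ]) ℤ.* (a ℤ.+ -[1+ 0 ]) ℤ.- (a ℤ.+ -[1+ 0 ]) ℤ.* (b ℤ.+ +0) ℤ.+ (b ℤ.+ +0) ℤ.* (b ℤ.+ +0)) ℤ.+ (((+ 2) ℤ.* a ℤ.- b) ℤ.- (+ 1))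
      f = ℤR.solve-∀
      Nx≡ : N x ≡ N (x - 1#) ℕ.+ suc k
      Nx≡ = ℤP.+-injective (trans (+N x) (trans (f a b) (cong₂ ℤ._+_ (sym (+N (x - 1#))) (cong (ℤ._- (+ 1)) tr≡))))

    N-shift⁻ : ∀ x k → trace x ≡ ℤ.- (+ (2 ℕ.+ k)) → N (x - (- 1#) * (- 1#) * (- 1#)) ℕ.< N x
    N-shift⁻ x@(eis a b) k tr≡ = subst (N (x - (- 1#)) ℕ.<_) (sym Nx≡) (ℕP.m<m+n (N (x - (- 1#))) (s≤s z≤n))
      where
      f : ∀ a b → a ℤ.* a ℤ.- a ℤ.* b ℤ.+ b ℤ.* b
        ≡ ((a ℤ.+ (+ 1)) ℤ.* (a ℤ.+ (+ 1)) ℤ.- (a ℤ.+ (+ 1)) ℤ.* (b ℤ.+ +0) ℤ.+ (b ℤ.+ +0) ℤ.* (b ℤ.+ +0)) ℤ.+ (ℤ.- ((+ 2) ℤ.* a ℤ.- b) ℤ.- (+ 1))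
      f = ℤR.solve-∀
      Nx≡ : N x ≡ N (x - (- 1#)) ℕ.+ suc k
      Nx≡ = ℤP.+-injective (trans (+N x) (trans (f a b) (cong₂ ℤ._+_ (sym (+N (x - (- 1#)))) (cong (λ w → ℤ.- w ℤ.- (+ 1)) tr≡))))

    trace-8 : ∀ x → trace (x * (2# * 2# * 2#)) ≡ (+ 8) ℤ.* trace x
    trace-8 (eis a b) = f a b
      where
      f : ∀ a b → (+ 2) ℤ.* (a ℤ.* (+ 8) ℤ.- b ℤ.* +0) ℤ.- (a ℤ.* +0 ℤ.+ b ℤ.* (+ 8) ℤ.- b ℤ.* +0) ≡ (+ 8) ℤ.* ((+ 2) ℤ.* a ℤ.- b)
      f = ℤR.solve-∀

  opaque
    -- The iteration converges from any relative error below 1. With s = 2 and t = ± 1 this asks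
    -- that ± tr(8α) > 1: the sign of the trace of α selects t, and the factor 2³ covers a trace of
    -- absolute value 1.
    initial : ∃ λ t → N (F t 2#) ℕ.< N (A t 2#)
    initial with trace α in tr≡
    ... | + zero = ⊥-elim (trace-α≢0 tr≡)
    ... | + suc k = 1# , N-shift (A 1# 2#) (6 ℕ.+ 8 ℕ.* k) (trans (trace-8 α) (trans (cong ((+ 8) ℤ.*_) tr≡) (trans (sym (ℤP.pos-* 8 (suc k))) (cong +_ (f k)))))
      where
      f : ∀ k → 8 ℕ.* suc k ≡ 2 ℕ.+ (6 ℕ.+ 8 ℕ.* k)
      f = ℕR.solve-∀
    ... | -[1+ k ] = - 1# , N-shift⁻ (A (- 1#) 2#) (6 ℕ.+ 8 ℕ.* k) (trans (trace-8 α) (trans (cong ((+ 8) ℤ.*_) tr≡)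
        (trans (sym (ℤP.neg-distribʳ-* (+ 8) (+ suc k))) (cong ℤ.-_ (trans (sym (ℤP.pos-* 8 (suc k))) (cong +_ (f k)))))))
      where
      f : ∀ k → 8 ℕ.* suc k ≡ 2 ℕ.+ (6 ℕ.+ 8 ℕ.* k)
      f = ℕR.solve-∀

  A≢0 : ∀ t {s} → s ≢ 0# → A t s ≢ 0#
  A≢0 t s≢0 = *≢0# α≢0 (*≢0# (*≢0# s≢0 s≢0) s≢0)

  f₀ n₀ : ℕ
  f₀ = N (F (proj₁ initial) 2#)
  n₀ = N (A (proj₁ initial) 2#)

  -- f₀/n₀ < 1 is the initial squared relative error, and the current one is at most its k-th power;
  -- a Newton step doubles k.
  record Approximation (k : ℕ) : Set where
    field
      t s : 𝔼
      s≢0 : s ≢ 0#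
      F<A : N (F t s) ℕ.< N (A t s)
      ratio : N (F t s) ℕ.* n₀ ℕ.^ k ℕ.≤ N (A t s) ℕ.* f₀ ℕ.^ k

  opaque
    refine : ∀ {k} → Approximation k → Approximation (k ℕ.+ k)
    refine {k} ap = record
      { t = t′ ; s = s′ ; s≢0 = *≢0# (*≢0# 3≢0 (A≢0 t s≢0)) s≢0
      ; F<A = ℕP.≤-<-trans F′≤ (subst (N (F t s) ℕ.* N (F t s) ℕ.* (729 ℕ.* (n ℕ.* n)) ℕ.<_) (sym A′≡)
          (subst (N (F t s) ℕ.* N (F t s) ℕ.* (729 ℕ.* (n ℕ.* n)) ℕ.<_) (e₀ n) (ℕP.*-monoˡ-< (729 ℕ.* (n ℕ.* n)) {{ℕ.≢-nonZero (n²≢0)}} (ℕP.*-mono-< F<A F<A))))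
      ; ratio = begin
          N (F t′ s′) ℕ.* n₀ ℕ.^ (k ℕ.+ k)                             ≤⟨ ℕP.*-monoˡ-≤ (n₀ ℕ.^ (k ℕ.+ k)) F′≤ ⟩
          f ℕ.* f ℕ.* (729 ℕ.* (n ℕ.* n)) ℕ.* n₀ ℕ.^ (k ℕ.+ k)         ≡⟨ cong (f ℕ.* f ℕ.* (729 ℕ.* (n ℕ.* n)) ℕ.*_) (ℕP.^-distribˡ-+-* n₀ k k) ⟩
          f ℕ.* f ℕ.* (729 ℕ.* (n ℕ.* n)) ℕ.* (n₀ ℕ.^ k ℕ.* n₀ ℕ.^ k)  ≡⟨ e₁ f n (n₀ ℕ.^ k) ⟩
          729 ℕ.* (n ℕ.* n) ℕ.* ((f ℕ.* n₀ ℕ.^ k) ℕ.* (f ℕ.* n₀ ℕ.^ k)) ≤⟨ ℕP.*-monoʳ-≤ (729 ℕ.* (n ℕ.* n)) (ℕP.*-mono-≤ ratio ratio) ⟩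
          729 ℕ.* (n ℕ.* n) ℕ.* ((n ℕ.* f₀ ℕ.^ k) ℕ.* (n ℕ.* f₀ ℕ.^ k)) ≡⟨ e₂ n (f₀ ℕ.^ k) ⟩
          729 ℕ.* (n ℕ.* n ℕ.* (n ℕ.* n)) ℕ.* (f₀ ℕ.^ k ℕ.* f₀ ℕ.^ k)   ≡⟨ cong₂ ℕ._*_ (sym A′≡) (sym (ℕP.^-distribˡ-+-* f₀ k k)) ⟩
          N (A t′ s′) ℕ.* f₀ ℕ.^ (k ℕ.+ k) ∎ }
      where
      open Approximation ap
      open ℕP.≤-Reasoning
      t′ s′ : 𝔼
      t′ = t * (4# * A t s - t * t * t)
      s′ = 3# * A t s * s
      f n : ℕ
      f = N (F t s)
      n = N (A t s)
      F′≤ : N (F t′ s′) ℕ.≤ f ℕ.* f ℕ.* (729 ℕ.* (n ℕ.* n))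
      F′≤ = ℕP.≤-trans (ℕP.≤-reflexive (cong N (next-F t s))) (N-error (A t s) (F t s) (ℕP.<⇒≤ F<A))
      A′≡ : N (A t′ s′) ≡ 729 ℕ.* (n ℕ.* n ℕ.* (n ℕ.* n))
      A′≡ = trans (cong N (next-A t s)) (N-3⁴ (A t s))
      n≢0 : n ≢ 0
      n≢0 = N≢0 (A≢0 t s≢0)
      n²≢0 : 729 ℕ.* (n ℕ.* n) ≢ 0
      n²≢0 eq with ℕP.m*n≡0⇒m≡0∨n≡0 729 eq
      ... | inj₂ nn≡0 = [ n≢0 , n≢0 ]′ (ℕP.m*n≡0⇒m≡0∨n≡0 n nn≡0)
      e₀ : ∀ n → n ℕ.* n ℕ.* (729 ℕ.* (n ℕ.* n)) ≡ 729 ℕ.* (n ℕ.* n ℕ.* (n ℕ.* n))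
      e₀ = ℕR.solve-∀
      e₁ : ∀ f n p → f ℕ.* f ℕ.* (729 ℕ.* (n ℕ.* n)) ℕ.* (p ℕ.* p) ≡ 729 ℕ.* (n ℕ.* n) ℕ.* ((f ℕ.* p) ℕ.* (f ℕ.* p))
      e₁ = ℕR.solve-∀
      e₂ : ∀ n p → 729 ℕ.* (n ℕ.* n) ℕ.* ((n ℕ.* p) ℕ.* (n ℕ.* p)) ≡ 729 ℕ.* (n ℕ.* n ℕ.* (n ℕ.* n)) ℕ.* (p ℕ.* p)
      e₂ = ℕR.solve-∀

    refined : ∀ j → ∃ λ k → suc j ℕ.≤ k × Approximation k
    refined zero = 1 , ℕP.≤-refl , record { t = proj₁ initial ; s = 2# ; s≢0 = λ () ; F<A = proj₂ initial
      ; ratio = ℕP.≤-reflexive (trans (cong (f₀ ℕ.*_) (ℕP.*-identityʳ n₀)) (trans (ℕP.*-comm f₀ n₀) (cong (n₀ ℕ.*_) (sym (ℕP.*-identityʳ f₀))))) }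
    refined (suc j) with refined j
    ... | k , j<k , ap = k ℕ.+ k , ℕP.+-mono-≤ (ℕP.≤-trans (s≤s z≤n) j<k) j<k , refine ap

    approximate : ∀ E → ∃₂ λ t s → s ≢ 0# × E ℕ.* N (F t s) ℕ.≤ N (A t s)
    approximate E with refined (E ℕ.* f₀)
    ... | k , Ef₀<k , ap = t , s , s≢0 , ℕP.*-cancelʳ-≤ (E ℕ.* N (F t s)) (N (A t s)) (n₀ ℕ.^ k) {{ℕP.m^n≢0 n₀ k {{ℕ.>-nonZero (ℕP.≤-<-trans z≤n (proj₂ initial))}}}} (begin
      E ℕ.* N (F t s) ℕ.* n₀ ℕ.^ k       ≡⟨ ℕP.*-assoc E (N (F t s)) (n₀ ℕ.^ k) ⟩
      E ℕ.* (N (F t s) ℕ.* n₀ ℕ.^ k)     ≤⟨ ℕP.*-monoʳ-≤ E ratio ⟩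
      E ℕ.* (N (A t s) ℕ.* f₀ ℕ.^ k)     ≡⟨ e E (N (A t s)) (f₀ ℕ.^ k) ⟩
      N (A t s) ℕ.* (E ℕ.* f₀ ℕ.^ k)     ≤⟨ ℕP.*-monoʳ-≤ (N (A t s)) (power-gap E f₀ n₀ k (proj₂ initial) (ℕP.<⇒≤ Ef₀<k) (ℕP.≤-trans (s≤s z≤n) Ef₀<k)) ⟩
      N (A t s) ℕ.* n₀ ℕ.^ k ∎)
      where
      open Approximation ap
      open ℕP.≤-Reasoning
      e : ∀ E a f → E ℕ.* (a ℕ.* f) ≡ a ℕ.* (E ℕ.* f)
      e = ℕR.solve-∀

    -- Extending the fraction t/s by conj s makes the denominator the rational integer N s, the
    -- modulus for the boxes below.
    rational-approximate : ∀ E → ∃₂ λ t n → 1 ℕ.≤ n × E ℕ.* N (F t (nat n)) ℕ.≤ N α ℕ.* (n ℕ.* n ℕ.* n ℕ.* (n ℕ.* n ℕ.* n))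
    rational-approximate E with approximate E
    ... | t , s , s≢0 , EF≤A = t * conj s , n , ℕP.n≢0⇒n>0 (N≢0 s≢0) , (begin
      E ℕ.* N (F (t * conj s) (nat n))         ≡⟨ cong (E ℕ.*_) (trans (cong N F≡) (trans (N-* (F t s) _) (cong (N (F t s) ℕ.*_) (N-cube (conj s))))) ⟩
      E ℕ.* (N (F t s) ℕ.* (m ℕ.* m ℕ.* m))    ≡⟨ cong (λ k → E ℕ.* (N (F t s) ℕ.* (k ℕ.* k ℕ.* k))) (N-conj s) ⟩
      E ℕ.* (N (F t s) ℕ.* (n ℕ.* n ℕ.* n))    ≡⟨ sym (ℕP.*-assoc E (N (F t s)) _) ⟩
      E ℕ.* N (F t s) ℕ.* (n ℕ.* n ℕ.* n)      ≤⟨ ℕP.*-monoˡ-≤ (n ℕ.* n ℕ.* n) EF≤A ⟩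
      N (A t s) ℕ.* (n ℕ.* n ℕ.* n)            ≡⟨ cong (ℕ._* (n ℕ.* n ℕ.* n)) (trans (N-* α _) (cong (N α ℕ.*_) (N-cube s))) ⟩
      N α ℕ.* (n ℕ.* n ℕ.* n) ℕ.* (n ℕ.* n ℕ.* n) ≡⟨ ℕP.*-assoc (N α) _ _ ⟩
      N α ℕ.* (n ℕ.* n ℕ.* n ℕ.* (n ℕ.* n ℕ.* n)) ∎)
      where
      open ℕP.≤-Reasoning
      n m : ℕ
      n = N s
      m = N (conj s)
      N-cube : ∀ x → N (x * x * x) ≡ N x ℕ.* N x ℕ.* N x
      N-cube x = trans (N-* (x * x) x) (cong (ℕ._* N x) (N-* x x))
      F≡ : F (t * conj s) (nat n) ≡ F t s * (conj s * conj s * conj s)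
      F≡ = trans (cong (F (t * conj s)) (sym (x*conj s))) (g α t s (conj s))
        where
        opaque
          unfolding _+_
          g : ∀ α t s c → α * (s * c * (s * c) * (s * c)) - t * c * (t * c) * (t * c) ≡ (α * (s * s * s) - t * t * t) * (c * c * c)
          g = solve-∀ 𝔼-ring

-- The box principle and elements of small norm.

abs : ℤ → ℕ
abs = ℤ.∣_∣

opaque
  -- A substitute for √N with values in ℕ: subadditive, submultiplicative up to the factor 2,
  -- exactly homogeneous for rational integers, and comparable with √N.
  ‖_‖ : 𝔼 → ℕ
  ‖ eis a b ‖ = abs a ℕ.+ abs b

opaque
  unfolding _+_ ‖_‖
  ‖‖-+ : ∀ x y → ‖ x + y ‖ ℕ.≤ ‖ x ‖ ℕ.+ ‖ y ‖
  ‖‖-+ (eis a b) (eis c d) = ℕP.≤-trans (ℕP.+-mono-≤ (ℤP.∣i+j∣≤∣i∣+∣j∣ a c) (ℤP.∣i+j∣≤∣i∣+∣j∣ b d))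
    (ℕP.≤-reflexive (f (abs a) (abs b) (abs c) (abs d)))
    where
    f : ∀ a b c d → (a ℕ.+ c) ℕ.+ (b ℕ.+ d) ≡ (a ℕ.+ b) ℕ.+ (c ℕ.+ d)
    f = ℕR.solve-∀

  ‖‖-neg : ∀ x → ‖ - x ‖ ≡ ‖ x ‖
  ‖‖-neg (eis a b) = cong₂ ℕ._+_ (ℤP.∣-i∣≡∣i∣ a) (ℤP.∣-i∣≡∣i∣ b)

  ‖‖-* : ∀ x y → ‖ x * y ‖ ℕ.≤ 2 ℕ.* (‖ x ‖ ℕ.* ‖ y ‖)
  ‖‖-* (eis a b) (eis c d) = begin
    abs (a ℤ.* c ℤ.- b ℤ.* d) ℕ.+ abs (a ℤ.* d ℤ.+ b ℤ.* c ℤ.- b ℤ.* d)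
      ≤⟨ ℕP.+-mono-≤ (∣-∣≤ (a ℤ.* c) (b ℤ.* d)) (ℕP.≤-trans (∣-∣≤ (a ℤ.* d ℤ.+ b ℤ.* c) (b ℤ.* d)) (ℕP.+-monoˡ-≤ (abs (b ℤ.* d)) (ℤP.∣i+j∣≤∣i∣+∣j∣ (a ℤ.* d) (b ℤ.* c)))) ⟩
    (abs (a ℤ.* c) ℕ.+ abs (b ℤ.* d)) ℕ.+ ((abs (a ℤ.* d) ℕ.+ abs (b ℤ.* c)) ℕ.+ abs (b ℤ.* d))
      ≡⟨ cong₂ ℕ._+_ (cong₂ ℕ._+_ (ℤP.abs-* a c) (ℤP.abs-* b d)) (cong₂ ℕ._+_ (cong₂ ℕ._+_ (ℤP.abs-* a d) (ℤP.abs-* b c)) (ℤP.abs-* b d)) ⟩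
    (A ℕ.* E ℕ.+ B ℕ.* D′) ℕ.+ ((A ℕ.* D′ ℕ.+ B ℕ.* E) ℕ.+ B ℕ.* D′)
      ≤⟨ ℕP.m≤m+n _ (A ℕ.* E ℕ.+ A ℕ.* D′ ℕ.+ B ℕ.* E) ⟩
    (A ℕ.* E ℕ.+ B ℕ.* D′) ℕ.+ ((A ℕ.* D′ ℕ.+ B ℕ.* E) ℕ.+ B ℕ.* D′) ℕ.+ (A ℕ.* E ℕ.+ A ℕ.* D′ ℕ.+ B ℕ.* E)
      ≡⟨ f A B E D′ ⟩
    2 ℕ.* ((A ℕ.+ B) ℕ.* (E ℕ.+ D′)) ∎
    where
    open ℕP.≤-Reasoning
    A B E D′ : ℕ
    A = abs a
    B = abs b
    E = abs c
    D′ = abs d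
    ∣-∣≤ : ∀ i j → abs (i ℤ.- j) ℕ.≤ abs i ℕ.+ abs j
    ∣-∣≤ i j = ℤP.∣i-j∣≤∣i∣+∣j∣ i j
    f : ∀ A B E D → (A ℕ.* E ℕ.+ B ℕ.* D) ℕ.+ ((A ℕ.* D ℕ.+ B ℕ.* E) ℕ.+ B ℕ.* D) ℕ.+ (A ℕ.* E ℕ.+ A ℕ.* D ℕ.+ B ℕ.* E)
      ≡ 2 ℕ.* ((A ℕ.+ B) ℕ.* (E ℕ.+ D))
    f = ℕR.solve-∀

  ‖nat*‖ : ∀ n x → ‖ nat n * x ‖ ≡ n ℕ.* ‖ x ‖
  ‖nat*‖ n (eis a b) = trans (cong₂ ℕ._+_ (trans (cong abs (f (+ n) a b)) (ℤP.abs-* (+ n) a)) (trans (cong abs (g (+ n) a b)) (ℤP.abs-* (+ n) b)))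
    (sym (ℕP.*-distribˡ-+ n (abs a) (abs b)))
    where
    f : ∀ n a b → n ℤ.* a ℤ.- +0 ℤ.* b ≡ n ℤ.* a
    f = ℤR.solve-∀
    g : ∀ n a b → n ℤ.* b ℤ.+ +0 ℤ.* a ℤ.- +0 ℤ.* b ≡ n ℤ.* b
    g = ℤR.solve-∀

  ‖‖²≤ : ∀ x → ‖ x ‖ ℕ.* ‖ x ‖ ℕ.≤ 16 ℕ.* N x
  ‖‖²≤ x@(eis a b) = begin
    (A ℕ.+ B) ℕ.* (A ℕ.+ B)                            ≤⟨ ℕP.m≤m+n _ (2 ℕ.* ((A ℕ.+ B) ℕ.* (A ℕ.+ B))) ⟩
    (A ℕ.+ B) ℕ.* (A ℕ.+ B) ℕ.+ 2 ℕ.* ((A ℕ.+ B) ℕ.* (A ℕ.+ B)) ≡⟨ e₁ A B ⟩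
    3 ℕ.* (A ℕ.* A) ℕ.+ 3 ℕ.* (B ℕ.* B) ℕ.+ 6 ℕ.* (A ℕ.* B) ≤⟨ ℕP.+-monoʳ-≤ (3 ℕ.* (A ℕ.* A) ℕ.+ 3 ℕ.* (B ℕ.* B)) 6AB≤ ⟩
    3 ℕ.* (A ℕ.* A) ℕ.+ 3 ℕ.* (B ℕ.* B) ℕ.+ (3 ℕ.* (A ℕ.* A) ℕ.+ 3 ℕ.* (B ℕ.* B))
      ≤⟨ ℕP.+-mono-≤ (ℕP.+-mono-≤ (re²≤ a b) (im²≤ a b)) (ℕP.+-mono-≤ (re²≤ a b) (im²≤ a b)) ⟩
    4 ℕ.* N x ℕ.+ 4 ℕ.* N x ℕ.+ (4 ℕ.* N x ℕ.+ 4 ℕ.* N x) ≡⟨ e₂ (N x) ⟩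
    16 ℕ.* N x ∎
    where
    open ℕP.≤-Reasoning
    A B : ℕ
    A = abs a
    B = abs b
    e₁ : ∀ A B → (A ℕ.+ B) ℕ.* (A ℕ.+ B) ℕ.+ 2 ℕ.* ((A ℕ.+ B) ℕ.* (A ℕ.+ B)) ≡ 3 ℕ.* (A ℕ.* A) ℕ.+ 3 ℕ.* (B ℕ.* B) ℕ.+ 6 ℕ.* (A ℕ.* B)
    e₁ = ℕR.solve-∀
    e₂ : ∀ n → 4 ℕ.* n ℕ.+ 4 ℕ.* n ℕ.+ (4 ℕ.* n ℕ.+ 4 ℕ.* n) ≡ 16 ℕ.* n
    e₂ = ℕR.solve-∀
    2AB≤ : ∀ A B → A ℕ.≤ B → 2 ℕ.* (A ℕ.* B) ℕ.≤ A ℕ.* A ℕ.+ B ℕ.* B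
    2AB≤ A B A≤B with ℕP.m≤n⇒∃[o]m+o≡n A≤B
    ... | d , refl = ℕP.≤-trans (ℕP.m≤m+n _ (d ℕ.* d)) (ℕP.≤-reflexive (f A d))
      where
      f : ∀ A d → 2 ℕ.* (A ℕ.* (A ℕ.+ d)) ℕ.+ d ℕ.* d ≡ A ℕ.* A ℕ.+ (A ℕ.+ d) ℕ.* (A ℕ.+ d)
      f = ℕR.solve-∀
    6AB≤ : 6 ℕ.* (A ℕ.* B) ℕ.≤ 3 ℕ.* (A ℕ.* A) ℕ.+ 3 ℕ.* (B ℕ.* B)
    6AB≤ = ℕP.≤-trans (ℕP.≤-reflexive (h A B)) (ℕP.≤-trans (ℕP.*-monoʳ-≤ 3 sym-2AB) (ℕP.≤-reflexive (ℕP.*-distribˡ-+ 3 (A ℕ.* A) (B ℕ.* B))))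
      where
      h : ∀ A B → 6 ℕ.* (A ℕ.* B) ≡ 3 ℕ.* (2 ℕ.* (A ℕ.* B))
      h = ℕR.solve-∀
      sym-2AB : 2 ℕ.* (A ℕ.* B) ℕ.≤ A ℕ.* A ℕ.+ B ℕ.* B
      sym-2AB with ℕP.≤-total A B
      ... | inj₁ A≤B = 2AB≤ A B A≤B
      ... | inj₂ B≤A = subst₂ (λ s t → 2 ℕ.* s ℕ.≤ t) (ℕP.*-comm B A) (ℕP.+-comm (B ℕ.* B) (A ℕ.* A)) (2AB≤ B A B≤A)

  N≤‖‖² : ∀ x → N x ℕ.≤ ‖ x ‖ ℕ.* ‖ x ‖
  N≤‖‖² (eis a b) = begin
    abs (a ℤ.* a ℤ.- a ℤ.* b ℤ.+ b ℤ.* b)                ≤⟨ ℤP.∣i+j∣≤∣i∣+∣j∣ (a ℤ.* a ℤ.- a ℤ.* b) (b ℤ.* b) ⟩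
    abs (a ℤ.* a ℤ.- a ℤ.* b) ℕ.+ abs (b ℤ.* b)           ≤⟨ ℕP.+-monoˡ-≤ (abs (b ℤ.* b)) (ℤP.∣i-j∣≤∣i∣+∣j∣ (a ℤ.* a) (a ℤ.* b)) ⟩
    abs (a ℤ.* a) ℕ.+ abs (a ℤ.* b) ℕ.+ abs (b ℤ.* b)      ≡⟨ cong₂ ℕ._+_ (cong₂ ℕ._+_ (ℤP.abs-* a a) (ℤP.abs-* a b)) (ℤP.abs-* b b) ⟩
    A ℕ.* A ℕ.+ A ℕ.* B ℕ.+ B ℕ.* B                      ≤⟨ ℕP.m≤m+n _ (A ℕ.* B) ⟩
    A ℕ.* A ℕ.+ A ℕ.* B ℕ.+ B ℕ.* B ℕ.+ A ℕ.* B           ≡⟨ f A B ⟩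
    (A ℕ.+ B) ℕ.* (A ℕ.+ B) ∎
    where
    open ℕP.≤-Reasoning
    A B : ℕ
    A = abs a
    B = abs b
    f : ∀ A B → A ℕ.* A ℕ.+ A ℕ.* B ℕ.+ B ℕ.* B ℕ.+ A ℕ.* B ≡ (A ℕ.+ B) ℕ.* (A ℕ.+ B)
    f = ℕR.solve-∀

  ‖‖≡0 : ∀ x → ‖ x ‖ ≡ 0 → x ≡ 0#
  ‖‖≡0 (eis a b) eq = cong₂ eis (ℤP.∣i∣≡0⇒i≡0 (ℕP.m+n≡0⇒m≡0 (abs a) eq)) (ℤP.∣i∣≡0⇒i≡0 (ℕP.m+n≡0⇒n≡0 (abs a) eq))

  gap : ∀ r d → abs (+ r ℤ.- + (r ℕ.+ d)) ≡ d
  gap r d = trans (cong abs (trans (cong (λ w → + r ℤ.- w) (ℤP.pos-+ r d)) (f (+ r) (+ d)))) (ℤP.∣-i∣≡∣i∣ (+ d))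
    where
    f : ∀ r d → r ℤ.- (r ℤ.+ d) ≡ ℤ.- d
    f = ℤR.solve-∀

  gap-sym : ∀ r s → abs (+ r ℤ.- + s) ≡ abs (+ s ℤ.- + r)
  gap-sym r s = trans (cong abs (f (+ r) (+ s))) (ℤP.∣-i∣≡∣i∣ (+ s ℤ.- + r))
    where
    f : ∀ r s → r ℤ.- s ≡ ℤ.- (s ℤ.- r)
    f = ℤR.solve-∀

opaque
  ⊑-+ : ∀ {x y r s} → ‖ x ‖ ℕ.≤ r → ‖ y ‖ ℕ.≤ s → ‖ x + y ‖ ℕ.≤ r ℕ.+ s
  ⊑-+ {x} {y} x≤ y≤ = ℕP.≤-trans (‖‖-+ x y) (ℕP.+-mono-≤ x≤ y≤)

  ⊑-sub : ∀ {x y r s} → ‖ x ‖ ℕ.≤ r → ‖ y ‖ ℕ.≤ s → ‖ x - y ‖ ℕ.≤ r ℕ.+ s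
  ⊑-sub {x} {y} {s = s} x≤ y≤ = ⊑-+ x≤ (subst (ℕ._≤ s) (sym (‖‖-neg y)) y≤)

  ⊑-* : ∀ {x y r s} → ‖ x ‖ ℕ.≤ r → ‖ y ‖ ℕ.≤ s → ‖ x * y ‖ ℕ.≤ 2 ℕ.* (r ℕ.* s)
  ⊑-* {x} {y} x≤ y≤ = ℕP.≤-trans (‖‖-* x y) (ℕP.*-monoʳ-≤ 2 (ℕP.*-mono-≤ x≤ y≤))

  ⊑-nat : ∀ n {x r} → ‖ x ‖ ℕ.≤ r → ‖ nat n * x ‖ ℕ.≤ n ℕ.* r
  ⊑-nat n {x} x≤ = ℕP.≤-trans (ℕP.≤-reflexive (‖nat*‖ n x)) (ℕP.*-monoʳ-≤ n x≤)

  -- Numbers with equal quotients by D differ by less than D; here the numbers are multiples of TT,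
  -- so residues in one cell are at most D/TT apart.
  ordered-cells : ∀ D TT .{{_ : ℕ.NonZero D}} r d → (r ℕ.* TT) ℕ./ D ≡ ((r ℕ.+ d) ℕ.* TT) ℕ./ D → d ℕ.* TT ℕ.≤ D
  ordered-cells D TT r d same = ℕP.≤-trans (ℕP.m≤n+m (d ℕ.* TT) (m ℕ.% D)) (ℕP.≤-trans (ℕP.≤-reflexive
      (ℕP.+-cancelʳ-≡ (m ℕ./ D ℕ.* D) (m ℕ.% D ℕ.+ d ℕ.* TT) (m′ ℕ.% D) (begin
        m ℕ.% D ℕ.+ d ℕ.* TT ℕ.+ m ℕ./ D ℕ.* D    ≡⟨ f (m ℕ.% D) (d ℕ.* TT) (m ℕ./ D ℕ.* D) ⟩
        (m ℕ.% D ℕ.+ m ℕ./ D ℕ.* D) ℕ.+ d ℕ.* TT  ≡⟨ cong (ℕ._+ d ℕ.* TT) (sym (ℕDM.m≡m%n+[m/n]*n m D)) ⟩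
        r ℕ.* TT ℕ.+ d ℕ.* TT                     ≡⟨ sym (ℕP.*-distribʳ-+ TT r d) ⟩
        m′                                        ≡⟨ ℕDM.m≡m%n+[m/n]*n m′ D ⟩
        m′ ℕ.% D ℕ.+ m′ ℕ./ D ℕ.* D               ≡⟨ cong (λ q → m′ ℕ.% D ℕ.+ q ℕ.* D) (sym same) ⟩
        m′ ℕ.% D ℕ.+ m ℕ./ D ℕ.* D ∎))) (ℕP.<⇒≤ (ℕDM.m%n<n m′ D)))
    where
    open ≡-Reasoning
    m m′ : ℕ
    m = r ℕ.* TT
    m′ = (r ℕ.+ d) ℕ.* TT
    f : ∀ a b c → a ℕ.+ b ℕ.+ c ≡ (a ℕ.+ c) ℕ.+ b
    f = ℕR.solve-∀

  same-cell : ∀ D TT .{{_ : ℕ.NonZero D}} r s → (r ℕ.* TT) ℕ./ D ≡ (s ℕ.* TT) ℕ./ D → abs (+ r ℤ.- + s) ℕ.* TT ℕ.≤ D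
  same-cell D TT r s same with ℕP.≤-total r s
  ... | inj₁ r≤s with ℕP.m≤n⇒∃[o]m+o≡n r≤s
  ...   | d , refl = subst (λ w → w ℕ.* TT ℕ.≤ D) (sym (gap r d)) (ordered-cells D TT r d same)
  same-cell D TT r s same | inj₂ s≤r with ℕP.m≤n⇒∃[o]m+o≡n s≤r
  ...   | d , refl = subst (λ w → w ℕ.* TT ℕ.≤ D) (sym (trans (gap-sym (s ℕ.+ d) s) (gap s d))) (ordered-cells D TT s d (sym same))

cell : ∀ D TT .{{_ : ℕ.NonZero D}} .{{_ : ℕ.NonZero TT}} → ℤ → Fin TT
cell D TT i = Fin.fromℕ< {((i ℤDM.%ℕ D) ℕ.* TT) ℕ./ D} (ℕDM.m<n*o⇒m/o<n (subst ((i ℤDM.%ℕ D) ℕ.* TT ℕ.<_) (ℕP.*-comm D TT) (ℕP.*-monoˡ-< TT (ℤDM.n%ℕd<d i D))))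

cellᴱ : ∀ D TT .{{_ : ℕ.NonZero D}} .{{_ : ℕ.NonZero TT}} → 𝔼 → Fin (TT ℕ.* TT)
cellᴱ D TT (eis a b) = Fin.combine (cell D TT a) (cell D TT b)

opaque
  cell-≡ : ∀ D TT .{{_ : ℕ.NonZero D}} .{{_ : ℕ.NonZero TT}} i j → cell D TT i ≡ cell D TT j → ∃ λ q → abs (i ℤ.- j ℤ.+ + D ℤ.* q) ℕ.* TT ℕ.≤ D
  cell-≡ D TT i j eq = (j ℤDM./ℕ D) ℤ.- (i ℤDM./ℕ D) ,
    subst (λ w → abs w ℕ.* TT ℕ.≤ D) (sym remainder) (same-cell D TT (i ℤDM.%ℕ D) (j ℤDM.%ℕ D)
      (trans (sym (FinP.toℕ-fromℕ< _)) (trans (cong toℕ eq) (FinP.toℕ-fromℕ< _))))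
    where
    f : ∀ r s a b d → (r ℤ.+ a ℤ.* d) ℤ.- (s ℤ.+ b ℤ.* d) ℤ.+ d ℤ.* (b ℤ.- a) ≡ r ℤ.- s
    f = ℤR.solve-∀
    remainder : i ℤ.- j ℤ.+ + D ℤ.* ((j ℤDM./ℕ D) ℤ.- (i ℤDM./ℕ D)) ≡ + (i ℤDM.%ℕ D) ℤ.- + (j ℤDM.%ℕ D)
    remainder = trans (cong₂ (λ s t → s ℤ.- t ℤ.+ + D ℤ.* ((j ℤDM./ℕ D) ℤ.- (i ℤDM./ℕ D))) (ℤDM.a≡a%ℕn+[a/ℕn]*n i D) (ℤDM.a≡a%ℕn+[a/ℕn]*n j D))
      (f (+ (i ℤDM.%ℕ D)) (+ (j ℤDM.%ℕ D)) (i ℤDM./ℕ D) (j ℤDM./ℕ D) (+ D))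

opaque
  unfolding _+_ ‖_‖
  cellᴱ-≡ : ∀ D TT .{{_ : ℕ.NonZero D}} .{{_ : ℕ.NonZero TT}} x y → cellᴱ D TT x ≡ cellᴱ D TT y → ∃ λ q → ‖ x - y + nat D * q ‖ ℕ.* TT ℕ.≤ D ℕ.+ D
  cellᴱ-≡ D TT (eis a b) (eis c d) eq with FinP.combine-injective _ _ _ _ eq
  ... | eq₁ , eq₂ with cell-≡ D TT a c eq₁ | cell-≡ D TT b d eq₂
  ...   | q , q≤ | r , r≤ = eis q r , ℕP.≤-trans (ℕP.≤-reflexive (trans
      (ℕP.*-distribʳ-+ TT (abs (a ℤ.+ ℤ.- c ℤ.+ (+ D ℤ.* q ℤ.- +0 ℤ.* r))) (abs (b ℤ.+ ℤ.- d ℤ.+ (+ D ℤ.* r ℤ.+ +0 ℤ.* q ℤ.- +0 ℤ.* r)))) (cong₂ (λ s t → abs s ℕ.* TT ℕ.+ abs t ℕ.* TT) (f a c (+ D) q r) (g b d (+ D) q r)))) (ℕP.+-mono-≤ q≤ r≤)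
    where
    f : ∀ a c D q r → a ℤ.+ ℤ.- c ℤ.+ (D ℤ.* q ℤ.- +0 ℤ.* r) ≡ a ℤ.- c ℤ.+ D ℤ.* q
    f = ℤR.solve-∀
    g : ∀ b d D q r → b ℤ.+ ℤ.- d ℤ.+ (D ℤ.* r ℤ.+ +0 ℤ.* q ℤ.- +0 ℤ.* r) ≡ b ℤ.- d ℤ.+ D ℤ.* r
    g = ℤR.solve-∀

module _ (T : ℕ) where
  -- Enumerates the elements with both coordinates in {0, ..., T}.
  digit : Fin (suc T ℕ.* suc T) → 𝔼
  digit i = eis (+ toℕ (proj₁ (Fin.remQuot {suc T} (suc T) i))) (+ toℕ (proj₂ (Fin.remQuot {suc T} (suc T) i)))

  opaque
    unfolding _+_ ‖_‖
    digit-injective : ∀ i j → digit i - digit j ≡ 0# → i ≡ j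
    digit-injective i j eq = trans (sym (FinP.combine-remQuot {suc T} (suc T) i)) (trans (cong₂ Fin.combine
      (same (cong (λ { (eis a _) → a }) digits)) (same (cong (λ { (eis _ b) → b }) digits))) (FinP.combine-remQuot {suc T} (suc T) j))
      where
      digits : digit i ≡ digit j
      digits = -≡0#⇒≡ (digit i) (digit j) eq
      same : ∀ {k l : Fin (suc T)} → + toℕ k ≡ + toℕ l → k ≡ l
      same p = FinP.toℕ-injective (ℤP.+-injective p)

    digit-difference : ∀ i j → ‖ digit i - digit j ‖ ℕ.≤ T ℕ.+ T
    digit-difference i j = ℕP.+-mono-≤ (difference (proj₁ (Fin.remQuot {suc T} (suc T) i)) (proj₁ (Fin.remQuot {suc T} (suc T) j)))
                                       (difference (proj₂ (Fin.remQuot {suc T} (suc T) i)) (proj₂ (Fin.remQuot {suc T} (suc T) j)))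
      where
      ordered : ∀ r s → r ℕ.≤ s → s ℕ.≤ T → abs (+ r ℤ.- + s) ℕ.≤ T
      ordered r s r≤s s≤T with ℕP.m≤n⇒∃[o]m+o≡n r≤s
      ... | d , refl = subst (ℕ._≤ T) (sym (gap r d)) (ℕP.≤-trans (ℕP.m≤n+m d r) s≤T)
      difference : ∀ (k l : Fin (suc T)) → abs (+ toℕ k ℤ.- + toℕ l) ℕ.≤ T
      difference k l with ℕP.≤-total (toℕ k) (toℕ l)
      ... | inj₁ k≤l = ordered (toℕ k) (toℕ l) k≤l (ℕP.≤-pred (FinP.toℕ<n l))
      ... | inj₂ l≤k = subst (ℕ._≤ T) (gap-sym (toℕ l) (toℕ k)) (ordered (toℕ l) (toℕ k) l≤k (ℕP.≤-pred (FinP.toℕ<n k)))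

opaque
  -- Dirichlet's box principle: with (T+1)⁴ pairs of coefficients and T⁴ cells two values of the form fall into the same cell.
  small-linear-form : ∀ T n t .{{_ : ℕ.NonZero T}} .{{_ : ℕ.NonZero n}} → ∃₂ λ x y → ∃ λ w →
    ¬ (y ≡ 0# × w ≡ 0#) × ‖ y ‖ ℕ.≤ T ℕ.+ T × ‖ w ‖ ℕ.≤ T ℕ.+ T ×
    ‖ nat n * (nat n * x) + nat n * (t * y) + t * t * w ‖ ℕ.* (T ℕ.* T) ℕ.≤ n ℕ.* n ℕ.+ n ℕ.* n
  small-linear-form T n t = go (FinP.pigeonhole fewer-cells value)
    where
    instance
      TT≢0 : ℕ.NonZero (T ℕ.* T)
      TT≢0 = ℕP.m*n≢0 T T
      D≢0 : ℕ.NonZero (n ℕ.* n)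
      D≢0 = ℕP.m*n≢0 n n
    SS : ℕ
    SS = suc T ℕ.* suc T
    fewer-cells : T ℕ.* T ℕ.* (T ℕ.* T) ℕ.< SS ℕ.* SS
    fewer-cells = ℕP.*-mono-< squares squares
      where
      squares : T ℕ.* T ℕ.< SS
      squares = ℕP.*-mono-< (ℕP.n<1+n T) (ℕP.n<1+n T)
    form : 𝔼 → 𝔼 → 𝔼
    form y w = nat n * (t * y) + t * t * w
    pair : Fin (SS ℕ.* SS) → Fin SS × Fin SS
    pair i = Fin.remQuot {SS} SS i
    value : Fin (SS ℕ.* SS) → Fin (T ℕ.* T ℕ.* (T ℕ.* T))
    value i = cellᴱ (n ℕ.* n) (T ℕ.* T) (form (digit T (proj₁ (pair i))) (digit T (proj₂ (pair i))))
    opaque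
      unfolding _+_
      f : ∀ n t y y′ w w′ q → n * (t * y) + t * t * w - (n * (t * y′) + t * t * w′) + n * n * q
        ≡ n * (n * q) + n * (t * (y - y′)) + t * t * (w - w′)
      f = solve-∀ 𝔼-ring
    go : (∃₂ λ i j → i Fin.< j × value i ≡ value j) → ∃₂ λ x y → ∃ λ w →
      ¬ (y ≡ 0# × w ≡ 0#) × ‖ y ‖ ℕ.≤ T ℕ.+ T × ‖ w ‖ ℕ.≤ T ℕ.+ T ×
      ‖ nat n * (nat n * x) + nat n * (t * y) + t * t * w ‖ ℕ.* (T ℕ.* T) ℕ.≤ n ℕ.* n ℕ.+ n ℕ.* n
    go (i , j , i<j , same) = q , y - y′ , w - w′ , distinct-digits , digit-difference T (proj₁ (pair i)) (proj₁ (pair j)) , digit-difference T (proj₂ (pair i)) (proj₂ (pair j)) ,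
      subst (λ v → ‖ v ‖ ℕ.* (T ℕ.* T) ℕ.≤ n ℕ.* n ℕ.+ n ℕ.* n)
        (trans (cong (λ v → form y w - form y′ w′ + v * q) (nat-* n n)) (f (nat n) t y y′ w w′ q)) (proj₂ close)
      where
      y y′ w w′ : 𝔼
      y = digit T (proj₁ (pair i))
      y′ = digit T (proj₁ (pair j))
      w = digit T (proj₂ (pair i))
      w′ = digit T (proj₂ (pair j))
      close : ∃ λ q → ‖ form y w - form y′ w′ + nat (n ℕ.* n) * q ‖ ℕ.* (T ℕ.* T) ℕ.≤ n ℕ.* n ℕ.+ n ℕ.* n
      close = cellᴱ-≡ (n ℕ.* n) (T ℕ.* T) (form y w) (form y′ w′) same
      q : 𝔼
      q = proj₁ close
      distinct-digits : ¬ (y - y′ ≡ 0# × w - w′ ≡ 0#)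
      distinct-digits (y≡ , w≡) = ℕP.<-irrefl (cong toℕ (trans (sym (FinP.combine-remQuot {SS} SS i)) (trans
        (cong₂ Fin.combine (digit-injective T (proj₁ (pair i)) (proj₁ (pair j)) y≡) (digit-injective T (proj₂ (pair i)) (proj₂ (pair j)) w≡)) (FinP.combine-remQuot {SS} SS j)))) i<j

opaque
  cube-mono⁻¹ : ∀ m n → m ℕ.* m ℕ.* m ℕ.≤ n ℕ.* n ℕ.* n → m ℕ.≤ n
  cube-mono⁻¹ m n m³≤n³ with m ℕ.≤? n
  ... | yes m≤n = m≤n
  ... | no m≰n = ⊥-elim (ℕP.<⇒≱ (ℕP.*-mono-< (ℕP.*-mono-< (ℕP.≰⇒> m≰n) (ℕP.≰⇒> m≰n)) (ℕP.≰⇒> m≰n)) m³≤n³)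

  m≤m*m : ∀ m → m ℕ.≤ m ℕ.* m
  m≤m*m zero = z≤n
  m≤m*m m@(suc _) = ℕP.m≤m*n m m

  -- 2KH < T makes KTH² at most half of T³ and KH³ strictly less than half.
  lopsided : ∀ K H T → 1 ℕ.≤ K → 2 ℕ.* (K ℕ.* H) ℕ.< T → K ℕ.* (T ℕ.* (H ℕ.* H) ℕ.+ H ℕ.* H ℕ.* H) ℕ.< T ℕ.* T ℕ.* T
  lopsided K H T 1≤K 2KH<T = ℕP.*-cancelˡ-< 2 _ _ (begin-strict
    2 ℕ.* (K ℕ.* (T ℕ.* (H ℕ.* H) ℕ.+ H ℕ.* H ℕ.* H))          ≡⟨ e₁ K T H ⟩
    T ℕ.* (2 ℕ.* (K ℕ.* H) ℕ.* H) ℕ.+ 2 ℕ.* (K ℕ.* H) ℕ.* (H ℕ.* H)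
      ≤⟨ ℕP.+-mono-≤ (ℕP.*-monoʳ-≤ T (ℕP.*-mono-≤ (ℕP.<⇒≤ 2KH<T) H≤T)) (ℕP.*-monoʳ-≤ (2 ℕ.* (K ℕ.* H)) (ℕP.*-mono-≤ H≤T H≤T)) ⟩
    T ℕ.* (T ℕ.* T) ℕ.+ 2 ℕ.* (K ℕ.* H) ℕ.* (T ℕ.* T)
      <⟨ ℕP.+-monoʳ-< (T ℕ.* (T ℕ.* T)) (ℕP.*-monoˡ-< (T ℕ.* T) {{ℕP.m*n≢0 T T {{T≢0}} {{T≢0}}}} 2KH<T) ⟩
    T ℕ.* (T ℕ.* T) ℕ.+ T ℕ.* (T ℕ.* T)                        ≡⟨ e₂ T ⟩
    2 ℕ.* (T ℕ.* T ℕ.* T) ∎)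
    where
    open ℕP.≤-Reasoning
    T≢0 : ℕ.NonZero T
    T≢0 = ℕ.>-nonZero (ℕP.≤-<-trans z≤n 2KH<T)
    H≤T : H ℕ.≤ T
    H≤T = ℕP.≤-trans (ℕP.m≤n*m H K {{ℕ.>-nonZero 1≤K}}) (ℕP.≤-trans (ℕP.m≤n*m (K ℕ.* H) 2) (ℕP.<⇒≤ 2KH<T))
    e₁ : ∀ K T H → 2 ℕ.* (K ℕ.* (T ℕ.* (H ℕ.* H) ℕ.+ H ℕ.* H ℕ.* H)) ≡ T ℕ.* (2 ℕ.* (K ℕ.* H) ℕ.* H) ℕ.+ 2 ℕ.* (K ℕ.* H) ℕ.* (H ℕ.* H)
    e₁ = ℕR.solve-∀
    e₂ : ∀ T → T ℕ.* (T ℕ.* T) ℕ.+ T ℕ.* (T ℕ.* T) ≡ 2 ℕ.* (T ℕ.* T ℕ.* T)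
    e₂ = ℕR.solve-∀

module SmallNorm (α : 𝔼) (α≡1 : λ³ ∣ α - 1#) where
  open CubeRoot α α≡1

  -- The norm of x + y∛α + w∛α².
  normα : 𝔼 → 𝔼 → 𝔼 → 𝔼
  normα x y w = x * x * x + α * (y * y * y) + α * α * (w * w * w) - 3# * α * (x * y * w)

  -- n² times x + yr + wr², with the approximation r = t/n in place of ∛α.
  linear : 𝔼 → ℕ → 𝔼 → 𝔼 → 𝔼 → 𝔼
  linear t n x y w = nat n * (nat n * x) + nat n * (t * y) + t * t * w

  -- c₀ bounds t/n and the error of its cube scaled by T³; c₁ bounds the coordinates of a point
  -- relative to T; B bounds the three summands of the linear form relative to n²H. K₁ = 2 · 2 · 12
  -- · B² belongs to the product with the linear form, the quadratic factor having six terms of size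
  -- 2(Bn²H)²; K₂ belongs to the error term.
  c₀ c₁ B K₁ K₂ K : ℕ
  c₀ = 8 ℕ.* N α
  c₁ = 2 ℕ.+ 4 ℕ.* c₀ ℕ.+ 8 ℕ.* (c₀ ℕ.* c₀)
  B = 1 ℕ.+ 2 ℕ.* c₀ ℕ.+ 4 ℕ.* (c₀ ℕ.* c₀)
  K₁ = 48 ℕ.* (B ℕ.* B)
  K₂ = 2 ℕ.* (c₀ ℕ.* (16 ℕ.+ 64 ℕ.* (c₀ ℕ.* c₀ ℕ.* c₀) ℕ.+ 8 ℕ.* c₀))
  K = K₁ ℕ.+ K₂

  -- An approximation whose cube is off by order T⁻³. For coordinates of order T this error adds
  -- only a bounded amount to the norm.
  record Root (T n : ℕ) (t : 𝔼) : Set where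
    field
      T≥1 : 1 ℕ.≤ T
      n≥1 : 1 ℕ.≤ n
      t≤ : ‖ t ‖ ℕ.≤ c₀ ℕ.* n
      F≤ : T ℕ.* T ℕ.* T ℕ.* ‖ F t (nat n) ‖ ℕ.≤ c₀ ℕ.* (n ℕ.* n ℕ.* n)

  opaque
    root : ∀ T → 1 ℕ.≤ T → ∃₂ λ n t → Root T n t
    -- T⁶ because N is the square of a size and an error of order T⁻³ is wanted.
    root T T≥1 with rational-approximate (T ℕ.* T ℕ.* T ℕ.* (T ℕ.* T ℕ.* T))
    ... | t , n , n≥1 , close = n , t , record { T≥1 = T≥1 ; n≥1 = n≥1
      ; t≤ = square-mono⁻¹ (‖ t ‖) (c₀ ℕ.* n) (ℕP.≤-trans (‖‖²≤ t) (ℕP.≤-trans (ℕP.*-monoʳ-≤ 16 Nt≤) (ℕP.≤-reflexive (e₁ a n))))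
      ; F≤ = square-mono⁻¹ (T³ ℕ.* ‖ F₀ ‖) (c₀ ℕ.* n³) (begin
          T³ ℕ.* ‖ F₀ ‖ ℕ.* (T³ ℕ.* ‖ F₀ ‖)       ≡⟨ e₂ T³ (‖ F₀ ‖) ⟩
          T³ ℕ.* T³ ℕ.* (‖ F₀ ‖ ℕ.* ‖ F₀ ‖)       ≤⟨ ℕP.*-monoʳ-≤ (T³ ℕ.* T³) (‖‖²≤ F₀) ⟩
          T³ ℕ.* T³ ℕ.* (16 ℕ.* N F₀)            ≡⟨ e₃ (T³ ℕ.* T³) (N F₀) ⟩
          16 ℕ.* (T³ ℕ.* T³ ℕ.* N F₀)            ≤⟨ ℕP.*-monoʳ-≤ 16 (ℕP.≤-trans close (ℕP.*-monoˡ-≤ (n³ ℕ.* n³) (m≤m*m a))) ⟩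
          16 ℕ.* (a ℕ.* a ℕ.* (n³ ℕ.* n³))       ≤⟨ ℕP.m≤m+n _ (48 ℕ.* (a ℕ.* a ℕ.* (n³ ℕ.* n³))) ⟩
          16 ℕ.* (a ℕ.* a ℕ.* (n³ ℕ.* n³)) ℕ.+ 48 ℕ.* (a ℕ.* a ℕ.* (n³ ℕ.* n³)) ≡⟨ e₄ a n³ ⟩
          c₀ ℕ.* n³ ℕ.* (c₀ ℕ.* n³) ∎) }
      where
      open ℕP.≤-Reasoning
      a n³ T³ : ℕ
      a = N α
      n³ = n ℕ.* n ℕ.* n
      T³ = T ℕ.* T ℕ.* T
      F₀ : 𝔼
      F₀ = F t (nat n)
      N-nat³ : N (nat n * nat n * nat n) ≡ n³ ℕ.* n³
      N-nat³ = trans (N-* (nat n * nat n) (nat n)) (trans (cong₂ ℕ._*_ (trans (N-* (nat n) (nat n)) (cong₂ ℕ._*_ (N-int (+ n)) (N-int (+ n)))) (N-int (+ n))) (e n))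
        where
        e : ∀ n → n ℕ.* n ℕ.* (n ℕ.* n) ℕ.* (n ℕ.* n) ≡ n ℕ.* n ℕ.* n ℕ.* (n ℕ.* n ℕ.* n)
        e = ℕR.solve-∀
      e₀ : ∀ a m → a ℕ.* a ℕ.* (m ℕ.* m) ≡ a ℕ.* m ℕ.* (a ℕ.* m)
      e₀ = ℕR.solve-∀
      e₁ : ∀ a n → 16 ℕ.* (4 ℕ.* (a ℕ.* a) ℕ.* (n ℕ.* n)) ≡ 8 ℕ.* a ℕ.* n ℕ.* (8 ℕ.* a ℕ.* n)
      e₁ = ℕR.solve-∀
      e₂ : ∀ T f → T ℕ.* f ℕ.* (T ℕ.* f) ≡ T ℕ.* T ℕ.* (f ℕ.* f)
      e₂ = ℕR.solve-∀
      e₃ : ∀ T f → T ℕ.* (16 ℕ.* f) ≡ 16 ℕ.* (T ℕ.* f)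
      e₃ = ℕR.solve-∀
      e₄ : ∀ a m → 16 ℕ.* (a ℕ.* a ℕ.* (m ℕ.* m)) ℕ.+ 48 ℕ.* (a ℕ.* a ℕ.* (m ℕ.* m)) ≡ 8 ℕ.* a ℕ.* m ℕ.* (8 ℕ.* a ℕ.* m)
      e₄ = ℕR.solve-∀
      a·n⁶≤ : a ℕ.* (n³ ℕ.* n³) ℕ.≤ a ℕ.* n³ ℕ.* (a ℕ.* n³)
      a·n⁶≤ = ℕP.≤-trans (ℕP.*-monoˡ-≤ (n³ ℕ.* n³) (m≤m*m a)) (ℕP.≤-reflexive (e₀ a n³))
      NA≤ : N (A t (nat n)) ℕ.≤ a ℕ.* n³ ℕ.* (a ℕ.* n³)
      NA≤ = ℕP.≤-trans (ℕP.≤-reflexive (trans (N-* α (nat n * nat n * nat n)) (cong (a ℕ.*_) N-nat³))) a·n⁶≤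
      T³≢0 : ℕ.NonZero (T³ ℕ.* T³)
      T³≢0 = ℕP.m*n≢0 T³ T³ {{nz}} {{nz}}
        where
        T≢0 : ℕ.NonZero T
        T≢0 = ℕ.>-nonZero T≥1
        nz : ℕ.NonZero T³
        nz = ℕP.m*n≢0 (T ℕ.* T) T {{ℕP.m*n≢0 T T {{T≢0}} {{T≢0}}}} {{T≢0}}
      NF≤ : N (- F₀) ℕ.≤ a ℕ.* n³ ℕ.* (a ℕ.* n³)
      NF≤ = ℕP.≤-trans (ℕP.≤-reflexive (N-neg F₀)) (ℕP.≤-trans (ℕP.m≤n*m (N F₀) (T³ ℕ.* T³) {{T³≢0}}) (ℕP.≤-trans close a·n⁶≤))
      opaque
        unfolding _+_
        t³≡ : ∀ A t → A + (- (A - t * t * t)) ≡ t * t * t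
        t³≡ = solve-∀ 𝔼-ring
      Nt≤ : N t ℕ.≤ 4 ℕ.* (a ℕ.* a) ℕ.* (n ℕ.* n)
      Nt≤ = cube-mono⁻¹ (N t) _ (begin
        N t ℕ.* N t ℕ.* N t                                  ≡⟨ sym (trans (N-* (t * t) t) (cong (ℕ._* N t) (N-* t t))) ⟩
        N (t * t * t)                                        ≡⟨ cong N (sym (t³≡ (A t (nat n)) t)) ⟩
        N (A t (nat n) + (- F₀))                             ≤⟨ N-+-≤ (A t (nat n)) (- F₀) (a ℕ.* n³) (a ℕ.* n³) NA≤ NF≤ ⟩
        (a ℕ.* n³ ℕ.+ a ℕ.* n³) ℕ.* (a ℕ.* n³ ℕ.+ a ℕ.* n³)   ≡⟨ e₅ a n ⟩
        4 ℕ.* (a ℕ.* a) ℕ.* (n ℕ.* n ℕ.* (n ℕ.* n) ℕ.* (n ℕ.* n)) ≤⟨ ℕP.*-monoˡ-≤ (n ℕ.* n ℕ.* (n ℕ.* n) ℕ.* (n ℕ.* n)) (m≤m³ (4 ℕ.* (a ℕ.* a))) ⟩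
        4 ℕ.* (a ℕ.* a) ℕ.* (4 ℕ.* (a ℕ.* a)) ℕ.* (4 ℕ.* (a ℕ.* a)) ℕ.* (n ℕ.* n ℕ.* (n ℕ.* n) ℕ.* (n ℕ.* n)) ≡⟨ e₆ (4 ℕ.* (a ℕ.* a)) (n ℕ.* n) ⟩
        4 ℕ.* (a ℕ.* a) ℕ.* (n ℕ.* n) ℕ.* (4 ℕ.* (a ℕ.* a) ℕ.* (n ℕ.* n)) ℕ.* (4 ℕ.* (a ℕ.* a) ℕ.* (n ℕ.* n)) ∎)
        where
        m≤m³ : ∀ m → m ℕ.≤ m ℕ.* m ℕ.* m
        m≤m³ zero = z≤n
        m≤m³ m@(suc _) = ℕP.≤-trans (m≤m*m m) (ℕP.m≤m*n (m ℕ.* m) m)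
        e₅ : ∀ a n → (a ℕ.* (n ℕ.* n ℕ.* n) ℕ.+ a ℕ.* (n ℕ.* n ℕ.* n)) ℕ.* (a ℕ.* (n ℕ.* n ℕ.* n) ℕ.+ a ℕ.* (n ℕ.* n ℕ.* n))
          ≡ 4 ℕ.* (a ℕ.* a) ℕ.* (n ℕ.* n ℕ.* (n ℕ.* n) ℕ.* (n ℕ.* n))
        e₅ = ℕR.solve-∀
        e₆ : ∀ b m → b ℕ.* b ℕ.* b ℕ.* (m ℕ.* m ℕ.* m) ≡ b ℕ.* m ℕ.* (b ℕ.* m) ℕ.* (b ℕ.* m)
        e₆ = ℕR.solve-∀

  opaque
    unfolding _+_
    -- Replacing α by its approximation (t/n)³ makes the norm form factor through the linear form.
    norm-identity : ∀ t ν x y w → let X = ν * (ν * x) ; Y = ν * (t * y) ; Z = t * t * w in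
      ν * (ν * (ν * (ν * (ν * (ν * normα x y w)))))
      ≡ (X + Y + Z) * (X * X + Y * Y + Z * Z - X * Y - Y * Z - Z * X)
        + F t ν * (ν * (ν * (ν * (y * y * y))) + (2# * (t * t * t) + F t ν) * (w * w * w) - 3# * (ν * (ν * (ν * (x * y * w)))))
    norm-identity = f α
      where
      f : ∀ α t ν x y w →
        ν * (ν * (ν * (ν * (ν * (ν * (x * x * x + α * (y * y * y) + α * α * (w * w * w) - 3# * α * (x * y * w)))))))
        ≡ (ν * (ν * x) + ν * (t * y) + t * t * w) * (ν * (ν * x) * (ν * (ν * x)) + ν * (t * y) * (ν * (t * y)) + t * t * w * (t * t * w)
            - ν * (ν * x) * (ν * (t * y)) - ν * (t * y) * (t * t * w) - t * t * w * (ν * (ν * x)))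
          + (α * (ν * ν * ν) - t * t * t) * (ν * (ν * (ν * (y * y * y))) + (2# * (t * t * t) + (α * (ν * ν * ν) - t * t * t)) * (w * w * w) - 3# * (ν * (ν * (ν * (x * y * w)))))
      f = solve-∀ 𝔼-ring

  opaque
    -- After division by n⁶ the identity has two terms: the linear form, of order T⁻², times a
    -- quadratic form of order H², and the error, of order T⁻³, times a cubic form of order H³. The
    -- bound is used twice: for H of order T it bounds the norm, and for H much smaller than T it
    -- forces the norm to vanish.
    norm-estimate : ∀ {T n t} → Root T n t → ∀ H x y w → ‖ x ‖ ℕ.≤ H → ‖ y ‖ ℕ.≤ H → ‖ w ‖ ℕ.≤ H →
      ‖ linear t n x y w ‖ ℕ.* (T ℕ.* T) ℕ.≤ n ℕ.* n ℕ.+ n ℕ.* n →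
      T ℕ.* T ℕ.* T ℕ.* ‖ normα x y w ‖ ℕ.≤ K ℕ.* (T ℕ.* (H ℕ.* H) ℕ.+ H ℕ.* H ℕ.* H)
    norm-estimate {T} {n} {t} rt H x y w x≤ y≤ w≤ small = ℕP.≤-trans (ℕP.*-cancelʳ-≤ _ _ n⁶ {{n⁶≢0}} (begin
      T³ ℕ.* ‖ normα x y w ‖ ℕ.* n⁶
        ≡⟨ e₁ T³ (‖ normα x y w ‖) n ⟩
      T³ ℕ.* (n ℕ.* (n ℕ.* (n ℕ.* (n ℕ.* (n ℕ.* (n ℕ.* ‖ normα x y w ‖))))))
        ≡⟨ cong (T³ ℕ.*_) (sym n⁶-norm) ⟩
      T³ ℕ.* ‖ ν * (ν * (ν * (ν * (ν * (ν * normα x y w))))) ‖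
        ≡⟨ cong (λ v → T³ ℕ.* ‖ v ‖) (norm-identity t ν x y w) ⟩
      T³ ℕ.* ‖ L * Q + F₀ * R ‖
        ≤⟨ ℕP.*-monoʳ-≤ T³ (⊑-+ (⊑-* {L} {Q} ℕP.≤-refl Q≤) (⊑-* {F₀} {R} ℕP.≤-refl R≤)) ⟩
      T³ ℕ.* (2 ℕ.* (‖ L ‖ ℕ.* q) ℕ.+ 2 ℕ.* (‖ F₀ ‖ ℕ.* r))
        ≡⟨ e₂ T (‖ L ‖) q (‖ F₀ ‖) r ⟩
      2 ℕ.* (T ℕ.* (‖ L ‖ ℕ.* (T ℕ.* T) ℕ.* q)) ℕ.+ 2 ℕ.* (T³ ℕ.* ‖ F₀ ‖ ℕ.* r)
        ≤⟨ ℕP.+-mono-≤ (ℕP.*-monoʳ-≤ 2 (ℕP.*-monoʳ-≤ T (ℕP.*-monoˡ-≤ q small))) (ℕP.*-monoʳ-≤ 2 (ℕP.*-monoˡ-≤ r F≤)) ⟩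
      2 ℕ.* (T ℕ.* ((n ℕ.* n ℕ.+ n ℕ.* n) ℕ.* q)) ℕ.+ 2 ℕ.* (c₀ ℕ.* (n ℕ.* n ℕ.* n) ℕ.* r)
        ≡⟨ cong₂ ℕ._+_ (e₃ T n H c₀) (e₄ n H c₀) ⟩
      K₁ ℕ.* (T ℕ.* (H ℕ.* H)) ℕ.* n⁶ ℕ.+ K₂ ℕ.* (H ℕ.* H ℕ.* H) ℕ.* n⁶
        ≡⟨ sym (ℕP.*-distribʳ-+ n⁶ (K₁ ℕ.* (T ℕ.* (H ℕ.* H))) (K₂ ℕ.* (H ℕ.* H ℕ.* H))) ⟩
      (K₁ ℕ.* (T ℕ.* (H ℕ.* H)) ℕ.+ K₂ ℕ.* (H ℕ.* H ℕ.* H)) ℕ.* n⁶ ∎)) (begin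
      K₁ ℕ.* (T ℕ.* (H ℕ.* H)) ℕ.+ K₂ ℕ.* (H ℕ.* H ℕ.* H)
        ≤⟨ ℕP.+-mono-≤ (ℕP.*-monoˡ-≤ (T ℕ.* (H ℕ.* H)) (ℕP.m≤m+n K₁ K₂)) (ℕP.*-monoˡ-≤ (H ℕ.* H ℕ.* H) (ℕP.m≤n+m K₂ K₁)) ⟩
      K ℕ.* (T ℕ.* (H ℕ.* H)) ℕ.+ K ℕ.* (H ℕ.* H ℕ.* H)   ≡⟨ sym (ℕP.*-distribˡ-+ K (T ℕ.* (H ℕ.* H)) (H ℕ.* H ℕ.* H)) ⟩
      K ℕ.* (T ℕ.* (H ℕ.* H) ℕ.+ H ℕ.* H ℕ.* H) ∎)
      where
      open Root rt
      open ℕP.≤-Reasoning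
      T³ n⁶ τ b q r : ℕ
      T³ = T ℕ.* T ℕ.* T
      n⁶ = n ℕ.* n ℕ.* n ℕ.* (n ℕ.* n ℕ.* n)
      τ = c₀ ℕ.* n
      b = n ℕ.* (n ℕ.* H) ℕ.+ n ℕ.* (2 ℕ.* (τ ℕ.* H)) ℕ.+ 2 ℕ.* (2 ℕ.* (τ ℕ.* τ) ℕ.* H)
      q = 2 ℕ.* (b ℕ.* b) ℕ.+ 2 ℕ.* (b ℕ.* b) ℕ.+ 2 ℕ.* (b ℕ.* b) ℕ.+ 2 ℕ.* (b ℕ.* b) ℕ.+ 2 ℕ.* (b ℕ.* b) ℕ.+ 2 ℕ.* (b ℕ.* b)
      r = n ℕ.* (n ℕ.* (n ℕ.* (2 ℕ.* (2 ℕ.* (H ℕ.* H) ℕ.* H))))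
        ℕ.+ 2 ℕ.* ((2 ℕ.* (2 ℕ.* (2 ℕ.* (τ ℕ.* τ) ℕ.* τ)) ℕ.+ c₀ ℕ.* (n ℕ.* n ℕ.* n)) ℕ.* (2 ℕ.* (2 ℕ.* (H ℕ.* H) ℕ.* H)))
        ℕ.+ 3 ℕ.* (n ℕ.* (n ℕ.* (n ℕ.* (2 ℕ.* (2 ℕ.* (H ℕ.* H) ℕ.* H)))))
      n⁶≢0 : ℕ.NonZero n⁶
      n⁶≢0 = ℕP.m*n≢0 (n ℕ.* n ℕ.* n) (n ℕ.* n ℕ.* n) {{nz}} {{nz}}
        where
        n≢0 : ℕ.NonZero n
        n≢0 = ℕ.>-nonZero n≥1
        nz : ℕ.NonZero (n ℕ.* n ℕ.* n)
        nz = ℕP.m*n≢0 (n ℕ.* n) n {{ℕP.m*n≢0 n n {{n≢0}} {{n≢0}}}} {{n≢0}}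
      ν F₀ X Y Z L Q R : 𝔼
      ν = nat n
      F₀ = F t ν
      X = ν * (ν * x)
      Y = ν * (t * y)
      Z = t * t * w
      L = X + Y + Z
      Q = X * X + Y * Y + Z * Z - X * Y - Y * Z - Z * X
      R = ν * (ν * (ν * (y * y * y))) + (2# * (t * t * t) + F₀) * (w * w * w) - 3# * (ν * (ν * (ν * (x * y * w))))
      n⁶-norm : ‖ ν * (ν * (ν * (ν * (ν * (ν * normα x y w))))) ‖ ≡ n ℕ.* (n ℕ.* (n ℕ.* (n ℕ.* (n ℕ.* (n ℕ.* ‖ normα x y w ‖)))))
      n⁶-norm = peel (peel (peel (peel (peel (‖nat*‖ n (normα x y w))))))
        where
        peel : ∀ {v s} → ‖ v ‖ ≡ s → ‖ ν * v ‖ ≡ n ℕ.* s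
        peel {v} eq = trans (‖nat*‖ n v) (cong (n ℕ.*_) eq)
      X≤ : ‖ X ‖ ℕ.≤ b
      X≤ = ℕP.≤-trans (⊑-nat n (⊑-nat n x≤)) (ℕP.≤-trans (ℕP.m≤m+n _ _) (ℕP.m≤m+n _ _))
      Y≤ : ‖ Y ‖ ℕ.≤ b
      Y≤ = ℕP.≤-trans (⊑-nat n (⊑-* t≤ y≤)) (ℕP.≤-trans (ℕP.m≤n+m (n ℕ.* (2 ℕ.* (τ ℕ.* H))) (n ℕ.* (n ℕ.* H))) (ℕP.m≤m+n _ _))
      Z≤ : ‖ Z ‖ ℕ.≤ b
      Z≤ = ℕP.≤-trans (⊑-* (⊑-* t≤ t≤) w≤) (ℕP.m≤n+m (2 ℕ.* (2 ℕ.* (τ ℕ.* τ) ℕ.* H)) (n ℕ.* (n ℕ.* H) ℕ.+ n ℕ.* (2 ℕ.* (τ ℕ.* H))))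
      Q≤ : ‖ Q ‖ ℕ.≤ q
      Q≤ = ⊑-sub (⊑-sub (⊑-sub (⊑-+ (⊑-+ (⊑-* X≤ X≤) (⊑-* Y≤ Y≤)) (⊑-* Z≤ Z≤)) (⊑-* X≤ Y≤)) (⊑-* Y≤ Z≤)) (⊑-* Z≤ X≤)
      F₀≤ : ‖ F₀ ‖ ℕ.≤ c₀ ℕ.* (n ℕ.* n ℕ.* n)
      F₀≤ = ℕP.≤-trans (ℕP.m≤n*m (‖ F₀ ‖) T³ {{ℕ.>-nonZero (ℕP.*-mono-≤ (ℕP.*-mono-≤ T≥1 T≥1) T≥1)}}) F≤
      R≤ : ‖ R ‖ ℕ.≤ r
      R≤ = ⊑-sub (⊑-+ (⊑-nat n (⊑-nat n (⊑-nat n (⊑-* (⊑-* y≤ y≤) y≤))))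
          (⊑-* (⊑-+ (⊑-nat 2 (⊑-* (⊑-* t≤ t≤) t≤)) F₀≤) (⊑-* (⊑-* w≤ w≤) w≤)))
        (⊑-nat 3 (⊑-nat n (⊑-nat n (⊑-nat n (⊑-* (⊑-* x≤ y≤) w≤)))))
      e₁ : ∀ T m n → T ℕ.* m ℕ.* (n ℕ.* n ℕ.* n ℕ.* (n ℕ.* n ℕ.* n)) ≡ T ℕ.* (n ℕ.* (n ℕ.* (n ℕ.* (n ℕ.* (n ℕ.* (n ℕ.* m))))))
      e₁ = ℕR.solve-∀
      e₂ : ∀ T l q f r → T ℕ.* T ℕ.* T ℕ.* (2 ℕ.* (l ℕ.* q) ℕ.+ 2 ℕ.* (f ℕ.* r)) ≡ 2 ℕ.* (T ℕ.* (l ℕ.* (T ℕ.* T) ℕ.* q)) ℕ.+ 2 ℕ.* (T ℕ.* T ℕ.* T ℕ.* f ℕ.* r)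
      e₂ = ℕR.solve-∀
      b≡ : ∀ n H c → n ℕ.* (n ℕ.* H) ℕ.+ n ℕ.* (2 ℕ.* (c ℕ.* n ℕ.* H)) ℕ.+ 2 ℕ.* (2 ℕ.* (c ℕ.* n ℕ.* (c ℕ.* n)) ℕ.* H)
        ≡ (1 ℕ.+ 2 ℕ.* c ℕ.+ 4 ℕ.* (c ℕ.* c)) ℕ.* (n ℕ.* n ℕ.* H)
      b≡ = ℕR.solve-∀
      e₃ : ∀ T n H c → let b = n ℕ.* (n ℕ.* H) ℕ.+ n ℕ.* (2 ℕ.* (c ℕ.* n ℕ.* H)) ℕ.+ 2 ℕ.* (2 ℕ.* (c ℕ.* n ℕ.* (c ℕ.* n)) ℕ.* H)
                           B = 1 ℕ.+ 2 ℕ.* c ℕ.+ 4 ℕ.* (c ℕ.* c) in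
        2 ℕ.* (T ℕ.* ((n ℕ.* n ℕ.+ n ℕ.* n) ℕ.* (2 ℕ.* (b ℕ.* b) ℕ.+ 2 ℕ.* (b ℕ.* b) ℕ.+ 2 ℕ.* (b ℕ.* b) ℕ.+ 2 ℕ.* (b ℕ.* b) ℕ.+ 2 ℕ.* (b ℕ.* b) ℕ.+ 2 ℕ.* (b ℕ.* b))))
        ≡ 48 ℕ.* (B ℕ.* B) ℕ.* (T ℕ.* (H ℕ.* H)) ℕ.* (n ℕ.* n ℕ.* n ℕ.* (n ℕ.* n ℕ.* n))
      e₃ T n H c = trans (cong (λ b → 2 ℕ.* (T ℕ.* ((n ℕ.* n ℕ.+ n ℕ.* n) ℕ.* (2 ℕ.* (b ℕ.* b) ℕ.+ 2 ℕ.* (b ℕ.* b) ℕ.+ 2 ℕ.* (b ℕ.* b) ℕ.+ 2 ℕ.* (b ℕ.* b) ℕ.+ 2 ℕ.* (b ℕ.* b) ℕ.+ 2 ℕ.* (b ℕ.* b)))))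
          (b≡ n H c)) (g T n H (1 ℕ.+ 2 ℕ.* c ℕ.+ 4 ℕ.* (c ℕ.* c)))
        where
        g : ∀ T n H B → 2 ℕ.* (T ℕ.* ((n ℕ.* n ℕ.+ n ℕ.* n) ℕ.* (2 ℕ.* (B ℕ.* (n ℕ.* n ℕ.* H) ℕ.* (B ℕ.* (n ℕ.* n ℕ.* H))) ℕ.+ 2 ℕ.* (B ℕ.* (n ℕ.* n ℕ.* H) ℕ.* (B ℕ.* (n ℕ.* n ℕ.* H)))
          ℕ.+ 2 ℕ.* (B ℕ.* (n ℕ.* n ℕ.* H) ℕ.* (B ℕ.* (n ℕ.* n ℕ.* H))) ℕ.+ 2 ℕ.* (B ℕ.* (n ℕ.* n ℕ.* H) ℕ.* (B ℕ.* (n ℕ.* n ℕ.* H)))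
          ℕ.+ 2 ℕ.* (B ℕ.* (n ℕ.* n ℕ.* H) ℕ.* (B ℕ.* (n ℕ.* n ℕ.* H))) ℕ.+ 2 ℕ.* (B ℕ.* (n ℕ.* n ℕ.* H) ℕ.* (B ℕ.* (n ℕ.* n ℕ.* H))))))
          ≡ 48 ℕ.* (B ℕ.* B) ℕ.* (T ℕ.* (H ℕ.* H)) ℕ.* (n ℕ.* n ℕ.* n ℕ.* (n ℕ.* n ℕ.* n))
        g = ℕR.solve-∀
      e₄ : ∀ n H c → 2 ℕ.* (c ℕ.* (n ℕ.* n ℕ.* n) ℕ.* (n ℕ.* (n ℕ.* (n ℕ.* (2 ℕ.* (2 ℕ.* (H ℕ.* H) ℕ.* H))))
          ℕ.+ 2 ℕ.* ((2 ℕ.* (2 ℕ.* (2 ℕ.* (c ℕ.* n ℕ.* (c ℕ.* n)) ℕ.* (c ℕ.* n))) ℕ.+ c ℕ.* (n ℕ.* n ℕ.* n)) ℕ.* (2 ℕ.* (2 ℕ.* (H ℕ.* H) ℕ.* H)))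
          ℕ.+ 3 ℕ.* (n ℕ.* (n ℕ.* (n ℕ.* (2 ℕ.* (2 ℕ.* (H ℕ.* H) ℕ.* H)))))))
        ≡ 2 ℕ.* (c ℕ.* (16 ℕ.+ 64 ℕ.* (c ℕ.* c ℕ.* c) ℕ.+ 8 ℕ.* c)) ℕ.* (H ℕ.* H ℕ.* H) ℕ.* (n ℕ.* n ℕ.* n ℕ.* (n ℕ.* n ℕ.* n))
      e₄ = ℕR.solve-∀

  record Point (T : ℕ) : Set where
    field
      {n} : ℕ
      {t} : 𝔼
      isRoot : Root T n t
      x y w : 𝔼
      nonzero : ¬ (y ≡ 0# × w ≡ 0#)
      x≤ : ‖ x ‖ ℕ.≤ c₁ ℕ.* T
      y≤ : ‖ y ‖ ℕ.≤ c₁ ℕ.* T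
      w≤ : ‖ w ‖ ℕ.≤ c₁ ℕ.* T
      small : ‖ linear t n x y w ‖ ℕ.* (T ℕ.* T) ℕ.≤ n ℕ.* n ℕ.+ n ℕ.* n

  opaque
    point : ∀ T → 1 ℕ.≤ T → Point T
    point T T≥1 with root T T≥1
    ... | n , t , rt with small-linear-form T n t {{ℕ.>-nonZero T≥1}} {{ℕ.>-nonZero (Root.n≥1 rt)}}
    ...   | x , y , w , nonzero , y≤ , w≤ , small = record { isRoot = rt ; x = x ; y = y ; w = w ; nonzero = nonzero
        ; x≤ = ℕP.*-cancelˡ-≤ n {{n≢0}} (ℕP.*-cancelˡ-≤ n {{n≢0}} (begin
            n ℕ.* (n ℕ.* ‖ x ‖)           ≡⟨ sym (trans (‖nat*‖ n (nat n * x)) (cong (n ℕ.*_) (‖nat*‖ n x))) ⟩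
            ‖ nat n * (nat n * x) ‖       ≡⟨ cong ‖_‖ (isolate (nat n * (nat n * x)) (nat n * (t * y)) (t * t * w)) ⟩
            ‖ linear t n x y w - nat n * (t * y) - t * t * w ‖
              ≤⟨ ⊑-sub (⊑-sub L≤ (⊑-nat n (⊑-* t≤ y≤))) (⊑-* (⊑-* t≤ t≤) w≤) ⟩
            (n ℕ.* n ℕ.+ n ℕ.* n) ℕ.+ n ℕ.* (2 ℕ.* (c₀ ℕ.* n ℕ.* (T ℕ.+ T))) ℕ.+ 2 ℕ.* (2 ℕ.* (c₀ ℕ.* n ℕ.* (c₀ ℕ.* n)) ℕ.* (T ℕ.+ T))
              ≤⟨ ℕP.+-monoˡ-≤ _ (ℕP.+-monoˡ-≤ _ (ℕP.m≤m*n (n ℕ.* n ℕ.+ n ℕ.* n) T {{ℕ.>-nonZero T≥1}})) ⟩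
            (n ℕ.* n ℕ.+ n ℕ.* n) ℕ.* T ℕ.+ n ℕ.* (2 ℕ.* (c₀ ℕ.* n ℕ.* (T ℕ.+ T))) ℕ.+ 2 ℕ.* (2 ℕ.* (c₀ ℕ.* n ℕ.* (c₀ ℕ.* n)) ℕ.* (T ℕ.+ T))
              ≡⟨ e n T c₀ ⟩
            n ℕ.* (n ℕ.* (c₁ ℕ.* T)) ∎))
        ; y≤ = ℕP.≤-trans y≤ 2T≤ ; w≤ = ℕP.≤-trans w≤ 2T≤ ; small = small }
      where
      open Root rt using (n≥1; t≤)
      open ℕP.≤-Reasoning
      n≢0 : ℕ.NonZero n
      n≢0 = ℕ.>-nonZero n≥1
      2T≤ : T ℕ.+ T ℕ.≤ c₁ ℕ.* T
      2T≤ = ℕP.≤-trans (ℕP.≤-reflexive (f T)) (ℕP.*-monoˡ-≤ T (ℕP.≤-trans (ℕP.m≤m+n 2 (4 ℕ.* c₀)) (ℕP.m≤m+n _ (8 ℕ.* (c₀ ℕ.* c₀)))))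
        where
        f : ∀ T → T ℕ.+ T ≡ 2 ℕ.* T
        f = ℕR.solve-∀
      L≤ : ‖ linear t n x y w ‖ ℕ.≤ n ℕ.* n ℕ.+ n ℕ.* n
      L≤ = ℕP.≤-trans (ℕP.m≤m*n _ (T ℕ.* T) {{ℕ.>-nonZero (ℕP.*-mono-≤ T≥1 T≥1)}}) small
      opaque
        unfolding _+_
        isolate : ∀ X Y Z → X ≡ X + Y + Z - Y - Z
        isolate = solve-∀ 𝔼-ring
      e : ∀ n T c → (n ℕ.* n ℕ.+ n ℕ.* n) ℕ.* T ℕ.+ n ℕ.* (2 ℕ.* (c ℕ.* n ℕ.* (T ℕ.+ T))) ℕ.+ 2 ℕ.* (2 ℕ.* (c ℕ.* n ℕ.* (c ℕ.* n)) ℕ.* (T ℕ.+ T))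
        ≡ n ℕ.* (n ℕ.* ((2 ℕ.+ 4 ℕ.* c ℕ.+ 8 ℕ.* (c ℕ.* c)) ℕ.* T))
      e = ℕR.solve-∀

  C₁ : ℕ
  C₁ = K ℕ.* (c₁ ℕ.* c₁ ℕ.+ c₁ ℕ.* c₁ ℕ.* c₁)

  opaque
    K≥1 : 1 ℕ.≤ K
    K≥1 = ℕP.≤-trans (s≤s z≤n) (ℕP.m≤m+n K₁ K₂)

    norm-bounded : ∀ {T} (P : Point T) → ‖ normα (Point.x P) (Point.y P) (Point.w P) ‖ ℕ.≤ C₁
    norm-bounded {T} P = ℕP.*-cancelˡ-≤ (T ℕ.* T ℕ.* T) {{ℕ.>-nonZero (ℕP.*-mono-≤ (ℕP.*-mono-≤ T≥1 T≥1) T≥1)}}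
      (ℕP.≤-trans (norm-estimate isRoot (c₁ ℕ.* T) x y w x≤ y≤ w≤ small) (ℕP.≤-reflexive (e K c₁ T)))
      where
      open Point P
      open Root isRoot
      e : ∀ K c T → K ℕ.* (T ℕ.* (c ℕ.* T ℕ.* (c ℕ.* T)) ℕ.+ c ℕ.* T ℕ.* (c ℕ.* T) ℕ.* (c ℕ.* T)) ≡ T ℕ.* T ℕ.* T ℕ.* (K ℕ.* (c ℕ.* c ℕ.+ c ℕ.* c ℕ.* c))
      e = ℕR.solve-∀

    -- If the coordinates of P also served the much larger T′, the estimate for T′ with the small
    -- height c₁T would leave a norm of size below 1, hence 0, against anisotropy.
    points-distinct : (∀ x y w → normα x y w ≡ 0# → y ≡ 0# × w ≡ 0#) →
      ∀ {T T′} (P : Point T) (P′ : Point T′) → 2 ℕ.* (K ℕ.* (c₁ ℕ.* T)) ℕ.< T′ →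
      ¬ (Point.x P ≡ Point.x P′ × Point.y P ≡ Point.y P′ × Point.w P ≡ Point.w P′)
    points-distinct anisotropic {T} {T′} P P′ gap (x≡ , y≡ , w≡) = Point.nonzero P (anisotropic x y w (‖‖≡0 (normα x y w) (vanish (‖ normα x y w ‖) refl)))
      where
      open Point P
      x′ y′ w′ : 𝔼
      x′ = Point.x P′
      y′ = Point.y P′
      w′ = Point.w P′
      small′ : ‖ linear (Point.t P′) (Point.n P′) x y w ‖ ℕ.* (T′ ℕ.* T′) ℕ.≤ Point.n P′ ℕ.* Point.n P′ ℕ.+ Point.n P′ ℕ.* Point.n P′
      small′ = subst (λ v → ‖ v ‖ ℕ.* (T′ ℕ.* T′) ℕ.≤ Point.n P′ ℕ.* Point.n P′ ℕ.+ Point.n P′ ℕ.* Point.n P′)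
        (sym (trans (cong (λ v → linear (Point.t P′) (Point.n P′) v y w) x≡) (cong₂ (linear (Point.t P′) (Point.n P′) x′) y≡ w≡))) (Point.small P′)
      vanish : ∀ m → ‖ normα x y w ‖ ≡ m → ‖ normα x y w ‖ ≡ 0
      vanish zero eq = eq
      vanish (suc m) eq = ⊥-elim (ℕP.<⇒≱ (lopsided K (c₁ ℕ.* T) T′ K≥1 gap) (ℕP.≤-trans
        (ℕP.m≤m*n (T′ ℕ.* T′ ℕ.* T′) (suc m)) (subst (λ k → T′ ℕ.* T′ ℕ.* T′ ℕ.* k ℕ.≤ _) eq (norm-estimate (Point.isRoot P′) (c₁ ℕ.* T) x y w x≤ y≤ w≤ small′))))

  heights : ℕ → ℕ
  heights zero = 1
  heights (suc i) = suc (2 ℕ.* (K ℕ.* (c₁ ℕ.* heights i)))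

  opaque
    heights≥1 : ∀ i → 1 ℕ.≤ heights i
    heights≥1 zero = ℕP.≤-refl
    heights≥1 (suc i) = s≤s z≤n

    heights-gap : ∀ {i j} → i ℕ.< j → 2 ℕ.* (K ℕ.* (c₁ ℕ.* heights i)) ℕ.< heights j
    heights-gap {i} {suc j} (s≤s i≤j) with ℕP.m≤n⇒m<n∨m≡n i≤j
    ... | inj₂ refl = ℕP.n<1+n _
    ... | inj₁ i<j = ℕP.<-≤-trans (heights-gap i<j) (ℕP.≤-trans (ℕP.≤-trans (ℕP.m≤n*m (heights j) c₁) (ℕP.≤-trans (ℕP.m≤n*m (c₁ ℕ.* heights j) K {{ℕ.>-nonZero K≥1}}) (ℕP.m≤n*m _ 2))) (ℕP.n≤1+n _))

  points : ∀ i → Point (heights i)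
  points i = point (heights i) (heights≥1 i)

-- A nontrivial unit as the quotient of two elements of equal norm.

opaque
  -- The modulus 2c + 1 exceeds the size 2c of any difference.
  bounded-≡ : ∀ c x y → ‖ x ‖ ℕ.≤ c → ‖ y ‖ ℕ.≤ c → residueᴱ (suc (c ℕ.+ c)) x ≡ residueᴱ (suc (c ℕ.+ c)) y → x ≡ y
  bounded-≡ c x y x≤ y≤ same = go (residueᴱ-≡ (suc (c ℕ.+ c)) x y same)
    where
    opaque
      unfolding _+_
      isolate : ∀ y v → y + v - y ≡ v
      isolate = solve-∀ 𝔼-ring
    V : ℕ
    V = suc (c ℕ.+ c)
    go : (∃ λ q → x ≡ y + nat V * q) → x ≡ y
    go (q , x≡) = trans x≡ (trans (cong (λ r → y + nat V * r) (‖‖≡0 q (vanish (‖ q ‖) refl))) (trans (cong (λ v → y + v) (*-zeroʳ (nat V))) (trans (+-comm y 0#) (+-identityˡ y))))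
      where
      vanish : ∀ k → ‖ q ‖ ≡ k → ‖ q ‖ ≡ 0
      vanish zero eq = eq
      vanish (suc k) eq = ⊥-elim (ℕP.<⇒≱ (ℕP.n<1+n (c ℕ.+ c)) (begin
        V                     ≤⟨ ℕP.m≤m*n V (suc k) ⟩
        V ℕ.* suc k           ≡⟨ cong (V ℕ.*_) (sym eq) ⟩
        V ℕ.* ‖ q ‖           ≡⟨ sym (‖nat*‖ V q) ⟩
        ‖ nat V * q ‖         ≡⟨ cong ‖_‖ (trans (sym (isolate y (nat V * q))) (cong (_- y) (sym x≡))) ⟩
        ‖ x - y ‖             ≤⟨ ⊑-sub x≤ y≤ ⟩
        c ℕ.+ c ∎))
        where open ℕP.≤-Reasoning

opaque
  collision : ∀ c W .{{_ : ℕ.NonZero W}} (f : ℕ → 𝔼) (h : ℕ → 𝕋) → (∀ i → ‖ f i ‖ ℕ.≤ c) →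
    ∃₂ λ i j → i ℕ.< j × f i ≡ f j × (∃ λ q → h i ≡ h j +ᵀ scale (nat W) q)
  collision c W f h bounded = go (FinP.pigeonhole (ℕP.n<1+n _) λ i → Fin.combine (residueᴱ (suc (c ℕ.+ c)) (f (toℕ i))) (residueᵀ W (h (toℕ i))))
    where
    go : ∀ {n} → (∃₂ λ (i j : Fin n) → i Fin.< j × Fin.combine (residueᴱ (suc (c ℕ.+ c)) (f (toℕ i))) (residueᵀ W (h (toℕ i)))
        ≡ Fin.combine (residueᴱ (suc (c ℕ.+ c)) (f (toℕ j))) (residueᵀ W (h (toℕ j)))) →
      ∃₂ λ i j → i ℕ.< j × f i ≡ f j × (∃ λ q → h i ≡ h j +ᵀ scale (nat W) q)
    go (i , j , i<j , same) = toℕ i , toℕ j , i<j ,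
      bounded-≡ c (f (toℕ i)) (f (toℕ j)) (bounded (toℕ i)) (bounded (toℕ j)) (proj₁ same′) ,
      residueᵀ-≡ W (h (toℕ i)) (h (toℕ j)) (proj₂ same′)
      where
      same′ : residueᴱ (suc (c ℕ.+ c)) (f (toℕ i)) ≡ residueᴱ (suc (c ℕ.+ c)) (f (toℕ j)) × residueᵀ W (h (toℕ i)) ≡ residueᵀ W (h (toℕ j))
      same′ = FinP.combine-injective _ _ _ _ same

module NontrivialUnit {b g : 𝔼} (S : StructureConstants b g) (anisotropic : ∀ x → Order.nm S x ≡ 0# → x ≡ 0ᵀ)
  (g≢0 : g ≢ 0#) (α≡1 : λ³ ∣ b * (g * g) - 1#) where
  open Order S
  open Ambiguous S
  open Units S
  open SmallNorm (b * (g * g)) α≡1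
  open CommutativeRing 𝕆 using () renaming (distribʳ to ·-distribʳ)

  -- θ² = gθ₂, hence the coefficient g · w.
  element : 𝔼 → 𝔼 → 𝔼 → 𝕋
  element x y w = const x +ᵀ scale y θ₁ +ᵀ scale (g * w) θ₂

  opaque
    unfolding _+ᵀ_
    toθ-element : ∀ x y w → toθ (element x y w) ≡ scale 3# (tri x y (g * w))
    toθ-element x y w = cong₃ tri (f₀ x y (g * w)) (f₁ x y (g * w)) (f₂ x y (g * w))
      where
      opaque
        unfolding _+_
        f₀ : ∀ x y v → (x + y * 1# + v * 1#) + (x + y * ω² + v * ω) + (x + y * ω + v * ω²) ≡ 3# * x
        f₀ = solve-∀ 𝔼-ring
        f₁ : ∀ x y v → (x + y * 1# + v * 1#) + ω * (x + y * ω² + v * ω) + ω² * (x + y * ω + v * ω²) ≡ 3# * y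
        f₁ = solve-∀ 𝔼-ring
        f₂ : ∀ x y v → (x + y * 1# + v * 1#) + ω² * (x + y * ω² + v * ω) + ω * (x + y * ω + v * ω²) ≡ 3# * v
        f₂ = solve-∀ 𝔼-ring

    nm-element : ∀ x y w → nm (element x y w) ≡ normα x y w
    nm-element x y w = *-cancelˡ 27# (λ ()) (trans (27·nm (element x y w) (toθ-element x y w)) (f b g x y w))
      where
      opaque
        unfolding _+_
        f : ∀ b g x y w → 3# * x * (3# * x) * (3# * x) + b * (g * g) * (3# * y * (3# * y) * (3# * y))
            + b * b * g * (3# * (g * w) * (3# * (g * w)) * (3# * (g * w))) - 3# * (b * g) * (3# * x * (3# * y) * (3# * (g * w)))
          ≡ 27# * (x * x * x + b * (g * g) * (y * y * y) + b * (g * g) * (b * (g * g)) * (w * w * w) - 3# * (b * (g * g)) * (x * y * w))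
        f = solve-∀ 𝔼-ring

  opaque
    coordinates-determined : ∀ {x y v x′ y′ v′} → scale 3# (tri x y (g * v)) ≡ scale 3# (tri x′ y′ (g * v′)) → x ≡ x′ × y ≡ y′ × v ≡ v′
    coordinates-determined {x} {y} {v} {x′} {y′} {v′} eq = go (scale-cancel 3# 3≢0 eq)
      where
      go : tri x y (g * v) ≡ tri x′ y′ (g * v′) → x ≡ x′ × y ≡ y′ × v ≡ v′
      go eq = cong (λ { (tri a _ _) → a }) eq , cong (λ { (tri _ a _) → a }) eq , *-cancelˡ g g≢0 (cong (λ { (tri _ _ a) → a }) eq)

  opaque
    element-injective : ∀ {x y w x′ y′ w′} → element x y w ≡ element x′ y′ w′ → x ≡ x′ × y ≡ y′ × w ≡ w′
    element-injective {x} {y} {w} {x′} {y′} {w′} eq = coordinates-determined (trans (sym (toθ-element x y w)) (trans (cong toθ eq) (toθ-element x′ y′ w′)))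

    normα-anisotropic : ∀ x y w → normα x y w ≡ 0# → y ≡ 0# × w ≡ 0#
    normα-anisotropic x y w norm≡0 = proj₂ (coordinates-determined {x} {y} {w} {0#} {0#} {0#} (trans (sym (toθ-element x y w))
      (trans (cong toθ (anisotropic (element x y w) (trans (nm-element x y w) norm≡0))) (trans (toθ-const 0#) (cong (λ z → scale 3# (tri 0# 0# z)) (sym (*-zeroʳ g)))))))

  opaque
    pointNorm : ℕ → 𝔼
    pointNorm i = normα (Point.x (points i)) (Point.y (points i)) (Point.w (points i))

    pointElement : ℕ → 𝕋
    pointElement i = element (Point.x (points i)) (Point.y (points i)) (Point.w (points i))

    nm-pointElement : ∀ i → nm (pointElement i) ≡ pointNorm i
    nm-pointElement i = nm-element (Point.x (points i)) (Point.y (points i)) (Point.w (points i))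

    pointNorms-bounded : ∃ λ c → ∀ i → ‖ pointNorm i ‖ ℕ.≤ c
    pointNorms-bounded = C₁ , λ i → norm-bounded (points i)

    pointNorm≢0 : ∀ i → pointNorm i ≢ 0#
    pointNorm≢0 i norm≡0 = Point.nonzero (points i) (normα-anisotropic (Point.x (points i)) (Point.y (points i)) (Point.w (points i)) norm≡0)

    pointElement-injective : ∀ {i j} → i ℕ.< j → pointElement i ≢ pointElement j
    pointElement-injective {i} {j} i<j eq = points-distinct normα-anisotropic (points i) (points j) (heights-gap i<j) (element-injective eq)

  IndependentUnit : ℕ → Set
  IndependentUnit E = ∃₂ λ u y → nm u ≡ 1# × y ≢ 0ᵀ × u ≡ 1ᵀ +ᵀ y × u ≡1[mod 3# * nat E ]

  opaque
    -- Congruence modulo a multiple of the norm makes the quotient of two elements integral.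
    quotient-unit : ∀ E F {eᵢ eⱼ q} → eᵢ ≢ eⱼ → nm eᵢ ≡ nm eⱼ → nm eⱼ ≢ 0# → nm eⱼ ∣ nat F →
      eᵢ ≡ eⱼ +ᵀ scale (nat (3 ℕ.* E ℕ.* F)) q → IndependentUnit E
    quotient-unit E F {eᵢ} {eⱼ} {q} eᵢ≢eⱼ same-norm ν≢0 (f , F≡) eᵢ≡ = 1ᵀ +ᵀ y , y , nm-u , y≢0 , refl ,
      (scale f (q · adj) , cong (λ z → 1ᵀ +ᵀ z) (trans (cong (λ c → scale (c * f) (q · adj)) (nat-* 3 E)) (sym (scale-scale (3# * nat E) f (q · adj)))))
      where
      open ≡-Reasoning
      -- The unit is eᵢ/eⱼ = 1 + 3EF · q/eⱼ. From eⱼ · adj = ν and F = νf one gets F/eⱼ = f · adj,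
      -- so y = 3Ef · q · adj is integral and divisible by 3E.
      adj y : 𝕋
      adj = σ eⱼ · σ (σ eⱼ)
      y = scale (nat (3 ℕ.* E) * f) (q · adj)
      ν : 𝔼
      ν = nm eⱼ
      adj·eⱼ : adj · eⱼ ≡ const ν
      adj·eⱼ = trans (·-comm adj eⱼ) (nm-spec eⱼ)
      y·eⱼ : y · eⱼ ≡ scale (nat (3 ℕ.* E ℕ.* F)) q
      y·eⱼ = begin
        scale (nat (3 ℕ.* E) * f) (q · adj) · eⱼ        ≡⟨ scale-·ˡ (nat (3 ℕ.* E) * f) (q · adj) eⱼ ⟩
        scale (nat (3 ℕ.* E) * f) (q · adj · eⱼ)        ≡⟨ cong (scale (nat (3 ℕ.* E) * f)) (trans (·-assoc q adj eⱼ) (trans (cong (q ·_) adj·eⱼ) (trans (·-comm q (const ν)) (const-· ν q)))) ⟩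
        scale (nat (3 ℕ.* E) * f) (scale ν q)           ≡⟨ scale-scale (nat (3 ℕ.* E) * f) ν q ⟩
        scale (nat (3 ℕ.* E) * f * ν) q                 ≡⟨ cong (λ s → scale s q) (trans (*-assoc (nat (3 ℕ.* E)) f ν) (trans (cong (nat (3 ℕ.* E) *_) (trans (*-comm f ν) (sym F≡))) (sym (nat-* (3 ℕ.* E) F)))) ⟩
        scale (nat (3 ℕ.* E ℕ.* F)) q ∎
      u·eⱼ : (1ᵀ +ᵀ y) · eⱼ ≡ eᵢ
      u·eⱼ = trans (·-distribʳ eⱼ 1ᵀ y) (trans (cong₂ _+ᵀ_ (·-identityˡ eⱼ) y·eⱼ) (sym eᵢ≡))
      nm-u : nm (1ᵀ +ᵀ y) ≡ 1#
      nm-u = *-cancelˡ ν ν≢0 (begin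
        ν * nm (1ᵀ +ᵀ y)          ≡⟨ *-comm ν (nm (1ᵀ +ᵀ y)) ⟩
        nm (1ᵀ +ᵀ y) * ν          ≡⟨ sym (nm-· (1ᵀ +ᵀ y) eⱼ) ⟩
        nm ((1ᵀ +ᵀ y) · eⱼ)       ≡⟨ cong nm u·eⱼ ⟩
        nm eᵢ                     ≡⟨ same-norm ⟩
        ν                         ≡⟨ sym (*-identityʳ ν) ⟩
        ν * 1# ∎)
      y≢0 : y ≢ 0ᵀ
      y≢0 y≡0 = eᵢ≢eⱼ (trans (sym u·eⱼ) (trans (cong (_· eⱼ) (trans (cong (λ z → 1ᵀ +ᵀ z) y≡0) (trans (+ᵀ-comm 1ᵀ 0ᵀ) (+ᵀ-identityˡ 1ᵀ)))) (·-identityˡ eⱼ)))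

  opaque
    -- ν divides the integer N ν, which is positive and at most c².
    bounded-norm-∣ : ∀ c ν → ν ≢ 0# → ‖ ν ‖ ℕ.≤ c → ν ∣ nat ((c ℕ.* c) !)
    bounded-norm-∣ c ν ν≢0 ν≤ = ∣-trans (conj ν , sym (x*conj ν)) (nat-∣ (divides-! (c ℕ.* c) (N ν) (ℕP.n≢0⇒n>0 (N≢0 ν≢0))
      (ℕP.≤-trans (N≤‖‖² ν) (ℕP.*-mono-≤ ν≤ ν≤))))

  opaque
    independent-unit : ∀ E .{{_ : ℕ.NonZero E}} → IndependentUnit E
    independent-unit E = go pointNorms-bounded
      where
      go : (∃ λ c → ∀ i → ‖ pointNorm i ‖ ℕ.≤ c) → IndependentUnit E
      go (c , bounded) = from-collision (collision c (3 ℕ.* E ℕ.* F)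
          {{ℕP.m*n≢0 (3 ℕ.* E) F {{ℕP.m*n≢0 3 E}} {{(c ℕ.* c) ℕP.!≢0}}}} pointNorm pointElement bounded)
        where
        F : ℕ
        F = (c ℕ.* c) !
        from-collision : (∃₂ λ i j → i ℕ.< j × pointNorm i ≡ pointNorm j × (∃ λ q → pointElement i ≡ pointElement j +ᵀ scale (nat (3 ℕ.* E ℕ.* F)) q)) → IndependentUnit E
        from-collision (i , j , i<j , norms≡ , q , eᵢ≡) = quotient-unit E F (pointElement-injective i<j)
          (trans (nm-pointElement i) (trans norms≡ (sym (nm-pointElement j)))) ν≢0
          (bounded-norm-∣ c (nm (pointElement j)) ν≢0 (subst (λ v → ‖ v ‖ ℕ.≤ c) (sym (nm-pointElement j)) (bounded j))) eᵢ≡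
          where
          ν≢0 : nm (pointElement j) ≢ 0#
          ν≢0 ν≡0 = pointNorm≢0 j (trans (sym (nm-pointElement j)) ν≡0)

  opaque
    existence : Descent → NormRoot
    existence descent = go (independent-unit (3 ℕ.* exponent) {{ℕP.m*n≢0 3 exponent {{_}} {{exponent≢0}}}})
      where
      go : IndependentUnit (3 ℕ.* exponent) → NormRoot
      go (u , y , nm-u , y≢0 , u≡ , u≡1) = norm-root descent anisotropic u y nm-u y≢0 u≡ u≡1

-- The field ℚ(ζ₃) and the embedding of ℤ[ζ₃].

infixl 6 _⊞_
infixl 7 _⊠_

-- Data.Rational's operations unfold on variables; these copies do not.
opaque
  _⊞_ _⊠_ : ℚ → ℚ → ℚ
  _⊞_ = ℚ._+_
  _⊠_ = ℚ._*_

  ℚ0 ℚ1 ℚ-1 : ℚ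
  ℚ0 = 0ℚ
  ℚ1 = 1ℚ
  ℚ-1 = ℚ.- 1ℚ

  ℚ-isCommutativeSemiring : IsCommutativeSemiring _≡_ _⊞_ _⊠_ ℚ0 ℚ1
  ℚ-isCommutativeSemiring = IsCommutativeRing.isCommutativeSemiring ℚP.+-*-isCommutativeRing

  neg≡ : ∀ p → ℚ.- p ≡ ℚ-1 ⊠ p
  neg≡ p = sym (RingProperties.-1*x≈-x ℚP.+-*-ring p)

ℚ-commutativeSemiring : CommutativeSemiring 0ℓ 0ℓ
ℚ-commutativeSemiring = record { isCommutativeSemiring = ℚ-isCommutativeSemiring }

fraction : ℤ → ℚ
fraction a = a ℚ./ 1

opaque
  unfolding _⊞_
  fromℚᵘ-+ : ∀ p q → ℚ.fromℚᵘ (p ℚᵘ.+ q) ≡ ℚ.fromℚᵘ p ⊞ ℚ.fromℚᵘ q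
  fromℚᵘ-+ p q = ℚP.toℚᵘ-injective (ℚᵘP.≃-trans (ℚP.toℚᵘ-fromℚᵘ (p ℚᵘ.+ q)) (ℚᵘP.≃-sym (ℚᵘP.≃-trans (ℚP.toℚᵘ-homo-+ (ℚ.fromℚᵘ p) (ℚ.fromℚᵘ q))
    (ℚᵘP.+-cong (ℚP.toℚᵘ-fromℚᵘ p) (ℚP.toℚᵘ-fromℚᵘ q)))))

  fromℚᵘ-* : ∀ p q → ℚ.fromℚᵘ (p ℚᵘ.* q) ≡ ℚ.fromℚᵘ p ⊠ ℚ.fromℚᵘ q
  fromℚᵘ-* p q = ℚP.toℚᵘ-injective (ℚᵘP.≃-trans (ℚP.toℚᵘ-fromℚᵘ (p ℚᵘ.* q)) (ℚᵘP.≃-sym (ℚᵘP.≃-trans (ℚP.toℚᵘ-homo-* (ℚ.fromℚᵘ p) (ℚ.fromℚᵘ q))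
    (ℚᵘP.*-cong (ℚP.toℚᵘ-fromℚᵘ p) (ℚP.toℚᵘ-fromℚᵘ q)))))

opaque
  fraction-+ : ∀ a b → fraction (a ℤ.+ b) ≡ fraction a ⊞ fraction b
  fraction-+ a b = trans (ℚP.fromℚᵘ-cong {ℚᵘ.mkℚᵘ (a ℤ.+ b) 0} {ℚᵘ.mkℚᵘ a 0 ℚᵘ.+ ℚᵘ.mkℚᵘ b 0} (ℚᵘ.*≡* (f a b))) (fromℚᵘ-+ (ℚᵘ.mkℚᵘ a 0) (ℚᵘ.mkℚᵘ b 0))
    where
    f : ∀ a b → (a ℤ.+ b) ℤ.* (+ 1) ≡ (a ℤ.* (+ 1) ℤ.+ b ℤ.* (+ 1)) ℤ.* (+ 1)
    f = ℤR.solve-∀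

  fraction-* : ∀ a b → fraction (a ℤ.* b) ≡ fraction a ⊠ fraction b
  fraction-* a b = fromℚᵘ-* (ℚᵘ.mkℚᵘ a 0) (ℚᵘ.mkℚᵘ b 0)

  fraction-neg : ∀ a → fraction (ℤ.- a) ≡ fraction ℤ.-1ℤ ⊠ fraction a
  fraction-neg a = trans (cong fraction (sym (ℤP.-1*i≡-i a))) (fraction-* ℤ.-1ℤ a)

  fraction-inverse : ∀ n → fraction (+ suc n) ⊠ ((+ 1) ℚ./ suc n) ≡ fraction (+ 1)
  fraction-inverse n = trans (sym (fromℚᵘ-* (ℚᵘ.mkℚᵘ (+ suc n) 0) (ℚᵘ.mkℚᵘ (+ 1) n)))
    (ℚP.fromℚᵘ-cong {ℚᵘ.mkℚᵘ (+ suc n) 0 ℚᵘ.* ℚᵘ.mkℚᵘ (+ 1) n} {ℚᵘ.mkℚᵘ (+ 1) 0} (ℚᵘ.*≡* (trans (ℤP.*-identityʳ ((+ suc n) ℤ.* (+ 1))) (trans (ℤP.*-identityʳ (+ suc n)) (trans (cong (λ k → + suc k) (sym (ℕP.+-identityʳ n))) (sym (ℤP.*-identityˡ (+ suc (n ℕ.+ 0)))))))))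

opaque
  unfolding _⊞_
  fraction-0 : fraction (+ 0) ≡ ℚ0
  fraction-0 = refl

  fraction-1 : fraction (+ 1) ≡ ℚ1
  fraction-1 = refl

  fraction--1 : fraction ℤ.-1ℤ ≡ ℚ-1
  fraction--1 = refl

infixl 6 _+ₖ_
infixl 7 _*ₖ_

opaque
  _+ₖ_ _*ₖ_ : 𝕂 → 𝕂 → 𝕂
  _+ₖ_ (_+_ζₖ a b) (_+_ζₖ c d) = _+_ζₖ (a ⊞ c) (b ⊞ d)
  _*ₖ_ (_+_ζₖ a b) (_+_ζₖ c d) = _+_ζₖ (a ⊠ c ⊞ ℚ-1 ⊠ (b ⊠ d)) (a ⊠ d ⊞ b ⊠ c ⊞ ℚ-1 ⊠ (b ⊠ d))

0ₖ 1ₖ : 𝕂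
0ₖ = _+_ζₖ ℚ0 ℚ0
1ₖ = _+_ζₖ ℚ1 ℚ0

opaque
  unfolding _+ₖ_ _⊞_
  ⊕ₖ≡ : ∀ x y → x D.⊕ₖ y ≡ x +ₖ y
  ⊕ₖ≡ x y = refl

  ⊗ₖ≡ : ∀ x y → x D.⊗ₖ y ≡ x *ₖ y
  ⊗ₖ≡ (_+_ζₖ a b) (_+_ζₖ c d) = cong₂ _+_ζₖ (cong (λ z → (a ℚ.* c) ℚ.+ z) (neg≡ (b ℚ.* d))) (cong (λ z → (a ℚ.* d) ℚ.+ (b ℚ.* c) ℚ.+ z) (neg≡ (b ℚ.* d)))

  𝟘ₖ≡ : D.𝟘ₖ ≡ 0ₖ
  𝟘ₖ≡ = refl

module _ where
  open NatSolver ℚ-commutativeSemiring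

  opaque
    unfolding _+ₖ_
    +ₖ-assoc : ∀ x y z → x +ₖ y +ₖ z ≡ x +ₖ (y +ₖ z)
    +ₖ-assoc (_+_ζₖ a b) (_+_ζₖ c d) (_+_ζₖ e f) = cong₂ _+_ζₖ (p a c e) (p b d f)
      where
      p : ∀ a b c → a ⊞ b ⊞ c ≡ a ⊞ (b ⊞ c)
      p = solve 3 (λ a b c → a :+ b :+ c := a :+ (b :+ c)) refl

    +ₖ-comm : ∀ x y → x +ₖ y ≡ y +ₖ x
    +ₖ-comm (_+_ζₖ a b) (_+_ζₖ c d) = cong₂ _+_ζₖ (p a c) (p b d)
      where
      p : ∀ a b → a ⊞ b ≡ b ⊞ a
      p = solve 2 (λ a b → a :+ b := b :+ a) refl

    +ₖ-identityˡ : ∀ x → 0ₖ +ₖ x ≡ x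
    +ₖ-identityˡ (_+_ζₖ a b) = cong₂ _+_ζₖ (p a) (p b)
      where
      p : ∀ a → ℚ0 ⊞ a ≡ a
      p = solve 1 (λ a → con 0 :+ a := a) refl

    *ₖ-assoc : ∀ x y z → x *ₖ y *ₖ z ≡ x *ₖ (y *ₖ z)
    *ₖ-assoc (_+_ζₖ a b) (_+_ζₖ c d) (_+_ζₖ e f) = cong₂ _+_ζₖ (p ℚ-1 a b c d e f) (q ℚ-1 a b c d e f)
      where
      -- `ℚ-1` is generalised to a variable n. Multiplication with ω² = n(ω + 1) is associative for
      -- every n, so the identity is free of subtraction and within reach of a semiring solver.
      p : ∀ n a b c d e f → (a ⊠ c ⊞ n ⊠ (b ⊠ d)) ⊠ e ⊞ n ⊠ ((a ⊠ d ⊞ b ⊠ c ⊞ n ⊠ (b ⊠ d)) ⊠ f)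
        ≡ a ⊠ (c ⊠ e ⊞ n ⊠ (d ⊠ f)) ⊞ n ⊠ (b ⊠ (c ⊠ f ⊞ d ⊠ e ⊞ n ⊠ (d ⊠ f)))
      p = solve 7 (λ n a b c d e f → (a :* c :+ n :* (b :* d)) :* e :+ n :* ((a :* d :+ b :* c :+ n :* (b :* d)) :* f)
        := a :* (c :* e :+ n :* (d :* f)) :+ n :* (b :* (c :* f :+ d :* e :+ n :* (d :* f)))) refl
      q : ∀ n a b c d e f → (a ⊠ c ⊞ n ⊠ (b ⊠ d)) ⊠ f ⊞ (a ⊠ d ⊞ b ⊠ c ⊞ n ⊠ (b ⊠ d)) ⊠ e ⊞ n ⊠ ((a ⊠ d ⊞ b ⊠ c ⊞ n ⊠ (b ⊠ d)) ⊠ f)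
        ≡ a ⊠ (c ⊠ f ⊞ d ⊠ e ⊞ n ⊠ (d ⊠ f)) ⊞ b ⊠ (c ⊠ e ⊞ n ⊠ (d ⊠ f)) ⊞ n ⊠ (b ⊠ (c ⊠ f ⊞ d ⊠ e ⊞ n ⊠ (d ⊠ f)))
      q = solve 7 (λ n a b c d e f → (a :* c :+ n :* (b :* d)) :* f :+ (a :* d :+ b :* c :+ n :* (b :* d)) :* e :+ n :* ((a :* d :+ b :* c :+ n :* (b :* d)) :* f)
        := a :* (c :* f :+ d :* e :+ n :* (d :* f)) :+ b :* (c :* e :+ n :* (d :* f)) :+ n :* (b :* (c :* f :+ d :* e :+ n :* (d :* f)))) refl

    *ₖ-comm : ∀ x y → x *ₖ y ≡ y *ₖ x
    *ₖ-comm (_+_ζₖ a b) (_+_ζₖ c d) = cong₂ _+_ζₖ (p ℚ-1 a b c d) (q ℚ-1 a b c d)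
      where
      p : ∀ n a b c d → a ⊠ c ⊞ n ⊠ (b ⊠ d) ≡ c ⊠ a ⊞ n ⊠ (d ⊠ b)
      p = solve 5 (λ n a b c d → a :* c :+ n :* (b :* d) := c :* a :+ n :* (d :* b)) refl
      q : ∀ n a b c d → a ⊠ d ⊞ b ⊠ c ⊞ n ⊠ (b ⊠ d) ≡ c ⊠ b ⊞ d ⊠ a ⊞ n ⊠ (d ⊠ b)
      q = solve 5 (λ n a b c d → a :* d :+ b :* c :+ n :* (b :* d) := c :* b :+ d :* a :+ n :* (d :* b)) refl

    *ₖ-identityˡ : ∀ x → 1ₖ *ₖ x ≡ x
    *ₖ-identityˡ (_+_ζₖ a b) = cong₂ _+_ζₖ (p ℚ-1 a b) (q ℚ-1 a b)
      where
      p : ∀ n a b → ℚ1 ⊠ a ⊞ n ⊠ (ℚ0 ⊠ b) ≡ a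
      p = solve 3 (λ n a b → con 1 :* a :+ n :* (con 0 :* b) := a) refl
      q : ∀ n a b → ℚ1 ⊠ b ⊞ ℚ0 ⊠ a ⊞ n ⊠ (ℚ0 ⊠ b) ≡ b
      q = solve 3 (λ n a b → con 1 :* b :+ con 0 :* a :+ n :* (con 0 :* b) := b) refl

    *ₖ-zeroˡ : ∀ x → 0ₖ *ₖ x ≡ 0ₖ
    *ₖ-zeroˡ (_+_ζₖ a b) = cong₂ _+_ζₖ (p ℚ-1 a b) (q ℚ-1 a b)
      where
      p : ∀ n a b → ℚ0 ⊠ a ⊞ n ⊠ (ℚ0 ⊠ b) ≡ ℚ0
      p = solve 3 (λ n a b → con 0 :* a :+ n :* (con 0 :* b) := con 0) refl
      q : ∀ n a b → ℚ0 ⊠ b ⊞ ℚ0 ⊠ a ⊞ n ⊠ (ℚ0 ⊠ b) ≡ ℚ0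
      q = solve 3 (λ n a b → con 0 :* b :+ con 0 :* a :+ n :* (con 0 :* b) := con 0) refl

    *ₖ-distribʳ : ∀ x y z → (y +ₖ z) *ₖ x ≡ y *ₖ x +ₖ z *ₖ x
    *ₖ-distribʳ (_+_ζₖ a b) (_+_ζₖ c d) (_+_ζₖ e f) = cong₂ _+_ζₖ (p ℚ-1 a b c d e f) (q ℚ-1 a b c d e f)
      where
      p : ∀ n a b c d e f → (c ⊞ e) ⊠ a ⊞ n ⊠ ((d ⊞ f) ⊠ b) ≡ c ⊠ a ⊞ n ⊠ (d ⊠ b) ⊞ (e ⊠ a ⊞ n ⊠ (f ⊠ b))
      p = solve 7 (λ n a b c d e f → (c :+ e) :* a :+ n :* ((d :+ f) :* b) := c :* a :+ n :* (d :* b) :+ (e :* a :+ n :* (f :* b))) refl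
      q : ∀ n a b c d e f → (c ⊞ e) ⊠ b ⊞ (d ⊞ f) ⊠ a ⊞ n ⊠ ((d ⊞ f) ⊠ b) ≡ c ⊠ b ⊞ d ⊠ a ⊞ n ⊠ (d ⊠ b) ⊞ (e ⊠ b ⊞ f ⊠ a ⊞ n ⊠ (f ⊠ b))
      q = solve 7 (λ n a b c d e f → (c :+ e) :* b :+ (d :+ f) :* a :+ n :* ((d :+ f) :* b)
        := c :* b :+ d :* a :+ n :* (d :* b) :+ (e :* b :+ f :* a :+ n :* (f :* b))) refl

    rational-* : ∀ x y z → x ⊠ y ≡ z → _+_ζₖ x ℚ0 *ₖ _+_ζₖ y ℚ0 ≡ _+_ζₖ z ℚ0
    rational-* x y z xy≡z = cong₂ _+_ζₖ (trans (p ℚ-1 (x ⊠ y)) xy≡z) (q ℚ-1 x y)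
      where
      p : ∀ n v → v ⊞ n ⊠ (ℚ0 ⊠ ℚ0) ≡ v
      p = solve 2 (λ n v → v :+ n :* (con 0 :* con 0) := v) refl
      q : ∀ n x y → x ⊠ ℚ0 ⊞ ℚ0 ⊠ y ⊞ n ⊠ (ℚ0 ⊠ ℚ0) ≡ ℚ0
      q = solve 3 (λ n x y → x :* con 0 :+ con 0 :* y :+ n :* (con 0 :* con 0) := con 0) refl

𝕂-commutativeSemiring : CommutativeSemiring 0ℓ 0ℓ
𝕂-commutativeSemiring = record
  { Carrier = 𝕂 ; _≈_ = _≡_ ; _+_ = _+ₖ_ ; _*_ = _*ₖ_ ; 0# = 0ₖ ; 1# = 1ₖ
  ; isCommutativeSemiring = isCommutativeSemiringˡ record
    { +-isCommutativeMonoid = isCommutativeMonoidˡ record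
      { isSemigroup = record { isMagma = ≡-isMagma _+ₖ_ ; assoc = +ₖ-assoc } ; identityˡ = +ₖ-identityˡ ; comm = +ₖ-comm }
    ; *-isCommutativeMonoid = isCommutativeMonoidˡ record
      { isSemigroup = record { isMagma = ≡-isMagma _*ₖ_ ; assoc = *ₖ-assoc } ; identityˡ = *ₖ-identityˡ ; comm = *ₖ-comm }
    ; distribʳ = *ₖ-distribʳ
    ; zeroˡ = *ₖ-zeroˡ } }

module 𝕂Solve = NatSolver 𝕂-commutativeSemiring

toK : 𝔼 → 𝒪K
toK (eis a b) = _+_ζ a b

fromK : 𝒪K → 𝔼
fromK x = eis (𝒪K.re x) (𝒪K.im x)

opaque
  embed : 𝔼 → 𝕂
  embed x = D.ι (toK x)

  embed≡ : ∀ x → D.ι (toK x) ≡ embed x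
  embed≡ x = refl

opaque
  unfolding embed _+_ _+ₖ_
  embed-+ : ∀ x y → embed (x + y) ≡ embed x +ₖ embed y
  embed-+ (eis a b) (eis c d) = cong₂ _+_ζₖ (fraction-+ a c) (fraction-+ b d)

opaque
  unfolding embed _+_ _+ₖ_
  embed-* : ∀ x y → embed (x * y) ≡ embed x *ₖ embed y
  embed-* (eis a b) (eis c d) = cong₂ _+_ζₖ
    (trans (fraction-+ (a ℤ.* c) (ℤ.- (b ℤ.* d))) (cong₂ _⊞_ (fraction-* a c) neg))
    (trans (fraction-+ (a ℤ.* d ℤ.+ b ℤ.* c) (ℤ.- (b ℤ.* d)))
      (cong₂ _⊞_ (trans (fraction-+ (a ℤ.* d) (b ℤ.* c)) (cong₂ _⊞_ (fraction-* a d) (fraction-* b c))) neg))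
    where
    neg : fraction (ℤ.- (b ℤ.* d)) ≡ ℚ-1 ⊠ (fraction b ⊠ fraction d)
    neg = trans (fraction-neg (b ℤ.* d)) (cong₂ _⊠_ fraction--1 (fraction-* b d))

opaque
  unfolding embed _⊞_
  embed-0 : embed 0# ≡ 0ₖ
  embed-0 = refl

opaque
  unfolding embed
  embed-nat-inverse : ∀ n → ∃ λ x → embed (nat (suc n)) *ₖ x ≡ 1ₖ
  embed-nat-inverse n = _+_ζₖ ((+ 1) ℚ./ suc n) ℚ0 , trans (cong (λ z → _+_ζₖ (fraction (+ suc n)) z *ₖ _+_ζₖ ((+ 1) ℚ./ suc n) ℚ0) fraction-0)
    (rational-* (fraction (+ suc n)) ((+ 1) ℚ./ suc n) ℚ1 (trans (fraction-inverse n) fraction-1))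

opaque
  embed-inverse : ∀ {x} → x ≢ 0# → ∃ λ y → embed x *ₖ y ≡ 1ₖ
  embed-inverse {x} x≢0 = go (N x) refl
    where
    go : ∀ n → N x ≡ n → ∃ λ y → embed x *ₖ y ≡ 1ₖ
    go zero Nx≡0 = ⊥-elim (N≢0 x≢0 Nx≡0)
    go (suc n) Nx≡ = result (embed-nat-inverse n)
      where
      result : (∃ λ y → embed (nat (suc n)) *ₖ y ≡ 1ₖ) → ∃ λ y → embed x *ₖ y ≡ 1ₖ
      result (y , inverse) = embed (conj x) *ₖ y , trans (sym (*ₖ-assoc (embed x) (embed (conj x)) y))
        (trans (cong (_*ₖ y) (trans (sym (embed-* x (conj x))) (cong embed (trans (x*conj x) (cong nat Nx≡))))) inverse)

module _ where
  open 𝕂Solve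

  opaque
    -- Here t is 1/3 and h is 1/g, the factors in the coordinates of an element of the order in L.
    -- Each h left over is matched with a g from α = bg².
    product₀ : ∀ b g h t x₀ x₁ x₂ y₀ y₁ y₂ → g *ₖ h ≡ 1ₖ →
      t *ₖ x₀ *ₖ (t *ₖ y₀) +ₖ b *ₖ (g *ₖ g) *ₖ (t *ₖ x₁ *ₖ (t *ₖ (h *ₖ y₂)) +ₖ t *ₖ (h *ₖ x₂) *ₖ (t *ₖ y₁))
      ≡ t *ₖ (t *ₖ (x₀ *ₖ y₀ +ₖ b *ₖ g *ₖ (x₁ *ₖ y₂ +ₖ x₂ *ₖ y₁)))
    product₀ b g h t x₀ x₁ x₂ y₀ y₁ y₂ gh≡1 = trans
      (solve 10 (λ b g h t x₀ x₁ x₂ y₀ y₁ y₂ → t :* x₀ :* (t :* y₀) :+ b :* (g :* g) :* (t :* x₁ :* (t :* (h :* y₂)) :+ t :* (h :* x₂) :* (t :* y₁))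
        := t :* (t :* (x₀ :* y₀ :+ g :* h :* (b :* g :* (x₁ :* y₂ :+ x₂ :* y₁))))) refl b g h t x₀ x₁ x₂ y₀ y₁ y₂)
      (cong (λ v → t *ₖ (t *ₖ (x₀ *ₖ y₀ +ₖ v))) (trans (cong (_*ₖ (b *ₖ g *ₖ (x₁ *ₖ y₂ +ₖ x₂ *ₖ y₁))) gh≡1) (*ₖ-identityˡ _)))

    product₁ : ∀ b g h t x₀ x₁ x₂ y₀ y₁ y₂ → g *ₖ h ≡ 1ₖ →
      t *ₖ x₀ *ₖ (t *ₖ y₁) +ₖ t *ₖ x₁ *ₖ (t *ₖ y₀) +ₖ b *ₖ (g *ₖ g) *ₖ (t *ₖ (h *ₖ x₂) *ₖ (t *ₖ (h *ₖ y₂)))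
      ≡ t *ₖ (t *ₖ (x₀ *ₖ y₁ +ₖ x₁ *ₖ y₀ +ₖ b *ₖ (x₂ *ₖ y₂)))
    product₁ b g h t x₀ x₁ x₂ y₀ y₁ y₂ gh≡1 = trans
      (solve 10 (λ b g h t x₀ x₁ x₂ y₀ y₁ y₂ → t :* x₀ :* (t :* y₁) :+ t :* x₁ :* (t :* y₀) :+ b :* (g :* g) :* (t :* (h :* x₂) :* (t :* (h :* y₂)))
        := t :* (t :* (x₀ :* y₁ :+ x₁ :* y₀ :+ g :* h :* (g :* h :* (b :* (x₂ :* y₂)))))) refl b g h t x₀ x₁ x₂ y₀ y₁ y₂)
      (cong (λ v → t *ₖ (t *ₖ (x₀ *ₖ y₁ +ₖ x₁ *ₖ y₀ +ₖ v))) (trans (cong (λ e → e *ₖ (e *ₖ (b *ₖ (x₂ *ₖ y₂)))) gh≡1)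
        (trans (*ₖ-identityˡ _) (*ₖ-identityˡ _))))

    product₂ : ∀ g h t x₀ x₁ x₂ y₀ y₁ y₂ → g *ₖ h ≡ 1ₖ →
      t *ₖ x₀ *ₖ (t *ₖ (h *ₖ y₂)) +ₖ t *ₖ x₁ *ₖ (t *ₖ y₁) +ₖ t *ₖ (h *ₖ x₂) *ₖ (t *ₖ y₀)
      ≡ h *ₖ (t *ₖ (t *ₖ (x₀ *ₖ y₂ +ₖ x₂ *ₖ y₀ +ₖ g *ₖ (x₁ *ₖ y₁))))
    product₂ g h t x₀ x₁ x₂ y₀ y₁ y₂ gh≡1 = trans
      (cong (λ v → t *ₖ x₀ *ₖ (t *ₖ (h *ₖ y₂)) +ₖ v +ₖ t *ₖ (h *ₖ x₂) *ₖ (t *ₖ y₀))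
        (sym (trans (cong (_*ₖ (t *ₖ x₁ *ₖ (t *ₖ y₁))) gh≡1) (*ₖ-identityˡ _))))
      (solve 9 (λ g h t x₀ x₁ x₂ y₀ y₁ y₂ → t :* x₀ :* (t :* (h :* y₂)) :+ g :* h :* (t :* x₁ :* (t :* y₁)) :+ t :* (h :* x₂) :* (t :* y₀)
        := h :* (t :* (t :* (x₀ :* y₂ :+ x₂ :* y₀ :+ g :* (x₁ :* y₁))))) refl g h t x₀ x₁ x₂ y₀ y₁ y₂)

    norm-form : ∀ b g h t k x₀ x₁ x₂ → g *ₖ h ≡ 1ₖ →
      t *ₖ x₀ *ₖ (t *ₖ x₀) *ₖ (t *ₖ x₀) +ₖ b *ₖ (g *ₖ g) *ₖ (t *ₖ x₁ *ₖ (t *ₖ x₁) *ₖ (t *ₖ x₁))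
        +ₖ b *ₖ (g *ₖ g) *ₖ (b *ₖ (g *ₖ g)) *ₖ (t *ₖ (h *ₖ x₂) *ₖ (t *ₖ (h *ₖ x₂)) *ₖ (t *ₖ (h *ₖ x₂)))
        +ₖ k *ₖ (b *ₖ (g *ₖ g)) *ₖ (t *ₖ x₀ *ₖ (t *ₖ x₁) *ₖ (t *ₖ (h *ₖ x₂)))
      ≡ t *ₖ (t *ₖ (t *ₖ (x₀ *ₖ x₀ *ₖ x₀ +ₖ b *ₖ (g *ₖ g) *ₖ (x₁ *ₖ x₁ *ₖ x₁) +ₖ b *ₖ b *ₖ g *ₖ (x₂ *ₖ x₂ *ₖ x₂) +ₖ k *ₖ (b *ₖ g) *ₖ (x₀ *ₖ x₁ *ₖ x₂))))
    norm-form b g h t k x₀ x₁ x₂ gh≡1 = trans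
      (solve 8 (λ b g h t k x₀ x₁ x₂ →
        t :* x₀ :* (t :* x₀) :* (t :* x₀) :+ b :* (g :* g) :* (t :* x₁ :* (t :* x₁) :* (t :* x₁))
          :+ b :* (g :* g) :* (b :* (g :* g)) :* (t :* (h :* x₂) :* (t :* (h :* x₂)) :* (t :* (h :* x₂)))
          :+ k :* (b :* (g :* g)) :* (t :* x₀ :* (t :* x₁) :* (t :* (h :* x₂)))
        := t :* (t :* (t :* (x₀ :* x₀ :* x₀ :+ b :* (g :* g) :* (x₁ :* x₁ :* x₁) :+ g :* h :* (g :* h :* (g :* h :* (b :* b :* g :* (x₂ :* x₂ :* x₂))))
             :+ g :* h :* (k :* (b :* g) :* (x₀ :* x₁ :* x₂)))))) refl b g h t k x₀ x₁ x₂)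
      (cong₂ (λ v w → t *ₖ (t *ₖ (t *ₖ (x₀ *ₖ x₀ *ₖ x₀ +ₖ b *ₖ (g *ₖ g) *ₖ (x₁ *ₖ x₁ *ₖ x₁) +ₖ v +ₖ w))))
        (trans (cong (λ e → e *ₖ (e *ₖ (e *ₖ (b *ₖ b *ₖ g *ₖ (x₂ *ₖ x₂ *ₖ x₂))))) gh≡1) (trans (*ₖ-identityˡ _) (trans (*ₖ-identityˡ _) (*ₖ-identityˡ _))))
        (trans (cong (_*ₖ (k *ₖ (b *ₖ g) *ₖ (x₀ *ₖ x₁ *ₖ x₂))) gh≡1) (*ₖ-identityˡ _)))

    cancel : ∀ s t x → s *ₖ t ≡ 1ₖ → t *ₖ (s *ₖ x) ≡ x
    cancel s t x st≡1 = trans (solve 3 (λ s t x → t :* (s :* x) := s :* t :* x) refl s t x) (trans (cong (_*ₖ x) st≡1) (*ₖ-identityˡ x))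

    spread : ∀ s t x y → s *ₖ t ≡ 1ₖ → s *ₖ x ≡ y → t *ₖ x ≡ t *ₖ (t *ₖ y)
    spread s t x y st≡1 sx≡y = cong (t *ₖ_) (trans (sym (cancel s t x st≡1)) (cong (t *ₖ_) sx≡y))

    swap-factors : ∀ h t x → t *ₖ (h *ₖ x) ≡ h *ₖ (t *ₖ x)
    swap-factors = solve 3 (λ h t x → t :* (h :* x) := h :* (t :* x)) refl

    distrib₂ : ∀ h t x y → t *ₖ (h *ₖ (x +ₖ y)) ≡ t *ₖ (h *ₖ x) +ₖ t *ₖ (h *ₖ y)
    distrib₂ = solve 4 (λ h t x y → t :* (h :* (x :+ y)) := t :* (h :* x) :+ t :* (h :* y)) refl

    distrib₁ : ∀ t x y → t *ₖ (x +ₖ y) ≡ t *ₖ x +ₖ t *ₖ y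
    distrib₁ = solve 3 (λ t x y → t :* (x :+ y) := t :* x :+ t :* y) refl

    zero₂ : ∀ h t s → t *ₖ (h *ₖ (s *ₖ 0ₖ)) ≡ 0ₖ
    zero₂ = solve 3 (λ h t s → t :* (h :* (s :* con 0)) := con 0) refl

-- The order inside L: homomorphism, norm, integrality, units.

cong-⟨⟩ : ∀ {a b c a′ b′ c′} → a ≡ a′ → b ≡ b′ → c ≡ c′ → ⟨ a ∣ b ∣ c ⟩ ≡ ⟨ a′ ∣ b′ ∣ c′ ⟩
cong-⟨⟩ refl refl refl = refl

opaque
  _∙*_ : ∀ {x y u v} → embed x ≡ u → embed y ≡ v → embed (x * y) ≡ u *ₖ v
  _∙*_ {x} {y} p q = trans (embed-* x y) (cong₂ _*ₖ_ p q)

  _∙+_ : ∀ {x y u v} → embed x ≡ u → embed y ≡ v → embed (x + y) ≡ u +ₖ v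
  _∙+_ {x} {y} p q = trans (embed-+ x y) (cong₂ _+ₖ_ p q)

  _⊗≡_ : ∀ {x y u v} → x ≡ u → y ≡ v → x D.⊗ₖ y ≡ u *ₖ v
  _⊗≡_ {x} {y} p q = trans (⊗ₖ≡ x y) (cong₂ _*ₖ_ p q)

  _⊕≡_ : ∀ {x y u v} → x ≡ u → y ≡ v → x D.⊕ₖ y ≡ u +ₖ v
  _⊕≡_ {x} {y} p q = trans (⊕ₖ≡ x y) (cong₂ _+ₖ_ p q)

opaque
  unfolding _+ᵀ_
  toθ-+ : ∀ x y → toθ (x +ᵀ y) ≡ toθ x +ᵀ toθ y
  toθ-+ (tri a b c) (tri d e f) = cong₃ tri (f₀ a b c d e f) (f₁ a b c d e f) (f₂ a b c d e f)
    where
    opaque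
      unfolding _+_
      f₀ : ∀ a b c d e f → a + d + (b + e) + (c + f) ≡ a + b + c + (d + e + f)
      f₀ = solve-∀ 𝔼-ring
      f₁ : ∀ a b c d e f → a + d + ω * (b + e) + ω² * (c + f) ≡ a + ω * b + ω² * c + (d + ω * e + ω² * f)
      f₁ = solve-∀ 𝔼-ring
      f₂ : ∀ a b c d e f → a + d + ω² * (b + e) + ω * (c + f) ≡ a + ω² * b + ω * c + (d + ω² * e + ω * f)
      f₂ = solve-∀ 𝔼-ring

-- The order in the field: θ ↦ ∛α and θ₂ ↦ (∛α)²/g.
module Field {b g : 𝔼} (S : StructureConstants b g) (g≢0 : g ≢ 0#) where
  open Order S

  α : 𝒪K
  α = toK (b * (g * g))

  opaque
    ⅓-spec : ∃ λ t → embed 3# *ₖ t ≡ 1ₖ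
    ⅓-spec = embed-inverse 3≢0

    g⁻¹-spec : ∃ λ h → embed g *ₖ h ≡ 1ₖ
    g⁻¹-spec = embed-inverse g≢0

  ⅓ g⁻¹ : 𝕂
  ⅓ = proj₁ ⅓-spec
  g⁻¹ = proj₁ g⁻¹-spec

  coordinates : 𝕋 → 𝕃
  coordinates (tri x₀ x₁ x₂) = ⟨ ⅓ *ₖ embed x₀ ∣ ⅓ *ₖ embed x₁ ∣ ⅓ *ₖ (g⁻¹ *ₖ embed x₂) ⟩

  Φ : 𝕋 → 𝕃
  Φ x = coordinates (toθ x)

  opaque
    α̂≡ : D.ι α ≡ embed b *ₖ (embed g *ₖ embed g)
    α̂≡ = trans (embed≡ (b * (g * g))) (refl ∙* (refl ∙* refl))

  opaque
    unfolding _+ᵀ_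
    coordinates-+ : ∀ X Y → coordinates (X +ᵀ Y) ≡ D._⊕ₗ_ α (coordinates X) (coordinates Y)
    coordinates-+ (tri x₀ x₁ x₂) (tri y₀ y₁ y₂) = cong-⟨⟩
      (trans (trans (cong (⅓ *ₖ_) (embed-+ x₀ y₀)) (distrib₁ ⅓ (embed x₀) (embed y₀))) (sym (⊕ₖ≡ (⅓ *ₖ embed x₀) (⅓ *ₖ embed y₀))))
      (trans (trans (cong (⅓ *ₖ_) (embed-+ x₁ y₁)) (distrib₁ ⅓ (embed x₁) (embed y₁))) (sym (⊕ₖ≡ (⅓ *ₖ embed x₁) (⅓ *ₖ embed y₁))))
      (trans (trans (cong (λ z → ⅓ *ₖ (g⁻¹ *ₖ z)) (embed-+ x₂ y₂)) (distrib₂ g⁻¹ ⅓ (embed x₂) (embed y₂))) (sym (⊕ₖ≡ (⅓ *ₖ (g⁻¹ *ₖ embed x₂)) (⅓ *ₖ (g⁻¹ *ₖ embed y₂)))))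

    coordinates-* : ∀ X Y Z → scale 3# Z ≡ mulθ b g X Y → coordinates Z ≡ D._⊗ₗ_ α (coordinates X) (coordinates Y)
    coordinates-* (tri x₀ x₁ x₂) (tri y₀ y₁ y₂) (tri z₀ z₁ z₂) eq = cong-⟨⟩
      (trans (spread (embed 3#) ⅓ (embed z₀) _ (proj₂ ⅓-spec) (trans (sym (embed-* 3# z₀)) (trans (cong (λ { (tri a _ _) → embed a }) eq)
          ((refl ∙* refl) ∙+ ((refl ∙* refl) ∙* ((refl ∙* refl) ∙+ (refl ∙* refl)))))))
        (trans (sym (product₀ (embed b) (embed g) g⁻¹ ⅓ (embed x₀) (embed x₁) (embed x₂) (embed y₀) (embed y₁) (embed y₂) (proj₂ g⁻¹-spec)))
          (sym ((_⊗≡_ {X₀} {Y₀} refl refl) ⊕≡ (_⊗≡_ {D.ι α} α̂≡ ((_⊗≡_ {X₁} {Y₂} refl refl) ⊕≡ (_⊗≡_ {X₂} {Y₁} refl refl)))))))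
      (trans (spread (embed 3#) ⅓ (embed z₁) _ (proj₂ ⅓-spec) (trans (sym (embed-* 3# z₁)) (trans (cong (λ { (tri _ a _) → embed a }) eq)
          (((refl ∙* refl) ∙+ (refl ∙* refl)) ∙+ (refl ∙* (refl ∙* refl))))))
        (trans (sym (product₁ (embed b) (embed g) g⁻¹ ⅓ (embed x₀) (embed x₁) (embed x₂) (embed y₀) (embed y₁) (embed y₂) (proj₂ g⁻¹-spec)))
          (sym (((_⊗≡_ {X₀} {Y₁} refl refl) ⊕≡ (_⊗≡_ {X₁} {Y₀} refl refl)) ⊕≡ (_⊗≡_ {D.ι α} α̂≡ (_⊗≡_ {X₂} {Y₂} refl refl))))))
      (trans (trans (swap-factors g⁻¹ ⅓ (embed z₂)) (cong (g⁻¹ *ₖ_) (spread (embed 3#) ⅓ (embed z₂) _ (proj₂ ⅓-spec) (trans (sym (embed-* 3# z₂)) (trans (cong (λ { (tri _ _ a) → embed a }) eq)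
          (((refl ∙* refl) ∙+ (refl ∙* refl)) ∙+ (refl ∙* (refl ∙* refl))))))))
        (trans (sym (product₂ (embed g) g⁻¹ ⅓ (embed x₀) (embed x₁) (embed x₂) (embed y₀) (embed y₁) (embed y₂) (proj₂ g⁻¹-spec)))
          (sym (((_⊗≡_ {X₀} {Y₂} refl refl) ⊕≡ (_⊗≡_ {X₁} {Y₁} refl refl)) ⊕≡ (_⊗≡_ {X₂} {Y₀} refl refl)))))
      where
      X₀ X₁ X₂ Y₀ Y₁ Y₂ : 𝕂
      X₀ = ⅓ *ₖ embed x₀
      X₁ = ⅓ *ₖ embed x₁
      X₂ = ⅓ *ₖ (g⁻¹ *ₖ embed x₂)
      Y₀ = ⅓ *ₖ embed y₀
      Y₁ = ⅓ *ₖ embed y₁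
      Y₂ = ⅓ *ₖ (g⁻¹ *ₖ embed y₂)

    coordinates-const : ∀ s → coordinates (scale 3# (tri s 0# 0#)) ≡ D.ιₗ α (D.ι (toK s))
    coordinates-const s = cong-⟨⟩
      (trans (cong (⅓ *ₖ_) (embed-* 3# s)) (trans (cancel (embed 3#) ⅓ (embed s) (proj₂ ⅓-spec)) (sym (embed≡ s))))
      (trans (cong (⅓ *ₖ_) (trans (_∙*_ {3#} {0#} refl embed-0) (sym (*ₖ-identityˡ _)))) (trans (zero₂ 1ₖ ⅓ (embed 3#)) (sym 𝟘ₖ≡)))
      (trans (cong (λ z → ⅓ *ₖ (g⁻¹ *ₖ z)) (_∙*_ {3#} {0#} refl embed-0)) (trans (zero₂ g⁻¹ ⅓ (embed 3#)) (sym 𝟘ₖ≡)))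

    Norm-coordinates : ∀ X x₀ x₁ x₂ ν → X ≡ tri x₀ x₁ x₂ → 27# * ν ≡ normθ b g x₀ x₁ x₂ → D.Normₗ α (coordinates X) ≡ D.ι (toK ν)
    Norm-coordinates .(tri x₀ x₁ x₂) x₀ x₁ x₂ ν refl eq = begin
      D.Normₗ α (coordinates (tri x₀ x₁ x₂))
        ≡⟨ (((cube X₀) ⊕≡ (_⊗≡_ {D.ι α} α̂≡ (cube X₁))) ⊕≡ (_⊗≡_ {D.ι α D.⊗ₖ D.ι α} (_⊗≡_ {D.ι α} {D.ι α} α̂≡ α̂≡) (cube X₂)))
           ⊕≡ (_⊗≡_ {D.ι (D.⊝ D.𝟛) D.⊗ₖ D.ι α} (_⊗≡_ {D.ι (D.⊝ D.𝟛)} {D.ι α} -𝟛≡ α̂≡) (_⊗≡_ {X₀ D.⊗ₖ X₁} {X₂} (_⊗≡_ {X₀} {X₁} refl refl) refl)) ⟩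
      _ ≡⟨ norm-form (embed b) (embed g) g⁻¹ ⅓ (embed (- 3#)) (embed x₀) (embed x₁) (embed x₂) (proj₂ g⁻¹-spec) ⟩
      ⅓ *ₖ (⅓ *ₖ (⅓ *ₖ _))
        ≡⟨ cong (λ z → ⅓ *ₖ (⅓ *ₖ (⅓ *ₖ z))) (sym ((((((refl ∙* refl) ∙* refl) ∙+ ((refl ∙* (refl ∙* refl)) ∙* ((refl ∙* refl) ∙* refl)))
             ∙+ (((refl ∙* refl) ∙* refl) ∙* ((refl ∙* refl) ∙* refl)))) ∙+ ((_∙*_ {(- 3#)} refl (refl ∙* refl)) ∙* ((refl ∙* refl) ∙* refl)))) ⟩
      ⅓ *ₖ (⅓ *ₖ (⅓ *ₖ embed (x₀ * x₀ * x₀ + b * (g * g) * (x₁ * x₁ * x₁) + b * b * g * (x₂ * x₂ * x₂) + (- 3#) * (b * g) * (x₀ * x₁ * x₂))))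
        ≡⟨ cong (λ z → ⅓ *ₖ (⅓ *ₖ (⅓ *ₖ embed z))) (trans (sym (signed _ (b * g) (x₀ * x₁ * x₂))) (trans (sym eq) (cubed ν))) ⟩
      ⅓ *ₖ (⅓ *ₖ (⅓ *ₖ embed (3# * (3# * (3# * ν)))))
        ≡⟨ cong (λ z → ⅓ *ₖ (⅓ *ₖ z)) (peel (3# * (3# * ν))) ⟩
      ⅓ *ₖ (⅓ *ₖ embed (3# * (3# * ν)))
        ≡⟨ cong (⅓ *ₖ_) (peel (3# * ν)) ⟩
      ⅓ *ₖ embed (3# * ν)
        ≡⟨ trans (peel ν) (sym (embed≡ ν)) ⟩
      D.ι (toK ν) ∎
      where
      open ≡-Reasoning
      X₀ X₁ X₂ : 𝕂
      X₀ = ⅓ *ₖ embed x₀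
      X₁ = ⅓ *ₖ embed x₁
      X₂ = ⅓ *ₖ (g⁻¹ *ₖ embed x₂)
      cube : ∀ x → x D.⊗ₖ x D.⊗ₖ x ≡ x *ₖ x *ₖ x
      cube x = _⊗≡_ {x D.⊗ₖ x} {x} (_⊗≡_ {x} {x} refl refl) refl
      peel : ∀ x → ⅓ *ₖ embed (3# * x) ≡ embed x
      peel x = trans (cong (⅓ *ₖ_) (embed-* 3# x)) (cancel (embed 3#) ⅓ (embed x) (proj₂ ⅓-spec))
      opaque
        unfolding _+_ embed
        -𝟛≡ : D.ι (D.⊝ D.𝟛) ≡ embed (- 3#)
        -𝟛≡ = refl
      opaque
        unfolding _+_
        signed : ∀ x y z → x - 3# * y * z ≡ x + (- 3#) * y * z
        signed = solve-∀ 𝔼-ring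
        cubed : ∀ x → 27# * x ≡ 3# * (3# * (3# * x))
        cubed = solve-∀ 𝔼-ring

module IntegersOfField {b g : 𝔼} (S : StructureConstants b g) (g≢0 : g ≢ 0#) where
  open Order S
  open Field S g≢0
  open CommutativeRing 𝕆 using (zeroˡ)
  open Solve using (_:+_; _:*_; _:=_; con)

  opaque
    Φ-+ : ∀ x y → Φ (x +ᵀ y) ≡ D._⊕ₗ_ α (Φ x) (Φ y)
    Φ-+ x y = trans (cong coordinates (toθ-+ x y)) (coordinates-+ (toθ x) (toθ y))

    Φ-· : ∀ x y → Φ (x · y) ≡ D._⊗ₗ_ α (Φ x) (Φ y)
    Φ-· x y = coordinates-* (toθ x) (toθ y) (toθ (x · y)) (toθ-· x y)

    Φ-const : ∀ s → Φ (const s) ≡ D.ιₗ α (D.ι (toK s))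
    Φ-const s = trans (cong coordinates (toθ-const s)) (coordinates-const s)

    Φ-norm : ∀ x → D.Normₗ α (Φ x) ≡ D.ι (toK (nm x))
    Φ-norm x = go (toθ x) refl
      where
      go : ∀ X → toθ x ≡ X → D.Normₗ α (Φ x) ≡ D.ι (toK (nm x))
      go (tri x₀ x₁ x₂) eq = Norm-coordinates (toθ x) x₀ x₁ x₂ (nm x) eq (27·nm x eq)

  opaque
    const-cancel : ∀ s → const (- s) +ᵀ const s ≡ 0ᵀ
    const-cancel s = trans (sym (const-+ (- s) s)) (cong const (+-inverseˡ s))

    -- The characteristic polynomial in the Horner shape to which `polyEval` unfolds at degree 3.
    monic-relation : ∀ x t → x · (x · x) +ᵀ const t · x ≡ const (tr x) · (x · x) +ᵀ const (nm x) →
      x · (x · (x · 1ᵀ)) +ᵀ (const (- nm x) +ᵀ x · (const t +ᵀ x · (const (- tr x) +ᵀ x · 0ᵀ))) ≡ 0ᵀ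
    monic-relation x t eq = begin
      x · (x · (x · 1ᵀ)) +ᵀ (const (- nm x) +ᵀ x · (const t +ᵀ x · (const (- tr x) +ᵀ x · 0ᵀ)))
        ≡⟨ Solve.solve 4 (λ x n t r → x :* (x :* (x :* con 1)) :+ (n :+ x :* (t :+ x :* (r :+ x :* con 0)))
             := x :* (x :* x) :+ t :* x :+ (n :+ r :* (x :* x))) refl x (const (- nm x)) (const t) (const (- tr x)) ⟩
      x · (x · x) +ᵀ const t · x +ᵀ (const (- nm x) +ᵀ const (- tr x) · (x · x))
        ≡⟨ cong (λ w → w +ᵀ (const (- nm x) +ᵀ const (- tr x) · (x · x))) eq ⟩
      const (tr x) · (x · x) +ᵀ const (nm x) +ᵀ (const (- nm x) +ᵀ const (- tr x) · (x · x))
        ≡⟨ Solve.solve 5 (λ s r n m v → r :* v :+ n :+ (m :+ s :* v) := (s :+ r) :* v :+ (m :+ n)) refl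
             (const (- tr x)) (const (tr x)) (const (nm x)) (const (- nm x)) (x · x) ⟩
      (const (- tr x) +ᵀ const (tr x)) · (x · x) +ᵀ (const (- nm x) +ᵀ const (nm x))
        ≡⟨ cong₂ (λ v w → v · (x · x) +ᵀ w) (const-cancel (tr x)) (const-cancel (nm x)) ⟩
      0ᵀ · (x · x) +ᵀ 0ᵀ
        ≡⟨ trans (cong (λ v → v +ᵀ 0ᵀ) (zeroˡ (x · x))) (+ᵀ-identityˡ 0ᵀ) ⟩
      0ᵀ ∎
      where open ≡-Reasoning

    integral : ∀ x → D.Integral α (Φ x)
    integral x = go (charPoly x)
      where
      times : ∀ {v w} → v ≡ Φ w → D._⊗ₗ_ α (Φ x) v ≡ Φ (x · w)
      times {w = w} v≡ = trans (cong (D._⊗ₗ_ α (Φ x)) v≡) (sym (Φ-· x w))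
      plus : ∀ s {v w} → v ≡ Φ w → D._⊕ₗ_ α (D.ιₗ α (D.ι (toK s))) v ≡ Φ (const s +ᵀ w)
      plus s {w = w} v≡ = trans (cong₂ (D._⊕ₗ_ α) (sym (Φ-const s)) v≡) (sym (Φ-+ (const s) w))
      go : (∃ λ t → x · (x · x) +ᵀ const t · x ≡ const (tr x) · (x · x) +ᵀ const (nm x)) → D.Integral α (Φ x)
      go (t , eq) = 3 , coefficients , (begin
        D._⊕ₗ_ α (D._^ₗ_ α (Φ x) 3) (D.polyEval α 3 coefficients (Φ x))
          ≡⟨ cong₂ (D._⊕ₗ_ α) (times (times (times (sym (Φ-const 1#))))) (plus (- nm x) (times (plus t (times (plus (- tr x) (times (sym (Φ-const 0#)))))))) ⟩
        D._⊕ₗ_ α (Φ (x · (x · (x · 1ᵀ)))) (Φ (const (- nm x) +ᵀ x · (const t +ᵀ x · (const (- tr x) +ᵀ x · 0ᵀ))))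
          ≡⟨ sym (Φ-+ (x · (x · (x · 1ᵀ))) (const (- nm x) +ᵀ x · (const t +ᵀ x · (const (- tr x) +ᵀ x · 0ᵀ)))) ⟩
        Φ (x · (x · (x · 1ᵀ)) +ᵀ (const (- nm x) +ᵀ x · (const t +ᵀ x · (const (- tr x) +ᵀ x · 0ᵀ))))
          ≡⟨ cong Φ (monic-relation x t eq) ⟩
        Φ 0ᵀ ≡⟨ Φ-const 0# ⟩
        D.𝟘ₗ α ∎)
        where
        open ≡-Reasoning
        coefficients : Fin 3 → 𝒪K
        coefficients Fin.zero = toK (- nm x)
        coefficients (Fin.suc Fin.zero) = toK t
        coefficients (Fin.suc (Fin.suc _)) = toK (- tr x)

    unit : ∀ u → nm u ≡ ω → D.UnitOL α (Φ u)
    unit u nm-u = integral u , Φ v , integral v , trans (sym (Φ-· u v)) (trans (cong Φ u·v≡1) (Φ-const 1#))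
      where
      open ≡-Reasoning
      -- u · σ u · σ²u = ω, so the product of the other two conjugates is corrected by ω⁻¹ = ω².
      v : 𝕋
      v = scale ω² (σ u · σ (σ u))
      opaque
        unfolding _+_
        ω²ω≡1 : ω² * ω ≡ 1#
        ω²ω≡1 = refl
      u·v≡1 : u · v ≡ 1ᵀ
      u·v≡1 = begin
        u · v                                      ≡⟨ ·-comm u v ⟩
        scale ω² (σ u · σ (σ u)) · u               ≡⟨ scale-·ˡ ω² (σ u · σ (σ u)) u ⟩
        scale ω² (σ u · σ (σ u) · u)               ≡⟨ cong (scale ω²) (trans (·-comm (σ u · σ (σ u)) u) (nm-spec u)) ⟩
        scale ω² (const (nm u))                    ≡⟨ trans (cong (λ s → scale ω² (const s)) nm-u) (scale-const ω² ω) ⟩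
        const (ω² * ω)                             ≡⟨ cong const ω²ω≡1 ⟩
        1ᵀ ∎

-- Translation of the hypotheses, and the conclusion.

opaque
  unfolding _+_
  fromK-⊗ : ∀ x y → fromK (x D.⊗ y) ≡ fromK x * fromK y
  fromK-⊗ x y = refl

  fromK-⊖ : ∀ x y → fromK (x D.⊖ y) ≡ fromK x - fromK y
  fromK-⊖ x y = refl

  fromK-λ³ : fromK (D.λ₃ D.^ᴷ 3) ≡ λ³
  fromK-λ³ = refl

  N-fromK : ∀ x → N (fromK x) ≡ D.Nᴷ x
  N-fromK x = refl

fromK-toK : ∀ x → fromK (toK x) ≡ x
fromK-toK (eis a b) = refl

opaque
  fromK-^ : ∀ x n → fromK (x D.^ᴷ n) ≡ fromK x ^ n
  fromK-^ x zero = refl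
  fromK-^ x (suc n) = trans (fromK-⊗ x (x D.^ᴷ n)) (cong (fromK x *_) (fromK-^ x n))

  fromK-Π : ∀ n f → fromK (D.Πᴷ n f) ≡ Π n (fromK ∘ f)
  fromK-Π zero f = refl
  fromK-Π (suc n) f = trans (fromK-⊗ (f Fin.zero) (D.Πᴷ n (f ∘ Fin.suc))) (cong (fromK (f Fin.zero) *_) (fromK-Π n (f ∘ Fin.suc)))

  fromK-injective : ∀ {x y} → fromK x ≡ fromK y → x ≡ y
  fromK-injective = cong toK

  ∣ᴷ⇒∣ : ∀ {x y} → x D.∣ᴷ y → fromK x ∣ fromK y
  ∣ᴷ⇒∣ {x} (c , y≡) = fromK c , trans (cong fromK y≡) (fromK-⊗ x c)

  ∣⇒∣ᴷ : ∀ {x y} → fromK x ∣ fromK y → x D.∣ᴷ y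
  ∣⇒∣ᴷ {x} (c , y≡) = toK c , fromK-injective (trans y≡ (trans (cong (fromK x *_) (sym (fromK-toK c))) (sym (fromK-⊗ x (toK c)))))

  unit⇒unitᴷ : ∀ {x} → IsUnit (fromK x) → D.IsUnitᴷ x
  unit⇒unitᴷ {x} (y , xy≡1) = toK y , fromK-injective (trans (fromK-⊗ x (toK y)) (trans (cong (fromK x *_) (fromK-toK y)) xy≡1))

  fromK-prime : ∀ {p} → D.IsPrimeᴷ p → IsPrime (fromK p)
  fromK-prime {p} (p≢0 , ¬unit , prime) = (λ p≡0 → p≢0 (fromK-injective p≡0)) , (λ unit → ¬unit (unit⇒unitᴷ unit)) , λ x y p∣xy →
    [ (λ p∣x → inj₁ (subst (fromK p ∣_) (fromK-toK x) (∣ᴷ⇒∣ p∣x))) , (λ p∣y → inj₂ (subst (fromK p ∣_) (fromK-toK y) (∣ᴷ⇒∣ p∣y))) ]′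
    (prime (toK x) (toK y) (∣⇒∣ᴷ (subst (fromK p ∣_) (trans (cong₂ _*_ (sym (fromK-toK x)) (sym (fromK-toK y))) (sym (fromK-⊗ (toK x) (toK y)))) p∣xy)))

  -- If p = qc, the prime p divides q or c. In the first case c is a unit and p, q are associated;
  -- in the second q is a unit.
  non-associated⇒∤ : ∀ {p q} → D.IsPrimeᴷ p → D.IsPrimeᴷ q → ¬ D.Associated p q → ¬ fromK q ∣ fromK p
  non-associated⇒∤ {p} {q} primeᵖ primeᵠ ¬assoc (c , p≡) = [ p∣q-case , p∣c-case ]′ (proj₂ (proj₂ (fromK-prime primeᵖ)) (fromK q) c (subst (fromK p ∣_) p≡ (1# , sym (trans (*-comm (fromK p) 1#) (*-identityˡ (fromK p))))))
    where
    open ≡-Reasoning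
    p∣q-case : fromK p ∣ fromK q → ⊥
    p∣q-case (d , q≡) = ¬assoc (toK c , unit⇒unitᴷ (d , subst (λ z → z * d ≡ 1#) (sym (fromK-toK c)) cd≡1) , fromK-injective (begin
      fromK p                      ≡⟨ trans p≡ (*-comm (fromK q) c) ⟩
      c * fromK q                  ≡⟨ cong (_* fromK q) (sym (fromK-toK c)) ⟩
      fromK (toK c) * fromK q      ≡⟨ sym (fromK-⊗ (toK c) q) ⟩
      fromK (toK c D.⊗ q) ∎))
      where
      cd≡1 : c * d ≡ 1#
      cd≡1 = *-cancelˡ (fromK q) (proj₁ (fromK-prime primeᵠ)) (begin
        fromK q * (c * d)          ≡⟨ sym (*-assoc (fromK q) c d) ⟩
        fromK q * c * d            ≡⟨ cong (_* d) (sym p≡) ⟩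
        fromK p * d                ≡⟨ sym q≡ ⟩
        fromK q                    ≡⟨ sym (trans (*-comm (fromK q) 1#) (*-identityˡ (fromK q))) ⟩
        fromK q * 1# ∎)
    p∣c-case : fromK p ∣ c → ⊥
    p∣c-case (d , c≡) = proj₁ (proj₂ (fromK-prime primeᵠ)) (d , *-cancelˡ (fromK p) (proj₁ (fromK-prime primeᵖ)) (begin
      fromK p * (fromK q * d)      ≡⟨ trans (sym (*-assoc (fromK p) (fromK q) d)) (trans (cong (_* d) (*-comm (fromK p) (fromK q))) (*-assoc (fromK q) (fromK p) d)) ⟩
      fromK q * (fromK p * d)      ≡⟨ cong (fromK q *_) (sym c≡) ⟩
      fromK q * c                  ≡⟨ sym p≡ ⟩
      fromK p                      ≡⟨ sym (trans (*-comm (fromK p) 1#) (*-identityˡ (fromK p))) ⟩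
      fromK p * 1# ∎))

  fromK-log : ∀ {p v} r → D.CubicResLog p v r → ∀ k → N (fromK p) ≡ suc (9 ℕ.* k) → fromK p ∣ fromK v ^ (3 ℕ.* k) - ω ^ toℕ r
  fromK-log {p} {v} r log k N≡ = subst (fromK p ∣_) (trans (fromK-⊖ (v D.^ᴷ ((D.Nᴷ p ℕ.∸ 1) ℕ./ 3)) (D.ζ₃ D.^ᴷ toℕ r))
    (cong₂ _-_ (trans (fromK-^ v ((D.Nᴷ p ℕ.∸ 1) ℕ./ 3)) (cong (fromK v ^_) exponent≡)) (fromK-^ D.ζ₃ (toℕ r)))) (∣ᴷ⇒∣ log)
    where
    exponent≡ : (D.Nᴷ p ℕ.∸ 1) ℕ./ 3 ≡ 3 ℕ.* k
    exponent≡ = trans (cong (λ n → (n ℕ.∸ 1) ℕ./ 3) (trans (sym (N-fromK p)) N≡)) (trans (cong (λ n → n ℕ./ 3) (f k)) (ℕDM.m*n/n≡m (3 ℕ.* k) 3))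
      where
      f : ∀ k → 9 ℕ.* k ≡ 3 ℕ.* k ℕ.* 3
      f = ℕR.solve-∀

  fromK-alphaOf : ∀ n π a → fromK (D.alphaOf n π a) ≡ Π n (λ i → fromK (π i) ^ D.expo (a i))
  fromK-alphaOf n π a = trans (fromK-Π n (λ i → π i D.^ᴷ D.expo (a i))) (Π-cong n (λ i → fromK-^ (π i) (D.expo (a i))))

module Conclusion (m : ℕ) (π : Fin (suc m) → 𝔼) (a : Fin (suc m) → Fin 2)
  (prime : ∀ i → IsPrime (π i)) (distinct : ∀ i j → i ≢ j → ¬ π i ∣ π j) (π≡1 : ∀ i → λ³ ∣ π i - 1#)
  (ℓ : Fin (suc m) → Fin (suc m) → Fin 3)
  (log : ∀ i j → i ≢ j → ∀ k → N (π j) ≡ suc (9 ℕ.* k) → π j ∣ π i ^ (3 ℕ.* k) - ω ^ toℕ (ℓ i j))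
  (full : D.FullRank₃ m (D.redei m a ℓ)) where
  open Setup m π a prime distinct π≡1 ℓ log full
  open Order S
  open Units S

  α : 𝔼
  α = Π (suc m) (λ i → π i ^ D.expo (a i))

  opaque
    α≡βγ² : α ≡ β * (γ * γ)
    α≡βγ² = trans (Π-cong (suc m) (λ i → part-power (a i) (π i))) (trans (Π-* (suc m) βf (λ i → γf i * γf i)) (cong (β *_) (Π-* (suc m) γf γf)))

    γ≢0 : γ ≢ 0#
    γ≢0 γ≡0 = βγ≢0 (trans (cong (β *_) γ≡0) (*-zeroʳ β))

    -- This stands for the irreducibility of X³ - α and comes from total ramification at a single
    -- prime: the norm of a primitive element is a power of `π Fin.zero` times a cofactor prime to
    -- it, hence nonzero.
    anisotropic : ∀ x → nm x ≡ 0# → x ≡ 0ᵀ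
    anisotropic x nm≡0 with x ≟ᵀ 0ᵀ
    ... | yes x≡0 = x≡0
    ... | no x≢0 with primitive-part x x≢0
    ...   | c , y , c≢0 , refl , prim = ⊥-elim (*≢0# (*≢0# c≢0 (*≢0# c≢0 c≢0)) (nm-y≢0 (toθ y) refl) (trans (sym (nm-scale c y)) nm≡0))
      where
      nm-y≢0 : ∀ X → toθ y ≡ X → nm y ≢ 0#
      nm-y≢0 (tri x₀ x₁ x₂) toθy≡ nm≡0 = Local.p∤ν′ loc (subst (π Fin.zero ∣_) (sym ν′≡0) ∣0#)
        where
        loc : Local Fin.zero x₀ x₁ x₂ (nm y)
        loc = local Fin.zero x₀ x₁ x₂ (nm y) (primitive-coordinates (prime Fin.zero) (R.p∤3 Fin.zero) y prim toθy≡) (27·nm y toθy≡)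
        ν′≡0 : Local.ν′ loc ≡ 0#
        ν′≡0 = *-cancelˡ (π Fin.zero ^ Local.e loc) (^≢0# (Local.e loc) (Prime.p≢0# (prime Fin.zero)))
          (trans (sym (Local.ν≡ loc)) (trans nm≡0 (sym (*-zeroʳ _))))

    βγ²≡1 : λ³ ∣ β * (γ * γ) - 1#
    βγ²≡1 = subst (λ w → λ³ ∣ β * (γ * γ) - w) (trans (*-identityˡ _) (*-identityˡ 1#))
      (Mod.≈-* λ³ (Π-≡1 (suc m) βf (proj₁ ∘ part≡1)) (Mod.≈-* λ³ (Π-≡1 (suc m) γf (proj₂ ∘ part≡1)) (Π-≡1 (suc m) γf (proj₂ ∘ part≡1))))

    descent : Descent
    descent u nm-u with descend u nm-u
    ... | step v k relation unit = v , k , relation , unit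

    norm-ω : NormRoot
    norm-ω = NontrivialUnit.existence S anisotropic γ≢0 βγ²≡1 descent

  open Field S γ≢0 using (Φ)
  open IntegersOfField S γ≢0 using (unit; Φ-norm)

  opaque
    unit-of-norm-ζ : Σ 𝕃 λ u → D.UnitOL (toK α) u × (D.Normₗ (toK α) u ≡ D.ι D.ζ₃)
    unit-of-norm-ζ = subst (λ v → Σ 𝕃 λ u → D.UnitOL (toK v) u × (D.Normₗ (toK v) u ≡ D.ι D.ζ₃)) (sym α≡βγ²) (go norm-ω)
      where
      go : NormRoot → Σ 𝕃 λ u → D.UnitOL (toK (β * (γ * γ))) u × (D.Normₗ (toK (β * (γ * γ))) u ≡ D.ι D.ζ₃)
      go (u , nm-u) = Φ u , unit u nm-u , trans (Φ-norm u) (cong (λ z → D.ι (toK z)) nm-u)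

theorem2p3 : (m : ℕ) (π : Fin (suc m) → 𝒪K) (a : Fin (suc m) → Fin 2)
  → (∀ i → IsPrimeᴷ (π i))
  → (∀ i j → i ≢ j → ¬ Associated (π i) (π j))
  → (∀ i → π i ≡ 𝟙 [mod λ₃ ^ᴷ 3 ])
  → (ℓ : Fin (suc m) → Fin (suc m) → Fin 3)
  → (∀ i j → i ≢ j → CubicResLog (π j) (π i) (ℓ i j))
  → FullRank₃ m (redei m a ℓ)
  → Σ 𝕃 λ u → UnitOL (alphaOf (suc m) π a) u
      × (Normₗ (alphaOf (suc m) π a) u ≡ ι ζ₃)
theorem2p3 m π a prime distinct π≡1 ℓ log full =
  subst (λ α → Σ 𝕃 λ u → UnitOL α u × (Normₗ α u ≡ ι ζ₃)) (cong toK (sym (fromK-alphaOf (suc m) π a)))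
    (Conclusion.unit-of-norm-ζ m (fromK ∘ π) a (λ i → fromK-prime (prime i))
      (λ i j i≢j → non-associated⇒∤ (prime j) (prime i) (distinct j i (i≢j ∘ sym)))
      (λ i → subst₂ _∣_ fromK-λ³ (fromK-⊖ (π i) 𝟙) (∣ᴷ⇒∣ (π≡1 i)))
      ℓ (λ i j i≢j → fromK-log (ℓ i j) (log i j i≢j)) full)
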